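{- Let $G$ be a 1-tough graph on $n$ vertices with minimum degree $\delta$, and let $c$ denote the circumference of $G$ (the length of a longest cycle in $G$). Then either $G$ is hamiltonian or $$ c\ge\begin{cases} 2\delta+2 & \text{when } n\equiv 1 \pmod 3,\\ 2\delta+3 & \text{when } n\equiv 2 \pmod 3 \text{ or } n\equiv 1 \pmod 4,\\ 2\delta+4 & \text{otherwise}. \end{cases} $$
   Context: All graphs are finite, undirected, without loops or multiple edges. For a graph $G$ and $S\subseteq V(G)$, $G\setminus S$ is the subgraph induced by $V(G)\setminus S$, and $s(H)$ denotes the number of components of a graph $H$. A graph $G$ is 1-tough if $|S|\ge s(G\setminus S)$ for every subset $S\subseteq V(G)$ with $s(G\setminus S)>1$. A graph on $n$ vertices is hamiltonian if it contains a cycle of length $n$. The length of a path or cycle is its number of edges. -}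

module Defs where

open import Data.Nat using (ℕ; zero; suc; _+_; _*_; _≤_; _<_; _%_; _≡ᵇ_)
open import Data.Bool using (Bool; true; false; if_then_else_; _∨_)
open import Data.Fin using (Fin; zero; suc; inject₁; fromℕ)
open import Data.Fin.Subset using (Subset; _∈_; _∉_; ∣_∣)
open import Data.Vec using (tabulate)
open import Data.Product using (Σ; ∃; _×_; _,_)
open import Function.Definitions using (Injective)
open import Function.Bundles using (_⇔_)
open import Relation.Binary.PropositionalEquality using (_≡_)

record Graph (n : ℕ) : Set where
  field
    adj   : Fin n → Fin n → Bool
    sym   : ∀ u v → adj u v ≡ adj v u
    irrefl : ∀ v → adj v v ≡ false

open Graph public

Edge : ∀ {n} → Graph n → Fin n → Fin n → Set
Edge G u v = adj G u v ≡ true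

deg : ∀ {n} → Graph n → Fin n → ℕ
deg G v = ∣ tabulate (adj G v) ∣

IsMinDegree : ∀ {n} → Graph n → ℕ → Set
IsMinDegree {n} G δ = (Σ (Fin n) λ v → deg G v ≡ δ) × (∀ v → δ ≤ deg G v)

data Reach {n} (G : Graph n) (S : Subset n) (u : Fin n) : Fin n → Set where
  here : u ∉ S → Reach G S u u
  step : ∀ {v w} → Reach G S u v → Edge G v w → w ∉ S → Reach G S u w

NumComponents : ∀ {n} → Graph n → Subset n → ℕ → Set
NumComponents {n} G S k =
  Σ (Fin n → Fin k) λ label →
    (∀ (c : Fin k) → Σ (Fin n) λ v → (v ∉ S) × (label v ≡ c)) ×
    (∀ u v → u ∉ S → v ∉ S → (label u ≡ label v) ⇔ Reach G S u v)

OneTough : ∀ {n} → Graph n → Set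
OneTough {n} G = ∀ (S : Subset n) (k : ℕ) → NumComponents G S k → 1 < k → k ≤ ∣ S ∣

record Cycle {n} (G : Graph n) (len : ℕ) : Set where
  field
    m      : ℕ
    len≡   : len ≡ 3 + m
    vert   : Fin (3 + m) → Fin n
    inj    : Injective _≡_ _≡_ vert
    edges  : ∀ (i : Fin (2 + m)) → Edge G (vert (inject₁ i)) (vert (suc i))
    close  : Edge G (vert (fromℕ (2 + m))) (vert zero)

Hamiltonian : ∀ {n} → Graph n → Set
Hamiltonian {n} G = Cycle G n

IsCircumference : ∀ {n} → Graph n → ℕ → Set
IsCircumference G c = Cycle G c × (∀ l → Cycle G l → l ≤ c)

bound : ℕ → ℕ → ℕ
bound n δ =
  if n % 3 ≡ᵇ 1 then 2 * δ + 2
  else if (n % 3 ≡ᵇ 2) ∨ (n % 4 ≡ᵇ 1) then 2 * δ + 3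
  else 2 * δ + 4

-- Let L be a longest cycle, c its length, and suppose c ≤ 2δ + 3 and c ≠ n. The main tool is a weighted count
-- along L (spread): if the members of M ⊆ L are joined pairwise by long paths outside L, then rerouting L keeps
-- them far apart, and toughness, applied to M, excludes that L consists of the minimal gaps only. Applied to the
-- ends of a maximal path hanging off L, it shows that every vertex outside L lies in a "clump": a clique P which
-- is a component of G ∖ L, completely joined to a set N ⊆ L, with |P| + |N| = 1 + δ and |N| (1 + |P|) + 2 ≤ c.
-- Hence |N| = 2, or |P| = 1 and |N| ≥ 3, or |P| = 2 and |N| = 3. In the second case toughness and reroutings of L force
-- δ = 3, c = 9 and at most two vertices outside L, while in the third c = 11, δ = 4 and every other clump has
-- |N| = 2 and |P| = 3. If |N| = 2 throughout, there are at most two clumps, and only one if c = 2δ + 2.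
-- Counting n = c + Σ |P| then contradicts c < bound n δ in every case.
module Submission where

-- Plain counting gives only `wsum ω M` ≤ c; the 2 in `spread` is where toughness acts. A link
-- between two segments, or an edge from inside a segment to the outside component, costs two
-- vertices beyond this estimate. With at most one to spare, deleting `M` therefore separates the
-- segments from each other and from that component, leaving |M| + 1 parts. For a clump, c ≤ 2δ + 3
-- and |P| + |N| = 1 + δ turn |N| (1 + |P|) + 2 ≤ c into (|N| - 2)(|P| - 1) ≤ 1, the origin of the
-- three shapes. The shape |P| = 1 is the laborious one: c may exceed the minimum 2|N| by three, so
-- counting alone permits edges between segments, and explicit longer cycles have to refute them.
-- The excess of three, shared by all segments, is the budget that keeps the cases few. Connectivity
-- and longest paths are never computed. Existence statements stand under double negation, which
-- suffices because what is finally drawn from them is a contradiction or a decidable statement.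

open import Defs renaming (sym to adj-sym)
open import Data.Bool using (Bool; true; false; _∧_; if_then_else_; _∨_) renaming (T to IsTrue; _≟_ to _≟ᵇ_)
open import Data.Bool.Properties using (T-∧; ∨-zeroʳ)
open import Data.Empty using (⊥; ⊥-elim)
open import Data.Fin using (Fin; zero; suc; inject₁; fromℕ) renaming (_≟_ to _≟ᶠ_)
open import Data.Fin.Properties using (injective⇒≤)
import Data.Fin.Subset as Subset
open import Data.List using (List; []; _∷_; _++_; length; reverse; map; filter; lookup; tabulate; allFin; concat)
open import Data.List.Membership.Propositional using (_∈_; _∉_; lose; find)
open import Data.List.Membership.Propositional.Properties using (∈-++⁺ˡ; ∈-++⁺ʳ; ∈-++⁻; ∈-∃++; ∈-filter⁺; ∈-filter⁻; ∈-lookup; ∈-tabulate⁻; ∈-map⁺; ∈-map⁻; ∈-allFin; ∈-concat⁺; ∈-concat⁻′)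
open import Data.List.Properties using (length-++; length-reverse; ++-assoc; unfold-reverse; reverse-++; length-tabulate; ++-identityʳ; length-map; map-++; ∷ʳ-injective; ∷-injective; ∷-injectiveʳ; ++-cancelˡ)
open import Data.List.Relation.Binary.Permutation.Propositional.Properties using (shift; All-resp-↭; Any-resp-↭)
open import Data.List.Relation.Unary.All as All using (All; []; _∷_)
open import Data.List.Relation.Unary.All.Properties using (¬Any⇒All¬; ++⁺; ++⁻ˡ; ++⁻ʳ)
open import Data.List.Relation.Unary.AllPairs using (AllPairs; []; _∷_)
open import Data.List.Relation.Unary.Any as Any using (Any; here; there; any?)
open import Data.List.Relation.Unary.Any.Properties using (reverse⁺; reverse⁻; lookup-index) renaming (++⁺ʳ to any-++ʳ; ++⁺ˡ to any-++ˡ; ++⁻ to any-++⁻)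
open import Data.Nat
open import Data.Nat.DivMod using ([m+kn]%n≡m%n)
open import Data.Nat.ListAction using (sum)
open import Data.Nat.Properties hiding (_≟_)
open import Data.Nat.Tactic.RingSolver using (solve-∀)
open import Data.Product using (_×_; _,_; proj₁; proj₂; Σ; ∃-syntax)
open import Data.Sum using (_⊎_; inj₁; inj₂; [_,_]′)
open import Data.Unit using (⊤; tt)
import Data.Vec as Vec
open import Data.Vec.Properties using (lookup∘tabulate; []=⇒lookup; lookup⇒[]=)
open import Function.Bundles using (Equivalence; mk⇔)
open import Function.Definitions using (Injective)
open import Relation.Binary.Definitions using (DecidableEquality)
open import Relation.Binary.PropositionalEquality
open import Relation.Nullary using (yes; no; ¬_; Dec; contradiction; does)
open import Relation.Nullary.Decidable using (decidable-stable; dec-true; _⊎-dec_; ¬?)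
open import Relation.Unary using (Decidable)
open import Algebra.Properties.CommutativeSemigroup +-commutativeSemigroup using (interchange)

-- Linear arithmetic on list lengths

infixr 7 _·_
infixl 7 _⊕_
infixl 8 _⊗_
infix 6 _≼_ _≋_

-- One syntax of list shapes serves two reflective tests: `lnorm` reads off lengths, and `flat` the
-- multiset of blocks, on which distinctness and membership depend.
data LExp : Set where
  #_ •_ : ℕ → LExp
  _·_   : LExp → LExp → LExp
  rev   : LExp → LExp
  ε     : LExp

data Exp : Set where
  κ at : ℕ → Exp
  _⊕_  : Exp → Exp → Exp
  _⊗_  : ℕ → Exp → Exp
  lng  : LExp → Exp

data Rel : Set where
  _≼_ _≋_ : Exp → Exp → Rel

data Key : Set where
  ka kl ke : ℕ → Key

_≡ᵏ_ : Key → Key → Bool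
ka m ≡ᵏ ka n = m ≡ᵇ n
kl m ≡ᵏ kl n = m ≡ᵇ n
ke m ≡ᵏ ke n = m ≡ᵇ n
_    ≡ᵏ _    = false

≡ᵏ⇒≡ : ∀ j k → IsTrue (j ≡ᵏ k) → j ≡ k
≡ᵏ⇒≡ (ka m) (ka n) t = cong ka (≡ᵇ⇒≡ m n t)
≡ᵏ⇒≡ (kl m) (kl n) t = cong kl (≡ᵇ⇒≡ m n t)
≡ᵏ⇒≡ (ke m) (ke n) t = cong ke (≡ᵇ⇒≡ m n t)

-- This takes one occurrence of the key out of the list, the flag telling whether there was one.
insert? : Key → List Key → Bool × List Key
insert? k [] = false , []
insert? k (j ∷ js) with k ≡ᵏ j
... | true  = true , js
... | false = proj₁ (insert? k js) , j ∷ proj₂ (insert? k js)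

_⊆ᵏ_ : List Key → List Key → Bool
[]       ⊆ᵏ js = true
(k ∷ ks) ⊆ᵏ js = proj₁ (insert? k js) ∧ (ks ⊆ᵏ proj₂ (insert? k js))

module _ (val : Key → ℕ) where

  vals : List Key → ℕ
  vals []       = 0
  vals (k ∷ ks) = val k + vals ks

  vals-++ : ∀ js ks → vals (js ++ ks) ≡ vals js + vals ks
  vals-++ []       ks = refl
  vals-++ (j ∷ js) ks = trans (cong (val j +_) (vals-++ js ks)) (sym (+-assoc (val j) _ _))

  vals-insert? : ∀ k js → IsTrue (proj₁ (insert? k js)) → vals js ≡ val k + vals (proj₂ (insert? k js))
  vals-insert? k (j ∷ js) t with k ≡ᵏ j in eq
  ... | true  = cong (λ i → val i + vals js) (sym (≡ᵏ⇒≡ k j (subst IsTrue (sym eq) tt)))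
  ... | false = trans (cong (val j +_) (vals-insert? k js t)) (x∙yz≈y∙xz (val j) (val k) _)
    where
    open import Algebra.Properties.CommutativeSemigroup +-commutativeSemigroup using (x∙yz≈y∙xz)

  vals-⊆ : ∀ ks js → IsTrue (ks ⊆ᵏ js) → vals ks ≤ vals js
  vals-⊆ []       js t = z≤n
  vals-⊆ (k ∷ ks) js t with Equivalence.to T-∧ t
  ... | t₁ , t₂ = ≤-trans (+-monoʳ-≤ (val k) (vals-⊆ ks _ t₂)) (≤-reflexive (sym (vals-insert? k js t₁)))

flat : LExp → List Key
flat (# i)   = kl i ∷ []
flat (• i)   = ke i ∷ []
flat (e · f) = flat e ++ flat f
flat (rev e) = flat e
flat ε       = []

NF : Set
NF = ℕ × List Key

_⊞_ : NF → NF → NF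
(m , js) ⊞ (n , ks) = m + n , js ++ ks

times : ℕ → NF → NF
times zero    a = 0 , []
times (suc k) a = a ⊞ times k a

-- The first argument is the number of list elements in scope.
lnorm : ℕ → LExp → NF
lnorm t (# i)   = 0 , kl i ∷ []
lnorm t (• i)   = (if i <ᵇ t then 1 else 0) , []
lnorm t (e · f) = lnorm t e ⊞ lnorm t f
lnorm t (rev e) = lnorm t e
lnorm t ε       = 0 , []

norm : ℕ → Exp → NF
norm t (κ n)   = n , []
norm t (at i)  = 0 , ka i ∷ []
norm t (e ⊕ f) = norm t e ⊞ norm t f
norm t (k ⊗ e) = times k (norm t e)
norm t (lng e) = lnorm t e

-- Certificates of linear inequalities over ℕ whose atoms are numbers (at) and lengths of lists (lng). A
-- certificate gives, for every hypothesis, its multiplier and the multiplier of its converse (which only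
-- an equation has).
low high : ℕ → List Rel → List (ℕ × ℕ) → NF
low t []             cs             = 0 , []
low t (r ∷ rs)       []             = 0 , []
low t (e ≼ f ∷ rs)   ((a , b) ∷ cs) = times a (norm t e) ⊞ low t rs cs
low t (e ≋ f ∷ rs)   ((a , b) ∷ cs) = (times a (norm t e) ⊞ times b (norm t f)) ⊞ low t rs cs
high t []            cs             = 0 , []
high t (r ∷ rs)      []             = 0 , []
high t (e ≼ f ∷ rs)  ((a , b) ∷ cs) = times a (norm t f) ⊞ high t rs cs
high t (e ≋ f ∷ rs)  ((a , b) ∷ cs) = (times a (norm t f) ⊞ times b (norm t e)) ⊞ high t rs cs

dominated : NF → NF → Bool
dominated (m , js) (n , ks) = (m ≤ᵇ n) ∧ (js ⊆ᵏ ks)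

-- The number `k` is a rounding allowance: (k + 1) g ≤ (k + 1) h + k already implies g ≤ h over ℕ,
-- so certificates may divide.
check : ℕ → List Rel → Exp → Exp → ℕ → List (ℕ × ℕ) → Bool
check t rs g h k cs =
  dominated (times (suc k) (norm t g) ⊞ high t rs cs)
            ((k , []) ⊞ (times (suc k) (norm t h) ⊞ low t rs cs))

-- Arithmetic contradictions are all reached in one way: `lin` derives 1 ≤ 0 from the collected
-- bounds.
1≰0 : {A : Set} → 1 ≤ 0 → A
1≰0 ()

lookup₀ : {B : Set} → B → List B → ℕ → B
lookup₀ b []       i       = b
lookup₀ b (x ∷ xs) zero    = x
lookup₀ b (x ∷ xs) (suc i) = lookup₀ b xs i

-- An index out of range yields the empty list, so that no default vertex is required; this is why
-- `lnorm` has to know how many elements are in scope.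
element : {A : Set} → List A → ℕ → List A
element []       i       = []
element (x ∷ xs) zero    = x ∷ []
element (x ∷ xs) (suc i) = element xs i

module _ {A : Set} where

  ⟦_⟧ˡ : LExp → List (List A) → List A → List A
  ⟦ # i ⟧ˡ   σ τ = lookup₀ [] σ i
  ⟦ • i ⟧ˡ   σ τ = element τ i
  ⟦ e · f ⟧ˡ σ τ = ⟦ e ⟧ˡ σ τ ++ ⟦ f ⟧ˡ σ τ
  ⟦ rev e ⟧ˡ σ τ = reverse (⟦ e ⟧ˡ σ τ)
  ⟦ ε ⟧ˡ     σ τ = []

module _ {A : Set} (ρ : List ℕ) (σ : List (List A)) (τ : List A) where

  ⟦_⟧ : Exp → ℕ
  ⟦ κ n ⟧   = n
  ⟦ at i ⟧  = lookup₀ 0 ρ i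
  ⟦ e ⊕ f ⟧ = ⟦ e ⟧ + ⟦ f ⟧
  ⟦ k ⊗ e ⟧ = k * ⟦ e ⟧
  ⟦ lng e ⟧ = length (⟦ e ⟧ˡ σ τ)

  ⟦_⟧ʳ : Rel → Set
  ⟦ e ≼ f ⟧ʳ = ⟦ e ⟧ ≤ ⟦ f ⟧
  ⟦ e ≋ f ⟧ʳ = ⟦ e ⟧ ≡ ⟦ f ⟧

  Hold : List Rel → Set
  Hold []       = ⊤
  Hold (r ∷ rs) = ⟦ r ⟧ʳ × Hold rs

  private
    keyval : Key → ℕ
    keyval (ka i) = lookup₀ 0 ρ i
    keyval (kl i) = length (lookup₀ [] σ i)
    keyval (ke i) = 0

    nf : NF → ℕ
    nf (n , ks) = n + vals keyval ks

    nf-⊞ : ∀ a b → nf (a ⊞ b) ≡ nf a + nf b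
    nf-⊞ (m , js) (n , ks) = trans (cong (m + n +_) (vals-++ keyval js ks)) (interchange m n _ _)

    nf-times : ∀ k a → nf (times k a) ≡ k * nf a
    nf-times zero    a = refl
    nf-times (suc k) a = trans (nf-⊞ a (times k a)) (cong (nf a +_) (nf-times k a))

    element-length : ∀ (τ : List A) i → length (element τ i) ≡ (if i <ᵇ length τ then 1 else 0)
    element-length []      zero    = refl
    element-length []      (suc i) = refl
    element-length (x ∷ τ) zero    = refl
    element-length (x ∷ τ) (suc i) = element-length τ i

    nf-lnorm : ∀ e → nf (lnorm (length τ) e) ≡ length (⟦ e ⟧ˡ σ τ)
    nf-lnorm (# i)   = +-identityʳ _
    nf-lnorm (• i)   = trans (+-identityʳ _) (sym (element-length τ i))
    nf-lnorm (e · f) = trans (nf-⊞ (lnorm _ e) _)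
                             (trans (cong₂ _+_ (nf-lnorm e) (nf-lnorm f)) (sym (length-++ (⟦ e ⟧ˡ σ τ))))
    nf-lnorm (rev e) = trans (nf-lnorm e) (sym (length-reverse (⟦ e ⟧ˡ σ τ)))
    nf-lnorm ε       = refl

    N = norm (length τ)

    nf-norm : ∀ e → nf (N e) ≡ ⟦ e ⟧
    nf-norm (κ n)   = +-identityʳ n
    nf-norm (at i)  = +-identityʳ _
    nf-norm (e ⊕ f) = trans (nf-⊞ (N e) (N f)) (cong₂ _+_ (nf-norm e) (nf-norm f))
    nf-norm (k ⊗ e) = trans (nf-times k (N e)) (cong (k *_) (nf-norm e))
    nf-norm (lng e) = nf-lnorm e

    times-norm : ∀ k e → nf (times k (N e)) ≡ k * ⟦ e ⟧
    times-norm k e = trans (nf-times k (N e)) (cong (k *_) (nf-norm e))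

    low≤high : ∀ rs cs → Hold rs → nf (low (length τ) rs cs) ≤ nf (high (length τ) rs cs)
    low≤high []           cs             h       = z≤n
    low≤high (r ∷ rs)     []             h       = z≤n
    low≤high (e ≼ f ∷ rs) ((a , b) ∷ cs) (p , h) = begin
      nf (times a (N e) ⊞ low _ rs cs)        ≡⟨ nf-⊞ (times a (N e)) _ ⟩
      nf (times a (N e)) + nf (low _ rs cs)   ≡⟨ cong₂ _+_ (times-norm a e) refl ⟩
      a * ⟦ e ⟧ + nf (low _ rs cs)            ≤⟨ +-mono-≤ (*-monoʳ-≤ a p) (low≤high rs cs h) ⟩
      a * ⟦ f ⟧ + nf (high _ rs cs)           ≡⟨ cong₂ _+_ (times-norm a f) refl ⟨
      nf (times a (N f)) + nf (high _ rs cs)  ≡⟨ nf-⊞ (times a (N f)) _ ⟨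
      nf (times a (N f) ⊞ high _ rs cs)       ∎
      where open ≤-Reasoning
    low≤high (e ≋ f ∷ rs) ((a , b) ∷ cs) (p , h) = begin
      nf ((times a (N e) ⊞ times b (N f)) ⊞ low _ rs cs)  ≡⟨ nf-⊞ (times a (N e) ⊞ times b (N f)) _ ⟩
      nf (times a (N e) ⊞ times b (N f)) + nf (low _ rs cs)
        ≡⟨ cong₂ _+_ (trans (nf-⊞ (times a (N e)) _) (cong₂ _+_ (times-norm a e) (times-norm b f))) refl ⟩
      (a * ⟦ e ⟧ + b * ⟦ f ⟧) + nf (low _ rs cs)
        ≤⟨ +-mono-≤ (≤-reflexive (cong₂ _+_ (cong (a *_) p) (cong (b *_) (sym p)))) (low≤high rs cs h) ⟩
      (a * ⟦ f ⟧ + b * ⟦ e ⟧) + nf (high _ rs cs)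
        ≡⟨ cong₂ _+_ (trans (nf-⊞ (times a (N f)) _) (cong₂ _+_ (times-norm a f) (times-norm b e))) refl ⟨
      nf (times a (N f) ⊞ times b (N e)) + nf (high _ rs cs)
        ≡⟨ nf-⊞ (times a (N f) ⊞ times b (N e)) _ ⟨
      nf ((times a (N f) ⊞ times b (N e)) ⊞ high _ rs cs)  ∎
      where open ≤-Reasoning

    nf-dominated : ∀ a b → IsTrue (dominated a b) → nf a ≤ nf b
    nf-dominated (m , js) (n , ks) t with Equivalence.to T-∧ t
    ... | t₁ , t₂ = +-mono-≤ (≤ᵇ⇒≤ m n t₁) (vals-⊆ keyval js ks t₂)

  -- If g ≤ h failed then (k + 1) h + k < (k + 1) g, against the checked domination.
  lin : ∀ rs g h k cs {_ : IsTrue (check (length τ) rs g h k cs)} → Hold rs → ⟦ g ⟧ ≤ ⟦ h ⟧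
  lin rs g h k cs {t} hold with ⟦ g ⟧ ≤? ⟦ h ⟧
  ... | yes g≤h = g≤h
  ... | no  g≰h = contradiction (+-cancelʳ-≤ (nf L) _ _ main) (<⇒≱ strict)
    where
    L = low (length τ) rs cs
    H = high (length τ) rs cs
    main : suc k * ⟦ g ⟧ + nf L ≤ k + suc k * ⟦ h ⟧ + nf L
    main = begin
      suc k * ⟦ g ⟧ + nf L  ≤⟨ +-monoʳ-≤ (suc k * ⟦ g ⟧) (low≤high rs cs hold) ⟩
      suc k * ⟦ g ⟧ + nf H  ≡⟨ trans (nf-⊞ (times (suc k) (N g)) H) (cong₂ _+_ (times-norm (suc k) g) refl) ⟨
      nf (times (suc k) (N g) ⊞ H)
        ≤⟨ nf-dominated (times (suc k) (N g) ⊞ H) ((k , []) ⊞ (times (suc k) (N h) ⊞ L)) t ⟩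
      nf ((k , []) ⊞ (times (suc k) (N h) ⊞ L))  ≡⟨ nf-⊞ (k , []) (times (suc k) (N h) ⊞ L) ⟩
      k + 0 + nf (times (suc k) (N h) ⊞ L)
        ≡⟨ cong₂ _+_ (+-identityʳ k) (trans (nf-⊞ (times (suc k) (N h)) L) (cong₂ _+_ (times-norm (suc k) h) refl)) ⟩
      k + (suc k * ⟦ h ⟧ + nf L)  ≡⟨ +-assoc k _ _ ⟨
      k + suc k * ⟦ h ⟧ + nf L    ∎
      where open ≤-Reasoning
    strict : k + suc k * ⟦ h ⟧ < suc k * ⟦ g ⟧
    strict = ≤-trans (≤-reflexive (sym (*-suc (suc k) ⟦ h ⟧))) (*-monoʳ-≤ (suc k) (≰⇒> g≰h))

-- Lists without repetition

private
  variable
    El El′ : Set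

em : ∀ (P : Set) → (Dec P → ⊥) → ⊥
em P k = k (no λ p → k (yes p))

first : ∀ {P : El → Set} → Decidable P → ∀ {xs} → Any P xs →
        ∃[ as ] ∃[ t ] ∃[ bs ] (xs ≡ as ++ t ∷ bs × All (λ a → ¬ P a) as × P t)
first P? {x ∷ xs} p with P? x
... | yes px = [] , x , xs , refl , [] , px
first P? {x ∷ xs} (here px) | no ¬px = contradiction px ¬px
first P? {x ∷ xs} (there p) | no ¬px with first P? p
... | as , t , bs , refl , none , pt = x ∷ as , t , bs , refl , ¬px ∷ none , pt

last : ∀ {P : El → Set} → Decidable P → ∀ {xs} → Any P xs →
       ∃[ as ] ∃[ t ] ∃[ bs ] (xs ≡ as ++ t ∷ bs × All (λ b → ¬ P b) bs × P t)
last P? {x ∷ xs} p with any? P? xs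
... | yes q with last P? q
...   | as , t , bs , refl , none , pt = x ∷ as , t , bs , refl , none , pt
last P? {x ∷ xs} (here px) | no ¬q = [] , x , xs , refl , All.tabulate (λ b∈ pb → ¬q (lose b∈ pb)) , px
last P? {x ∷ xs} (there p) | no ¬q = contradiction p ¬q

wsum : (El → ℕ) → List El → ℕ
wsum ω xs = sum (map ω xs)

wsum-++ : ∀ (ω : El → ℕ) xs ys → wsum ω (xs ++ ys) ≡ wsum ω xs + wsum ω ys
wsum-++ ω []       ys = refl
wsum-++ ω (x ∷ xs) ys = trans (cong (ω x +_) (wsum-++ ω xs ys)) (sym (+-assoc (ω x) _ _))

wsum-const : ∀ {ω : El → ℕ} k xs → (∀ {x} → x ∈ xs → ω x ≡ k) → wsum ω xs ≡ length xs * k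
wsum-const k []       h = refl
wsum-const k (x ∷ xs) h = cong₂ _+_ (h (here refl)) (wsum-const k xs (λ p → h (there p)))

module Distinct {El : Set} (_≟_ : DecidableEquality El) where

  open import Data.List.Membership.DecPropositional _≟_ public using (_∈?_)

  single : El → El → ℕ
  single v x with v ≟ x
  ... | yes _ = 1
  ... | no  _ = 0

  cnt : El → List El → ℕ
  cnt v []       = 0
  cnt v (x ∷ xs) = single v x + cnt v xs

  single-refl : ∀ v → single v v ≡ 1
  single-refl v with v ≟ v
  ... | yes _ = refl
  ... | no ¬p = contradiction refl ¬p

  single-≢ : ∀ {v x} → v ≢ x → single v x ≡ 0
  single-≢ {v} {x} v≢x with v ≟ x
  ... | yes p = contradiction p v≢x
  ... | no  _ = refl

  cnt-++ : ∀ v xs ys → cnt v (xs ++ ys) ≡ cnt v xs + cnt v ys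
  cnt-++ v []       ys = refl
  cnt-++ v (x ∷ xs) ys = trans (cong (single v x +_) (cnt-++ v xs ys)) (sym (+-assoc (single v x) _ _))

  cnt-reverse : ∀ v xs → cnt v (reverse xs) ≡ cnt v xs
  cnt-reverse v []       = refl
  cnt-reverse v (x ∷ xs) = begin
    cnt v (reverse (x ∷ xs))            ≡⟨ cong (cnt v) (unfold-reverse x xs) ⟩
    cnt v (reverse xs ++ x ∷ [])        ≡⟨ cnt-++ v (reverse xs) _ ⟩
    cnt v (reverse xs) + (single v x + 0) ≡⟨ cong₂ _+_ (cnt-reverse v xs) (+-identityʳ _) ⟩
    cnt v xs + single v x               ≡⟨ +-comm (cnt v xs) _ ⟩
    single v x + cnt v xs               ∎
    where open ≡-Reasoning

  ∈⇒cnt : ∀ {v xs} → v ∈ xs → 1 ≤ cnt v xs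
  ∈⇒cnt {v} (here refl)     = ≤-trans (≤-reflexive (sym (single-refl v))) (m≤m+n _ _)
  ∈⇒cnt {v} {x ∷ _} (there p) = ≤-trans (∈⇒cnt p) (m≤n+m _ (single v x))

  ∉⇒cnt : ∀ {v} xs → v ∉ xs → cnt v xs ≡ 0
  ∉⇒cnt []       h = refl
  ∉⇒cnt (x ∷ xs) h = cong₂ _+_ (single-≢ (λ p → h (here p))) (∉⇒cnt xs (λ p → h (there p)))

  -- Phrased by multiplicities, distinctness passes to every list with smaller multiplicities,
  -- whatever its order. That makes it accessible to a test on multisets of blocks.
  record NoDup (xs : List El) : Set where
    constructor nodup
    field once : ∀ v → cnt v xs ≤ 1

  open NoDup public

  cnt⇒∈ : ∀ {v} xs → 1 ≤ cnt v xs → v ∈ xs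
  cnt⇒∈ {v} xs h with v ∈? xs
  ... | yes p = p
  ... | no ¬p = ⊥-elim (<⇒≱ h (≤-reflexive (∉⇒cnt xs ¬p)))

  cnt-⊆ : ∀ σ τ new old {_ : IsTrue (flat new ⊆ᵏ flat old)} v → cnt v (⟦ new ⟧ˡ σ τ) ≤ cnt v (⟦ old ⟧ˡ σ τ)
  cnt-⊆ σ τ new old {t} v = begin
    cnt v (⟦ new ⟧ˡ σ τ)   ≡⟨ value new ⟨
    vals val (flat new)    ≤⟨ vals-⊆ val (flat new) (flat old) t ⟩
    vals val (flat old)    ≡⟨ value old ⟩
    cnt v (⟦ old ⟧ˡ σ τ)   ∎
    where
    open ≤-Reasoning
    val : Key → ℕ
    val (ka i) = 0
    val (kl i) = cnt v (lookup₀ [] σ i)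
    val (ke i) = cnt v (element τ i)
    value : ∀ e → vals val (flat e) ≡ cnt v (⟦ e ⟧ˡ σ τ)
    value (# i)   = +-identityʳ _
    value (• i)   = +-identityʳ _
    value (e · f) = trans (vals-++ val (flat e) (flat f))
                          (trans (cong₂ _+_ (value e) (value f)) (sym (cnt-++ v (⟦ e ⟧ˡ σ τ) _)))
    value (rev e) = trans (value e) (sym (cnt-reverse v (⟦ e ⟧ˡ σ τ)))
    value ε       = refl

  -- Every rerouting below rearranges blocks of a known list, possibly reversing or dropping some.
  -- Its distinctness is then settled by evaluation.
  nodup⊆ : ∀ σ τ new old {_ : IsTrue (flat new ⊆ᵏ flat old)} →
           NoDup (⟦ old ⟧ˡ σ τ) → NoDup (⟦ new ⟧ˡ σ τ)
  nodup⊆ σ τ new old {t} h .once v = ≤-trans (cnt-⊆ σ τ new old {t} v) (once h v)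

  ∈⊆ : ∀ σ τ new old {_ : IsTrue (flat new ⊆ᵏ flat old)} {v} → v ∈ ⟦ new ⟧ˡ σ τ → v ∈ ⟦ old ⟧ˡ σ τ
  ∈⊆ σ τ new old {t} {v} p = cnt⇒∈ (⟦ old ⟧ˡ σ τ) (≤-trans (∈⇒cnt p) (cnt-⊆ σ τ new old {t} v))

  NoDup-[] : NoDup []
  NoDup-[] .once v = z≤n

  NoDup-disjoint : ∀ {xs ys v} → NoDup (xs ++ ys) → v ∈ xs → v ∈ ys → ⊥
  NoDup-disjoint {xs} {ys} {v} h p q =
    (1≰0 (lin {A = ⊤} (cnt v (xs ++ ys) ∷ cnt v xs ∷ cnt v ys ∷ []) ([]) ([]) ((at 0 ≼ κ 1) ∷ (at 0 ≋ (at 1 ⊕ at 2)) ∷ (κ 1 ≼ at 1) ∷ (κ 1 ≼ at 2) ∷ []) (κ 1) (κ 0) 0 ((1 , 0) ∷ (0 , 1) ∷ (1 , 0) ∷ (1 , 0) ∷ []) (once h v , cnt-++ v xs ys , ∈⇒cnt p , ∈⇒cnt q , tt)))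

  NoDup-head : ∀ {x xs} → NoDup (x ∷ xs) → x ∉ xs
  NoDup-head h p = NoDup-disjoint {_ ∷ []} h (here refl) p

  NoDup-++ : ∀ {xs ys} → NoDup xs → NoDup ys → (∀ {v} → v ∈ xs → v ∈ ys → ⊥) → NoDup (xs ++ ys)
  NoDup-++ {xs} {ys} p q d .once v with v ∈? xs
  ... | yes v∈ = (lin {A = ⊤} (cnt v xs ∷ cnt v ys ∷ cnt v (xs ++ ys) ∷ []) ([]) ([]) ((at 0 ≼ κ 1) ∷ (at 1 ≋ κ 0) ∷ (at 2 ≋ (at 0 ⊕ at 1)) ∷ []) (at 2) (κ 1) 0 ((1 , 0) ∷ (1 , 0) ∷ (1 , 0) ∷ []) (once p v , ∉⇒cnt ys (d v∈) , cnt-++ v xs ys , tt))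
  ... | no v∉  = (lin {A = ⊤} (cnt v ys ∷ cnt v xs ∷ cnt v (xs ++ ys) ∷ []) ([]) ([]) ((at 0 ≼ κ 1) ∷ (at 1 ≋ κ 0) ∷ (at 2 ≋ (at 1 ⊕ at 0)) ∷ []) (at 2) (κ 1) 0 ((1 , 0) ∷ (1 , 0) ∷ (1 , 0) ∷ []) (once q v , ∉⇒cnt xs v∉ , cnt-++ v xs ys , tt))

  NoDup-single : ∀ x → NoDup (x ∷ [])
  NoDup-single x .once v with v ≟ x
  ... | yes _ = s≤s z≤n
  ... | no  _ = z≤n

  NoDup-∷ : ∀ {x xs} → x ∉ xs → NoDup xs → NoDup (x ∷ xs)
  NoDup-∷ {x} x∉ p = NoDup-++ {x ∷ []} (NoDup-single x) p λ { (here refl) q → x∉ q }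

  NoDup-tail : ∀ {x xs} → NoDup (x ∷ xs) → NoDup xs
  NoDup-tail {x} {xs} h = (nodup⊆ (xs ∷ []) (x ∷ []) (# 0) ((• 0 · # 0)) (h))

  NoDup-++ˡ : ∀ xs {ys} → NoDup (xs ++ ys) → NoDup xs
  NoDup-++ˡ xs {ys} h = (nodup⊆ (xs ∷ ys ∷ []) ([]) (# 0) ((# 0 · # 1)) (h))

  NoDup-++ʳ : ∀ xs {ys} → NoDup (xs ++ ys) → NoDup ys
  NoDup-++ʳ xs {ys} h = (nodup⊆ (xs ∷ ys ∷ []) ([]) (# 1) ((# 0 · # 1)) (h))

  NoDup-filter : ∀ {P : El → Set} (P? : Decidable P) {xs} → NoDup xs → NoDup (filter P? xs)
  NoDup-filter P? {xs} h .once v = ≤-trans (below xs) (once h v)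
    where
    below : ∀ xs → cnt v (filter P? xs) ≤ cnt v xs
    below [] = z≤n
    below (x ∷ xs) with P? x
    ... | yes _ = +-monoʳ-≤ (single v x) (below xs)
    ... | no  _ = ≤-trans (below xs) (m≤n+m _ _)

  wsum-⊆ : ∀ (ω : El → ℕ) {xs ys} → NoDup xs → (∀ {v} → v ∈ xs → v ∈ ys) → wsum ω xs ≤ wsum ω ys
  wsum-⊆ ω {[]}          h s = z≤n
  wsum-⊆ ω {x ∷ xs} {ys} h s with ∈-∃++ (s (here refl))
  ... | as , bs , refl =
    (lin {A = ⊤} (wsum ω xs ∷ wsum ω (as ++ bs) ∷ wsum ω as ∷ wsum ω bs ∷ wsum ω (as ++ x ∷ bs) ∷ ω x ∷ []) ([]) ([]) ((at 0 ≼ at 1) ∷ (at 1 ≋ (at 2 ⊕ at 3)) ∷ (at 4 ≋ (at 2 ⊕ (at 5 ⊕ at 3))) ∷ []) ((at 5 ⊕ at 0)) (at 4) 0 ((1 , 0) ∷ (1 , 0) ∷ (0 , 1) ∷ []) (wsum-⊆ ω {xs} {as ++ bs} (NoDup-tail h) other , wsum-++ ω as bs , wsum-++ ω as (x ∷ bs) , tt))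
    where
    other : ∀ {v} → v ∈ xs → v ∈ as ++ bs
    other p with ∈-++⁻ as (s (there p))
    ... | inj₁ q            = ∈-++⁺ˡ q
    ... | inj₂ (here refl)  = ⊥-elim (NoDup-head h p)
    ... | inj₂ (there q)    = ∈-++⁺ʳ as q

  length-⊆ : ∀ {xs ys} → NoDup xs → (∀ {v} → v ∈ xs → v ∈ ys) → length xs ≤ length ys
  length-⊆ {xs} {ys} h s = subst₂ _≤_ (ones xs) (ones ys) (wsum-⊆ (λ _ → 1) h s)
    where
    ones : ∀ xs → wsum (λ (_ : El) → 1) xs ≡ length xs
    ones []       = refl
    ones (x ∷ xs) = cong suc (ones xs)

  -- A missing `v` could be put in front of `xs`, which would make it too long for `ys`.
  ⊆-reverse : ∀ {xs ys} → NoDup xs → (∀ {v} → v ∈ xs → v ∈ ys) → length ys ≤ length xs →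
              ∀ {v} → v ∈ ys → v ∈ xs
  ⊆-reverse {xs} {ys} h s l {v} p with v ∈? xs
  ... | yes q = q
  ... | no ¬q = ⊥-elim (<⇒≱ (length-⊆ {v ∷ xs} (NoDup-∷ ¬q h) λ { (here refl) → p ; (there q) → s q }) l)

trues : ∀ {k} → (Fin k → Bool) → List (Fin k)
trues {zero}  f = []
trues {suc k} f with f zero
... | true  = zero ∷ map suc (trues (λ i → f (suc i)))
... | false = map suc (trues (λ i → f (suc i)))

∣tabulate∣ : ∀ {k} (f : Fin k → Bool) → Subset.∣ Vec.tabulate f ∣ ≡ length (trues f)
∣tabulate∣ {zero}  f = refl
∣tabulate∣ {suc k} f with f zero
... | true  = cong suc (trans (∣tabulate∣ (λ i → f (suc i))) (sym (length-map Fin.suc (trues (λ i → f (suc i))))))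
... | false = trans (∣tabulate∣ (λ i → f (suc i))) (sym (length-map Fin.suc (trues (λ i → f (suc i)))))

trues⁻ : ∀ {k} (f : Fin k → Bool) {i} → i ∈ trues f → f i ≡ true
trues⁻ {suc k} f p with f zero in eq
trues⁻ {suc k} f (here refl) | true = eq
trues⁻ {suc k} f (there p)   | true with ∈-map⁻ suc p
... | i , q , refl = trues⁻ (λ i → f (suc i)) q
trues⁻ {suc k} f p           | false with ∈-map⁻ suc p
... | i , q , refl = trues⁻ (λ i → f (suc i)) q

module TrueLists where
  open Distinct

  private
    nodup-map-suc : ∀ {k} {xs : List (Fin k)} → NoDup _≟ᶠ_ xs → NoDup _≟ᶠ_ (map suc xs)
    nodup-map-suc {xs = []}     h = NoDup-[] _≟ᶠ_
    nodup-map-suc {xs = x ∷ xs} h = NoDup-∷ _≟ᶠ_ new (nodup-map-suc (NoDup-tail _≟ᶠ_ h))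
      where
      new : suc x ∉ map suc xs
      new p with ∈-map⁻ suc p
      ... | _ , q , refl = NoDup-head _≟ᶠ_ h q

  trues-nodup : ∀ {k} (f : Fin k → Bool) → NoDup _≟ᶠ_ (trues f)
  trues-nodup {zero}  f = NoDup-[] _≟ᶠ_
  trues-nodup {suc k} f with f zero
  ... | true  = NoDup-∷ _≟ᶠ_ new (nodup-map-suc (trues-nodup (λ i → f (suc i))))
    where
    new : zero ∉ map suc (trues (λ i → f (suc i)))
    new p with ∈-map⁻ suc p
    ... | _ , _ , ()
  ... | false = nodup-map-suc (trues-nodup (λ i → f (suc i)))

open TrueLists public

-- Finiteness of `Fin k` allows double negation to pass the quantifier, so that finitely many
-- undecided facts can be assumed at once.
∀¬¬⇒¬¬∀ : ∀ {k} {P : Fin k → Set} → (∀ i → ¬ ¬ P i) → ¬ ¬ (∀ i → P i)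
∀¬¬⇒¬¬∀ {zero}  h z = z λ ()
∀¬¬⇒¬¬∀ {suc k} h z =
  h zero λ p → ∀¬¬⇒¬¬∀ (λ i → h (suc i)) λ ps → z λ { zero → p ; (suc i) → ps i }

allpairs-lookup : ∀ {A : Set} {R : A → A → Set} {xs} → AllPairs R xs → ∀ i j → i ≢ j →
                  R (lookup xs i) (lookup xs j) ⊎ R (lookup xs j) (lookup xs i)
allpairs-lookup (r ∷ rs) zero    zero    i≢j = contradiction refl i≢j
allpairs-lookup (r ∷ rs) zero    (suc j) i≢j = inj₁ (All.lookup r (∈-lookup j))
allpairs-lookup (r ∷ rs) (suc i) zero    i≢j = inj₂ (All.lookup r (∈-lookup i))
allpairs-lookup (r ∷ rs) (suc i) (suc j) i≢j = allpairs-lookup rs i j (λ eq → i≢j (cong suc eq))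

-- As `P` need not be decidable, the maximum is found only up to double negation: a value that is
-- not maximal leads to a larger one, and `fuel` bounds the distance left to `B`.
bounded-max : ∀ (P : ℕ → Set) B → (∀ {k} → P k → k ≤ B) → ∀ {k} → P k → ¬ ¬ (∃[ m ] (P m × (∀ {j} → P j → j ≤ m)))
bounded-max P B bnd {k} p = go (B ∸ k) k p ≤-refl
  where
  go : ∀ fuel k → P k → B ∸ k ≤ fuel → ¬ ¬ (∃[ m ] (P m × (∀ {j} → P j → j ≤ m)))
  go fuel k p le no-max = no-max (k , p , λ {j} q → decidable-stable (j ≤? k) λ j≰k → higher fuel le j q (≰⇒> j≰k))
    where
    higher : ∀ fuel → B ∸ k ≤ fuel → ∀ j → P j → k < j → ⊥
    higher zero le j q k<j = <⇒≱ k<j (≤-trans (bnd q) (m∸n≡0⇒m≤n (n≤0⇒n≡0 le)))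
    higher (suc fuel) le j q k<j = go fuel j q (s≤s⁻¹ (≤-trans (∸-monoʳ-< k<j (bnd q)) le)) no-max

split-cases : ∀ {A : Set} X {a : A} {Y} U {b V} → X ++ a ∷ Y ≡ U ++ b ∷ V →
              (∃[ D ] (U ≡ X ++ a ∷ D)) ⊎ (X ≡ U × a ≡ b × Y ≡ V) ⊎ (∃[ D ] (X ≡ U ++ b ∷ D × V ≡ D ++ a ∷ Y))
split-cases []      []      refl = inj₂ (inj₁ (refl , refl , refl))
split-cases []      (u ∷ U) refl = inj₁ (U , refl)
split-cases (x ∷ X) []      refl = inj₂ (inj₂ (X , refl , refl))
split-cases (x ∷ X) (u ∷ U) eq with ∷-injective eq
... | refl , eq′ with split-cases X U eq′
...   | inj₁ (D , refl)                      = inj₁ (D , refl)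
...   | inj₂ (inj₁ (refl , refl , refl))     = inj₂ (inj₁ (refl , refl , refl))
...   | inj₂ (inj₂ (D , refl , refl))        = inj₂ (inj₂ (D , refl , refl))

module _ {V : Set} where

  not-odd : ∀ {a b c : V} {s t u : List V} → length s ≡ 2 → length t ≡ 2 → length u ≡ 2 →
            ¬ Any (λ σ → length (proj₂ σ) ≢ 2) ((a , s) ∷ (b , t) ∷ (c , u) ∷ [])
  not-odd p q r (here h)                 = h p
  not-odd p q r (there (here h))         = h q
  not-odd p q r (there (there (here h))) = h r

middle-of-three : ∀ {A : Set} {y q : A} {r} o b → length r ≤ 2 → 1 ≤ length o → 1 ≤ length b → y ∷ r ≡ o ++ q ∷ b →
                  ∃[ w ] (r ≡ q ∷ w ∷ [])
middle-of-three (_ ∷ []) (w ∷ []) _ _ _ refl = w , refl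
middle-of-three {q = q} (_ ∷ []) (w ∷ w′ ∷ b) l _ _ refl = (1≰0 (lin ([]) (b ∷ []) (q ∷ w ∷ w′ ∷ []) ((lng ((• 0 · (• 1 · (• 2 · # 0)))) ≼ κ 2) ∷ []) (κ 1) (κ 0) 0 ((1 , 0) ∷ []) (l , tt)))
middle-of-three {q = q} (_ ∷ o₁ ∷ o) (w ∷ b) l _ _ refl = (1≰0 (lin ([]) (o ∷ b ∷ []) (o₁ ∷ q ∷ w ∷ []) ((lng ((• 0 · (# 0 · (• 1 · (• 2 · # 1))))) ≼ κ 2) ∷ []) (κ 1) (κ 0) 0 ((1 , 0) ∷ []) (l , tt)))

pairs-of-three : ∀ {A : Set} {R : A → A → Set} {a b d} → (∀ {x y} → R x y → R y x) → R a b → R b d → R d a →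
                 ∀ {x y} → x ∈ a ∷ b ∷ d ∷ [] → y ∈ a ∷ b ∷ d ∷ [] → x ≢ y → R x y
pairs-of-three R-sym ab bd da (here refl) (here refl) ≢ = contradiction refl ≢
pairs-of-three R-sym ab bd da (here refl) (there (here refl)) _ = ab
pairs-of-three R-sym ab bd da (here refl) (there (there (here refl))) _ = R-sym da
pairs-of-three R-sym ab bd da (there (here refl)) (here refl) _ = R-sym ab
pairs-of-three R-sym ab bd da (there (here refl)) (there (here refl)) ≢ = contradiction refl ≢
pairs-of-three R-sym ab bd da (there (here refl)) (there (there (here refl))) _ = bd
pairs-of-three R-sym ab bd da (there (there (here refl))) (here refl) _ = da
pairs-of-three R-sym ab bd da (there (there (here refl))) (there (here refl)) _ = R-sym bd
pairs-of-three R-sym ab bd da (there (there (here refl))) (there (there (here refl))) ≢ = contradiction refl ≢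

-- Values of the bound, and the possible sizes of a clump

private
  bound≡2δ+2 : ∀ n δ → n % 3 ≡ 1 → bound n δ ≡ 2 * δ + 2
  bound≡2δ+2 n δ eq rewrite eq = refl

  bound≡2δ+3 : ∀ n δ → n % 3 ≡ 2 → bound n δ ≡ 2 * δ + 3
  bound≡2δ+3 n δ eq rewrite eq = refl

  2δ+2≤2δ+3 : ∀ δ → 2 * δ + 2 ≤ 2 * δ + 3
  2δ+2≤2δ+3 δ = +-monoʳ-≤ (2 * δ) (s≤s (s≤s z≤n))

  -- Only an inequality, since n ≡ 1 (mod 4) leaves n mod 3 open and the first case of `bound` takes
  -- precedence.
  bound≤2δ+3 : ∀ n δ → n % 4 ≡ 1 → bound n δ ≤ 2 * δ + 3
  bound≤2δ+3 n δ eq rewrite eq with n % 3 ≡ᵇ 1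
  ... | true  = 2δ+2≤2δ+3 δ
  ... | false rewrite ∨-zeroʳ (n % 3 ≡ᵇ 2) = ≤-refl

bound≤2δ+4 : ∀ n δ → bound n δ ≤ 2 * δ + 4
bound≤2δ+4 n δ with n % 3 ≡ᵇ 1 | (n % 3 ≡ᵇ 2) ∨ (n % 4 ≡ᵇ 1)
... | true  | _     = +-monoʳ-≤ (2 * δ) (s≤s (s≤s z≤n))
... | false | true  = +-monoʳ-≤ (2 * δ) (s≤s (s≤s (s≤s z≤n)))
... | false | false = ≤-refl

private
  -- (s ∸ 2) (q ∸ 1) ≤ 1
  small-cases : ∀ {q s δ l} → 1 ≤ q → 2 ≤ s → q + s ≡ 1 + δ → s * (1 + q) + 2 ≤ l → l ≤ 2 * δ + 3 →
                s ≡ 2 ⊎ (q ≡ 1 × 3 ≤ δ) ⊎ (q ≡ 2 × s ≡ 3)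
  small-cases {s = 1} _ (s≤s ()) _ _ _
  small-cases {1} {2} _ _ _ _ _ = inj₁ refl
  small-cases {suc (suc q)} {2} _ _ _ _ _ = inj₁ refl
  small-cases {1} {suc (suc (suc s))} _ _ c _ _ = inj₂ (inj₁ (refl , ≤-trans (s≤s (s≤s (s≤s z≤n))) (≤-reflexive (suc-injective c))))
  small-cases {2} {3} _ _ _ _ _ = inj₂ (inj₂ (refl , refl))
  small-cases {2} {suc (suc (suc (suc s)))} {δ} {l} _ _ c k m =
    ⊥-elim ((1≰0 (lin {A = ⊤} (s ∷ δ ∷ l ∷ []) ([]) ([]) (((κ 2 ⊕ (κ 4 ⊕ at 0)) ≋ (κ 1 ⊕ at 1)) ∷ ((κ 14 ⊕ 3 ⊗ (at 0)) ≼ at 2) ∷ (at 2 ≼ (2 ⊗ (at 1) ⊕ κ 3)) ∷ []) (κ 1) (κ 0) 0 ((0 , 2) ∷ (1 , 0) ∷ (1 , 0) ∷ []) (c , ≤-trans (≤-reflexive (sym (eq s))) k , m , tt))))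
    where
    eq : ∀ s → (4 + s) * 3 + 2 ≡ 14 + 3 * s
    eq = solve-∀
  small-cases {suc (suc (suc q))} {suc (suc (suc s))} {δ} {l} _ _ c k m = ⊥-elim ((1≰0 (lin {A = ⊤} (q ∷ s ∷ δ ∷ (s * q) ∷ l ∷ []) ([]) ([]) ((((κ 3 ⊕ at 0) ⊕ (κ 3 ⊕ at 1)) ≋ (κ 1 ⊕ at 2)) ∷ ((((κ 14 ⊕ 3 ⊗ (at 0)) ⊕ 4 ⊗ (at 1)) ⊕ at 3) ≼ at 4) ∷ (at 4 ≼ (2 ⊗ (at 2) ⊕ κ 3)) ∷ []) (κ 1) (κ 0) 0 ((1 , 3) ∷ (1 , 0) ∷ (1 , 0) ∷ []) (c , ≤-trans (≤-reflexive (sym (eq s q))) k , m , tt))))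
    where
    eq : ∀ s q → (3 + s) * (4 + q) + 2 ≡ 14 + 3 * q + 4 * s + (s * q)
    eq = solve-∀

-- Paths and cycles as vertex lists

module _ {n : ℕ} (G : Graph n) where

  V : Set
  V = Fin n

  open Distinct (_≟ᶠ_ {n}) public

  E : V → V → Set
  E = Edge G

  E? : ∀ u v → Dec (E u v)
  E? u v = adj G u v ≟ᵇ true

  E-sym : ∀ {u v} → E u v → E v u
  E-sym {u} {v} e = trans (adj-sym G v u) e

  E-irrefl : ∀ {v} → ¬ E v v
  E-irrefl {v} e with trans (sym e) (irrefl G v)
  ... | ()

  E⇒≢ : ∀ {u v} → E u v → u ≢ v
  E⇒≢ e refl = E-irrefl e

  -- Path u xs v lists all vertices of the path; Lk u xs v only the inner ones.
  data Path : V → List V → V → Set where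
    [_] : ∀ u → Path u (u ∷ []) u
    _∷_ : ∀ {u w xs v} → E u w → Path w xs v → Path u (u ∷ xs) v

  Lk : V → List V → V → Set
  Lk u []       v = E u v
  Lk u (x ∷ xs) v = E u x × Lk x xs v

  start∈ : ∀ {a xs b} → Path a xs b → a ∈ xs
  start∈ [ u ]   = here refl
  start∈ (e ∷ p) = here refl

  end∈ : ∀ {a xs b} → Path a xs b → b ∈ xs
  end∈ [ u ]   = here refl
  end∈ (e ∷ p) = there (end∈ p)

  path-nonempty : ∀ {a xs b} → Path a xs b → 1 ≤ length xs
  path-nonempty [ u ]   = s≤s z≤n
  path-nonempty (e ∷ p) = s≤s z≤n

  infixr 5 _⟨_⟩_

  _⟨_⟩_ : ∀ {a xs b c ys d} → Path a xs b → E b c → Path c ys d → Path a (xs ++ ys) d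
  [ u ]   ⟨ f ⟩ q = f ∷ q
  (e ∷ p) ⟨ f ⟩ q = e ∷ (p ⟨ f ⟩ q)

  path-reverse : ∀ {a xs b} → Path a xs b → Path b (reverse xs) a
  path-reverse [ u ] = [ u ]
  path-reverse {xs = u ∷ xs} (e ∷ p) =
    subst (λ l → Path _ l u) (sym (unfold-reverse u xs)) (path-reverse p ⟨ E-sym e ⟩ [ u ])

  lk-path : ∀ {u xs v ys w} → Lk u xs v → Path v ys w → Path u (u ∷ xs ++ ys) w
  lk-path {xs = []}     e       p = e ∷ p
  lk-path {xs = x ∷ xs} (e , l) p = e ∷ lk-path l p

  path-lk : ∀ {a xs b ys c zs d} → Path a xs b → Lk b ys c → Path c zs d → Path a (xs ++ ys ++ zs) d
  path-lk [ u ]   l q = lk-path l q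
  path-lk (e ∷ p) l q = e ∷ path-lk p l q

  lk-split : ∀ {u v} xs {y ys} → Lk u (xs ++ y ∷ ys) v → Lk u xs y × Lk y ys v
  lk-split []       (e , l) = e , l
  lk-split (x ∷ xs) (e , l) with lk-split xs l
  ... | l₁ , l₂ = (e , l₁) , l₂

  lk-++ : ∀ {u v w} xs {ys} → Lk u xs v → Lk v ys w → Lk u (xs ++ v ∷ ys) w
  lk-++ []       e       l = e , l
  lk-++ (x ∷ xs) (e , k) l = e , lk-++ xs k l

  lk-reverse : ∀ {u v} xs → Lk u xs v → Lk v (reverse xs) u
  lk-reverse []       e       = E-sym e
  lk-reverse (x ∷ xs) (e , l) =
    subst (λ z → Lk _ z _) (sym (unfold-reverse x xs)) (lk-++ (reverse xs) (lk-reverse xs l) (E-sym e))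

  lk-inner : ∀ {u x xs v} → Lk u (x ∷ xs) v → ∃[ y ] (E u x × Path x (x ∷ xs) y × E y v)
  lk-inner {x = x} {xs = []} (e , f) = x , e , [ x ] , f
  lk-inner {xs = y ∷ ys} (e , f , l) with lk-inner {xs = ys} (f , l)
  ... | z , _ , p , g = z , e , f ∷ p , g

  inner-lk : ∀ {u a xs b v} → E u a → Path a xs b → E b v → Lk u xs v
  inner-lk e [ u ]   g = e , g
  inner-lk e (f ∷ p) g = e , inner-lk f p g

  edge-path : ∀ {a w xs b} → E a w → Path w xs b → ∃[ ys ] (xs ≡ ys ++ b ∷ [] × Lk a ys b)
  edge-path e [ u ] = [] , refl , e
  edge-path {w = w} e (f ∷ p) with edge-path f p
  ... | ys , refl , l = w ∷ ys , refl , e , l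

  path-tail : ∀ {a u xs b} → Path a (u ∷ xs) b → a ≢ b → ∃[ ys ] (xs ≡ ys ++ b ∷ [] × Lk a ys b)
  path-tail [ u ]   a≢b = contradiction refl a≢b
  path-tail (e ∷ p) a≢b = edge-path e p

  path-suffix : ∀ {a b} xs {y ys} → Path a (xs ++ y ∷ ys) b → Path y (y ∷ ys) b
  path-suffix []           [ u ]   = [ u ]
  path-suffix []           (e ∷ p) = e ∷ p
  path-suffix (x ∷ [])     (e ∷ p) = path-suffix [] p
  path-suffix (x ∷ z ∷ xs) (e ∷ p) = path-suffix (z ∷ xs) p

  path-prefix : ∀ {a b} xs {y ys} → Path a (xs ++ y ∷ ys) b → Path a (xs ++ y ∷ []) y
  path-prefix []           [ u ]   = [ u ]
  path-prefix []           (e ∷ p) = [ _ ]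
  path-prefix (x ∷ [])     (e ∷ p) = e ∷ path-prefix [] p
  path-prefix (x ∷ z ∷ xs) (e ∷ p) = e ∷ path-prefix (z ∷ xs) p

  path-cut : ∀ {a b} x xs {y ys} → Path a ((x ∷ xs) ++ y ∷ ys) b → ∃[ z ] (Path a (x ∷ xs) z × E z y)
  path-cut x [] (e ∷ [ y ])   = x , [ x ] , e
  path-cut x [] (e ∷ (f ∷ p)) = x , [ x ] , e
  path-cut x (w ∷ xs) (e ∷ p) with path-cut w xs p
  ... | z , q , g = z , e ∷ q , g

  path-first : ∀ {a x xs b} → Path a (x ∷ xs) b → a ≡ x
  path-first [ u ]   = refl
  path-first (e ∷ p) = refl

  record Cyc (L : List V) : Set where
    constructor cyc
    field
      {source target} : V
      nodupᶜ   : NoDup L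
      longᶜ    : 3 ≤ length L
      pathᶜ    : Path source L target
      closeᶜ   : E target source

  open Cyc public

  private
    lookup-injective : ∀ {xs} → NoDup xs → Injective _≡_ _≡_ (lookup xs)
    lookup-injective {x ∷ xs} h {zero}  {zero}  eq = refl
    lookup-injective {x ∷ xs} h {zero}  {suc j} eq =
      ⊥-elim (NoDup-head h (subst (_∈ xs) (sym eq) (∈-lookup j)))
    lookup-injective {x ∷ xs} h {suc i} {zero}  eq = ⊥-elim (NoDup-head h (subst (_∈ xs) eq (∈-lookup i)))
    lookup-injective {x ∷ xs} h {suc i} {suc j} eq = cong suc (lookup-injective (NoDup-tail h) eq)

    lookup-edge : ∀ {a x xs b} → Path a (x ∷ xs) b → ∀ (i : Fin (length xs)) →
                  E (lookup (x ∷ xs) (inject₁ i)) (lookup (x ∷ xs) (suc i))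
    lookup-edge (e ∷ [ w ])     zero    = e
    lookup-edge (e ∷ (f ∷ p))   zero    = e
    lookup-edge (e ∷ p@(_ ∷ _)) (suc i) = lookup-edge p i

    lookup-end : ∀ {a x xs b} → Path a (x ∷ xs) b → lookup (x ∷ xs) (fromℕ (length xs)) ≡ b
    lookup-end [ u ]           = refl
    lookup-end (e ∷ [ w ])     = refl
    lookup-end (e ∷ p@(_ ∷ _)) = lookup-end p

    tabulate-path : ∀ k (f : Fin (suc k) → V) → (∀ (i : Fin k) → E (f (inject₁ i)) (f (suc i))) →
                    Path (f zero) (tabulate f) (f (fromℕ k))
    tabulate-path zero    f h = [ f zero ]
    tabulate-path (suc k) f h = h zero ∷ tabulate-path k (λ i → f (suc i)) (λ i → h (suc i))

  another-member : ∀ {M v} → 2 ≤ length M → NoDup M → v ∈ M → ∃[ w ] (w ∈ M × w ≢ v)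
  another-member {m ∷ m′ ∷ M} _ nd (here refl) = m′ , there (here refl) , λ { refl → NoDup-head nd (here refl) }
  another-member {m ∷ m′ ∷ M} _ nd (there h) = m , here refl , λ { refl → NoDup-head nd h }
  another-member {m ∷ []} (s≤s ()) _ _

  tabulate-nodup : ∀ {k} (f : Fin k → V) → Injective _≡_ _≡_ f → NoDup (tabulate f)
  tabulate-nodup {zero}  f h = NoDup-[]
  tabulate-nodup {suc k} f h =
    NoDup-∷ new (tabulate-nodup (λ i → f (suc i)) (λ eq → suc-inj (h eq)))
    where
    suc-inj : ∀ {m} {i j : Fin m} → suc i ≡ suc j → i ≡ j
    suc-inj refl = refl
    new : f zero ∉ tabulate (λ i → f (suc i))
    new p with ∈-tabulate⁻ p
    ... | i , eq with h eq
    ... | ()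

  toCycle : ∀ {L} → Cyc L → Cycle G (length L)
  toCycle {x ∷ y ∷ z ∷ L} c = record
    { m = length L ; len≡ = refl ; vert = lookup (x ∷ y ∷ z ∷ L)
    ; inj = lookup-injective (nodupᶜ c)
    ; edges = lookup-edge (pathᶜ c)
    ; close = subst₂ E (sym (lookup-end (pathᶜ c))) (path-first (pathᶜ c)) (closeᶜ c) }
  toCycle {[]} (cyc d () p e)
  toCycle {x ∷ []} (cyc d (s≤s ()) p e)
  toCycle {x ∷ y ∷ []} (cyc d (s≤s (s≤s ())) p e)

  fromCycle : ∀ {l} → Cycle G l → ∃[ L ] (Cyc L × length L ≡ l)
  fromCycle record { m = m ; len≡ = len≡ ; vert = vert ; inj = inj ; edges = edges ; close = close } =
    tabulate vert
    , cyc (tabulate-nodup vert inj)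
          (≤-trans (m≤m+n 3 m) (≤-reflexive (sym (length-tabulate vert))))
          (tabulate-path (2 + m) vert edges) close
    , trans (length-tabulate vert) (sym len≡)

  Max : ℕ → Set
  Max c = ∀ {L} → Cyc L → length L ≤ c

  -- Exchange arguments against the maximal cycle length

  module Exchange {c : ℕ} (max : Max c) where

    -- In use, `A` is an arc of a longest cycle and `Q` a path outside it, so that the complementary
    -- arc has at least as many inner vertices as `Q` has vertices.
    basic : ∀ {a A b p Q q} → Path a A b → Path p Q q → E b p → E q a → a ≢ b → NoDup (A ++ Q) →
            length A + length Q ≤ c
    basic {A = A} {Q = Q} pA pQ e f a≢b h =
      (lin (c ∷ []) (A ∷ Q ∷ []) ([]) ((lng ((# 0 · # 1)) ≼ at 0) ∷ []) ((lng (# 0) ⊕ lng (# 1))) (at 0) 0 ((1 , 0) ∷ []) (max (cyc h ((lin ([]) (A ∷ Q ∷ []) ([]) ((κ 2 ≼ lng (# 0)) ∷ (κ 1 ≼ lng (# 1)) ∷ []) (κ 3) (lng ((# 0 · # 1))) 0 ((1 , 0) ∷ (1 , 0) ∷ []) (two pA a≢b , path-nonempty pQ , tt)))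
                 (pA ⟨ e ⟩ pQ) f) , tt))
      where
      two : ∀ {a A b} → Path a A b → a ≢ b → 2 ≤ length A
      two [ u ] h = contradiction refl h
      two (e ∷ p) h = s≤s (path-nonempty p)

    -- The exchange along a chord: the cycle runs through `A`, then `Q`, and through `B` backwards,
    -- returning by the edge between the starts of the two arcs.
    cross : ∀ {a A b x B y p Q q} → Path a A b → Path x B y → Path p Q q → E b p → E q y → E x a →
            NoDup (A ++ Q ++ B) → length A + length Q + length B ≤ c
    cross {A = A} {B = B} {Q = Q} pA pB pQ e f g h =
      (lin (c ∷ []) (A ∷ Q ∷ B ∷ []) ([]) ((lng ((# 0 · (# 1 · rev (# 2)))) ≼ at 0) ∷ []) (((lng (# 0) ⊕ lng (# 1)) ⊕ lng (# 2))) (at 0) 0 ((1 , 0) ∷ []) (max (cyc ((nodup⊆ (A ∷ Q ∷ B ∷ []) ([]) ((# 0 · (# 1 · rev (# 2)))) ((# 0 · (# 1 · # 2))) (h)))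
                 ((lin ([]) (A ∷ Q ∷ B ∷ []) ([]) ((κ 1 ≼ lng (# 0)) ∷ (κ 1 ≼ lng (# 1)) ∷ (κ 1 ≼ lng (# 2)) ∷ []) (κ 3) (lng ((# 0 · (# 1 · rev (# 2))))) 0 ((1 , 0) ∷ (1 , 0) ∷ (1 , 0) ∷ []) (path-nonempty pA , path-nonempty pQ , path-nonempty pB , tt)))
                 (pA ⟨ e ⟩ pQ ⟨ f ⟩ path-reverse pB) g) , tt))

    cross′ : ∀ {a A b x B y p Q q r L s} → Path a A b → Path x B y → Path p Q q → Path r L s →
             E b p → E q y → E x r → E s a →
             NoDup (A ++ Q ++ B ++ L) → length A + length Q + length B + length L ≤ c
    cross′ {A = A} {B = B} {Q = Q} {L = L} pA pB pQ pL e f g k h =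
      (lin (c ∷ []) (A ∷ Q ∷ B ∷ L ∷ []) ([]) ((lng ((# 0 · (# 1 · (rev (# 2) · # 3)))) ≼ at 0) ∷ []) ((((lng (# 0) ⊕ lng (# 1)) ⊕ lng (# 2)) ⊕ lng (# 3))) (at 0) 0 ((1 , 0) ∷ []) (max (cyc ((nodup⊆ (A ∷ Q ∷ B ∷ L ∷ []) ([]) ((# 0 · (# 1 · (rev (# 2) · # 3)))) ((# 0 · (# 1 · (# 2 · # 3)))) (h)))
                 ((lin ([]) (A ∷ Q ∷ B ∷ L ∷ []) ([]) ((κ 1 ≼ lng (# 0)) ∷ (κ 1 ≼ lng (# 1)) ∷ (κ 1 ≼ lng (# 2)) ∷ []) (κ 3) (lng ((# 0 · (# 1 · (rev (# 2) · # 3))))) 0 ((1 , 0) ∷ (1 , 0) ∷ (1 , 0) ∷ []) (path-nonempty pA , path-nonempty pQ , path-nonempty pB , tt)))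
                 (pA ⟨ e ⟩ pQ ⟨ f ⟩ path-reverse pB ⟨ g ⟩ pL) k) , tt))

    crossLk : ∀ {a A b x B y p Q q ls} → Path a A b → Path x B y → Path p Q q → E b p → E q y →
              Lk x ls a → NoDup (A ++ Q ++ B ++ ls) →
              length A + length Q + length B + length ls ≤ c
    crossLk {A = A} {B = B} {Q = Q} {ls = []} pA pB pQ e f g h =
      (lin (c ∷ []) (A ∷ Q ∷ B ∷ []) ([]) ((((lng (# 0) ⊕ lng (# 1)) ⊕ lng (# 2)) ≼ at 0) ∷ []) ((((lng (# 0) ⊕ lng (# 1)) ⊕ lng (# 2)) ⊕ κ 0)) (at 0) 0 ((1 , 0) ∷ []) (cross pA pB pQ e f g ((nodup⊆ (A ∷ Q ∷ B ∷ []) ([]) ((# 0 · (# 1 · # 2))) ((# 0 · (# 1 · (# 2 · ε)))) (h))) , tt))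
    crossLk {ls = l ∷ ls} pA pB pQ e f g h with lk-inner g
    ... | _ , g₁ , pL , g₂ = cross′ pA pB pQ pL e f g₁ g₂ h

  -- Connection inside a set of vertices

  data Con (X : V → Set) (u : V) : V → Set where
    stop : X u → Con X u u
    _▷_,_ : ∀ {v w} → Con X u v → E v w → X w → Con X u w

  con-end : ∀ {X u v} → Con X u v → X v
  con-end (stop x)    = x
  con-end (c ▷ _ , x) = x

  con-trans : ∀ {X u v w} → Con X u v → Con X v w → Con X u w
  con-trans c (stop x)    = c
  con-trans c (d ▷ e , x) = con-trans c d ▷ e , x

  con-sym : ∀ {X u v} → Con X u v → Con X v u
  con-sym (stop x)    = stop x
  con-sym (c ▷ e , x) = con-trans (stop x ▷ E-sym e , con-end c) (con-sym c)

  con-closed : ∀ {X : V → Set} {K : V → Set} {u v} → (∀ {v w} → X v → X w → K v → E v w → K w) →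
               K u → Con X u v → K v
  con-closed h k (stop x)    = k
  con-closed h k (c ▷ e , x) = h (con-end c) x (con-closed h k c) e

  -- Toughness as a bound on pairwise separated vertices

  module Toughness (tough : OneTough G) where

    -- The component labelling that `OneTough` asks for can only be built when connection is
    -- decided; `separated` supplies `dec` under double negation.
    module Labelling (S : List V) (dec : ∀ u v → Dec (Con (_∉ S) u v)) where

      private
        X : V → Set
        X = _∉ S

        S′ : Subset.Subset n
        S′ = Vec.tabulate (λ v → does (v ∈? S))

        ∈S′⇒ : ∀ {v} → v Subset.∈ S′ → v ∈ S
        ∈S′⇒ {v} p with v ∈? S | trans (sym (lookup∘tabulate (λ v → does (v ∈? S)) v)) ([]=⇒lookup p)
        ... | yes q | _ = q
        ... | no  _ | ()

        ⇒∈S′ : ∀ {v} → v ∈ S → v Subset.∈ S′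
        ⇒∈S′ {v} p = lookup⇒[]= v S′ (trans (lookup∘tabulate (λ v → does (v ∈? S)) v) (dec-true (v ∈? S) p))

        ∣S′∣≤ : Subset.∣ S′ ∣ ≤ length S
        ∣S′∣≤ = ≤-trans (≤-reflexive (∣tabulate∣ (λ v → does (v ∈? S))))
                  (length-⊆ (trues-nodup (λ v → does (v ∈? S)))
                    λ p → ∈S′⇒ (lookup⇒[]= _ S′ (trans (lookup∘tabulate (λ v → does (v ∈? S)) _)
                                                    (trues⁻ (λ v → does (v ∈? S)) p))))

        reach⇒con : ∀ {u v} → Reach G S′ u v → Con X u v
        reach⇒con (here h)     = stop (λ p → h (⇒∈S′ p))
        reach⇒con (step r e h) = reach⇒con r ▷ e , (λ p → h (⇒∈S′ p))

        con⇒reach : ∀ {u v} → Con X u v → Reach G S′ u v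
        con⇒reach (stop h)    = here (λ p → h (∈S′⇒ p))
        con⇒reach (c ▷ e , h) = step (con⇒reach c) e (λ p → h (∈S′⇒ p))

        record Transversal (L : List V) : Set where
          field
            K       : List V
            outside : All X K
            apart   : AllPairs (λ u v → ¬ Con X u v) K
            covers  : ∀ {v} → v ∈ L → X v → Any (Con X v) K

        transversal : ∀ L → Transversal L
        transversal [] = record { K = [] ; outside = [] ; apart = [] ; covers = λ () }
        transversal (x ∷ L) with transversal L
        ... | record { K = K ; outside = o ; apart = a ; covers = c } with x ∈? S | any? (dec x) K
        ...   | yes x∈ | _ = record
          { K = K ; outside = o ; apart = a ; covers = λ { (here refl) h → contradiction x∈ h ; (there p) h → c p h } }
        ...   | no x∉ | yes q = record
          { K = K ; outside = o ; apart = a ; covers = λ { (here refl) h → q ; (there p) h → c p h } }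
        ...   | no x∉ | no ¬q = record
          { K = x ∷ K ; outside = x∉ ∷ o ; apart = ¬Any⇒All¬ K ¬q ∷ a
          ; covers = λ { (here refl) h → here (stop x∉) ; (there p) h → there (c p h) } }

        open Transversal (transversal (allFin n))

        cover : ∀ v → X v → Any (Con X v) K
        cover v = covers (∈-allFin v)

        unique : ∀ i j → Con X (lookup K i) (lookup K j) → i ≡ j
        unique i j c with i ≟ᶠ j
        ... | yes p = p
        ... | no ¬p = ⊥-elim ([ (λ f → f c) , (λ f → f (con-sym c)) ]′ (allpairs-lookup apart i j ¬p))

        -- A labelling is total on the vertices, so those of `S` receive the default `d`.
        label-of : Fin (length K) → ∀ v → Dec (v ∈ S) → Fin (length K)
        label-of d v (yes _) = d
        label-of d v (no h)  = Any.index (cover v h)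

        label-con : ∀ d v → X v → (p : Dec (v ∈ S)) → Con X v (lookup K (label-of d v p))
        label-con d v h (yes q) = contradiction q h
        label-con d v h (no q)  = lookup-index (cover v q)

      components : ∀ r → X r → NumComponents G S′ (length K)
      components r r∉ = label , onto , same
        where
        d = Any.index (cover r r∉)
        label = λ v → label-of d v (v ∈? S)
        spec : ∀ v → X v → Con X v (lookup K (label v))
        spec v h = label-con d v h (v ∈? S)
        onto : ∀ c → Σ V λ v → (v Subset.∉ S′) × (label v ≡ c)
        onto c = lookup K c , (λ p → k∉ (∈S′⇒ p)) , sym (unique c _ (spec (lookup K c) k∉))
          where k∉ = All.lookup outside (∈-lookup c)
        same : ∀ u v → u Subset.∉ S′ → v Subset.∉ S′ → _
        same u v u∉ v∉ = mk⇔
          (λ eq → con⇒reach (con-trans (spec u u∉′)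
                    (con-sym (subst (λ l → Con X v (lookup K l)) (sym eq) (spec v v∉′)))))
          (λ r → unique _ _ (con-trans (con-sym (spec u u∉′)) (con-trans (reach⇒con r) (spec v v∉′))))
          where
          u∉′ = λ p → u∉ (⇒∈S′ p)
          v∉′ = λ p → v∉ (⇒∈S′ p)

      -- Sending each given vertex to its class in the transversal is injective. So the number of
      -- components is at least the length of the list; in particular it exceeds 1, and toughness
      -- applies.
      bound-reps : ∀ r rs → 1 ≤ length rs → All X (r ∷ rs) → AllPairs (λ u v → ¬ Con X u v) (r ∷ rs) →
                   length (r ∷ rs) ≤ length S
      bound-reps r rs l o@(r∉ ∷ _) a =
        ≤-trans r≤k (≤-trans (tough S′ (length K) (components r r∉) (≤-trans (s≤s l) r≤k)) ∣S′∣≤)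
        where
        at-rep : ∀ i → X (lookup (r ∷ rs) i)
        at-rep i = All.lookup o (∈-lookup i)
        r≤k : length (r ∷ rs) ≤ length K
        r≤k = injective⇒≤ {f = λ i → Any.index (cover (lookup (r ∷ rs) i) (at-rep i))} inj
          where
          inj : ∀ {i j} → _ → i ≡ j
          inj {i} {j} eq with i ≟ᶠ j
          ... | yes p = p
          ... | no ¬p = ⊥-elim ([ (λ f → f c) , (λ f → f (con-sym c)) ]′ (allpairs-lookup a i j ¬p))
            where
            c : Con X (lookup (r ∷ rs) i) (lookup (r ∷ rs) j)
            c = con-trans (lookup-index (cover _ (at-rep i)))
                  (con-sym (subst (λ l → Con X _ (lookup K l)) (sym eq) (lookup-index (cover _ (at-rep j)))))

    -- This is the form in which toughness is used throughout: a separator and a list of witnesses,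
    -- one for each component claimed. The conclusion is decidable, which permits deciding all
    -- connections under double negation.
    separated : ∀ (S rs : List V) → 2 ≤ length rs → All (_∉ S) rs →
                AllPairs (λ u v → ¬ Con (_∉ S) u v) rs → length rs ≤ length S
    separated S (r ∷ rs) (s≤s l) o a = decidable-stable (_ ≤? _) λ ¬p →
      ∀¬¬⇒¬¬∀ (λ u → ∀¬¬⇒¬¬∀ (λ v → em (Con (_∉ S) u v))) λ dec →
        ¬p (Labelling.bound-reps S dec r rs l o a)

  nbrs : V → List V
  nbrs v = trues (adj G v)

  nbrs⁻ : ∀ {v w} → w ∈ nbrs v → E v w
  nbrs⁻ {v} p = trues⁻ (adj G v) p

  nbrs-nodup : ∀ v → NoDup (nbrs v)
  nbrs-nodup v = trues-nodup (adj G v)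

  deg-nbrs : ∀ v → deg G v ≡ length (nbrs v)
  deg-nbrs v = ∣tabulate∣ (adj G v)

  con-path : ∀ {X u v} → Con X u v → ∃[ p ] (Path u p v × NoDup p × (∀ {x} → x ∈ p → X x))
  con-path {u = u} (stop x) = u ∷ [] , [ u ] , NoDup-single u , λ { (here refl) → x }
  con-path (_▷_,_ {w = w} c e x) with con-path c
  ... | p , path , nd , all with w ∈? p
  ...   | no w∉ = p ++ w ∷ [] , path ⟨ e ⟩ [ w ]
                , NoDup-++ nd (NoDup-single w) (λ { q (here refl) → w∉ q })
                , λ q → [ all , (λ { (here refl) → x }) ]′ (∈-++⁻ p q)
  -- The walk has returned to `w`, and the loop is cut off.
  ...   | yes w∈ with ∈-∃++ w∈
  ...     | as , bs , refl = as ++ w ∷ [] , path-prefix as path , (nodup⊆ (as ∷ bs ∷ []) (w ∷ []) ((# 0 · (• 0 · ε))) ((# 0 · (• 0 · # 1))) (nd))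
                           , λ q → [ (λ r → all (∈-++⁺ˡ r)) , (λ { (here refl) → x }) ]′ (∈-++⁻ as q)

  path-con : ∀ {X a p b} → Path a p b → (∀ {x} → x ∈ p → X x) → Con X a b
  path-con [ u ]   h = stop (h (here refl))
  path-con (e ∷ p) h =
    con-trans (stop (h (here refl)) ▷ e , h (there (start∈ p))) (path-con p (λ q → h (there q)))

  path-con∈ : ∀ {X a p b v} → Path a p b → (∀ {x} → x ∈ p → X x) → v ∈ p → Con X a v
  path-con∈ path h v∈ with ∈-∃++ v∈
  ... | as , bs , refl = path-con (path-prefix as path)
        λ q → [ (λ r → h (∈-++⁺ˡ r)) , (λ { (here refl) → h v∈ }) ]′ (∈-++⁻ as q)

  glue : ∀ {a p z q b} → Path a p z → Path z (z ∷ q) b → Path a (p ++ q) b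
  glue [ u ]   r = r
  glue (e ∷ p) r = e ∷ glue p r

  record Trim (D Z : V → Set) (p : List V) : Set where
    field
      {d z}  : V
      q      : List V
      path   : Path d q z
      d∈D    : D d
      z∈Z    : Z z
      distinct : NoDup q
      sub    : ∀ {x} → x ∈ q → x ∈ p
      onlyD  : ∀ {x} → x ∈ q → D x → x ≡ d
      onlyZ  : ∀ {x} → x ∈ q → Z x → x ≡ z

  -- The path is stopped at its first vertex in `Z` and then started at the last vertex in `D`
  -- before it.
  trim : ∀ {D Z : V → Set} (D? : Decidable D) (Z? : Decidable Z) {u p v} →
         Path u p v → NoDup p → D u → Z v → Trim D Z p
  trim {D} {Z} D? Z? path nd Du Zv with first Z? (lose (end∈ path) Zv)
  ... | as , z , bs , refl , none , Zz with path-prefix as path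
  ...   | pre with last D? (lose (start∈ pre) Du)
  ...     | cs , d , ds , eq , noneD , Dd = record
    { q = d ∷ ds
    ; path = path-suffix cs (subst (λ l → Path _ l z) eq pre)
    ; d∈D = Dd ; z∈Z = Zz
    ; distinct = NoDup-++ʳ cs (subst NoDup eq ((nodup⊆ (as ∷ bs ∷ []) (z ∷ []) ((# 0 · (• 0 · ε))) ((# 0 · (• 0 · # 1))) (nd))))
    ; sub = λ x∈ → [ ∈-++⁺ˡ , (λ { (here refl) → ∈-++⁺ʳ as (here refl) }) ]′ (∈-++⁻ as (back x∈))
    ; onlyD = λ { (here refl) _ → refl ; (there x∈) Dx → ⊥-elim (All.lookup noneD x∈ Dx) }
    ; onlyZ = λ x∈ Zx → [ (λ r → ⊥-elim (All.lookup none r Zx)) , (λ { (here refl) → refl }) ]′ (∈-++⁻ as (back x∈))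
    }
    where
    back : ∀ {x} → x ∈ d ∷ ds → x ∈ as ++ z ∷ []
    back x∈ = subst (_ ∈_) (sym eq) (∈-++⁺ʳ cs x∈)

  -- No cut vertices, and fans

  module TwoConnected (tough : OneTough G) where

    open Toughness tough

    connected : ∀ a b → ¬ ¬ Con (_∉ []) a b
    connected a b h with separated [] (a ∷ b ∷ []) (s≤s (s≤s z≤n))
                           ((λ ()) ∷ (λ ()) ∷ []) ((h ∷ []) ∷ [] ∷ [])
    ... | ()

    -- Toughness for a separator of one vertex: two components would be one too many.
    connected₂ : ∀ s {a b} → a ≢ s → b ≢ s → ¬ ¬ Con (_∉ s ∷ []) a b
    connected₂ s {a} {b} a≢s b≢s h with separated (s ∷ []) (a ∷ b ∷ []) (s≤s (s≤s z≤n))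
         ((λ { (here p) → a≢s p }) ∷ (λ { (here p) → b≢s p }) ∷ []) ((h ∷ []) ∷ [] ∷ [])
    ... | s≤s ()

    record Fan (D C : List V) (d₀ : V) : Set where
      field
        {d t₁ t₂} : V
        T₁ T₂  : List V
        path₁  : Path d₀ T₁ t₁
        path₂  : Path d T₂ t₂
        d∈D    : d ∈ D
        t₁∈C   : t₁ ∈ C
        t₂∈C   : t₂ ∈ C
        distinct : NoDup (T₁ ++ T₂)
        onlyC₁ : ∀ {x} → x ∈ T₁ → x ∈ C → x ≡ t₁
        onlyC₂ : ∀ {x} → x ∈ T₂ → x ∈ C → x ≡ t₂
        onlyD₁ : ∀ {x} → x ∈ T₁ → x ∈ D → x ≡ d₀
        onlyD₂ : ∀ {x} → x ∈ T₂ → x ∈ D → x ≡ d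

    -- Of the two vertices `c₁`, `c₂` one differs from `d₀`. It is joined to `d′` without passing
    -- `d₀`, and trimming such a path gives one from `D` to `Z` that avoids `d₀`.
    detour : ∀ {C D : List V} {Z : V → Set} {c₁ c₂ d₀ d′} → c₁ ∈ C → c₂ ∈ C → c₁ ≢ c₂ → d′ ∈ D → d′ ≢ d₀ →
             Decidable Z → (∀ {x} → x ∈ C → Z x) →
             (∀ {p} → (q : Trim (_∈ D) Z p) → d₀ ∉ Trim.q q → ⊥) → ⊥
    detour {C} {D} {Z} {c₁} {c₂} {d₀} {d′} c₁∈ c₂∈ c₁≢c₂ d′∈ d′≢d₀ Z? C⊆Z k with c₁ ≟ᶠ d₀
    ... | no p = from c₁ c₁∈ p
      where
      from : ∀ c → c ∈ C → c ≢ d₀ → ⊥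
      from c c∈ c≢ = connected₂ d₀ d′≢d₀ c≢ λ con → let _ , path , nd , avoid = con-path con
                                                        q = trim (_∈? D) Z? path nd d′∈ (C⊆Z c∈) in
                     k q (λ r → avoid (Trim.sub q r) (here refl))
    ... | yes refl = connected₂ d₀ d′≢d₀ (λ p → c₁≢c₂ (sym p)) λ con → let _ , path , nd , avoid = con-path con
                                                                           q = trim (_∈? D) Z? path nd d′∈ (C⊆Z c₂∈) in
                     k q (λ r → avoid (Trim.sub q r) (here refl))

    -- Two disjoint D–C paths one of which starts at the first vertex of a given D–C path W:
    -- induct on W, adding its second vertex to D.
    fan : ∀ C {c₁ c₂} → c₁ ∈ C → c₂ ∈ C → c₁ ≢ c₂ → ∀ D {d₀ d′ W t} → Path d₀ W t → NoDup W →
          d₀ ∈ D → d′ ∈ D → d′ ≢ d₀ → t ∈ C →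
          (∀ {x} → x ∈ W → x ∈ D → x ≡ d₀) → (∀ {x} → x ∈ W → x ∈ C → x ≡ t) → ¬ ¬ Fan D C d₀
    fan C c₁∈ c₂∈ c₁≢c₂ D [ d₀ ] nd d₀∈ d′∈ d′≢d₀ t∈ hD hC k =
      detour c₁∈ c₂∈ c₁≢c₂ d′∈ d′≢d₀ (_∈? C) (λ p → p) λ { record { q = q ; path = pq ; d∈D = q∈D ; z∈Z = z∈ ; distinct = ndq ; onlyD = oD ; onlyZ = oZ } d₀∉ → k record
        { T₁ = d₀ ∷ [] ; T₂ = q ; path₁ = [ d₀ ] ; path₂ = pq ; d∈D = q∈D ; t₁∈C = t∈ ; t₂∈C = z∈
        ; distinct = NoDup-∷ d₀∉ ndq
        ; onlyC₁ = hC ; onlyC₂ = oZ ; onlyD₁ = hD ; onlyD₂ = oD } }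
    fan C c₁∈ c₂∈ c₁≢c₂ D {d₀} {t = t} (_∷_ {w = w} e p) nd d₀∈ d′∈ d′≢d₀ t∈ hD hC k =
      fan C c₁∈ c₂∈ c₁≢c₂ (w ∷ D) p (NoDup-tail nd) (here refl) (there d₀∈) d₀≢w t∈
        (λ { x∈ (here eq) → eq ; x∈ (there x∈D) → ⊥-elim (off x∈ x∈D) })
        (λ x∈ → hC (there x∈)) extend
      where
      off : ∀ {x} → x ∈ _ → x ∉ D
      off x∈ x∈D with hD (there x∈) x∈D
      ... | refl = NoDup-head nd x∈
      d₀≢w : d₀ ≢ w
      d₀≢w refl = NoDup-head nd (start∈ p)
      d₀∉C : d₀ ∉ C
      d₀∉C d₀∈C = NoDup-head nd (subst (_∈ _) (sym (hC (here refl) d₀∈C)) (end∈ p))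
      extend : Fan (w ∷ D) C w → ⊥
      extend F = branch (Fan.d∈D F)
        where
        open Fan F
        T₁∩D : ∀ {x} → x ∈ T₁ → x ∉ D
        T₁∩D x∈ x∈D with onlyD₁ x∈ (there x∈D)
        ... | refl = off (start∈ p) x∈D
        d₀T₁ : Path d₀ (d₀ ∷ T₁) t₁
        d₀T₁ = e ∷ path₁
        onlyC₁′ : ∀ {x} → x ∈ d₀ ∷ T₁ → x ∈ C → x ≡ t₁
        onlyC₁′ (here refl) x∈C = ⊥-elim (d₀∉C x∈C)
        onlyC₁′ (there x∈) x∈C = onlyC₁ x∈ x∈C
        onlyD₁′ : ∀ {x} → x ∈ d₀ ∷ T₁ → x ∈ D → x ≡ d₀
        onlyD₁′ (here eq) x∈D = eq
        onlyD₁′ (there x∈) x∈D = ⊥-elim (T₁∩D x∈ x∈D)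
        disj : ∀ {x} → x ∈ T₁ → x ∈ T₂ → ⊥
        disj = NoDup-disjoint distinct
        nd₁ : NoDup T₁
        nd₁ = NoDup-++ˡ T₁ distinct
        nd₂ : NoDup T₂
        nd₂ = NoDup-++ʳ T₁ distinct
        Z : V → Set
        Z x = x ∈ T₁ ⊎ (x ∈ T₂ ⊎ x ∈ C)
        Z? : Decidable Z
        Z? x = (x ∈? T₁) ⊎-dec ((x ∈? T₂) ⊎-dec (x ∈? C))
        branch : d ∈ w ∷ D → ⊥
        branch (here eq) = disj (start∈ path₁) (subst (_∈ T₂) eq (start∈ path₂))
        branch (there d∈) with d ≟ᶠ d₀
        -- The second path starts elsewhere in `D`, so `d₀` can be put in front of the first.
        ... | no d≢d₀ = k record
          { T₁ = d₀ ∷ T₁ ; T₂ = T₂ ; path₁ = d₀T₁ ; path₂ = path₂ ; d∈D = d∈ ; t₁∈C = t₁∈C ; t₂∈C = t₂∈C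
          ; distinct = NoDup-∷ (λ d₀∈TT → [ (λ q → T₁∩D q d₀∈) , (λ q → d≢d₀ (sym (onlyD₂ q (there d₀∈)))) ]′ (∈-++⁻ T₁ d₀∈TT)) distinct
          ; onlyC₁ = onlyC₁′ ; onlyC₂ = onlyC₂ ; onlyD₁ = onlyD₁′ ; onlyD₂ = λ x∈ x∈D → onlyD₂ x∈ (there x∈D) }
        -- Both paths now lead back to `d₀`, one of them through `w`. A path from `D` avoiding `d₀`
        -- replaces the beginning of whichever it meets first, and the other one keeps its start at
        -- `d₀`. If it reaches `C` without meeting `T₂`, it is itself the second path beside `T₂`.
        ... | yes refl = detour c₁∈ c₂∈ c₁≢c₂ d′∈ d′≢d₀ Z? (λ x∈ → inj₂ (inj₂ x∈)) reroute
          where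
          reroute : ∀ {p} → (q : Trim (_∈ D) Z p) → d₀ ∉ Trim.q q → ⊥
          reroute record { q = q ; path = Pq ; d∈D = q∈D ; z∈Z = inj₁ z∈ ; distinct = ndq ; onlyD = oD ; onlyZ = oZ } d₀∉
            with ∈-∃++ z∈
          ... | as , bs , refl = k record
            { T₁ = T₂ ; T₂ = q ++ bs ; path₁ = path₂ ; path₂ = glue Pq (path-suffix as path₁)
            ; d∈D = q∈D ; t₁∈C = t₂∈C ; t₂∈C = t₁∈C
            ; distinct = NoDup-++ nd₂ (NoDup-++ ndq (NoDup-tail (NoDup-++ʳ as nd₁)) q∩bs)
                           (λ x∈ x∈q → [ q∩T₂ x∈ , (λ x∈bs → disj (in₁ x∈bs) x∈) ]′ (∈-++⁻ q x∈q))
            ; onlyC₁ = onlyC₂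
            ; onlyC₂ = λ x∈ x∈C → [ (λ x∈q → trans (oZ x∈q (inj₂ (inj₂ x∈C))) (onlyC₁ z∈ (subst (_∈ C) (oZ x∈q (inj₂ (inj₂ x∈C))) x∈C)))
                                  , (λ x∈bs → onlyC₁ (in₁ x∈bs) x∈C) ]′ (∈-++⁻ q x∈)
            ; onlyD₁ = λ x∈ x∈D → onlyD₂ x∈ (there x∈D)
            ; onlyD₂ = λ x∈ x∈D → [ (λ x∈q → oD x∈q x∈D) , (λ x∈bs → ⊥-elim (T₁∩D (in₁ x∈bs) x∈D)) ]′ (∈-++⁻ q x∈) }
            where
            in₁ : ∀ {x} → x ∈ bs → x ∈ as ++ _ ∷ bs
            in₁ x∈ = ∈-++⁺ʳ as (there x∈)
            q∩bs : ∀ {x} → x ∈ q → x ∈ bs → ⊥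
            q∩bs x∈ x∈bs with oZ x∈ (inj₁ (in₁ x∈bs))
            ... | refl = NoDup-head (NoDup-++ʳ as nd₁) x∈bs
            q∩T₂ : ∀ {x} → x ∈ T₂ → x ∈ q → ⊥
            q∩T₂ x∈ x∈q with oZ x∈q (inj₂ (inj₁ x∈))
            ... | refl = disj z∈ x∈
          reroute record { q = q ; path = Pq ; d∈D = q∈D ; z∈Z = inj₂ (inj₁ z∈) ; distinct = ndq ; onlyD = oD ; onlyZ = oZ } d₀∉
            with ∈-∃++ z∈
          ... | [] , bs , refl = d₀∉ (subst (_∈ q) (sym (path-first path₂)) (end∈ Pq))
          ... | a ∷ as , bs , refl = k record
            { T₁ = d₀ ∷ T₁ ; T₂ = q ++ bs ; path₁ = d₀T₁ ; path₂ = glue Pq (path-suffix (a ∷ as) path₂)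
            ; d∈D = q∈D ; t₁∈C = t₁∈C ; t₂∈C = t₂∈C
            ; distinct = NoDup-++ (NoDup-∷ (λ x∈ → T₁∩D x∈ d₀∈) nd₁)
                           (NoDup-++ ndq (NoDup-tail (NoDup-++ʳ (a ∷ as) nd₂)) q∩bs)
                           (λ { (here refl) x∈ → [ d₀∉ , d₀∉bs ]′ (∈-++⁻ q x∈)
                              ; (there x∈T₁) x∈ → [ q∩T₁ x∈T₁ , (λ x∈bs → disj x∈T₁ (in₂ x∈bs)) ]′ (∈-++⁻ q x∈) })
            ; onlyC₁ = onlyC₁′
            ; onlyC₂ = λ x∈ x∈C → [ (λ x∈q → trans (oZ x∈q (inj₂ (inj₂ x∈C))) (onlyC₂ z∈ (subst (_∈ C) (oZ x∈q (inj₂ (inj₂ x∈C))) x∈C)))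
                                  , (λ x∈bs → onlyC₂ (in₂ x∈bs) x∈C) ]′ (∈-++⁻ q x∈)
            ; onlyD₁ = onlyD₁′
            ; onlyD₂ = λ x∈ x∈D → [ (λ x∈q → oD x∈q x∈D)
                                  , (λ x∈bs → ⊥-elim (d₀∉bs (subst (_∈ bs) (onlyD₂ (in₂ x∈bs) (there x∈D)) x∈bs))) ]′ (∈-++⁻ q x∈) }
            where
            in₂ : ∀ {x} → x ∈ bs → x ∈ (a ∷ as) ++ _ ∷ bs
            in₂ x∈ = ∈-++⁺ʳ (a ∷ as) (there x∈)
            d₀∉bs : d₀ ∉ bs
            d₀∉bs x∈ = NoDup-head nd₂ (∈-++⁺ʳ as (there (subst (_∈ bs) (path-first path₂) x∈)))
            q∩bs : ∀ {x} → x ∈ q → x ∈ bs → ⊥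
            q∩bs x∈ x∈bs with oZ x∈ (inj₂ (inj₁ (in₂ x∈bs)))
            ... | refl = NoDup-head (NoDup-++ʳ (a ∷ as) nd₂) x∈bs
            q∩T₁ : ∀ {x} → x ∈ T₁ → x ∈ q → ⊥
            q∩T₁ x∈ x∈q with oZ x∈q (inj₁ x∈)
            ... | refl = disj x∈ z∈
          reroute record { z = z ; q = q ; path = Pq ; d∈D = q∈D ; z∈Z = inj₂ (inj₂ z∈) ; distinct = ndq ; onlyD = oD ; onlyZ = oZ } d₀∉
            with z ∈? T₂
          ... | yes z∈₂ = reroute record { q = q ; path = Pq ; d∈D = q∈D ; z∈Z = inj₂ (inj₁ z∈₂) ; distinct = ndq
                                         ; sub = λ x∈ → x∈ ; onlyD = oD ; onlyZ = oZ } d₀∉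
          ... | no z∉₂ = k record
            { T₁ = T₂ ; T₂ = q ; path₁ = path₂ ; path₂ = Pq
            ; d∈D = q∈D ; t₁∈C = t₂∈C ; t₂∈C = z∈
            ; distinct = NoDup-++ nd₂ ndq (λ x∈ x∈q → z∉₂ (subst (_∈ T₂) (oZ x∈q (inj₂ (inj₁ x∈))) x∈))
            ; onlyC₁ = onlyC₂ ; onlyC₂ = λ x∈ x∈C → oZ x∈ (inj₂ (inj₂ x∈C))
            ; onlyD₁ = λ x∈ x∈D → onlyD₂ x∈ (there x∈D) ; onlyD₂ = oD }

  -- Cutting a cycle into segments

  Seg : Set
  Seg = V × List V

  flatten : List Seg → List V
  flatten []            = []
  flatten ((ξ , s) ∷ Z) = ξ ∷ s ++ flatten Z

  heads : List Seg → List V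
  heads = map proj₁

  arc : List Seg → V → List V
  arc Y η = flatten Y ++ η ∷ []

  -- A segment consists of a cutting vertex and the stretch behind it. Its right neighbour is the
  -- head of the next segment, so the end of the chain is carried along as an index and not listed.
  data Chain : V → List Seg → V → Set where
    []  : ∀ {η} → Chain η [] η
    _∷_ : ∀ {ξ s ζ Y η} → Lk ξ s ζ → Chain ζ Y η → Chain ξ ((ξ , s) ∷ Y) η

  ∈-resp : ∀ {v : V} {xs ys} → xs ≡ ys → v ∈ xs → v ∈ ys
  ∈-resp refl p = p

  flatten-++ : ∀ X Y → flatten (X ++ Y) ≡ flatten X ++ flatten Y
  flatten-++ []            Y = refl
  flatten-++ ((ξ , s) ∷ X) Y = cong (ξ ∷_) (trans (cong (s ++_) (flatten-++ X Y)) (sym (++-assoc s _ _)))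

  chain-++⁻ : ∀ X {Y a b} → Chain a (X ++ Y) b → ∃[ m ] (Chain a X m × Chain m Y b)
  chain-++⁻ []      c       = _ , [] , c
  chain-++⁻ (_ ∷ X) (l ∷ c) with chain-++⁻ X c
  ... | m , c₁ , c₂ = m , l ∷ c₁ , c₂

  chain-++⁺ : ∀ {X Y a m b} → Chain a X m → Chain m Y b → Chain a (X ++ Y) b
  chain-++⁺ []      d = d
  chain-++⁺ (l ∷ c) d = l ∷ chain-++⁺ c d

  arc-path : ∀ {a Y b} → Chain a Y b → Path a (arc Y b) b
  arc-path {b = b} [] = [ b ]
  arc-path {b = b} (_∷_ {ξ} {s} {Y = Y} l c) =
    subst (λ xs → Path ξ xs b) (cong (ξ ∷_) (sym (++-assoc s (flatten Y) (b ∷ [])))) (lk-path l (arc-path c))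

  heads⊆flatten : ∀ {v} Z → v ∈ heads Z → v ∈ flatten Z
  heads⊆flatten (_ ∷ Z)       (here eq) = here eq
  heads⊆flatten ((ξ , s) ∷ Z) (there p) = there (∈-++⁺ʳ s (heads⊆flatten Z p))

  chain-start∈ : ∀ {a Y b} → Chain a Y b → a ∈ heads Y ++ b ∷ []
  chain-start∈ []      = here refl
  chain-start∈ (l ∷ c) = here refl

  locate : ∀ Z {v} → v ∈ flatten Z → v ∉ heads Z →
           ∃[ X ] ∃[ ξ ] ∃[ s ] ∃[ Y ] (Z ≡ X ++ (ξ , s) ∷ Y × v ∈ s)
  locate ((ξ , s) ∷ Z) (here refl) h = contradiction (here refl) h
  locate ((ξ , s) ∷ Z) (there p)   h with ∈-++⁻ s p
  ... | inj₁ q = [] , ξ , s , Z , refl , q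
  ... | inj₂ q with locate Z q (λ r → h (there r))
  ...   | X , ξ′ , s′ , Y , refl , r = (ξ , s) ∷ X , ξ′ , s′ , Y , refl , r

  rotate : ∀ as {m bs} → Cyc (as ++ m ∷ bs) → Cyc ((m ∷ bs) ++ as)
  rotate [] {m} {bs} c = subst Cyc (cong (m ∷_) (sym (++-identityʳ bs))) c
  rotate (a ∷ as) {m} {bs} (cyc d l p e) with path-cut a as p
  ... | z , q , f = cyc ((nodup⊆ (as ∷ bs ∷ []) (a ∷ m ∷ []) (((• 1 · # 1) · (• 0 · # 0))) (((• 0 · # 0) · (• 1 · # 1))) (d)))
                        ((lin ([]) (as ∷ bs ∷ []) (a ∷ m ∷ []) ((κ 3 ≼ lng (((• 0 · # 0) · (• 1 · # 1)))) ∷ []) (κ 3) (lng (((• 1 · # 1) · (• 0 · # 0)))) 0 ((1 , 0) ∷ []) (l , tt)))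
                        (path-suffix (a ∷ as) p ⟨ e ⟩ q) f

  segment : ∀ (M : List V) {u a xs b η} → E u a → Path a xs b → E b η → η ∈ M →
            ∃[ s ] ∃[ Y ] ∃[ ζ ] (xs ≡ s ++ flatten Y × Lk u s ζ × Chain ζ Y η ×
              All (_∉ M) s × All (_∈ M) (heads Y) × All (λ σ → All (_∉ M) (proj₂ σ)) Y)
  segment M {a = a} e [ a ] f η∈ with a ∈? M
  ... | yes a∈ = [] , (a , []) ∷ [] , a , refl , e , f ∷ [] , [] , a∈ ∷ [] , [] ∷ []
  ... | no a∉  = a ∷ [] , [] , _ , refl , (e , f) , [] , a∉ ∷ [] , [] , []
  segment M {a = a} e (e′ ∷ p) f η∈ with segment M e′ p f η∈ | a ∈? M
  ... | s , Y , ζ , refl , l , c , off , hs , offs | yes a∈ =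
    [] , (a , s) ∷ Y , a , refl , e , l ∷ c , [] , a∈ ∷ hs , off ∷ offs
  ... | s , Y , ζ , refl , l , c , off , hs , offs | no a∉ =
    a ∷ s , Y , ζ , refl , (e , l) , c , a∉ ∷ off , hs , offs

  -- The cycle L, cut into segments at the vertices of M.
  record Rep (L M : List V) (Z : List Seg) : Set where
    constructor rep
    field
      {a}    : V
      chain  : Chain a Z a
      nodupᶻ : NoDup (flatten Z)
      size   : length (flatten Z) ≡ length L
      to     : ∀ {v} → v ∈ flatten Z → v ∈ L
      from   : ∀ {v} → v ∈ L → v ∈ flatten Z
      headsM : All (_∈ M) (heads Z)
      offM   : All (λ σ → All (_∉ M) (proj₂ σ)) Z

  open Rep public

  open-cycle : ∀ {m xs} → Cyc (m ∷ xs) → ∃[ w ] ∃[ b ] (E m w × Path w xs b × E b m)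
  open-cycle (cyc d l (e ∷ p) f) = _ , _ , e , p , f
  open-cycle (cyc d (s≤s ()) [ m ] f)

  represent : ∀ {L M m} → Cyc L → m ∈ L → m ∈ M → ∃[ s ] ∃[ Z ] Rep L M ((m , s) ∷ Z)
  represent {M = M} {m = m} c m∈L m∈M with ∈-∃++ m∈L
  ... | as , bs , refl with rotate as c
  ...   | cy with open-cycle cy
  ...     | w , b , e , p , f with segment M e p f m∈M
  ...       | s , Y , ζ , eq , lk , ch , off , hs , offs =
    s , Y , rep (lk ∷ ch) (subst NoDup (cong (m ∷_) eq) (nodupᶜ cy))
      (trans (cong length (cong (m ∷_) (sym eq))) (trans (length-++ (m ∷ bs)) (trans (+-comm (length (m ∷ bs)) _) (sym (length-++ as)))))
      (λ v∈ → swap (∈-resp (cong (m ∷_) (sym eq)) v∈))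
      (λ v∈ → ∈-resp (cong (m ∷_) eq) (swap′ v∈))
      (m∈M ∷ hs) (off ∷ offs)
    where
    swap : ∀ {v} → v ∈ (m ∷ bs) ++ as → v ∈ as ++ m ∷ bs
    swap v∈ = [ ∈-++⁺ʳ as , ∈-++⁺ˡ ]′ (∈-++⁻ (m ∷ bs) v∈)
    swap′ : ∀ {v} → v ∈ as ++ m ∷ bs → v ∈ (m ∷ bs) ++ as
    swap′ v∈ = [ ∈-++⁺ʳ (m ∷ bs) , ∈-++⁺ˡ ]′ (∈-++⁻ as v∈)

  rechain : ∀ {L M Z b} → Chain b Z b → Rep L M Z → Rep L M Z
  rechain ch (rep _ nd sz to from hs off) = rep ch nd sz to from hs off

  rep-rotate : ∀ {L M} X {Y} → Rep L M (X ++ Y) → Rep L M (Y ++ X)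
  rep-rotate X {Y} (rep ch nd sz to from hs off) with chain-++⁻ X ch
  ... | m , c₁ , c₂ = rep (chain-++⁺ c₂ c₁)
    (subst NoDup (sym (flatten-++ Y X)) ((nodup⊆ (flatten X ∷ flatten Y ∷ []) ([]) ((# 1 · # 0)) ((# 0 · # 1)) (subst NoDup (flatten-++ X Y) nd))))
    (trans (cong length (flatten-++ Y X)) (trans (length-++ (flatten Y)) (trans (+-comm (length (flatten Y)) _)
      (trans (sym (length-++ (flatten X))) (trans (cong length (sym (flatten-++ X Y))) sz)))))
    (λ v∈ → to (∈-resp (sym (flatten-++ X Y)) ([ ∈-++⁺ʳ (flatten X) , ∈-++⁺ˡ ]′ (∈-++⁻ (flatten Y) (∈-resp (flatten-++ Y X) v∈)))))
    (λ v∈ → ∈-resp (sym (flatten-++ Y X)) ([ ∈-++⁺ʳ (flatten Y) , ∈-++⁺ˡ ]′ (∈-++⁻ (flatten X) (∈-resp (flatten-++ X Y) (from v∈)))))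
    (subst (All _) (sym (map-++ proj₁ Y X)) (++⁺ (++⁻ʳ (heads X) hs′) (++⁻ˡ (heads X) hs′)))
    (++⁺ (++⁻ʳ X off) (++⁻ˡ X off))
    where hs′ = subst (All _) (map-++ proj₁ X Y) hs

  off-heads : ∀ {L M Z v} → Rep L M Z → v ∈ L → v ∉ heads Z → v ∉ M
  off-heads {Z = Z} R v∈L v∉ with locate Z (from R v∈L) v∉
  ... | X , ξ , s , Y , refl , v∈s = All.lookup (All.head (++⁻ʳ X (offM R))) v∈s

  M⊆heads : ∀ {L M Z v} → Rep L M Z → v ∈ L → v ∈ M → v ∈ heads Z
  M⊆heads {Z = Z} {v} R v∈L v∈M with v ∈? heads Z
  ... | yes p = p
  ... | no ¬p = contradiction v∈M (off-heads R v∈L ¬p)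

  heads-nodup : ∀ Z → NoDup (flatten Z) → NoDup (heads Z)
  heads-nodup []            h = NoDup-[]
  heads-nodup ((ξ , s) ∷ Z) h =
    NoDup-∷ (λ p → NoDup-head h (∈-++⁺ʳ s (heads⊆flatten Z p))) (heads-nodup Z (NoDup-++ʳ (ξ ∷ s) h))

  flatten-pair : ∀ ξ s Y ξ′ s′ W →
    flatten ((ξ , s) ∷ Y ++ (ξ′ , s′) ∷ W) ≡ ξ ∷ s ++ flatten Y ++ ξ′ ∷ s′ ++ flatten W
  flatten-pair ξ s Y ξ′ s′ W = cong (λ z → ξ ∷ s ++ z) (flatten-++ Y ((ξ′ , s′) ∷ W))

  -- Around the cycle follow `ξ`, `s`, the arc from `α` to `ξ′`, `s′`, and the arc from `β` to `ξ`.
  -- Both reroutings need exactly these two arcs.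
  record Pair (M : List V) (k : ℕ) (ξ : V) (s : List V) (Y : List Seg) (ξ′ : V) (s′ : List V) (W : List Seg) : Set where
    field
      {α β}  : V
      lk     : Lk ξ s α
      lk′    : Lk ξ′ s′ β
      chY    : Chain α Y ξ′
      chW    : Chain β W ξ
      nd     : NoDup (ξ ∷ s ++ flatten Y ++ ξ′ ∷ s′ ++ flatten W)
      len    : length (ξ ∷ s ++ flatten Y ++ ξ′ ∷ s′ ++ flatten W) ≡ k
      ξ∈     : ξ ∈ M
      ξ′∈    : ξ′ ∈ M
      α∈     : α ∈ M
      β∈     : β ∈ M
      ξ≢ξ′   : ξ ≢ ξ′
      α≢β    : α ≢ β

    arcY : Path α (arc Y ξ′) ξ′
    arcY = arc-path chY

    arcW : Path β (arc W ξ) ξ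
    arcW = arc-path chW

  pair : ∀ {L M ξ s Y ξ′ s′ W} → Rep L M ((ξ , s) ∷ Y ++ (ξ′ , s′) ∷ W) → Pair M (length L) ξ s Y ξ′ s′ W
  pair {M = M} {ξ} {s} {Y} {ξ′} {s′} {W} (rep (lk ∷ ch) nd sz to from (ξ∈ ∷ hs) off) with chain-++⁻ Y ch
  ... | _ , chY , lk′ ∷ chW = record
    { lk = lk ; lk′ = lk′ ; chY = chY ; chW = chW ; nd = nd′
    ; len = trans (cong length (sym (flatten-pair ξ s Y ξ′ s′ W))) sz
    ; ξ∈ = ξ∈ ; ξ′∈ = ξ′∈
    ; α∈ = All.lookup (++⁺ hsY (ξ′∈ ∷ [])) (chain-start∈ chY)
    ; β∈ = All.lookup (++⁺ hsW (ξ∈ ∷ [])) (chain-start∈ chW)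
    ; ξ≢ξ′ = λ { refl → NoDup-head nd′ (∈-++⁺ʳ s (∈-++⁺ʳ (flatten Y) (here refl))) }
    ; α≢β = λ { refl → NoDup-disjoint {arc Y ξ′} {arc W ξ}
                         ((nodup⊆ (s ∷ flatten Y ∷ s′ ∷ flatten W ∷ []) (ξ ∷ ξ′ ∷ []) (((# 1 · (• 1 · ε)) · (# 3 · (• 0 · ε)))) ((• 0 · (# 0 · (# 1 · (• 1 · (# 2 · # 3)))))) (nd′)))
                         (start∈ (arc-path chY)) (start∈ (arc-path chW)) } }
    where
    nd′ = subst NoDup (flatten-pair ξ s Y ξ′ s′ W) nd
    hs′ = subst (All (_∈ M)) (map-++ proj₁ Y ((ξ′ , s′) ∷ W)) hs
    hsY = ++⁻ˡ (heads Y) hs′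
    ξ′∈ = All.head (++⁻ʳ (heads Y) hs′)
    hsW = All.tail (++⁻ʳ (heads Y) hs′)

  record Single (M : List V) (k : ℕ) (ξ : V) (s : List V) (Y : List Seg) : Set where
    field
      {α}  : V
      lk   : Lk ξ s α
      chY  : Chain α Y ξ
      nd   : NoDup (ξ ∷ s ++ flatten Y)
      len  : length (ξ ∷ s ++ flatten Y) ≡ k
      ξ∈   : ξ ∈ M
      α∈   : α ∈ M

  single-seg : ∀ {L M ξ s Y} → Rep L M ((ξ , s) ∷ Y) → Single M (length L) ξ s Y
  single-seg {Y = Y} (rep (lk ∷ ch) nd sz to from hs off) = record
    { lk = lk ; chY = ch ; nd = nd ; len = sz ; ξ∈ = All.head hs ; α∈ = All.lookup (++⁺ (All.tail hs) (All.head hs ∷ [])) (chain-start∈ ch) }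

  chain-start≢ : ∀ {ξ s Y α} → 1 ≤ length Y → NoDup (ξ ∷ s ++ flatten Y) → Chain α Y ξ → α ≢ ξ
  chain-start≢ {s = s} l nd (_ ∷ _) refl = NoDup-head nd (∈-++⁺ʳ s (here refl))
  chain-start≢ () nd []

  -- What a path outside the cycle says about the segments

  module Bounds {c : ℕ} (max : Max c) where
    open Exchange max

    disjoint-nodup : ∀ {xs Q} → NoDup xs → NoDup Q → (∀ {v} → v ∈ Q → v ∉ xs) → NoDup (xs ++ Q)
    disjoint-nodup h k d = NoDup-++ h k (λ p q → d q p)

    -- Replacing the stretch `s` by `Q` gives another cycle.
    gap : ∀ {M ξ s Y p Q q} → (S : Single M c ξ s Y) → 1 ≤ length Y → Path p Q q → E ξ p → E q (Single.α S) →
          NoDup Q → (∀ {v} → v ∈ Q → v ∉ ξ ∷ s ++ flatten Y) → length Q ≤ length s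
    gap {ξ = ξ} {s} {Y} {Q = Q} S l pQ e f ndQ off =
      (lin (c ∷ []) (s ∷ flatten Y ∷ Q ∷ []) (ξ ∷ []) ((lng ((• 0 · (# 0 · # 1))) ≋ at 0) ∷ ((lng ((# 1 · (• 0 · ε))) ⊕ lng (# 2)) ≼ at 0) ∷ []) (lng (# 2)) (lng (# 0)) 0 ((0 , 1) ∷ (1 , 0) ∷ []) (len , basic (arc-path chY) pQ e f (chain-start≢ {s = s} l nd chY)
          ((nodup⊆ (s ∷ flatten Y ∷ Q ∷ []) (ξ ∷ []) (((# 1 · (• 0 · ε)) · # 2)) (((• 0 · (# 0 · # 1)) · # 2)) (disjoint-nodup nd ndQ off))) , tt))
      where open Single S

    -- An attachment d inside a segment splits it into gaps on both sides.
    gapˡ : ∀ {M ξ o d r Y p Q q} → Single M c ξ (o ++ d ∷ r) Y → Path p Q q → E ξ p → E q d →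
           NoDup Q → (∀ {v} → v ∈ Q → v ∉ ξ ∷ (o ++ d ∷ r) ++ flatten Y) → length Q ≤ length o
    gapˡ {ξ = ξ} {o} {d} {r} {Y} {Q = Q} S pQ e f ndQ off =
      (lin (c ∷ []) (o ∷ r ∷ flatten Y ∷ Q ∷ []) (ξ ∷ d ∷ []) ((lng ((• 0 · ((# 0 · (• 1 · # 1)) · # 2))) ≋ at 0) ∷ ((lng ((• 1 · (# 1 · (# 2 · (• 0 · ε))))) ⊕ lng (# 3)) ≼ at 0) ∷ []) (lng (# 3)) (lng (# 0)) 0 ((0 , 1) ∷ (1 , 0) ∷ []) (len , basic (lk-path (proj₂ (lk-split o lk)) (arc-path chY)) pQ e f
          (λ { refl → NoDup-head nd (∈-++⁺ˡ (∈-++⁺ʳ o (here refl))) })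
          ((nodup⊆ (o ∷ r ∷ flatten Y ∷ Q ∷ []) (ξ ∷ d ∷ []) (((• 1 · (# 1 · (# 2 · (• 0 · ε)))) · # 3)) (((• 0 · ((# 0 · (• 1 · # 1)) · # 2)) · # 3)) (disjoint-nodup nd ndQ off))) , tt))
      where open Single S

    gapʳ : ∀ {M ξ o d r Y p Q q} → (S : Single M c ξ (o ++ d ∷ r) Y) → Path p Q q → E d p → E q (Single.α S) →
           NoDup Q → (∀ {v} → v ∈ Q → v ∉ ξ ∷ (o ++ d ∷ r) ++ flatten Y) → length Q ≤ length r
    gapʳ {ξ = ξ} {o} {d} {r} {Y} {Q = Q} S pQ e f ndQ off =
      (lin (c ∷ []) (o ∷ r ∷ flatten Y ∷ Q ∷ []) (ξ ∷ d ∷ []) ((lng ((• 0 · ((# 0 · (• 1 · # 1)) · # 2))) ≋ at 0) ∷ ((lng (((# 2 · (• 0 · ε)) · (# 0 · (• 1 · ε)))) ⊕ lng (# 3)) ≼ at 0) ∷ []) (lng (# 3)) (lng (# 1)) 0 ((0 , 1) ∷ (1 , 0) ∷ []) (len , basic (path-lk (arc-path chY) (proj₁ (lk-split o lk)) [ d ]) pQ e f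
          (λ { refl → NoDup-disjoint {o ++ d ∷ r} {flatten Y ++ ξ ∷ []}
                        ((nodup⊆ (o ∷ r ∷ flatten Y ∷ []) (ξ ∷ d ∷ []) (((# 0 · (• 1 · # 1)) · (# 2 · (• 0 · ε)))) ((• 0 · ((# 0 · (• 1 · # 1)) · # 2))) (nd)))
                        (∈-++⁺ʳ o (here refl)) (start∈ (arc-path chY)) })
          ((nodup⊆ (o ∷ r ∷ flatten Y ∷ Q ∷ []) (ξ ∷ d ∷ []) ((((# 2 · (• 0 · ε)) · (# 0 · (• 1 · ε))) · # 3)) (((• 0 · ((# 0 · (• 1 · # 1)) · # 2)) · # 3)) (disjoint-nodup nd ndQ off))) , tt))
      where open Single S

    module _ {M ξ o₁ y r₁ Y ξ′ o₂ z r₂ W}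
             (P : Pair M c ξ (o₁ ++ y ∷ r₁) Y ξ′ (o₂ ++ z ∷ r₂) W) where
      open Pair P

      private
        all : List V
        all = ξ ∷ (o₁ ++ y ∷ r₁) ++ flatten Y ++ ξ′ ∷ (o₂ ++ z ∷ r₂) ++ flatten W

      -- The two ways of rerouting the cycle along a link from y to z and a path Q outside the cycle.
      reroute₁ : ∀ {p Q q ls} → Path p Q q → E ξ′ p → E q ξ → Lk z ls y → NoDup (Q ++ ls) →
                 (∀ {v} → v ∈ Q ++ ls → v ∉ all) → length Q + length ls ≤ length o₁ + length o₂
      reroute₁ {Q = Q} {ls = ls} pQ e f l ndQ off =
        (lin (c ∷ []) (o₁ ∷ r₁ ∷ flatten Y ∷ o₂ ∷ r₂ ∷ flatten W ∷ Q ∷ ls ∷ []) (ξ ∷ y ∷ ξ′ ∷ z ∷ []) ((lng ((• 0 · ((# 0 · (• 1 · # 1)) · (# 2 · (• 2 · ((# 3 · (• 3 · # 4)) · # 5)))))) ≋ at 0) ∷ ((((lng ((• 1 · (# 1 · (# 2 · (• 2 · ε))))) ⊕ lng (# 6)) ⊕ lng ((• 3 · (# 4 · (# 5 · (• 0 · ε)))))) ⊕ lng (# 7)) ≼ at 0) ∷ []) ((lng (# 6) ⊕ lng (# 7))) ((lng (# 0) ⊕ lng (# 3))) 0 ((0 , 1) ∷ (1 , 0) ∷ []) (len , crossLk (lk-path (proj₂ (lk-split o₁ lk)) arcY) (lk-path (proj₂ (lk-split o₂ lk′)) arcW) pQ e f l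
            ((nodup⊆ (o₁ ∷ r₁ ∷ flatten Y ∷ o₂ ∷ r₂ ∷ flatten W ∷ Q ∷ ls ∷ []) (ξ ∷ y ∷ ξ′ ∷ z ∷ []) (((• 1 · (# 1 · (# 2 · (• 2 · ε)))) · (# 6 · ((• 3 · (# 4 · (# 5 · (• 0 · ε)))) · # 7)))) (((• 0 · ((# 0 · (• 1 · # 1)) · (# 2 · (• 2 · ((# 3 · (• 3 · # 4)) · # 5))))) · (# 6 · # 7))) (disjoint-nodup nd ndQ off))) , tt))

      reroute₂ : ∀ {p Q q ls} → Path p Q q → E α p → E q β → Lk y ls z → NoDup (Q ++ ls) →
                 (∀ {v} → v ∈ Q ++ ls → v ∉ all) → length Q + length ls ≤ length r₁ + length r₂
      reroute₂ {Q = Q} {ls = ls} pQ e f l ndQ off =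
        (lin (c ∷ []) (o₁ ∷ r₁ ∷ flatten Y ∷ o₂ ∷ r₂ ∷ flatten W ∷ Q ∷ ls ∷ []) (ξ ∷ y ∷ ξ′ ∷ z ∷ []) ((lng ((• 0 · ((# 0 · (• 1 · # 1)) · (# 2 · (• 2 · ((# 3 · (• 3 · # 4)) · # 5)))))) ≋ at 0) ∷ ((((lng (rev (((# 2 · (• 2 · ε)) · (# 3 · (• 3 · ε))))) ⊕ lng (# 6)) ⊕ lng (rev (((# 5 · (• 0 · ε)) · (# 0 · (• 1 · ε)))))) ⊕ lng (# 7)) ≼ at 0) ∷ []) ((lng (# 6) ⊕ lng (# 7))) ((lng (# 1) ⊕ lng (# 4))) 0 ((0 , 1) ∷ (1 , 0) ∷ []) (len , crossLk (path-reverse (path-lk arcY (proj₁ (lk-split o₂ lk′)) [ z ]))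
                  (path-reverse (path-lk arcW (proj₁ (lk-split o₁ lk)) [ y ])) pQ e f l
            ((nodup⊆ (o₁ ∷ r₁ ∷ flatten Y ∷ o₂ ∷ r₂ ∷ flatten W ∷ Q ∷ ls ∷ []) (ξ ∷ y ∷ ξ′ ∷ z ∷ []) ((rev (((# 2 · (• 2 · ε)) · (# 3 · (• 3 · ε)))) · (# 6 · (rev (((# 5 · (• 0 · ε)) · (# 0 · (• 1 · ε)))) · # 7)))) (((• 0 · ((# 0 · (• 1 · # 1)) · (# 2 · (• 2 · ((# 3 · (• 3 · # 4)) · # 5))))) · (# 6 · # 7))) (disjoint-nodup nd ndQ off))) , tt))

  -- The weighted count

  module _ (tough : OneTough G) where

    open Toughness tough
    open TwoConnected tough

    module Separation (L M S : List V) (M⊆S : ∀ {v} → v ∈ M → v ∈ S) where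

      -- No link, avoiding S, leaves the segment s for a segment of Z.
      NoLink : List V → List Seg → Set
      NoLink s Z = ∀ {X ξ′ s′ Y y z ls} → Z ≡ X ++ (ξ′ , s′) ∷ Y → y ∈ s → z ∈ s′ →
                   y ∉ S → z ∉ S → Lk y ls z → NoDup ls → (∀ {v} → v ∈ ls → v ∉ L) → ⊥

      Attached : List V → V → Set
      Attached s v = v ∉ L × ∃[ y ] ∃[ w ] (y ∈ s × y ∉ S × E y w × Con (_∉ L) w v)

      -- A walk avoiding `S` leaves `s` only for vertices outside `L`; coming back to `L` in another
      -- segment would complete a link. A path taken from the excursion serves as that link.
      confined : ∀ {ξ s Z u v} → NoLink s Z → Rep L M ((ξ , s) ∷ Z) → u ∈ s → Con (_∉ S) u v → v ∈ s ⊎ Attached s v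
      confined {ξ} {s} {Z} nolink R u∈ = con-closed {K = λ v → v ∈ s ⊎ Attached s v} closed (inj₁ u∈)
        where
        elsewhere : ∀ {w} → w ∉ S → w ∈ L → w ∉ s →
                    ∃[ X ] ∃[ ξ′ ] ∃[ s′ ] ∃[ Y ] (Z ≡ X ++ (ξ′ , s′) ∷ Y × w ∈ s′)
        elsewhere w∉ w∈ w∉s with from R w∈
        ... | here refl = contradiction (M⊆S (All.head (headsM R))) w∉
        ... | there p with ∈-++⁻ s p
        ...   | inj₁ w∈s = contradiction w∈s w∉s
        ...   | inj₂ w∈Z = locate Z w∈Z (λ h → w∉ (M⊆S (All.lookup (headsM R) (there h))))
        linked : ∀ {y w ls} → y ∈ s → y ∉ S → w ∉ S → w ∈ L → Lk y ls w → NoDup ls →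
                 (∀ {v} → v ∈ ls → v ∉ L) → w ∈ s
        linked {w = w} y∈ y∉ w∉ w∈ l nd off with w ∈? s
        ... | yes p = p
        ... | no ¬p with elsewhere w∉ w∈ ¬p
        ...   | X , ξ′ , s′ , Y , refl , q = ⊥-elim (nolink refl y∈ q y∉ w∉ l nd off)
        closed : ∀ {v w} → v ∉ S → w ∉ S → v ∈ s ⊎ Attached s v → E v w → w ∈ s ⊎ Attached s w
        closed {w = w} v∉ w∉ k e with w ∈? L
        closed v∉ w∉ (inj₁ v∈) e | yes w∈ = inj₁ (linked v∈ v∉ w∉ w∈ e NoDup-[] λ ())
        closed v∉ w∉ (inj₁ v∈) e | no w∉L = inj₂ (w∉L , _ , _ , v∈ , v∉ , e , stop w∉L)
        closed v∉ w∉ (inj₂ (_ , y , w , y∈ , y∉ , f , c)) e | no w∉L = inj₂ (w∉L , y , w , y∈ , y∉ , f , c ▷ e , w∉L)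
        closed v∉ w∉ (inj₂ (_ , y , w , y∈ , y∉ , f , c)) e | yes w∈ with con-path c
        ... | p , path , nd , off = inj₁ (linked y∈ y∉ w∉ w∈ (inner-lk f path e) nd off)

      apart : ∀ {ξ s Z u v} → NoLink s Z → Rep L M ((ξ , s) ∷ Z) → u ∈ s → v ∈ L → v ∉ s → ¬ Con (_∉ S) u v
      apart nolink R u∈ v∈ v∉ c with confined nolink R u∈ c
      ... | inj₁ p = v∉ p
      ... | inj₂ (p , _) = p v∈

    firsts : List Seg → List V
    firsts []                = []
    firsts ((ξ , [])    ∷ Z) = firsts Z
    firsts ((ξ , x ∷ s) ∷ Z) = x ∷ firsts Z

    firsts-length : ∀ Z → All (λ σ → 1 ≤ length (proj₂ σ)) Z → length (firsts Z) ≡ length Z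
    firsts-length []                []      = refl
    firsts-length ((ξ , x ∷ s) ∷ Z) (_ ∷ h) = cong suc (firsts-length Z h)

    firsts⊆ : ∀ Z {v} → v ∈ firsts Z → v ∈ flatten Z
    firsts⊆ ((ξ , [])    ∷ Z) p           = there (firsts⊆ Z p)
    firsts⊆ ((ξ , x ∷ s) ∷ Z) (here refl) = there (here refl)
    firsts⊆ ((ξ , x ∷ s) ∷ Z) (there p)   = there (there (∈-++⁺ʳ s (firsts⊆ Z p)))

    firsts∉ : ∀ {L M} Z → Rep L M Z → ∀ {v} → v ∈ firsts Z → v ∉ M
    firsts∉ {M = M} Z R = go Z (offM R)
      where
      go : ∀ Z → All (λ σ → All (_∉ M) (proj₂ σ)) Z → ∀ {v} → v ∈ firsts Z → v ∉ M
      go ((ξ , [])    ∷ Z) (_ ∷ os)       p           = go Z os p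
      go ((ξ , x ∷ s) ∷ Z) ((o ∷ _) ∷ os) (here refl) = o
      go ((ξ , x ∷ s) ∷ Z) (_ ∷ os)       (there p)   = go Z os p

    firsts-pairs : ∀ (R∼ : V → V → Set) xs T →
                   (∀ T₁ {ξ x s T₂ v} → T ≡ T₁ ++ (ξ , x ∷ s) ∷ T₂ → v ∈ firsts T₂ ⊎ v ∈ xs → R∼ x v) →
                   AllPairs R∼ xs → AllPairs R∼ (firsts T ++ xs)
    firsts-pairs R∼ xs []                h ps = ps
    firsts-pairs R∼ xs ((ξ , [])    ∷ T) h ps =
      firsts-pairs R∼ xs T (λ T₁ eq → h ((ξ , []) ∷ T₁) (cong ((ξ , []) ∷_) eq)) ps
    firsts-pairs R∼ xs ((ξ , x ∷ s) ∷ T) h ps =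
      All.tabulate (λ v∈ → h [] refl (∈-++⁻ (firsts T) v∈))
      ∷ firsts-pairs R∼ xs T (λ T₁ eq → h ((ξ , x ∷ s) ∷ T₁) (cong ((ξ , x ∷ s) ∷_) eq)) ps

    module _ {L : List V} (cycL : Cyc L) (max : Max (length L)) where
      open Bounds max

      module Joints (M : List V) (ω : V → ℕ) (x₀ : V) (x₀∉ : x₀ ∉ L) where

        private
          H : V → Set
          H v = Con (_∉ L) x₀ v

        -- Each member of `M` gives half its weight to the gap on either side. The weight condition
        -- says that a stretch of length |Q| together with its head pays for both halves. By `reach`
        -- all joints run in the one component of `x₀`.
        record Joint (ξ ξ′ : V) : Set where
          field
            {p q} : V
            Q     : List V
            path  : Path p Q q
            left  : E ξ p
            right : E q ξ′
            nd    : NoDup Q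
            off   : ∀ {v} → v ∈ Q → v ∉ L
            reach : H p
            weight : ω ξ + ω ξ′ ≤ 2 * (1 + length Q)

        joint-H : ∀ {ξ ξ′} (j : Joint ξ ξ′) → ∀ {v} → v ∈ Joint.Q j → H v
        joint-H j v∈ = con-trans (Joint.reach j) (path-con∈ (Joint.path j) (Joint.off j) v∈)

        module _ (joint : ∀ {ξ ξ′} → ξ ∈ M → ξ′ ∈ M → ξ ≢ ξ′ → Joint ξ ξ′)
                 (ndM : NoDup M) (M⊆L : ∀ {v} → v ∈ M → v ∈ L) (two : 2 ≤ length M) where

          private
            R : List Seg → Set
            R = Rep L M

            off-rep : ∀ {Z Q} → R Z → (∀ {v} → v ∈ Q → v ∉ L) → ∀ {v} → v ∈ Q → v ∉ flatten Z
            off-rep r h v∈ v∈Z = h v∈ (to r v∈Z)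

            count : ∀ {Z} → R Z → length M ≤ length Z
            count {Z} r = ≤-trans (length-⊆ ndM (λ v∈ → M⊆heads r (M⊆L v∈) v∈)) (≤-reflexive (length-map proj₁ Z))

            tail≥1 : ∀ {σ Y} → R (σ ∷ Y) → 1 ≤ length Y
            tail≥1 r = s≤s⁻¹ (≤-trans two (count r))

            hopJoint : ∀ {ξ s Y} (r : R ((ξ , s) ∷ Y)) → Joint ξ (Single.α (single-seg r))
            hopJoint {s = s} r = joint ξ∈ α∈ (λ eq → chain-start≢ {s = s} (tail≥1 r) nd chY (sym eq))
              where open Single (single-seg r)

            hop≥ : ∀ {ξ s Y} (r : R ((ξ , s) ∷ Y)) → length (Joint.Q (hopJoint r)) ≤ length s
            hop≥ {ξ} {s} {Y} r =
              gap (single-seg r) (tail≥1 r) J.path J.left J.right J.nd (off-rep r J.off)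
              where module J = Joint (hopJoint r)

            nonempty : ∀ {σ Y} → R (σ ∷ Y) → 1 ≤ length (proj₂ σ)
            nonempty r = ≤-trans (path-nonempty (Joint.path (hopJoint r))) (hop≥ r)

            -- The gap estimates are added along `Y`. Inner heads are charged from both sides,
            -- whence the factor 2, while `m` and `a` are charged once.
            chain-sum : ∀ X {Y a m} → Chain a X m → Chain m Y a → R (X ++ Y) →
                        2 * wsum ω (heads Y) + ω a ≤ 2 * length (flatten Y) + ω m
            chain-sum X chX [] r = ≤-refl
            chain-sum X {a = a} chX (_∷_ {ξ} {s} {ζ} {Y} l ch) r =
              (lin (ω ξ ∷ ω ζ ∷ wsum ω (heads Y) ∷ ω a ∷ []) (J.Q ∷ s ∷ flatten Y ∷ []) (ξ ∷ []) ((lng (# 0) ≼ lng (# 1)) ∷ ((at 0 ⊕ at 1) ≼ 2 ⊗ ((κ 1 ⊕ lng (# 0)))) ∷ ((2 ⊗ (at 2) ⊕ at 3) ≼ (2 ⊗ (lng (# 2)) ⊕ at 1)) ∷ []) ((2 ⊗ ((at 0 ⊕ at 2)) ⊕ at 3)) ((2 ⊗ (lng ((• 0 · (# 1 · # 2)))) ⊕ at 0)) 0 ((2 , 0) ∷ (1 , 0) ∷ (1 , 0) ∷ []) (hop≥ r′ , J.weight , chain-sum (X ++ (ξ , s) ∷ []) (chain-++⁺ chX (l ∷ [])) ch (subst R (sym (++-assoc X _ Y)) r) , tt))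
              where
              r′ : R ((ξ , s) ∷ Y ++ X)
              r′ = rechain (l ∷ chain-++⁺ ch chX) (rep-rotate X r)
              module J = Joint (hopJoint r′)

            all-nonempty : ∀ X Y → R (X ++ Y) → All (λ σ → 1 ≤ length (proj₂ σ)) Y
            all-nonempty X []      r = []
            all-nonempty X (σ ∷ Y) r =
              nonempty (rep-rotate X r) ∷ all-nonempty (X ++ σ ∷ []) Y (subst R (sym (++-assoc X _ Y)) r)

            weigh : ∀ {Z} → R Z → wsum ω M ≤ wsum ω (heads Z)
            weigh r = wsum-⊆ ω ndM (λ v∈ → M⊆heads r (M⊆L v∈) v∈)

          module _ (small : length L ≤ wsum ω M + 1) where

            private
              -- A path `f` from the joint, branching off at `z`, ends in `h`. The vertex `d` splits
              -- the segment into two gaps, each bridged through `z` and `f`; together they make it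
              -- longer than the joint by at least 2, one more than `small` grants.
              no-attachment : ∀ {ξ s Y d h} → R ((ξ , s) ∷ Y) → d ∈ s → E d h → H h → ⊥
              no-attachment {h = h} r d∈ e Hh with ∈-∃++ d∈
              no-attachment {ξ} {_} {Y} {d} {h} r d∈ e Hh | o , b , refl
                with con-path (con-trans (con-sym (Joint.reach (hopJoint r))) Hh)
              ... | _ , pth , ndp , offp
                with trim {D = _∈ Joint.Q (hopJoint r)} {Z = _≡ h} (_∈? Joint.Q (hopJoint r)) (_≟ᶠ h) pth ndp (start∈ (Joint.path (hopJoint r))) refl
              ... | record { q = [] ; path = () }
              ... | record { d = z ; q = z′ ∷ f ; path = pf ; d∈D = z∈ ; z∈Z = refl ; distinct = ndf ; sub = subf ; onlyD = onlyf }
                with path-first pf | ∈-∃++ z∈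
              ... | refl | Q₁ , Q₂ , eq =
                (1≰0 (lin (wsum ω M ∷ ω ξ ∷ wsum ω (heads Y) ∷ ω α ∷ []) (L ∷ o ∷ b ∷ flatten Y ∷ J.Q ∷ Q₁ ∷ Q₂ ∷ f ∷ []) (ξ ∷ d ∷ z ∷ []) ((lng (# 0) ≼ (at 0 ⊕ κ 1)) ∷ (at 0 ≼ (at 1 ⊕ at 2)) ∷ (lng ((• 0 · ((# 1 · (• 1 · # 2)) · # 3))) ≋ lng (# 0)) ∷ ((2 ⊗ (at 2) ⊕ at 1) ≼ (2 ⊗ (lng (# 3)) ⊕ at 3)) ∷ ((at 1 ⊕ at 3) ≼ 2 ⊗ ((κ 1 ⊕ lng (# 4)))) ∷ (lng (# 4) ≋ lng ((# 5 · (• 2 · # 6)))) ∷ (lng (((# 5 · (• 2 · ε)) · # 7)) ≼ lng (# 1)) ∷ (lng ((rev ((• 2 · # 7)) · # 6)) ≼ lng (# 2)) ∷ []) (κ 1) (κ 0) 0 ((2 , 0) ∷ (2 , 0) ∷ (2 , 0) ∷ (1 , 0) ∷ (1 , 0) ∷ (2 , 0) ∷ (2 , 0) ∷ (2 , 0) ∷ []) (small , weigh r , len , chain-sum ((ξ , o ++ d ∷ b) ∷ []) (lk ∷ []) chY r , J.weight , cong length eq , gapˡ {o = o} S (glue (path-prefix Q₁ pQ) pf) J.left (E-sym e) nd₁ off₁ , gapʳ {o = o} S (glue (path-reverse pf) (path-suffix Q₁ pQ)) e J.right nd₂ off₂ , tt)))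
                where
                S = single-seg r
                open Single S
                module J = Joint (hopJoint r)
                pQ : Path J.p (Q₁ ++ z ∷ Q₂) J.q
                pQ = subst (λ l → Path J.p l J.q) eq J.path
                ndQf : NoDup ((Q₁ ++ z ∷ Q₂) ++ f)
                ndQf = NoDup-++ (subst NoDup eq J.nd) (NoDup-tail ndf)
                         (λ v∈Q v∈f → NoDup-head ndf (subst (_∈ f) (onlyf (there v∈f) (∈-resp (sym eq) v∈Q)) v∈f))
                nd₁ : NoDup ((Q₁ ++ z ∷ []) ++ f)
                nd₁ = (nodup⊆ (Q₁ ∷ Q₂ ∷ f ∷ []) (z ∷ []) (((# 0 · (• 0 · ε)) · # 2)) (((# 0 · (• 0 · # 1)) · # 2)) (ndQf))
                nd₂ : NoDup (reverse (z ∷ f) ++ Q₂)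
                nd₂ = (nodup⊆ (Q₁ ∷ Q₂ ∷ f ∷ []) (z ∷ []) ((rev ((• 0 · # 2)) · # 1)) (((# 0 · (• 0 · # 1)) · # 2)) (ndQf))
                offQ : ∀ {v} → v ∈ Q₁ ++ z ∷ Q₂ → v ∉ L
                offQ v∈ = J.off (∈-resp (sym eq) v∈)
                off₁ : ∀ {v} → v ∈ (Q₁ ++ z ∷ []) ++ f → v ∉ ξ ∷ (o ++ d ∷ b) ++ flatten Y
                off₁ = off-rep r λ v∈ → [ (λ p → offQ ([ ∈-++⁺ˡ , (λ { (here refl) → ∈-++⁺ʳ Q₁ (here refl) }) ]′ (∈-++⁻ Q₁ p)))
                                        , (λ p → offp (subf (there p))) ]′ (∈-++⁻ (Q₁ ++ z ∷ []) v∈)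
                off₂ : ∀ {v} → v ∈ reverse (z ∷ f) ++ Q₂ → v ∉ ξ ∷ (o ++ d ∷ b) ++ flatten Y
                off₂ = off-rep r λ v∈ → [ (λ p → offp (subf (reverse⁻ p)))
                                        , (λ p → offQ (∈-++⁺ʳ Q₁ (there p))) ]′ (∈-++⁻ (reverse (z ∷ f)) v∈)

              -- The two reroutings through `ls` bound the parts before and the parts behind `y` and
              -- `z`. Their sum exceeds the two joints by at least 2, again too much. Avoiding the
              -- component `H` keeps `ls` disjoint from the joints.
              no-link : ∀ {ξ s Y ξ′ s′ W y z ls} → R ((ξ , s) ∷ Y ++ (ξ′ , s′) ∷ W) → y ∈ s → z ∈ s′ →
                        Lk y ls z → NoDup ls → (∀ {v} → v ∈ ls → v ∉ L) → (∀ {v} → v ∈ ls → ¬ H v) → ⊥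
              no-link {ξ} {s} {Y} {ξ′} {s′} {W} {y} {z} {ls} r y∈ z∈ l ndl offl ¬H with ∈-∃++ y∈ | ∈-∃++ z∈
              ... | o₁ , r₁ , refl | o₂ , r₂ , refl =
                (1≰0 (lin (wsum ω M ∷ ω ξ ∷ wsum ω (heads (Y ++ (ξ′ , s′) ∷ W)) ∷ wsum ω (heads Y ++ ξ′ ∷ heads W) ∷ wsum ω (heads Y) ∷ ω ξ′ ∷ wsum ω (heads W) ∷ ω α ∷ ω β ∷ []) (L ∷ o₁ ∷ r₁ ∷ flatten Y ∷ o₂ ∷ r₂ ∷ flatten W ∷ J.Q ∷ K.Q ∷ ls ∷ []) (ξ ∷ y ∷ ξ′ ∷ z ∷ []) ((lng (# 0) ≼ (at 0 ⊕ κ 1)) ∷ (at 0 ≼ (at 1 ⊕ at 2)) ∷ (at 2 ≋ at 3) ∷ (at 3 ≋ (at 4 ⊕ (at 5 ⊕ at 6))) ∷ (lng ((• 0 · ((# 1 · (• 1 · # 2)) · (# 3 · (• 2 · ((# 4 · (• 3 · # 5)) · # 6)))))) ≋ lng (# 0)) ∷ ((2 ⊗ (at 4) ⊕ at 5) ≼ (2 ⊗ (lng (# 3)) ⊕ at 7)) ∷ ((2 ⊗ (at 6) ⊕ at 1) ≼ (2 ⊗ (lng (# 6)) ⊕ at 8)) ∷ ((at 5 ⊕ at 1) ≼ 2 ⊗ ((κ 1 ⊕ lng (# 7)))) ∷ ((at 7 ⊕ at 8) ≼ 2 ⊗ ((κ 1 ⊕ lng (# 8)))) ∷ ((lng (#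 7) ⊕ lng (rev (# 9))) ≼ (lng (# 1) ⊕ lng (# 4))) ∷ ((lng (# 8) ⊕ lng (# 9)) ≼ (lng (# 2) ⊕ lng (# 5))) ∷ []) (κ 1) (κ 0) 0 ((2 , 0) ∷ (2 , 0) ∷ (2 , 0) ∷ (2 , 0) ∷ (2 , 0) ∷ (1 , 0) ∷ (1 , 0) ∷ (1 , 0) ∷ (1 , 0) ∷ (2 , 0) ∷ (2 , 0) ∷ []) (small , weigh r , cong (wsum ω) (map-++ proj₁ Y ((ξ′ , s′) ∷ W)) , wsum-++ ω (heads Y) (ξ′ ∷ heads W) , len , chain-sum ((ξ′ , s′) ∷ W ++ (ξ , s) ∷ []) (lk′ ∷ chain-++⁺ chW (lk ∷ [])) chY
                    (subst R (sym (++-assoc ((ξ′ , s′) ∷ W) _ Y)) (rep-rotate ((ξ , s) ∷ Y) r)) , chain-sum ((ξ , s) ∷ Y ++ (ξ′ , s′) ∷ []) (lk ∷ chain-++⁺ chY (lk′ ∷ [])) chW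
                    (subst R (sym (++-assoc ((ξ , s) ∷ Y) _ W)) r) , J.weight , K.weight , reroute₁ P J.path J.left J.right (lk-flip l) (nd′ J.nd (joint-H j)) (off′ J.off) , reroute₂ P K.path K.left K.right l (nd″ K.nd (joint-H k)) (off″ K.off) , tt)))
                where
                P = pair r
                open Pair P
                j = joint ξ′∈ ξ∈ (λ eq → ξ≢ξ′ (sym eq))
                k = joint α∈ β∈ α≢β
                module J = Joint j
                module K = Joint k
                lk-flip : Lk y ls z → Lk z (reverse ls) y
                lk-flip = lk-reverse ls
                nd″ : ∀ {Q} → NoDup Q → (∀ {v} → v ∈ Q → H v) → NoDup (Q ++ ls)
                nd″ h g = NoDup-++ h ndl (λ p q → ¬H q (g p))
                nd′ : ∀ {Q} → NoDup Q → (∀ {v} → v ∈ Q → H v) → NoDup (Q ++ reverse ls)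
                nd′ {Q} h g = (nodup⊆ (Q ∷ ls ∷ []) ([]) ((# 0 · rev (# 1))) ((# 0 · # 1)) (nd″ h g))
                all = ξ ∷ s ++ flatten Y ++ ξ′ ∷ s′ ++ flatten W
                out : ∀ {v} → v ∉ L → v ∉ all
                out h v∈ = h (to r (∈-resp (sym (flatten-pair ξ s Y ξ′ s′ W)) v∈))
                off″ : ∀ {Q} → (∀ {v} → v ∈ Q → v ∉ L) → ∀ {v} → v ∈ Q ++ ls → v ∉ all
                off″ {Q} h v∈ = out ([ h , offl ]′ (∈-++⁻ Q v∈))
                off′ : ∀ {Q} → (∀ {v} → v ∈ Q → v ∉ L) → ∀ {v} → v ∈ Q ++ reverse ls → v ∉ all
                off′ {Q} h v∈ = out ([ h , (λ p → offl (reverse⁻ p)) ]′ (∈-++⁻ Q v∈))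

            -- The heads are exactly the members of `M`. After their deletion no two segments are
            -- connected, nor is any of them connected to `x₀`: one component more than toughness
            -- allows.
            spread-⊥ : ∀ {m} → m ∈ M → ⊥
            spread-⊥ {m} m∈ with represent cycL (M⊆L m∈) m∈
            ... | s , Z′ , r = <⇒≱ (≤-reflexive enough) (separated (heads Z) reps two′ outside pairs)
              where
              Z = (m , s) ∷ Z′
              reps = firsts Z ++ x₀ ∷ []
              enough : 1 + length (heads Z) ≡ length reps
              enough = (≤-antisym (lin (length Z ∷ []) (heads Z ∷ firsts Z ∷ []) (x₀ ∷ []) ((lng (# 0) ≋ at 0) ∷ (lng (# 1) ≋ at 0) ∷ []) ((κ 1 ⊕ lng (# 0))) (lng ((# 1 · (• 0 · ε)))) 0 ((1 , 0) ∷ (0 , 1) ∷ []) (length-map proj₁ Z , firsts-length Z (all-nonempty [] Z r) , tt)) (lin (length Z ∷ []) (heads Z ∷ firsts Z ∷ []) (x₀ ∷ []) ((lng (# 0) ≋ at 0) ∷ (lng (# 1) ≋ at 0) ∷ []) (lng ((# 1 · (• 0 · ε)))) ((κ 1 ⊕ lng (# 0))) 0 ((0 , 1) ∷ (1 , 0) ∷ []) (length-map proj₁ Z , firsts-length Z (all-nonempty [] Z r) , tt)))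
              two′ : 2 ≤ length reps
              two′ = ≤-trans (s≤s (s≤s z≤n)) (≤-reflexive enough)
              heads∈ : ∀ {v} → v ∈ heads Z → v ∈ M
              heads∈ v∈ = All.lookup (headsM r) v∈
              outside : All (_∉ heads Z) reps
              outside = ++⁺ (All.tabulate (λ p q → firsts∉ Z r p (heads∈ q)))
                            ((λ p → x₀∉ (M⊆L (heads∈ p))) ∷ [])
              M⊆ : ∀ {v} → v ∈ M → v ∈ heads Z
              M⊆ v∈ = M⊆heads r (M⊆L v∈) v∈
              open Separation L M (heads Z) M⊆
              nolink : ∀ {ξ s Y} → R ((ξ , s) ∷ Y) → NoLink s Y
              nolink q refl y∈ z∈ _ _ l nd off = no-link q y∈ z∈ l nd off hidden
                where
                hidden : ∀ {v} → v ∈ _ → ¬ H v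
                hidden v∈ Hv with lk-con l v∈
                  where
                  lk-con : ∀ {y ls z v} → Lk y ls z → v ∈ ls → ∃[ w ] (E y w × (∀ {X} → (∀ {u} → u ∈ ls → X u) → Con X w v))
                  lk-con {ls = w ∷ ls} l v∈ with lk-inner l
                  ... | _ , e , p , _ = w , e , λ h → path-con∈ p h v∈
                ... | w , e , c = no-attachment q y∈ e (con-trans Hv (con-sym (c off)))
              sep : ∀ Z₁ {ξ x s Z₂ v} → Z ≡ Z₁ ++ (ξ , x ∷ s) ∷ Z₂ → v ∈ firsts Z₂ ⊎ v ∈ x₀ ∷ [] →
                    ¬ Con (_∉ heads Z) x v
              sep Z₁ {ξ} {x} {s} {Z₂} eq v∈ con = go (rep-rotate Z₁ (subst R eq r)) v∈
                where
                go : R ((ξ , x ∷ s) ∷ Z₂ ++ Z₁) → _ ⊎ _ → ⊥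
                go q (inj₁ v∈) = apart (nolink q) q (here refl) (to q (there (∈-++⁺ʳ (x ∷ s) in-rest)))
                    (λ v∈s → NoDup-disjoint {x ∷ s} (NoDup-tail (nodupᶻ q)) v∈s in-rest) con
                  where in-rest = ∈-resp (sym (flatten-++ Z₂ Z₁)) (∈-++⁺ˡ (firsts⊆ Z₂ v∈))
                go q (inj₂ (here refl)) with confined (nolink q) q (here refl) con
                ... | inj₁ p = x₀∉ (to q (there (∈-++⁺ˡ p)))
                ... | inj₂ (_ , y , w , y∈ , _ , e , c) = no-attachment q y∈ e (con-sym c)
              pairs : AllPairs (λ u v → ¬ Con (_∉ heads Z) u v) reps
              pairs = firsts-pairs (λ u v → ¬ Con (_∉ heads Z) u v) (x₀ ∷ []) Z sep ([] ∷ [])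

        spread : (joint : ∀ {ξ ξ′} → ξ ∈ M → ξ′ ∈ M → ξ ≢ ξ′ → Joint ξ ξ′) → NoDup M →
                 (∀ {v} → v ∈ M → v ∈ L) → 2 ≤ length M → wsum ω M + 2 ≤ length L
        spread joint ndM M⊆L two = decidable-stable (_ ≤? _) λ ¬p →
          spread-⊥ joint ndM M⊆L two ((lin (wsum ω M ∷ []) (L ∷ []) ([]) (((κ 1 ⊕ lng (# 0)) ≼ (at 0 ⊕ κ 2)) ∷ []) (lng (# 0)) ((at 0 ⊕ κ 1)) 0 ((1 , 0) ∷ []) (≰⇒> ¬p , tt))) (proj₂ (some M two))
          where
          some : ∀ (M : List V) → 2 ≤ length M → ∃[ m ] m ∈ M
          some (m ∷ _) _ = m , here refl

    -- Clumps

    module _ (δ : ℕ) (mindeg : ∀ v → δ ≤ deg G v) where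

      path-++-lk : ∀ {a u xs v ys b} → E a u → Path u xs v → Lk v ys b → Lk a (xs ++ ys) b
      path-++-lk e [ u ]   l = e , l
      path-++-lk e (f ∷ p) l = e , path-++-lk f p l

      lk-path-lk : ∀ {a xs u ys v zs b} → Lk a xs u → Path u ys v → Lk v zs b → Lk a (xs ++ ys ++ zs) b
      lk-path-lk {xs = []}     e       p l = path-++-lk e p l
      lk-path-lk {xs = x ∷ xs} (e , k) p l = e , lk-path-lk k p l

      nbr-count : ∀ v xs → (∀ {w} → E v w → w ∈ xs) → v ∈ xs → 1 + δ ≤ length xs
      nbr-count v xs h v∈ = ≤-trans (s≤s (≤-trans (mindeg v) (≤-reflexive (deg-nbrs v))))
        (length-⊆ {v ∷ nbrs v} (NoDup-∷ (λ p → E-irrefl (nbrs⁻ p)) (nbrs-nodup v))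
                  λ { (here refl) → v∈ ; (there p) → h (nbrs⁻ p) })

      -- The closed neighbourhood of `v` has at least 1 + δ members and therefore fills `xs`.
      nbr-full : ∀ v xs → (∀ {w} → E v w → w ∈ xs) → v ∈ xs → length xs ≤ 1 + δ → ∀ {w} → w ∈ xs → w ≢ v → E v w
      nbr-full v xs h v∈ l {w} w∈ w≢v
        with ⊆-reverse {v ∷ nbrs v} (NoDup-∷ (λ p → E-irrefl (nbrs⁻ p)) (nbrs-nodup v))
               (λ { (here refl) → v∈ ; (there p) → h (nbrs⁻ p) })
               (≤-trans l (s≤s (≤-trans (mindeg v) (≤-reflexive (deg-nbrs v))))) w∈
      ... | here eq = contradiction eq w≢v
      ... | there p = nbrs⁻ p

      -- The field `slack` is `spread` with the constant weight 1 + |P| on `N`, any two members of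
      -- which are joined through all of `P`. The equation `count` expresses that every degree in
      -- `P` is as small as possible.
      record Clump (L P N : List V) : Set where
        field
          {p q}   : V
          path    : Path p P q
          ndP     : NoDup P
          offP    : ∀ {v} → v ∈ P → v ∉ L
          ndN     : NoDup N
          N⊆L     : ∀ {v} → v ∈ N → v ∈ L
          N≥2     : 2 ≤ length N
          closed  : ∀ {z v} → z ∈ P → E z v → v ∈ P ⊎ v ∈ N
          clique  : ∀ {z v} → z ∈ P → v ∈ P → v ≢ z → E z v
          join    : ∀ {z v} → z ∈ P → v ∈ N → E z v
          count   : length P + length N ≡ 1 + δ
          slack   : length N * (1 + length P) + 2 ≤ length L

      module _ {L : List V} (cycL : Cyc L) (max : Max (length L)) (small : length L ≤ 2 * δ + 3) where

        -- Maximal paths hanging off the cycle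

        module Hanging (h : V) (h∉ : h ∉ L) where

          record Hang (ys : List V) : Set where
            field
              {y₀ y₁ yᵣ} : V
              y₀∈  : y₀ ∈ L
              edge : E y₀ y₁
              path : Path y₁ ys yᵣ
              nd   : NoDup ys
              off  : ∀ {v} → v ∈ ys → v ∉ L
              con  : Con (_∉ L) h y₁

          Maximal : ℕ → Set
          Maximal q = ∀ {ys} → Hang ys → length ys ≤ q

          some-hang : ¬ ¬ (∃[ ys ] Hang ys)
          some-hang k = connected h (Cyc.source cycL) λ con → from-con (con-path con)
            where
            from-con : ∃[ p ] (Path h p (Cyc.source cycL) × NoDup p × (∀ {x} → x ∈ p → x ∉ [])) → ⊥
            from-con (p , path , nd , _)
              with trim {D = _≡ h} {Z = _∈ L} (_≟ᶠ h) (_∈? L) path nd refl (start∈ (pathᶜ cycL))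
            ... | record { q = [] ; path = () }
            ... | record { q = x ∷ xs ; path = pq ; d∈D = refl ; z∈Z = z∈ ; distinct = ndq ; onlyZ = onlyZ }
              with path-first pq | path-tail pq (λ eq → h∉ (subst (_∈ L) (sym eq) z∈))
            ... | refl | ys , refl , _ with path-cut h ys pq
            ...   | w , pw , e = k (reverse (h ∷ ys) , record
              { y₀∈ = z∈ ; edge = E-sym e ; path = path-reverse pw
              ; nd = (nodup⊆ (ys ∷ []) (h ∷ _ ∷ []) (rev ((• 0 · # 0))) ((• 0 · (# 0 · (• 1 · ε)))) (ndq))
              ; off = λ v∈ → off (reverse⁻ v∈)
              ; con = path-con∈ pw off (end∈ pw) })
              where
              off : ∀ {v} → v ∈ h ∷ ys → v ∉ L
              off v∈ v∈L with onlyZ (∈-++⁺ˡ v∈) v∈L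
              ... | refl = NoDup-disjoint {h ∷ ys} ndq v∈ (here refl)

          hang-bound : ∀ {ys} → Hang ys → length ys ≤ n
          hang-bound H = ≤-trans (length-⊆ (Hang.nd H) (λ {v} _ → ∈-allFin v)) (≤-reflexive (length-tabulate (λ v → v)))

          max-hang : ¬ ¬ (∃[ ys ] (Hang ys × Maximal (length ys)))
          max-hang k = some-hang λ { (ys , H) →
            bounded-max (λ l → ∃[ ys ] (Hang ys × length ys ≡ l)) n (λ { (ys , H , refl) → hang-bound H }) (ys , H , refl)
              λ { (m , (ys , H , refl) , mx) → k (ys , H , λ {zs} K → mx (zs , K , refl)) } }

          module _ {q : ℕ} (maximal : Maximal q) where

            outer-nbr : ∀ {ys} (H : Hang ys) → length ys ≡ q → ∀ {w} → E (Hang.yᵣ H) w → w ∉ L → w ∈ ys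
            outer-nbr {ys} H eq {w} e w∉ with w ∈? ys
            ... | yes p = p
            ... | no ¬p = ⊥-elim (<⇒≱ (≤-reflexive (cong suc (sym eq))) (≤-trans (≤-reflexive ((≤-antisym (lin ([]) (ys ∷ []) (w ∷ []) ([]) ((κ 1 ⊕ lng (# 0))) (lng ((# 0 · (• 0 · ε)))) 0 ([]) (tt)) (lin ([]) (ys ∷ []) (w ∷ []) ([]) (lng ((# 0 · (• 0 · ε)))) ((κ 1 ⊕ lng (# 0))) 0 ([]) (tt))))) (maximal longer)))
              where
              open Hang H
              longer : Hang (ys ++ w ∷ [])
              longer = record { y₀∈ = y₀∈ ; edge = edge ; path = path ⟨ e ⟩ [ w ]
                              ; nd = NoDup-++ nd (NoDup-single w) (λ { r (here refl) → ¬p r })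
                              ; off = λ v∈ → [ off , (λ { (here refl) → w∉ }) ]′ (∈-++⁻ ys v∈) ; con = con }

            -- Otherwise the end of the path sees only y₀ and the path, and a fan from the part of the path
            -- behind its first neighbour leads around at least δ vertices.
            second-end : ∀ {ys} (H : Hang ys) → length ys ≡ q → ¬ ¬ (∃[ b ] (b ∈ L × b ≢ Hang.y₀ H × E (Hang.yᵣ H) b))
            second-end {ys} H len k = connected₂ y₀ yᵣ≢y₀ t≢y₀ λ con → first-step (proj₁ (proj₂ other)) (con-path con)
              where
              open Hang H
              only : ∀ {b} → b ∈ L → E yᵣ b → b ≡ y₀
              only {b} b∈ e with b ≟ᶠ y₀
              ... | yes p = p
              ... | no ¬p = ⊥-elim (k (b , b∈ , ¬p , e))
              yᵣ∉ : yᵣ ∉ L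
              yᵣ∉ = off (end∈ path)
              yᵣ≢y₀ : yᵣ ≢ y₀
              yᵣ≢y₀ eq = yᵣ∉ (subst (_∈ L) (sym eq) y₀∈)
              s≢t : Cyc.source cycL ≢ Cyc.target cycL
              s≢t eq = E⇒≢ (closeᶜ cycL) (sym eq)
              other : ∃[ t ] (t ∈ L × t ≢ y₀)
              other with Cyc.source cycL ≟ᶠ y₀
              ... | no ¬p = Cyc.source cycL , start∈ (pathᶜ cycL) , ¬p
              ... | yes p = Cyc.target cycL , end∈ (pathᶜ cycL) , λ eq → s≢t (trans p (sym eq))
              t≢y₀ = proj₂ (proj₂ other)
              first-step : ∀ {t} → t ∈ L → ∃[ p ] (Path yᵣ p t × NoDup p × (∀ {x} → x ∈ p → x ∉ y₀ ∷ [])) → ⊥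
              first-step t∈ (_ , [ _ ] , _ , _) = yᵣ∉ t∈
              first-step t∈ (_ , (_∷_ {w = w} e p) , _ , avoid) with w ∈? L
              ... | yes w∈ = avoid (there (start∈ p)) (here (only w∈ e))
              -- The fan starts from the part of the path behind the first neighbour `yⱼ` of `yᵣ`,
              -- and the given way to `L` leads from `yⱼ` back to `y₀`.
              ... | no w∉ with first (E? yᵣ) (lose (outer-nbr H len e w∉) e)
              ...   | pre , yⱼ , post , refl , none , e′ =
                fan L (start∈ (pathᶜ cycL)) (end∈ (pathᶜ cycL)) s≢t (yⱼ ∷ post) W ndW (here refl) (there yᵣ∈) yᵣ≢yⱼ y₀∈ onlyD onlyC around
                where
                yᵣ≢yⱼ : yᵣ ≢ yⱼ
                yᵣ≢yⱼ eq = E⇒≢ e′ eq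
                Dpath : Path yⱼ (yⱼ ∷ post) yᵣ
                Dpath = path-suffix pre path
                yᵣ∈ : yᵣ ∈ post
                yᵣ∈ with end∈ Dpath
                ... | here eq = contradiction eq yᵣ≢yⱼ
                ... | there q = q
                W : Path yⱼ (reverse (pre ++ yⱼ ∷ []) ++ y₀ ∷ []) y₀
                W = path-reverse (path-prefix pre path) ⟨ subst (λ y → E y y₀) refl (E-sym edge) ⟩ [ y₀ ]
                ndW : NoDup (reverse (pre ++ yⱼ ∷ []) ++ y₀ ∷ [])
                ndW = NoDup-++ ((nodup⊆ (pre ∷ post ∷ []) (yⱼ ∷ []) (rev ((# 0 · (• 0 · ε)))) ((# 0 · (• 0 · # 1))) (nd))) (NoDup-single y₀)
                        λ { v∈ (here refl) → off (onW v∈) y₀∈ }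
                  where
                  onW : ∀ {v} → v ∈ reverse (pre ++ yⱼ ∷ []) → v ∈ pre ++ yⱼ ∷ post
                  onW v∈ = [ ∈-++⁺ˡ , (λ { (here refl) → ∈-++⁺ʳ pre (here refl) }) ]′ (∈-++⁻ pre (reverse⁻ v∈))
                onlyD : ∀ {x} → x ∈ reverse (pre ++ yⱼ ∷ []) ++ y₀ ∷ [] → x ∈ yⱼ ∷ post → x ≡ yⱼ
                onlyD x∈ x∈D with ∈-++⁻ (reverse (pre ++ yⱼ ∷ [])) x∈
                ... | inj₂ (here refl) = ⊥-elim (off (∈-++⁺ʳ pre x∈D) y₀∈)
                ... | inj₁ r with ∈-++⁻ pre (reverse⁻ r)
                ...   | inj₁ x∈pre = ⊥-elim (NoDup-disjoint {pre} nd x∈pre x∈D)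
                ...   | inj₂ (here eq) = eq
                onlyC : ∀ {x} → x ∈ reverse (pre ++ yⱼ ∷ []) ++ y₀ ∷ [] → x ∈ L → x ≡ y₀
                onlyC x∈ x∈L with ∈-++⁻ (reverse (pre ++ yⱼ ∷ [])) x∈
                ... | inj₂ (here eq) = eq
                ... | inj₁ r = ⊥-elim (off ([ ∈-++⁺ˡ , (λ { (here refl) → ∈-++⁺ʳ pre (here refl) }) ]′ (∈-++⁻ pre (reverse⁻ r))) x∈L)
                around : Fan (yⱼ ∷ post) L yⱼ → ⊥
                around record { T₁ = [] ; path₁ = () }
                around record { T₂ = [] ; path₂ = () }
                around record { d∈D = here refl ; path₁ = p₁ ; path₂ = p₂ ; distinct = nd′ } =
                  NoDup-disjoint nd′ (start∈ p₁) (start∈ p₂)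
                around record { d = d ; t₁ = t₁ ; t₂ = t₂ ; T₁ = x ∷ T₁ ; T₂ = x′ ∷ T₂ ; path₁ = p₁ ; path₂ = p₂ ; d∈D = there d∈
                              ; t₁∈C = t₁∈ ; t₂∈C = t₂∈ ; distinct = nd′ ; onlyC₁ = oC₁ ; onlyC₂ = oC₂ ; onlyD₁ = oD₁ ; onlyD₂ = oD₂ }
                  with path-first p₁ | path-first p₂ | ∈-∃++ d∈
                ... | refl | refl | m , m′ , refl
                  with path-tail p₁ (λ eq → off (∈-++⁺ʳ pre (here refl)) (subst (_∈ L) (sym eq) t₁∈))
                     | path-tail p₂ (λ eq → off (∈-++⁺ʳ pre (there d∈)) (subst (_∈ L) (sym eq) t₂∈))
                     | last (E? yᵣ) {yⱼ ∷ m} (here e′)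
                ... | τ₁ , refl , l₁ | τ₂ , refl , l₂ | D₁ , u , g , eqD , noneg , eu = finish
                  where
                  Dsplit : pre ++ (yⱼ ∷ m) ++ d ∷ m′ ≡ pre ++ (D₁ ++ u ∷ g) ++ d ∷ m′
                  Dsplit = cong (λ z → pre ++ z ++ d ∷ m′) eqD
                  nds : NoDup (pre ++ (D₁ ++ u ∷ g) ++ d ∷ m′)
                  nds = subst NoDup Dsplit nd
                  Dp : Path yⱼ (D₁ ++ u ∷ g ++ d ∷ m′) yᵣ
                  Dp = subst (λ l → Path yⱼ l yᵣ) (trans (cong (_++ d ∷ m′) eqD) (++-assoc D₁ (u ∷ g) _)) Dpath
                  -- Here `u` is the last neighbour of `yᵣ` before `d`. Going from `yⱼ` to `u`,
                  -- across to `yᵣ` and back to `d` skips only `g`, which holds no neighbour of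
                  -- `yᵣ`. So `R` contains `yᵣ` and all its neighbours except `y₀`.
                  R = (D₁ ++ u ∷ []) ++ reverse (d ∷ m′)
                  mid : Path yⱼ R d
                  mid = path-prefix D₁ Dp ⟨ E-sym eu ⟩ path-reverse (path-suffix (yⱼ ∷ m) Dpath)
                  R⊆D : ∀ {v} → v ∈ R → v ∈ (yⱼ ∷ m) ++ d ∷ m′
                  R⊆D v∈ = ∈-resp (cong (_++ d ∷ m′) (sym eqD)) ([ (λ p → ∈-++⁺ˡ ([ ∈-++⁺ˡ , (λ { (here refl) → ∈-++⁺ʳ D₁ (here refl) }) ]′ (∈-++⁻ D₁ p)))
                             , (λ p → ∈-++⁺ʳ (D₁ ++ u ∷ g) (reverse⁻ p)) ]′ (∈-++⁻ (D₁ ++ u ∷ []) v∈))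
                  Q = reverse τ₁ ++ R ++ τ₂
                  lkQ : Lk t₁ Q t₂
                  lkQ = lk-path-lk (lk-reverse τ₁ l₁) mid l₂
                  big : 1 + δ ≤ 1 + length R
                  big = ≤-trans (nbr-count yᵣ (y₀ ∷ R) inR (there (∈-++⁺ʳ (D₁ ++ u ∷ []) (reverse⁺ (end∈ (path-suffix (yⱼ ∷ m) Dpath)))))) ≤-refl
                    where
                    inR : ∀ {w} → E yᵣ w → w ∈ y₀ ∷ R
                    inR {w} ew with w ∈? L
                    ... | yes w∈ = here (only w∈ ew)
                    ... | no w∉′ with ∈-++⁻ pre (∈-resp Dsplit (outer-nbr H len ew w∉′))
                    ...   | inj₁ p = ⊥-elim (All.lookup none p ew)
                    ...   | inj₂ p with ∈-++⁻ (D₁ ++ u ∷ g) p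
                    ...     | inj₂ r = there (∈-++⁺ʳ (D₁ ++ u ∷ []) (reverse⁺ r))
                    ...     | inj₁ r with ∈-++⁻ D₁ r
                    ...       | inj₁ r′ = there (∈-++⁺ˡ (∈-++⁺ˡ r′))
                    ...       | inj₂ (here refl) = there (∈-++⁺ˡ (∈-++⁺ʳ D₁ (here refl)))
                    ...       | inj₂ (there r′) = ⊥-elim (All.lookup noneg r′ ew)
                  ndR : NoDup R
                  ndR = (nodup⊆ (pre ∷ D₁ ∷ g ∷ m′ ∷ []) (u ∷ d ∷ []) (((# 1 · (• 0 · ε)) · rev ((• 1 · # 3)))) ((# 0 · ((# 1 · (• 0 · # 2)) · (• 1 · # 3)))) (nds))
                  ndτ : NoDup (reverse τ₁ ++ τ₂)
                  ndτ = (nodup⊆ (τ₁ ∷ τ₂ ∷ []) (yⱼ ∷ t₁ ∷ d ∷ t₂ ∷ []) ((rev (# 0) · # 1)) (((• 0 · (# 0 · (• 1 · ε))) · (• 2 · (# 1 · (• 3 · ε))))) (nd′))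
                  offτ₁ : ∀ {v} → v ∈ τ₁ → v ∉ (yⱼ ∷ m) ++ d ∷ m′
                  offτ₁ v∈ v∈D with oD₁ (there (∈-++⁺ˡ v∈)) v∈D
                  ... | refl = NoDup-head (NoDup-++ˡ (yⱼ ∷ τ₁ ++ t₁ ∷ []) nd′) (∈-++⁺ˡ v∈)
                  offτ₂ : ∀ {v} → v ∈ τ₂ → v ∉ (yⱼ ∷ m) ++ d ∷ m′
                  offτ₂ v∈ v∈D with oD₂ (there (∈-++⁺ˡ v∈)) v∈D
                  ... | refl = NoDup-head (NoDup-++ʳ (yⱼ ∷ τ₁ ++ t₁ ∷ []) nd′) (∈-++⁺ˡ v∈)
                  t₁∉τ : ∀ {v} → v ∈ τ₁ → v ∉ L
                  t₁∉τ v∈ v∈L with oC₁ (there (∈-++⁺ˡ v∈)) v∈L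
                  ... | refl = NoDup-disjoint {τ₁} {t₁ ∷ []} ((nodup⊆ (τ₁ ∷ τ₂ ∷ []) (yⱼ ∷ t₁ ∷ d ∷ t₂ ∷ []) ((# 0 · (• 1 · ε))) (((• 0 · (# 0 · (• 1 · ε))) · (• 2 · (# 1 · (• 3 · ε))))) (nd′))) v∈ (here refl)
                  t₂∉τ : ∀ {v} → v ∈ τ₂ → v ∉ L
                  t₂∉τ v∈ v∈L with oC₂ (there (∈-++⁺ˡ v∈)) v∈L
                  ... | refl = NoDup-disjoint {τ₂} {t₂ ∷ []} ((nodup⊆ (τ₁ ∷ τ₂ ∷ []) (yⱼ ∷ t₁ ∷ d ∷ t₂ ∷ []) ((# 1 · (• 3 · ε))) (((• 0 · (# 0 · (• 1 · ε))) · (• 2 · (# 1 · (• 3 · ε))))) (nd′))) v∈ (here refl)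
                  t₁≢t₂ : t₁ ≢ t₂
                  t₁≢t₂ refl = NoDup-disjoint {yⱼ ∷ τ₁ ++ t₁ ∷ []} nd′ (there (∈-++⁺ʳ τ₁ (here refl))) (there (∈-++⁺ʳ τ₂ (here refl)))
                  ndQ : NoDup Q
                  ndQ = (nodup⊆ (R ∷ τ₁ ∷ τ₂ ∷ []) ([]) ((rev (# 1) · (# 0 · # 2))) ((# 0 · (rev (# 1) · # 2))) (NoDup-++ ndR ndτ (λ p r → [ (λ s → offτ₁ (reverse⁻ s) (R⊆D p)) , (λ s → offτ₂ s (R⊆D p)) ]′ (∈-++⁻ (reverse τ₁) r))))
                  offQ : ∀ {v} → v ∈ Q → v ∉ L
                  offQ v∈ = [ (λ s → t₁∉τ (reverse⁻ s)) , (λ s → [ (λ r → off (∈-++⁺ʳ pre (R⊆D r))) , t₂∉τ ]′ (∈-++⁻ R s)) ]′ (∈-++⁻ (reverse τ₁) v∈)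
                  -- As |R| ≥ δ, weight 1 + δ may be put on each of `t₁` and `t₂`. Then `spread`
                  -- demands 2δ + 4 ≤ |L|.
                  ω : V → ℕ
                  ω _ = 1 + δ
                  heavy : (1 + δ) + (1 + δ) ≤ 2 * (1 + length Q)
                  heavy = (lin (δ ∷ []) (R ∷ τ₁ ∷ τ₂ ∷ []) ([]) (((κ 1 ⊕ at 0) ≼ (κ 1 ⊕ lng (# 0))) ∷ []) (((κ 1 ⊕ at 0) ⊕ (κ 1 ⊕ at 0))) (2 ⊗ ((κ 1 ⊕ lng ((rev (# 1) · (# 0 · # 2)))))) 0 ((2 , 0) ∷ []) (big , tt))
                  Q≥1 : 1 ≤ length Q
                  Q≥1 = (lin ([]) (R ∷ τ₁ ∷ τ₂ ∷ []) ([]) ((κ 1 ≼ lng (# 0)) ∷ []) (κ 1) (lng ((rev (# 1) · (# 0 · # 2)))) 0 ((1 , 0) ∷ []) (path-nonempty mid , tt))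
                  lk-inner′ : ∀ {u v} xs → 1 ≤ length xs → Lk u xs v → ∃[ p ] ∃[ q ] (E u p × Path p xs q × E q v)
                  lk-inner′ (x ∷ xs) _ l = x , lk-inner l
                  finish : ⊥
                  finish with lk-inner′ Q Q≥1 lkQ
                  ... | p , q , ep , pQ , eq = (1≰0 (lin (δ ∷ []) (L ∷ []) ([]) ((lng (# 0) ≼ (2 ⊗ (at 0) ⊕ κ 3)) ∷ ((((κ 1 ⊕ at 0) ⊕ ((κ 1 ⊕ at 0) ⊕ κ 0)) ⊕ κ 2) ≼ lng (# 0)) ∷ []) (κ 1) (κ 0) 0 ((1 , 0) ∷ (1 , 0) ∷ []) (small , spread joint (NoDup-∷ (λ { (here x) → t₁≢t₂ x }) (NoDup-single t₂))
                          (λ { (here refl) → t₁∈ ; (there (here refl)) → t₂∈ }) (s≤s (s≤s z≤n)) , tt)))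
                    where
                    open Joints cycL max (t₁ ∷ t₂ ∷ []) ω p (offQ (start∈ pQ))
                    joint : ∀ {ξ ξ′} → ξ ∈ t₁ ∷ t₂ ∷ [] → ξ′ ∈ t₁ ∷ t₂ ∷ [] → ξ ≢ ξ′ → Joint ξ ξ′
                    joint (here refl) (here refl) ne = contradiction refl ne
                    joint (here refl) (there (here refl)) ne = record
                      { Q = Q ; path = pQ ; left = ep ; right = eq ; nd = ndQ ; off = offQ ; reach = stop (offQ (start∈ pQ)) ; weight = heavy }
                    joint (there (here refl)) (here refl) ne = record
                      { Q = reverse Q ; path = path-reverse pQ ; left = E-sym eq ; right = E-sym ep
                      ; nd = (nodup⊆ (Q ∷ []) ([]) (rev (# 0)) (# 0) (ndQ)) ; off = λ v∈ → offQ (reverse⁻ v∈)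
                      ; reach = path-con pQ offQ
                      ; weight = subst (λ l → (1 + δ) + (1 + δ) ≤ 2 * (1 + l)) (sym (length-reverse Q)) heavy }
                    joint (there (here refl)) (there (here refl)) ne = contradiction refl ne

            back : ∀ {ys} (H : Hang ys) {b} → b ∈ L → E (Hang.yᵣ H) b → Hang (reverse ys)
            back {ys} H b∈ e = record
              { y₀∈ = b∈ ; edge = E-sym e ; path = path-reverse path ; nd = (nodup⊆ (ys ∷ []) ([]) (rev (# 0)) (# 0) (nd))
              ; off = λ v∈ → off (reverse⁻ v∈) ; con = con-trans con (path-con path off) }
              where open Hang H

            record End {ys : List V} (H : Hang ys) : Set where
              open Hang H
              field
                same   : ∀ {d} → d ∈ L → E y₁ d → E yᵣ d
                same⁻  : ∀ {d} → d ∈ L → E yᵣ d → E y₁ d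
                inner  : ∀ {w} → E yᵣ w → w ∉ L → w ∈ ys
                full   : ∀ {w} → w ∈ ys → w ≢ yᵣ → E yᵣ w
                N≥2    : 2 ≤ length (filter (E? y₁) L)
                count  : length ys + length (filter (E? y₁) L) ≡ 1 + δ
                slack  : length (filter (E? y₁) L) * (1 + length ys) + 2 ≤ length L

            module _ {ys : List V} (H : Hang ys) (len : length ys ≡ q) {b : V} (b∈ : b ∈ L) (yᵣb : E (Hang.yᵣ H) b) where
              open Hang H

              private
                N : List V
                N = filter (E? y₁) L

                inner₁ : ∀ {w} → E y₁ w → w ∉ L → w ∈ ys
                inner₁ e w∉ = reverse⁻ (outer-nbr (back H b∈ yᵣb) (trans (length-reverse ys) len) e w∉)

                nbr-in : ∀ {w} → E y₁ w → w ∈ ys ++ N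
                nbr-in {w} e with w ∈? L
                ... | yes w∈ = ∈-++⁺ʳ ys (∈-filter⁺ (E? y₁) w∈ e)
                ... | no w∉  = ∈-++⁺ˡ (inner₁ e w∉)

                N-large : 1 + δ ≤ length ys + length N
                N-large = ≤-trans (nbr-count y₁ (ys ++ N) nbr-in (∈-++⁺ˡ (start∈ path))) (≤-reflexive (length-++ ys))

                ndN : NoDup N
                ndN = NoDup-filter (E? y₁) (nodupᶜ cycL)

                N⁻ : ∀ {v} → v ∈ N → v ∈ L × E y₁ v
                N⁻ v∈ = ∈-filter⁻ (E? y₁) v∈

                off₁ : y₁ ∉ L
                off₁ = off (start∈ path)

              -- Weight 2 on N(y₁) and 2q on d: two members of N(y₁) are joined through y₁, a member and d
              -- through the whole path.
              no-private-nbr : ∀ {d} → d ∈ L → E yᵣ d → ¬ E y₁ d → ⊥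
              no-private-nbr {d} d∈ yᵣd ¬y₁d =
                (1≰0 (lin (ω d ∷ wsum ω N ∷ δ ∷ []) (L ∷ ys ∷ N ∷ []) ([]) ((((at 0 ⊕ at 1) ⊕ κ 2) ≼ lng (# 0)) ∷ (at 0 ≋ 2 ⊗ (lng (# 1))) ∷ (at 1 ≋ 2 ⊗ (lng (# 2))) ∷ ((κ 1 ⊕ at 2) ≼ (lng (# 1) ⊕ lng (# 2))) ∷ (lng (# 0) ≼ (2 ⊗ (at 2) ⊕ κ 3)) ∷ []) (κ 1) (κ 0) 0 ((1 , 0) ∷ (0 , 1) ∷ (0 , 1) ∷ (2 , 0) ∷ (1 , 0) ∷ []) (spread joint (NoDup-∷ d∉N ndN) (λ { (here refl) → d∈ ; (there v∈) → proj₁ (N⁻ v∈) }) two , ω-d , ωN , N-large , small , tt)))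
                where
                d∉N : d ∉ N
                d∉N p = ¬y₁d (proj₂ (N⁻ p))
                ω : V → ℕ
                ω v with v ≟ᶠ d
                ... | yes _ = 2 * length ys
                ... | no  _ = 2
                ω-d : ω d ≡ 2 * length ys
                ω-d with d ≟ᶠ d
                ... | yes _ = refl
                ... | no ¬p = contradiction refl ¬p
                ω-≢ : ∀ {v} → v ≢ d → ω v ≡ 2
                ω-≢ {v} v≢d with v ≟ᶠ d
                ... | yes p = contradiction p v≢d
                ... | no  _ = refl
                N≢d : ∀ {v} → v ∈ N → v ≢ d
                N≢d v∈ refl = d∉N v∈
                ωN : wsum ω N ≡ 2 * length N
                ωN = trans (wsum-const 2 N (λ v∈ → ω-≢ (N≢d v∈))) (*-comm (length N) 2)
                two : 2 ≤ length (d ∷ N)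
                two = length-⊆ {d ∷ y₀ ∷ []} (NoDup-∷ (λ { (here refl) → ¬y₁d (E-sym edge) }) (NoDup-single y₀))
                        (λ { (here refl) → here refl ; (there (here refl)) → there (∈-filter⁺ (E? y₁) y₀∈ (E-sym edge)) })
                open Joints cycL max (d ∷ N) ω y₁ off₁
                joint : ∀ {ξ ξ′} → ξ ∈ d ∷ N → ξ′ ∈ d ∷ N → ξ ≢ ξ′ → Joint ξ ξ′
                joint (here refl) (here refl) ne = contradiction refl ne
                joint {ξ} {ξ′} (there ξ∈) (there ξ′∈) ne = record
                  { Q = y₁ ∷ [] ; path = [ y₁ ] ; left = E-sym (proj₂ (N⁻ ξ∈)) ; right = proj₂ (N⁻ ξ′∈)
                  ; nd = NoDup-single y₁ ; off = λ { (here refl) → off₁ } ; reach = stop off₁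
                  ; weight = (lin {A = ⊤} (ω ξ ∷ ω ξ′ ∷ []) ([]) ([]) ((at 0 ≋ κ 2) ∷ (at 1 ≋ κ 2) ∷ []) ((at 0 ⊕ at 1)) (2 ⊗ ((κ 1 ⊕ κ 1))) 0 ((1 , 0) ∷ (1 , 0) ∷ []) (ω-≢ (N≢d ξ∈) , ω-≢ (N≢d ξ′∈) , tt)) }
                joint {ξ} (there ξ∈) (here refl) ne = record
                  { Q = ys ; path = path ; left = E-sym (proj₂ (N⁻ ξ∈)) ; right = yᵣd ; nd = nd ; off = off ; reach = stop off₁
                  ; weight = (lin (ω ξ ∷ ω d ∷ []) (ys ∷ []) ([]) ((at 0 ≋ κ 2) ∷ (at 1 ≋ 2 ⊗ (lng (# 0))) ∷ []) ((at 0 ⊕ at 1)) (2 ⊗ ((κ 1 ⊕ lng (# 0)))) 0 ((1 , 0) ∷ (1 , 0) ∷ []) (ω-≢ (N≢d ξ∈) , ω-d , tt)) }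
                joint {ξ′ = ξ′} (here refl) (there ξ′∈) ne = record
                  { Q = reverse ys ; path = path-reverse path ; left = E-sym yᵣd ; right = proj₂ (N⁻ ξ′∈)
                  ; nd = (nodup⊆ (ys ∷ []) ([]) (rev (# 0)) (# 0) (nd)) ; off = λ v∈ → off (reverse⁻ v∈) ; reach = path-con path off
                  ; weight = (lin (ω ξ′ ∷ ω d ∷ []) (ys ∷ []) ([]) ((at 0 ≋ κ 2) ∷ (at 1 ≋ 2 ⊗ (lng (# 0))) ∷ []) ((at 1 ⊕ at 0)) (2 ⊗ ((κ 1 ⊕ lng (rev (# 0))))) 0 ((1 , 0) ∷ (1 , 0) ∷ []) (ω-≢ (N≢d ξ′∈) , ω-d , tt)) }

            private
              -- From s (1 + p) = 2 (p + s) - 2 + (s - 2)(p - 1) follows 2 (p + s) ≤ l ≤ 2δ + 3, and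
              -- parity does the rest.
              deficit : ∀ p s δ l → 2 ≤ s → 1 ≤ p → 1 + δ ≤ p + s → s * (1 + p) + 2 ≤ l → l ≤ 2 * δ + 3 → p + s ≤ 1 + δ
              deficit (suc p) (suc (suc s)) δ l (s≤s (s≤s z≤n)) (s≤s z≤n) lower slack upper =
                (lin {A = ⊤} ((suc (suc s) * (1 + suc p)) ∷ p ∷ s ∷ (s * p) ∷ l ∷ δ ∷ []) ([]) ([]) ((at 0 ≋ (((κ 4 ⊕ 2 ⊗ (at 1)) ⊕ 2 ⊗ (at 2)) ⊕ at 3)) ∷ ((at 0 ⊕ κ 2) ≼ at 4) ∷ (at 4 ≼ (2 ⊗ (at 5) ⊕ κ 3)) ∷ []) (((κ 1 ⊕ at 1) ⊕ (κ 1 ⊕ (κ 1 ⊕ at 2)))) ((κ 1 ⊕ at 5)) 1 ((0 , 1) ∷ (1 , 0) ∷ (1 , 0) ∷ []) (product s p , slack , upper , tt))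
                where
                product : ∀ s p → suc (suc s) * (1 + suc p) ≡ 4 + 2 * p + 2 * s + s * p
                product = solve-∀

            -- By `no-private-nbr`, applied to the path and to its reversal, both ends see the same
            -- vertices of `L`. The whole path then joins any two of these, and the count becomes so
            -- tight that `yᵣ` must be adjacent to everything it may be adjacent to.
            end : ∀ {ys} (H : Hang ys) → length ys ≡ q → ¬ ¬ End H
            end {ys} H len k = second-end H len λ { (b , b∈ , b≢y₀ , yᵣb) → assemble b∈ b≢y₀ yᵣb }
              where
              open Hang H
              assemble : ∀ {b} → b ∈ L → b ≢ y₀ → E yᵣ b → ⊥
              assemble {b} b∈ b≢y₀ yᵣb = k record
                { same = same ; same⁻ = same⁻ ; inner = inner
                ; full = λ w∈ w≢ → nbr-full yᵣ (ys ++ N) nbr-in (∈-++⁺ˡ (end∈ path)) (≤-trans (≤-reflexive (length-++ ys)) upper) (∈-++⁺ˡ w∈) w≢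
                ; N≥2 = two ; count = ≤-antisym upper lower ; slack = slack }
                where
                N = filter (E? y₁) L
                inner : ∀ {w} → E yᵣ w → w ∉ L → w ∈ ys
                inner = outer-nbr H len
                same⁻ : ∀ {d} → d ∈ L → E yᵣ d → E y₁ d
                same⁻ {d} d∈ e with E? y₁ d
                ... | yes p = p
                ... | no ¬p = ⊥-elim (no-private-nbr H len b∈ yᵣb d∈ e ¬p)
                same : ∀ {d} → d ∈ L → E y₁ d → E yᵣ d
                same {d} d∈ e with E? yᵣ d
                ... | yes p = p
                ... | no ¬p = ⊥-elim (no-private-nbr (back H b∈ yᵣb) (trans (length-reverse ys) len) y₀∈ (E-sym edge) d∈ e ¬p)
                N⁻ : ∀ {v} → v ∈ N → v ∈ L × E y₁ v
                N⁻ v∈ = ∈-filter⁻ (E? y₁) v∈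
                nbr-in : ∀ {w} → E yᵣ w → w ∈ ys ++ N
                nbr-in {w} e with w ∈? L
                ... | yes w∈ = ∈-++⁺ʳ ys (∈-filter⁺ (E? y₁) w∈ (same⁻ w∈ e))
                ... | no w∉  = ∈-++⁺ˡ (inner e w∉)
                lower : 1 + δ ≤ length ys + length N
                lower = ≤-trans (nbr-count yᵣ (ys ++ N) nbr-in (∈-++⁺ˡ (end∈ path))) (≤-reflexive (length-++ ys))
                two : 2 ≤ length N
                two = length-⊆ {y₀ ∷ b ∷ []} (NoDup-∷ (λ { (here eq) → b≢y₀ (sym eq) }) (NoDup-single b))
                        λ { (here refl) → ∈-filter⁺ (E? y₁) y₀∈ (E-sym edge)
                          ; (there (here refl)) → ∈-filter⁺ (E? y₁) b∈ (same⁻ b∈ yᵣb) }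
                open Joints cycL max N (λ _ → 1 + length ys) y₁ (off (start∈ path))
                joint : ∀ {ξ ξ′} → ξ ∈ N → ξ′ ∈ N → ξ ≢ ξ′ → Joint ξ ξ′
                joint ξ∈ ξ′∈ _ = record
                  { Q = ys ; path = path ; left = E-sym (proj₂ (N⁻ ξ∈)) ; right = same (proj₁ (N⁻ ξ′∈)) (proj₂ (N⁻ ξ′∈))
                  ; nd = nd ; off = off ; reach = stop (off (start∈ path))
                  ; weight = (lin ([]) (ys ∷ []) ([]) ([]) (((κ 1 ⊕ lng (# 0)) ⊕ (κ 1 ⊕ lng (# 0)))) (2 ⊗ ((κ 1 ⊕ lng (# 0)))) 0 ([]) (tt)) }
                slack : length N * (1 + length ys) + 2 ≤ length L
                slack = subst (λ l → l + 2 ≤ length L) (wsum-const (1 + length ys) N (λ _ → refl))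
                          (spread joint (NoDup-filter (E? y₁) (nodupᶜ cycL)) (λ v∈ → proj₁ (N⁻ v∈)) two)
                upper : length ys + length N ≤ 1 + δ
                upper = deficit (length ys) (length N) δ (length L) two (path-nonempty path) lower slack small

          module Assemble {P : List V} (H : Hang P) (maximal : Maximal (length P)) where
            open Hang H

            private
              N = filter (E? y₁) L

              N⁻ : ∀ {v} → v ∈ N → v ∈ L × E y₁ v
              N⁻ v∈ = ∈-filter⁻ (E? y₁) v∈

            -- What the ends of maximal hanging paths on P know; every vertex of P becomes such an end.
            record Fact (z : V) : Set where
              field
                out  : ∀ {w} → E z w → w ∈ P ⊎ w ∈ N
                all  : ∀ {w} → w ∈ P → w ≢ z → E z w
                join : ∀ {w} → w ∈ N → E z w

            fact : End maximal H → ∀ z → ¬ ¬ (z ∈ P → Fact z)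
            fact En z k with z ∈? P
            ... | no z∉ = k λ z∈ → contradiction z∈ z∉
            ... | yes z∈ with ∈-∃++ z∈
            ...   | a ∷ as , bs , refl = split (path-cut a as path)
              where
              -- A rotation of the path: the predecessor `w` of `z` is adjacent to `yᵣ`, so the part
              -- from `z` on can be turned round. The result is again maximal, on the same vertices,
              -- and ends in `z`.
              split : ∃[ w ] (Path y₁ (a ∷ as) w × E w z) → ⊥
              split (w , pw , wz) = end maximal K len (λ En′ → k λ _ → record
                { out = λ {v} e → out En′ e
                ; all = λ v∈ v≢ → End.full En′ (perm v∈) v≢
                ; join = λ v∈ → End.same En′ (proj₁ (N⁻ v∈)) (proj₂ (N⁻ v∈)) })
                where
                w∈ : w ∈ (a ∷ as) ++ z ∷ bs
                w∈ = ∈-++⁺ˡ (end∈ pw)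
                yᵣ∈ : yᵣ ∈ z ∷ bs
                yᵣ∈ = end∈ (path-suffix (a ∷ as) path)
                w≢yᵣ : w ≢ yᵣ
                w≢yᵣ refl = NoDup-disjoint {a ∷ as} nd (end∈ pw) yᵣ∈
                K : Hang ((a ∷ as) ++ reverse (z ∷ bs))
                K = record { y₀∈ = y₀∈ ; edge = edge
                           ; path = pw ⟨ E-sym (End.full En w∈ w≢yᵣ) ⟩ path-reverse (path-suffix (a ∷ as) path)
                           ; nd = (nodup⊆ (as ∷ bs ∷ []) (a ∷ z ∷ []) (((• 0 · # 0) · rev ((• 1 · # 1)))) (((• 0 · # 0) · (• 1 · # 1))) (nd))
                           ; off = λ v∈ → off (perm⁻ v∈) ; con = con }
                  where
                  perm⁻ : ∀ {v} → v ∈ (a ∷ as) ++ reverse (z ∷ bs) → v ∈ (a ∷ as) ++ z ∷ bs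
                  perm⁻ v∈ = [ ∈-++⁺ˡ , (λ p → ∈-++⁺ʳ (a ∷ as) (reverse⁻ p)) ]′ (∈-++⁻ (a ∷ as) v∈)
                perm⁻ : ∀ {v} → v ∈ (a ∷ as) ++ reverse (z ∷ bs) → v ∈ (a ∷ as) ++ z ∷ bs
                perm⁻ v∈ = [ ∈-++⁺ˡ , (λ p → ∈-++⁺ʳ (a ∷ as) (reverse⁻ p)) ]′ (∈-++⁻ (a ∷ as) v∈)
                perm : ∀ {v} → v ∈ (a ∷ as) ++ z ∷ bs → v ∈ (a ∷ as) ++ reverse (z ∷ bs)
                perm v∈ = [ ∈-++⁺ˡ , (λ p → ∈-++⁺ʳ (a ∷ as) (reverse⁺ p)) ]′ (∈-++⁻ (a ∷ as) v∈)
                len : length ((a ∷ as) ++ reverse (z ∷ bs)) ≡ length ((a ∷ as) ++ z ∷ bs)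
                len = (≤-antisym (lin ([]) (as ∷ bs ∷ []) (a ∷ z ∷ []) ([]) (lng (((• 0 · # 0) · rev ((• 1 · # 1))))) (lng (((• 0 · # 0) · (• 1 · # 1)))) 0 ([]) (tt)) (lin ([]) (as ∷ bs ∷ []) (a ∷ z ∷ []) ([]) (lng (((• 0 · # 0) · (• 1 · # 1)))) (lng (((• 0 · # 0) · rev ((• 1 · # 1))))) 0 ([]) (tt)))
                out : End maximal K → ∀ {v} → E z v → v ∈ (a ∷ as) ++ z ∷ bs ⊎ v ∈ N
                out En′ {v} e with v ∈? L
                ... | yes v∈ = inj₂ (∈-filter⁺ (E? y₁) v∈ (End.same⁻ En′ v∈ e))
                ... | no v∉  = inj₁ (perm⁻ (End.inner En′ e v∉))
            ...   | [] , bs , refl with path-first path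
            -- The first vertex becomes the end when the whole path is reversed; `second-end`
            -- provides the vertex of `L` from which the reversed path hangs.
            ...     | refl = second-end maximal H refl λ { (b , b∈ , _ , yᵣb) → first-vertex b∈ yᵣb }
              where
              first-vertex : ∀ {b} → b ∈ L → E yᵣ b → ⊥
              first-vertex b∈ yᵣb = end maximal K (length-reverse (z ∷ bs)) (λ En′ → k λ _ → record
                { out = λ {v} e → out En′ e
                ; all = λ v∈ v≢ → End.full En′ (reverse⁺ v∈) v≢
                ; join = λ v∈ → proj₂ (N⁻ v∈) })
                where
                K : Hang (reverse (z ∷ bs))
                K = back maximal H b∈ yᵣb
                out : End maximal K → ∀ {v} → E z v → v ∈ z ∷ bs ⊎ v ∈ N
                out En′ {v} e with v ∈? L
                ... | yes v∈ = inj₂ (∈-filter⁺ (E? z) v∈ e)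
                ... | no v∉  = inj₁ (reverse⁻ (End.inner En′ e v∉))

            clump : End maximal H → (∀ z → z ∈ P → Fact z) → Clump L P N
            clump En f = record
              { path = path ; ndP = nd ; offP = off ; ndN = NoDup-filter (E? y₁) (nodupᶜ cycL) ; N⊆L = λ v∈ → proj₁ (N⁻ v∈)
              ; N≥2 = End.N≥2 En ; closed = λ z∈ e → Fact.out (f _ z∈) e ; clique = λ z∈ v∈ ne → Fact.all (f _ z∈) v∈ ne
              ; join = λ z∈ v∈ → Fact.join (f _ z∈) v∈ ; count = End.count En ; slack = End.slack En }

        -- The path is chosen maximal among those in the component of `h`. Since a clump is closed
        -- outside `L`, the vertex `h` itself lies in it.
        classify : ∀ {h} → h ∉ L → ¬ ¬ (∃[ P ] ∃[ N ] (Clump L P N × h ∈ P))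
        classify {h} h∉ k = max-hang λ { (P , H , mx) →
          end mx H refl λ En →
          ∀¬¬⇒¬¬∀ (Assemble.fact H mx En) λ f →
          let C = Assemble.clump H mx En f in
          k (P , _ , C , stays C (con-sym (Hang.con H)) (start∈ (Hang.path H))) }
          where
          open Hanging h h∉
          stays : ∀ {P N u v} → Clump L P N → Con (_∉ L) u v → u ∈ P → v ∈ P
          stays C con u∈ = con-closed (λ _ w∉ v∈ e → [ (λ p → p) , (λ p → contradiction (Clump.N⊆L C p) w∉) ]′ (Clump.closed C v∈ e)) u∈ con

      -- Clumps relative to any cycle of the maximal length

      module Chords {c : ℕ} (max : Max c) (small : c ≤ 2 * δ + 3) where

        open Exchange max

        -- Only the length is fixed here, because exchanges replace the cycle and clumps of the new
        -- cycle are then needed.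
        classified : ∀ {L h} → Cyc L → length L ≡ c → h ∉ L → ¬ ¬ (∃[ P ] ∃[ N ] (Clump L P N × h ∈ P))
        classified cy refl h∉ = classify cy max small h∉

        module C = Clump

        C-lk : ∀ {L P N ξ ξ′} → Clump L P N → ξ ∈ N → ξ′ ∈ N → Lk ξ P ξ′
        C-lk C ξ∈ ξ′∈ = inner-lk (E-sym (C.join C (start∈ (C.path C)) ξ∈)) (C.path C) (C.join C (end∈ (C.path C)) ξ′∈)

        C-nonempty : ∀ {L P N} → Clump L P N → 1 ≤ length P
        C-nonempty C = path-nonempty (C.path C)

        -- A clump is a union of components of G ∖ L: a walk outside L stays in it.
        C-stays : ∀ {L P N u v} → Clump L P N → Con (_∉ L) u v → u ∈ P → v ∈ P
        C-stays C con u∈ = con-closed (λ _ w∉ v∈ e → [ (λ p → p) , (λ p → contradiction (C.N⊆L C p) w∉) ]′ (C.closed C v∈ e)) u∈ con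

        C-nbr : ∀ {L P N z v} → Clump L P N → z ∈ P → E z v → v ∈ L → v ∈ N
        C-nbr C z∈ e v∈ = [ (λ p → contradiction v∈ (C.offP C p)) , (λ p → p) ]′ (C.closed C z∈ e)

        closed-apart : ∀ {S B u v} → (∀ {z w} → z ∈ B → E z w → w ∈ B ⊎ w ∈ S) → u ∈ B → v ∉ B → ¬ Con (_∉ S) u v
        closed-apart h u∈ v∉ con =
          v∉ (con-closed {K = _∈ _} (λ _ w∉ z∈ e → [ (λ p → p) , (λ p → contradiction p w∉) ]′ (h z∈ e)) u∈ con)

        far : ∀ {L P N a A b} → Clump L P N → Path a A b → NoDup A → (∀ {v} → v ∈ A → v ∈ L) → a ≢ b → a ∈ N → b ∈ N →
              length A + length P ≤ c
        far C pA nd sub a≢b a∈ b∈ = basic pA (C.path C) (E-sym (C.join C (start∈ (C.path C)) b∈))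
          (C.join C (end∈ (C.path C)) a∈) a≢b (NoDup-++ nd (C.ndP C) (λ p q → C.offP C q (sub p)))

        -- A vertex v freed by rerouting L into L′ is a clump on its own: an outside neighbour of v would see
        -- the two consecutive vertices v and z of L.
        lone : ∀ {L L′ v z A} → Cyc L → length L ≡ c → Cyc L′ → length L′ ≡ c → v ∉ L′ →
               (∀ {w} → w ∈ L → w ≢ v → w ∈ L′) → z ∈ L′ → E v z →
               Path z A v → NoDup A → (∀ {w} → w ∈ A → w ∈ L) → length A ≡ c →
               ¬ ¬ (∃[ N* ] Clump L′ (v ∷ []) N*)
        lone {L} {L′} {v} {z} {A} cy len cy′ len′ v∉ rest z∈′ e pA ndA A⊆ lenA k =
          classified cy′ len′ v∉ λ { (P* , N* , C* , v∈) → alone C* v∈ }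
          where
          alone : ∀ {P* N*} → Clump L′ P* N* → v ∈ P* → ⊥
          alone {P*} {N*} C* v∈ = ∀¬¬⇒¬¬∀ only λ f → k (N* , conv f)
            where
            only : ∀ h → ¬ ¬ (h ∈ P* → h ≡ v)
            only h m with h ∈? P* | h ≟ᶠ v
            ... | no h∉ | _ = m λ h∈ → contradiction h∈ h∉
            ... | yes _ | yes eq = m λ _ → eq
            ... | yes h∈ | no h≢v = classified cy len h∉L λ { (P′ , N′ , C′ , h∈′) →
                    (1≰0 (lin (c ∷ []) (A ∷ P′ ∷ []) ([]) (((lng (# 0) ⊕ lng (# 1)) ≼ at 0) ∷ (lng (# 0) ≋ at 0) ∷ (κ 1 ≼ lng (# 1)) ∷ []) (κ 1) (κ 0) 0 ((1 , 0) ∷ (0 , 1) ∷ (1 , 0) ∷ []) (far C′ pA ndA A⊆ (λ eq → E⇒≢ e (sym eq))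
                            (C-nbr C′ h∈′ (C.join C* h∈ z∈*) (A⊆ (start∈ pA)))
                            (C-nbr C′ h∈′ (C.clique C* h∈ v∈ (λ eq → h≢v (sym eq))) (A⊆ (end∈ pA))) , lenA , C-nonempty C′ , tt))) }
              where
              h∉L : h ∉ L
              h∉L h∈L = C.offP C* h∈ (rest h∈L h≢v)
              z∈* : z ∈ N*
              z∈* = C-nbr C* v∈ e z∈′
            conv : (∀ h → h ∈ P* → h ≡ v) → Clump L′ (v ∷ []) N*
            conv f = record { path = [ v ] ; ndP = NoDup-single v ; offP = λ { (here refl) → v∉ } ; ndN = C.ndN C*
              ; N⊆L = C.N⊆L C* ; N≥2 = C.N≥2 C*
              ; closed = λ { (here refl) e → [ (λ p → inj₁ (here (f _ p))) , inj₂ ]′ (C.closed C* v∈ e) }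
              ; clique = λ { (here refl) (here refl) ne → contradiction refl ne }
              ; join = λ { (here refl) w∈ → C.join C* v∈ w∈ }
              ; count = subst (λ l → l + length N* ≡ 1 + δ) one (C.count C*)
              ; slack = subst (λ l → length N* * (1 + l) + 2 ≤ length L′) one (C.slack C*) }
              where
              one : length P* ≡ 1
              one = ≤-antisym (length-⊆ {ys = v ∷ []} (C.ndP C*) (λ h∈ → here (f _ h∈))) (C-nonempty C*)

        record Arcs (L : List V) (a : V) (s : List V) (b : V) (t : List V) : Set where
          field
            lk₁  : Lk a s b
            lk₂  : Lk b t a
            nd   : NoDup (a ∷ s ++ b ∷ t)
            len  : length (a ∷ s ++ b ∷ t) ≡ c
            toL   : ∀ {v} → v ∈ a ∷ s ++ b ∷ t → v ∈ L
            fromL : ∀ {v} → v ∈ L → v ∈ a ∷ s ++ b ∷ t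

        data Place (a : V) (s : List V) (b : V) (t : List V) (v : V) : Set where
          at-a : v ≡ a → Place a s b t v
          in-s : v ∈ s → Place a s b t v
          at-b : v ≡ b → Place a s b t v
          in-t : v ∈ t → Place a s b t v

        place : ∀ {a b t v} s → v ∈ a ∷ s ++ b ∷ t → Place a s b t v
        place s (here eq) = at-a eq
        place s (there p) with ∈-++⁻ s p
        ... | inj₁ q         = in-s q
        ... | inj₂ (here eq) = at-b eq
        ... | inj₂ (there q) = in-t q

        arcs-of : ∀ {L a b} → Cyc L → length L ≡ c → a ∈ L → b ∈ L → a ≢ b → ∃[ s ] ∃[ t ] Arcs L a s b t
        arcs-of {a = a} {b} cy len a∈ b∈ a≢b with ∈-∃++ a∈
        ... | xs , ys , refl with rotate xs cy
        ...   | cy′ with open-cycle cy′ | ∈-++⁻ xs b∈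
        ...     | w , e , f , p , g | place-b with ∈-∃++ {v = b} {ys ++ xs} (moved place-b)
          where
          moved : b ∈ xs ⊎ b ∈ a ∷ ys → b ∈ ys ++ xs
          moved (inj₁ p)         = ∈-++⁺ʳ ys p
          moved (inj₂ (here eq)) = contradiction (sym eq) a≢b
          moved (inj₂ (there p)) = ∈-++⁺ˡ p
        ...       | s , t , eq with lk-split s (subst (λ l → Lk a l a) eq (inner-lk f p g))
        ...         | l₁ , l₂ = s , t , record
          { lk₁ = l₁ ; lk₂ = l₂ ; nd = subst NoDup (cong (a ∷_) eq) (nodupᶜ cy′)
          ; len = trans (sym (cong length (cong (a ∷_) eq))) (trans ((≤-antisym (lin ([]) (ys ∷ xs ∷ []) (a ∷ []) ([]) (lng (((• 0 · # 0) · # 1))) (lng ((# 1 · (• 0 · # 0)))) 0 ([]) (tt)) (lin ([]) (ys ∷ xs ∷ []) (a ∷ []) ([]) (lng ((# 1 · (• 0 · # 0)))) (lng (((• 0 · # 0) · # 1))) 0 ([]) (tt)))) len)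
          ; toL = λ v∈ → [ ∈-++⁺ʳ xs , ∈-++⁺ˡ ]′ (∈-++⁻ (a ∷ ys) (∈-resp (cong (a ∷_) (sym eq)) v∈))
          ; fromL = λ v∈ → ∈-resp (cong (a ∷_) eq) ([ ∈-++⁺ʳ (a ∷ ys) , ∈-++⁺ˡ ]′ (∈-++⁻ xs v∈)) }

        module _ {L a s b t} (X : Arcs L a s b t) where
          open Arcs X

          arcs-swap : Arcs L b t a s
          arcs-swap = record { lk₁ = lk₂ ; lk₂ = lk₁ ; nd = (nodup⊆ (s ∷ t ∷ []) (a ∷ b ∷ []) ((• 1 · (# 1 · (• 0 · # 0)))) ((• 0 · (# 0 · (• 1 · # 1)))) (nd))
            ; len = (≤-antisym (lin (c ∷ []) (s ∷ t ∷ []) (a ∷ b ∷ []) ((lng ((• 0 · (# 0 · (• 1 · # 1)))) ≋ at 0) ∷ []) (lng ((• 1 · (# 1 · (• 0 · # 0))))) (at 0) 0 ((1 , 0) ∷ []) (len , tt)) (lin (c ∷ []) (s ∷ t ∷ []) (a ∷ b ∷ []) ((lng ((• 0 · (# 0 · (• 1 · # 1)))) ≋ at 0) ∷ []) (at 0) (lng ((• 1 · (# 1 · (• 0 · # 0))))) 0 ((0 , 1) ∷ []) (len , tt)))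
            ; toL = λ v∈ → toL ([ ∈-++⁺ʳ (a ∷ s) , ∈-++⁺ˡ ]′ (∈-++⁻ (b ∷ t) v∈))
            ; fromL = λ v∈ → [ ∈-++⁺ʳ (b ∷ t) , ∈-++⁺ˡ ]′ (∈-++⁻ (a ∷ s) (fromL v∈)) }

          path-bta : Path b (b ∷ t ++ a ∷ []) a
          path-bta = lk-path lk₂ [ a ]

          arcs-≢ : a ≢ b
          arcs-≢ refl = NoDup-head nd (∈-++⁺ʳ s (here refl))

          arcs-gap : ∀ {P N} → Clump L P N → a ∈ N → b ∈ N → length P ≤ length s
          arcs-gap {P} C a∈ b∈ =
            (lin (c ∷ []) (s ∷ t ∷ P ∷ []) (a ∷ b ∷ []) ((lng ((• 0 · (# 0 · (• 1 · # 1)))) ≋ at 0) ∷ ((lng ((• 1 · (# 1 · (• 0 · ε)))) ⊕ lng (# 2)) ≼ at 0) ∷ []) (lng (# 2)) (lng (# 0)) 0 ((0 , 1) ∷ (1 , 0) ∷ []) (len , far C path-bta ((nodup⊆ (s ∷ t ∷ []) (a ∷ b ∷ []) ((• 1 · (# 1 · (• 0 · ε)))) ((• 0 · (# 0 · (• 1 · # 1)))) (nd)))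
                (λ v∈ → toL ([ (λ p → ∈-++⁺ʳ (a ∷ s) p) , (λ { (here refl) → here refl }) ]′ (∈-++⁻ (b ∷ t) v∈)))
                (λ eq → arcs-≢ (sym eq)) b∈ a∈ , tt))

          -- If s and the clump are equally long, they can be exchanged, and s is itself a clump.
          exchange-clump : ∀ {P N} → Clump L P N → a ∈ N → b ∈ N → length s ≡ length P →
                           ¬ ¬ (∃[ P* ] ∃[ N* ] (Clump (P ++ b ∷ t ++ a ∷ []) P* N* ×
                                (∀ {v} → v ∈ s → v ∈ P*) × a ∈ N* × b ∈ N* × Cyc (P ++ b ∷ t ++ a ∷ []) × length (P ++ b ∷ t ++ a ∷ []) ≡ c))
          exchange-clump {P} {N} C a∈ b∈ eq k = split s refl
            where
            L′ = P ++ b ∷ t ++ a ∷ []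
            len′ : length L′ ≡ c
            len′ = (≤-antisym (lin (c ∷ []) (s ∷ t ∷ P ∷ []) (a ∷ b ∷ []) ((lng ((• 0 · (# 0 · (• 1 · # 1)))) ≋ at 0) ∷ (lng (# 0) ≋ lng (# 2)) ∷ []) (lng ((# 2 · (• 1 · (# 1 · (• 0 · ε)))))) (at 0) 0 ((1 , 0) ∷ (0 , 1) ∷ []) (len , eq , tt)) (lin (c ∷ []) (s ∷ t ∷ P ∷ []) (a ∷ b ∷ []) ((lng ((• 0 · (# 0 · (• 1 · # 1)))) ≋ at 0) ∷ (lng (# 0) ≋ lng (# 2)) ∷ []) (at 0) (lng ((# 2 · (• 1 · (# 1 · (• 0 · ε)))))) 0 ((0 , 1) ∷ (1 , 0) ∷ []) (len , eq , tt)))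
            cyL′ : Cyc L′
            cyL′ = cyc (NoDup-++ (C.ndP C) ((nodup⊆ (s ∷ t ∷ []) (a ∷ b ∷ []) ((• 1 · (# 1 · (• 0 · ε)))) ((• 0 · (# 0 · (• 1 · # 1)))) (nd)))
                          (λ p r → C.offP C p (toL ([ ∈-++⁺ʳ (a ∷ s) , (λ { (here refl) → here refl }) ]′ (∈-++⁻ (b ∷ t) r)))))
                       ((lin ([]) (P ∷ t ∷ []) (b ∷ a ∷ []) ((κ 1 ≼ lng (# 0)) ∷ []) (κ 3) (lng ((# 0 · (• 0 · (# 1 · (• 1 · ε)))))) 0 ((1 , 0) ∷ []) (C-nonempty C , tt)))
                       (C.path C ⟨ C.join C (end∈ (C.path C)) b∈ ⟩ path-bta)
                       (E-sym (C.join C (start∈ (C.path C)) a∈))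
            off : ∀ {v} → v ∈ s → v ∉ L′
            off v∈ v∈L′ with ∈-++⁻ P v∈L′
            ... | inj₁ p = C.offP C p (toL (there (∈-++⁺ˡ v∈)))
            ... | inj₂ p = NoDup-disjoint {s} {b ∷ t ++ a ∷ []} ((nodup⊆ (s ∷ t ∷ []) (a ∷ b ∷ []) ((# 0 · (• 1 · (# 1 · (• 0 · ε))))) ((• 0 · (# 0 · (• 1 · # 1)))) (nd))) v∈ p
            b∈L′ : b ∈ L′
            b∈L′ = ∈-++⁺ʳ P (here refl)
            a∈L′ : a ∈ L′
            a∈L′ = ∈-++⁺ʳ P (there (∈-++⁺ʳ t (here refl)))
            split : ∀ s′ → s ≡ s′ → ⊥
            split [] refl = <⇒≱ (C-nonempty C) (≤-trans (≤-reflexive (sym eq)) z≤n)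
            split (x ∷ s′) refl with lk-inner lk₁
            ... | y , e , p , f = classified cyL′ len′ (off (here refl)) λ { (P* , N* , C* , x∈) →
              let sub : ∀ {v} → v ∈ s → v ∈ P*
                  sub v∈ = C-stays C* (path-con∈ p off v∈) x∈
              in k (P* , N* , C* , sub , C-nbr C* x∈ (E-sym e) a∈L′ , C-nbr C* (sub (end∈ p)) f b∈L′ , cyL′ , len′) }

          module _ {P P′ N N′ : List V} (C : Clump L P N) (C′ : Clump L P′ N′) (disj : ∀ {v} → v ∈ P → v ∉ P′)
                   (a∈ : a ∈ N) (b∈ : b ∈ N) where

            -- The neighbours of the two clumps alternate around `L`. Together the two reroutings
            -- cover `L` once, the vertices `a`, `y`, `b`, `z` a second time, and `P` and `P′`
            -- twice; their lengths add up to at most 2c.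
            crossing : ∀ {y z} → y ∈ s → z ∈ t → y ∈ N′ → z ∈ N′ → 2 * (length P + length P′) + 4 ≤ c
            crossing {y} {z} y∈ z∈ yN zN with ∈-∃++ y∈ | ∈-∃++ z∈
            ... | o₁ , r₁ , refl | o₂ , r₂ , refl =
              (lin (c ∷ []) (o₁ ∷ r₁ ∷ o₂ ∷ r₂ ∷ P ∷ P′ ∷ []) (a ∷ y ∷ b ∷ z ∷ []) ((lng ((• 0 · ((# 0 · (• 1 · # 1)) · (• 2 · (# 2 · (• 3 · # 3)))))) ≋ at 0) ∷ ((((lng ((• 1 · (# 1 · (• 2 · ε)))) ⊕ lng (# 4)) ⊕ lng ((• 3 · (# 3 · (• 0 · ε))))) ⊕ lng (# 5)) ≼ at 0) ∷ ((((lng (rev ((• 2 · (# 2 · (• 3 · ε))))) ⊕ lng (# 4)) ⊕ lng (rev ((• 0 · (# 0 · (• 1 · ε)))))) ⊕ lng (# 5)) ≼ at 0) ∷ []) ((2 ⊗ ((lng (# 4) ⊕ lng (# 5))) ⊕ κ 4)) (at 0) 0 ((0 , 1) ∷ (1 , 0) ∷ (1 , 0) ∷ []) (len , crossLk (lk-path (proj₂ s₁) [ b ]) (lk-path (proj₂ s₂) [ a ]) (C.path C)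
                  (E-sym (C.join C (start∈ (C.path C)) b∈)) (C.join C (end∈ (C.path C)) a∈) (C-lk C′ zN yN)
                  ((nodup⊆ (o₁ ∷ r₁ ∷ o₂ ∷ r₂ ∷ P ∷ P′ ∷ []) (a ∷ y ∷ b ∷ z ∷ []) (((• 1 · (# 1 · (• 2 · ε))) · (# 4 · ((• 3 · (# 3 · (• 0 · ε))) · # 5)))) (((• 0 · ((# 0 · (• 1 · # 1)) · (• 2 · (# 2 · (• 3 · # 3))))) · (# 4 · # 5))) (ndAll))) , crossLk (path-reverse (lk-path (proj₁ s₂) [ z ])) (path-reverse (lk-path (proj₁ s₁) [ y ])) (C.path C)
                  (E-sym (C.join C (start∈ (C.path C)) b∈)) (C.join C (end∈ (C.path C)) a∈) (C-lk C′ yN zN)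
                  ((nodup⊆ (o₁ ∷ r₁ ∷ o₂ ∷ r₂ ∷ P ∷ P′ ∷ []) (a ∷ y ∷ b ∷ z ∷ []) ((rev ((• 2 · (# 2 · (• 3 · ε)))) · (# 4 · (rev ((• 0 · (# 0 · (• 1 · ε)))) · # 5)))) (((• 0 · ((# 0 · (• 1 · # 1)) · (• 2 · (# 2 · (• 3 · # 3))))) · (# 4 · # 5))) (ndAll))) , tt))
              where
              s₁ = lk-split o₁ lk₁
              s₂ = lk-split o₂ lk₂
              ndAll : NoDup ((a ∷ (o₁ ++ y ∷ r₁) ++ b ∷ (o₂ ++ z ∷ r₂)) ++ P ++ P′)
              ndAll = NoDup-++ nd (NoDup-++ (C.ndP C) (C.ndP C′) disj)
                        (λ p r → [ (λ q → C.offP C q (toL p)) , (λ q → C.offP C′ q (toL p)) ]′ (∈-++⁻ P r))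

        arcs-splitˢ : ∀ {L a b t x} o {r} → Arcs L a (o ++ x ∷ r) b t → Arcs L x r b (t ++ a ∷ o)
        arcs-splitˢ {L} {a} {b} {t} {x} o {r} X = record
          { lk₁ = proj₂ (lk-split o lk₁) ; lk₂ = lk-++ t lk₂ (proj₁ (lk-split o lk₁))
          ; nd = (nodup⊆ (o ∷ r ∷ t ∷ []) (a ∷ x ∷ b ∷ []) ((• 1 · (# 1 · (• 2 · (# 2 · (• 0 · # 0)))))) ((• 0 · ((# 0 · (• 1 · # 1)) · (• 2 · # 2)))) (nd))
          ; len = (≤-antisym (lin (c ∷ []) (o ∷ r ∷ t ∷ []) (a ∷ x ∷ b ∷ []) ((lng ((• 0 · ((# 0 · (• 1 · # 1)) · (• 2 · # 2)))) ≋ at 0) ∷ []) (lng ((• 1 · (# 1 · (• 2 · (# 2 · (• 0 · # 0))))))) (at 0) 0 ((1 , 0) ∷ []) (len , tt)) (lin (c ∷ []) (o ∷ r ∷ t ∷ []) (a ∷ x ∷ b ∷ []) ((lng ((• 0 · ((# 0 · (• 1 · # 1)) · (• 2 · # 2)))) ≋ at 0) ∷ []) (at 0) (lng ((• 1 · (# 1 · (• 2 · (# 2 · (• 0 · # 0))))))) 0 ((0 , 1) ∷ []) (len , tt)))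
          ; toL = λ v∈ → toL (b₁ (place r v∈)) ; fromL = λ v∈ → f₁ (place (o ++ x ∷ r) (fromL v∈)) }
          where
          open Arcs X
          b₁ : ∀ {v} → Place x r b (t ++ a ∷ o) v → v ∈ a ∷ (o ++ x ∷ r) ++ b ∷ t
          b₁ (at-a refl) = there (∈-++⁺ˡ (∈-++⁺ʳ o (here refl)))
          b₁ (in-s p) = there (∈-++⁺ˡ (∈-++⁺ʳ o (there p)))
          b₁ (at-b refl) = there (∈-++⁺ʳ (o ++ x ∷ r) (here refl))
          b₁ (in-t p) with ∈-++⁻ t p
          ... | inj₁ q = there (∈-++⁺ʳ (o ++ x ∷ r) (there q))
          ... | inj₂ (here refl) = here refl
          ... | inj₂ (there q) = there (∈-++⁺ˡ (∈-++⁺ˡ q))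
          f₁ : ∀ {v} → Place a (o ++ x ∷ r) b t v → v ∈ x ∷ r ++ b ∷ (t ++ a ∷ o)
          f₁ (at-a refl) = there (∈-++⁺ʳ r (there (∈-++⁺ʳ t (here refl))))
          f₁ (at-b refl) = there (∈-++⁺ʳ r (here refl))
          f₁ (in-t p) = there (∈-++⁺ʳ r (there (∈-++⁺ˡ p)))
          f₁ (in-s p) with ∈-++⁻ o p
          ... | inj₁ q = there (∈-++⁺ʳ r (there (∈-++⁺ʳ t (there q))))
          ... | inj₂ (here refl) = here refl
          ... | inj₂ (there q) = there (∈-++⁺ˡ q)

        -- Clumps with two neighbours

        open Arcs

        arcs-splitᵖ : ∀ {L a b t x} o {r} → Arcs L a (o ++ x ∷ r) b t → Arcs L a o x (r ++ b ∷ t)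
        arcs-splitᵖ {t = t} o X = arcs-splitˢ t (arcs-swap (arcs-splitˢ o X))

        head-of : ∀ {xs : List V} → 1 ≤ length xs → ∃[ x ] (x ∈ xs)
        head-of {x ∷ xs} _ = x , here refl

        two-members : ∀ (N : List V) → length N ≡ 2 → NoDup N → ∃[ a ] ∃[ b ] (a ∈ N × b ∈ N × a ≢ b)
        two-members (a ∷ b ∷ []) _ h = a , b , here refl , there (here refl) , λ { refl → NoDup-head h (here refl) }

        module _ {L P N a s b t} (X : Arcs L a s b t) (C : Clump L P N) (a∈ : a ∈ N) (b∈ : b ∈ N) where

          arcs-gapᵗ : length P ≤ length t
          arcs-gapᵗ = arcs-gap (arcs-swap X) C b∈ a∈

          -- {a , b} would leave three components.
          three-blocks : ∀ {B x y} → x ∈ B → x ∉ a ∷ b ∷ [] → y ∈ L → y ∉ B → y ∉ a ∷ b ∷ [] →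
                         (∀ {v} → v ∈ B → v ∉ P) → (∀ {z w} → z ∈ B → E z w → w ∈ B ⊎ w ∈ a ∷ b ∷ []) →
                         (∀ {v} → v ∈ N → v ∈ a ∷ b ∷ []) → ⊥
          three-blocks {B} {x} {y} x∈ x∉ y∈ y∉B y∉ disj closed N⊆ =
            <⇒≱ {2} {3} ≤-refl (separated (a ∷ b ∷ []) (C.p C ∷ x ∷ y ∷ []) (s≤s (s≤s z≤n))
              ((λ r → C.offP C p∈ (ends r)) ∷ x∉ ∷ y∉ ∷ [])
              ((closed-apart closedP p∈ (disj x∈) ∷ closed-apart closedP p∈ (λ r → C.offP C r y∈) ∷ [])
               ∷ (closed-apart closed x∈ y∉B ∷ []) ∷ [] ∷ []))
            where
            p∈ = start∈ (C.path C)
            ends : ∀ {v} → v ∈ a ∷ b ∷ [] → v ∈ L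
            ends (here refl)         = toL X (here refl)
            ends (there (here refl)) = toL X (there (∈-++⁺ʳ s (here refl)))
            closedP : ∀ {z w} → z ∈ P → E z w → w ∈ P ⊎ w ∈ a ∷ b ∷ []
            closedP z∈ e = [ inj₁ , (λ r → inj₂ (N⊆ r)) ]′ (C.closed C z∈ e)

          off-ends-s : ∀ {v} → v ∈ s → v ∉ a ∷ b ∷ []
          off-ends-s v∈ r = NoDup-disjoint {s} {a ∷ b ∷ []} ((nodup⊆ (s ∷ t ∷ []) (a ∷ b ∷ []) ((# 0 · (• 0 · (• 1 · ε)))) ((• 0 · (# 0 · (• 1 · # 1)))) (nd X))) v∈ r

          off-ends-t : ∀ {v} → v ∈ t → v ∉ a ∷ b ∷ []
          off-ends-t v∈ r = NoDup-disjoint {t} {a ∷ b ∷ []} ((nodup⊆ (s ∷ t ∷ []) (a ∷ b ∷ []) ((# 1 · (• 0 · (• 1 · ε)))) ((• 0 · (# 0 · (• 1 · # 1)))) (nd X))) v∈ r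

          module _ (|N| : length N ≡ 2) where

            two-ends : ∀ {v} → v ∈ N → v ∈ a ∷ b ∷ []
            two-ends = ⊆-reverse {a ∷ b ∷ []} (NoDup-∷ (λ { (here eq) → arcs-≢ X eq }) (NoDup-single b))
                         (λ { (here refl) → a∈ ; (there (here refl)) → b∈ }) (≤-reflexive |N|)

            -- A segment as long as P could be exchanged with it, and would be a component of G ∖ {a , b}.
            long-arc : 1 + length P ≤ length s
            long-arc = decidable-stable (_ ≤? _) λ ¬p →
              exchange-clump X C a∈ b∈ (≤-antisym (s≤s⁻¹ (≰⇒> ¬p)) (arcs-gap X C a∈ b∈))
                λ { (P* , N* , C* , s⊆ , a∈* , b∈* , _) → isolated ¬p C* s⊆ a∈* b∈* }
              where
              isolated : ∀ {P* N*} → ¬ (1 + length P ≤ length s) → Clump (P ++ b ∷ t ++ a ∷ []) P* N* →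
                         (∀ {v} → v ∈ s → v ∈ P*) → a ∈ N* → b ∈ N* → ⊥
              isolated {P*} {N*} ¬p C* s⊆ a∈* b∈* with head-of (≤-trans (C-nonempty C) (arcs-gap X C a∈ b∈)) | head-of (≤-trans (C-nonempty C) arcs-gapᵗ)
              ... | x , x∈ | y , y∈ =
                three-blocks x∈ (off-ends-s x∈) (toL X (there (∈-++⁺ʳ s (there y∈))))
                  (λ y∈s → NoDup-disjoint {s} {t} ((nodup⊆ (s ∷ t ∷ []) (a ∷ b ∷ []) ((# 0 · # 1)) ((• 0 · (# 0 · (• 1 · # 1)))) (nd X))) y∈s y∈) (off-ends-t y∈)
                  (λ v∈ p → C.offP C p (toL X (there (∈-++⁺ˡ v∈)))) closed two-ends
                where
                nds : NoDup s
                nds = (nodup⊆ (s ∷ t ∷ []) (a ∷ b ∷ []) (# 0) ((• 0 · (# 0 · (• 1 · # 1)))) (nd X))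
                s≤P* : length s ≤ length P*
                s≤P* = length-⊆ nds s⊆
                -- The sums |P*| + |N*| and |P| + 2 agree and |N*| ≥ 2, so `P*` has no room for
                -- anything beyond `s`.
                P*≤s : length P* ≤ length s
                P*≤s = (lin (δ ∷ []) (P* ∷ N* ∷ P ∷ N ∷ s ∷ []) ([]) (((lng (# 0) ⊕ lng (# 1)) ≋ (κ 1 ⊕ at 0)) ∷ (κ 2 ≼ lng (# 1)) ∷ ((lng (# 2) ⊕ lng (# 3)) ≋ (κ 1 ⊕ at 0)) ∷ (lng (# 3) ≋ κ 2) ∷ (lng (# 2) ≼ lng (# 4)) ∷ []) (lng (# 0)) (lng (# 4)) 0 ((1 , 0) ∷ (1 , 0) ∷ (0 , 1) ∷ (1 , 0) ∷ (1 , 0) ∷ []) (C.count C* , C.N≥2 C* , C.count C , |N| , arcs-gap X C a∈ b∈ , tt))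
                N*≤2 : length N* ≤ 2
                N*≤2 = (lin (δ ∷ []) (P* ∷ N* ∷ s ∷ P ∷ N ∷ []) ([]) (((lng (# 0) ⊕ lng (# 1)) ≋ (κ 1 ⊕ at 0)) ∷ (lng (# 2) ≼ lng (# 0)) ∷ ((lng (# 3) ⊕ lng (# 4)) ≋ (κ 1 ⊕ at 0)) ∷ (lng (# 4) ≋ κ 2) ∷ (lng (# 3) ≼ lng (# 2)) ∷ []) (lng (# 1)) (κ 2) 0 ((1 , 0) ∷ (1 , 0) ∷ (0 , 1) ∷ (1 , 0) ∷ (1 , 0) ∷ []) (C.count C* , s≤P* , C.count C , |N| , arcs-gap X C a∈ b∈ , tt))
                closed : ∀ {z w} → z ∈ s → E z w → w ∈ s ⊎ w ∈ a ∷ b ∷ []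
                closed z∈ e with C.closed C* (s⊆ z∈) e
                ... | inj₁ p = inj₁ (⊆-reverse nds s⊆ P*≤s p)
                ... | inj₂ p = inj₂ (⊆-reverse {a ∷ b ∷ []} (NoDup-∷ (λ { (here eq) → arcs-≢ X eq }) (NoDup-single b))
                                       (λ { (here refl) → a∈* ; (there (here refl)) → b∈* }) N*≤2 p)

        Two : List V → List V → List V → Set
        Two L P N = Clump L P N × length N ≡ 2

        P-size : ∀ {L P N} → Two L P N → length P + 1 ≡ δ
        P-size {P = P} {N} (C , |N|) = (≤-antisym (lin (δ ∷ []) (P ∷ N ∷ []) ([]) (((lng (# 0) ⊕ lng (# 1)) ≋ (κ 1 ⊕ at 0)) ∷ (lng (# 1) ≋ κ 2) ∷ []) ((lng (# 0) ⊕ κ 1)) (at 0) 0 ((1 , 0) ∷ (0 , 1) ∷ []) (C.count C , |N| , tt)) (lin (δ ∷ []) (P ∷ N ∷ []) ([]) (((lng (# 0) ⊕ lng (# 1)) ≋ (κ 1 ⊕ at 0)) ∷ (lng (# 1) ≋ κ 2) ∷ []) (at 0) ((lng (# 0) ⊕ κ 1)) 0 ((0 , 1) ∷ (1 , 0) ∷ []) (C.count C , |N| , tt)))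

        δ≤arc : ∀ {L P N a s b t} → Arcs L a s b t → Two L P N → a ∈ N → b ∈ N → δ ≤ length s
        δ≤arc {P = P} {s = s} X (C , |N|) a∈ b∈ =
          (lin (δ ∷ []) (P ∷ s ∷ []) ([]) (((lng (# 0) ⊕ κ 1) ≋ at 0) ∷ ((κ 1 ⊕ lng (# 0)) ≼ lng (# 1)) ∷ []) (at 0) (lng (# 1)) 0 ((0 , 1) ∷ (1 , 0) ∷ []) (P-size (C , |N|) , long-arc X C a∈ b∈ |N| , tt))

        module _ {L P P′ N N′ : List V} (T : Two L P N) (T′ : Two L P′ N′) (disj : ∀ {v} → v ∈ P → v ∉ P′) where

          private
            C = proj₁ T
            C′ = proj₁ T′

          -- Deleting the two common neighbours would separate `P`, `P′` and the rest of the cycle.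
          same-ends : ∀ {a s b t} → Arcs L a s b t → a ∈ N → b ∈ N → a ∈ N′ → b ∈ N′ → ⊥
          same-ends {a} {s} {b} X a∈ b∈ a∈′ b∈′ with head-of (≤-trans (C-nonempty C) (arcs-gap X C a∈ b∈))
          ... | x , x∈ = three-blocks X C a∈ b∈ (start∈ (C.path C′)) (λ r → C.offP C′ (start∈ (C.path C′)) (ends r))
              (toL X (there (∈-++⁺ˡ x∈))) (λ p → C.offP C′ p (toL X (there (∈-++⁺ˡ x∈)))) (off-ends-s X C a∈ b∈ x∈)
              (λ v∈′ v∈ → disj v∈ v∈′)
              (λ z∈ e → [ inj₁ , (λ r → inj₂ (two-ends X C′ a∈′ b∈′ (proj₂ T′) r)) ]′ (C.closed C′ z∈ e))
              (two-ends X C a∈ b∈ (proj₂ T))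
            where
            ends : ∀ {v} → v ∈ a ∷ b ∷ [] → v ∈ L
            ends (here refl)         = toL X (here refl)
            ends (there (here refl)) = toL X (there (∈-++⁺ʳ s (here refl)))

          -- Both clumps have δ - 1 vertices, so `crossing` reads 4δ ≤ 2δ + 3, while δ ≥ 2.
          no-crossing : ∀ {a s b t y z} → Arcs L a s b t → a ∈ N → b ∈ N → y ∈ s → z ∈ t → y ∈ N′ → z ∈ N′ → ⊥
          no-crossing X a∈ b∈ y∈ z∈ yN zN =
            (1≰0 (lin (c ∷ δ ∷ []) (P ∷ P′ ∷ []) ([]) (((2 ⊗ ((lng (# 0) ⊕ lng (# 1))) ⊕ κ 4) ≼ at 0) ∷ (at 0 ≼ (2 ⊗ (at 1) ⊕ κ 3)) ∷ ((lng (# 0) ⊕ κ 1) ≋ at 1) ∷ ((lng (# 1) ⊕ κ 1) ≋ at 1) ∷ (κ 1 ≼ lng (# 0)) ∷ []) (κ 1) (κ 0) 0 ((1 , 0) ∷ (1 , 0) ∷ (0 , 0) ∷ (0 , 2) ∷ (2 , 0) ∷ []) (crossing X C C′ disj a∈ b∈ y∈ z∈ yN zN , small , P-size T , P-size T′ , C-nonempty C , tt)))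

          -- An arc has at most 1 + δ inner vertices, but the neighbours of the second clump are
          -- themselves δ vertices apart. Hence they do not both fit inside: one of them is an end
          -- of the arc, the other the inner vertex farthest from it.
          data Beside (a : V) (s : List V) (b : V) : Set where
            near-b : ∀ {x r} → s ≡ x ∷ r → x ∈ N′ → b ∈ N′ → 1 + δ ≤ length s → Beside a s b
            near-a : ∀ {x r} → s ≡ r ++ x ∷ [] → x ∈ N′ → a ∈ N′ → 1 + δ ≤ length s → Beside a s b

          module _ {a s b t} (X : Arcs L a s b t) (a∈ : a ∈ N) (b∈ : b ∈ N) where

            s-bound : length s ≤ 1 + δ
            s-bound = (lin (c ∷ δ ∷ []) (s ∷ t ∷ []) (a ∷ b ∷ []) ((lng ((• 0 · (# 0 · (• 1 · # 1)))) ≋ at 0) ∷ (at 0 ≼ (2 ⊗ (at 1) ⊕ κ 3)) ∷ (at 1 ≼ lng (# 1)) ∷ []) (lng (# 0)) ((κ 1 ⊕ at 1)) 0 ((1 , 0) ∷ (1 , 0) ∷ (1 , 0) ∷ []) (len X , small , δ≤arc (arcs-swap X) T b∈ a∈ , tt))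

            beside : ∀ {a′ b′} → a′ ∈ s → a′ ∈ N′ → b′ ∈ N′ → a′ ≢ b′ → b′ ∈ L → Beside a s b
            beside a′∈ aN bN ne b′∈ with ∈-∃++ a′∈ | place s (fromL X b′∈)
            beside {a′} a′∈ aN bN ne b′∈ | o , r , refl | at-b refl = finish o refl
              where
              r≥ : δ ≤ length r
              r≥ = δ≤arc (arcs-splitˢ o X) T′ aN bN
              finish : ∀ o′ → o ≡ o′ → Beside a s b
              finish [] refl = near-b refl aN bN (s≤s r≥)
              finish (w ∷ ws) refl = (1≰0 (lin (δ ∷ []) (ws ∷ r ∷ []) (w ∷ a′ ∷ []) ((lng (((• 0 · # 0) · (• 1 · # 1))) ≼ (κ 1 ⊕ at 0)) ∷ (at 0 ≼ lng (# 1)) ∷ []) (κ 1) (κ 0) 0 ((1 , 0) ∷ (1 , 0) ∷ []) (s-bound , r≥ , tt)))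
            beside {a′} a′∈ aN bN ne b′∈ | o , r , refl | at-a refl = finish r refl
              where
              o≥ : δ ≤ length o
              o≥ = δ≤arc (arcs-splitᵖ o X) T′ bN aN
              finish : ∀ r′ → r ≡ r′ → Beside a s b
              finish [] refl = near-a refl aN bN ((lin (δ ∷ []) (o ∷ []) (a′ ∷ []) ((at 0 ≼ lng (# 0)) ∷ []) ((κ 1 ⊕ at 0)) (lng ((# 0 · (• 0 · ε)))) 0 ((1 , 0) ∷ []) (o≥ , tt)))
              finish (w ∷ ws) refl = (1≰0 (lin (δ ∷ []) (o ∷ ws ∷ []) (a′ ∷ w ∷ []) ((lng ((# 0 · (• 0 · (• 1 · # 1)))) ≼ (κ 1 ⊕ at 0)) ∷ (at 0 ≼ lng (# 0)) ∷ []) (κ 1) (κ 0) 0 ((1 , 0) ∷ (1 , 0) ∷ []) (s-bound , o≥ , tt)))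
            beside a′∈ aN bN ne b′∈ | o , r , refl | in-t b′∈t = ⊥-elim (no-crossing X a∈ b∈ a′∈ b′∈t aN bN)
            beside {a′} {b′} a′∈ aN bN ne b′∈ | o , r , refl | in-s b′∈s with ∈-++⁻ o b′∈s
            ... | inj₂ (here eq) = contradiction (sym eq) ne
            ... | inj₁ q with ∈-∃++ q
            ...   | o₂ , r₂ , refl =
              (1≰0 (lin (δ ∷ []) (o₂ ∷ r₂ ∷ r ∷ []) (b′ ∷ a′ ∷ []) ((lng (((# 0 · (• 0 · # 1)) · (• 1 · # 2))) ≼ (κ 1 ⊕ at 0)) ∷ (at 0 ≼ lng (# 1)) ∷ []) (κ 1) (κ 0) 0 ((1 , 0) ∷ (1 , 0) ∷ []) (s-bound , δ≤arc (arcs-splitˢ o₂ (arcs-splitᵖ (o₂ ++ b′ ∷ r₂) X)) T′ bN aN , tt)))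
            beside {a′} {b′} a′∈ aN bN ne b′∈ | o , r , refl | in-s b′∈s | inj₂ (there q) with ∈-∃++ q
            ...   | o₂ , r₂ , refl =
              (1≰0 (lin (δ ∷ []) (o ∷ o₂ ∷ r₂ ∷ []) (a′ ∷ b′ ∷ []) ((lng ((# 0 · (• 0 · (# 1 · (• 1 · # 2))))) ≼ (κ 1 ⊕ at 0)) ∷ (at 0 ≼ lng (# 1)) ∷ []) (κ 1) (κ 0) 0 ((1 , 0) ∷ (1 , 0) ∷ []) (s-bound , δ≤arc (arcs-splitᵖ o₂ (arcs-splitˢ o X)) T′ aN bN , tt)))

          beside-one : ∀ {a s b t} → Arcs L a s b t → a ∈ N → b ∈ N → Beside a s b ⊎ Beside b t a
          beside-one {a} {s} {b} {t} X a∈ b∈ with two-members N′ (proj₂ T′) (C.ndN C′)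
          ... | a′ , b′ , aN , bN , ne = go (place s (fromL X (C.N⊆L C′ aN))) (place s (fromL X (C.N⊆L C′ bN)))
            where
            go : Place a s b t a′ → Place a s b t b′ → Beside a s b ⊎ Beside b t a
            go (in-s p) _ = inj₁ (beside X a∈ b∈ p aN bN ne (C.N⊆L C′ bN))
            go (in-t p) _ = inj₂ (beside (arcs-swap X) b∈ a∈ p aN bN ne (C.N⊆L C′ bN))
            go _ (in-s p) = inj₁ (beside X a∈ b∈ p bN aN (λ e → ne (sym e)) (C.N⊆L C′ aN))
            go _ (in-t p) = inj₂ (beside (arcs-swap X) b∈ a∈ p bN aN (λ e → ne (sym e)) (C.N⊆L C′ aN))
            go (at-a refl) (at-a refl) = contradiction refl ne
            go (at-b refl) (at-b refl) = contradiction refl ne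
            go (at-a refl) (at-b refl) = ⊥-elim (same-ends X a∈ b∈ aN bN)
            go (at-b refl) (at-a refl) = ⊥-elim (same-ends X a∈ b∈ bN aN)

          long-of : ∀ {a s b} → Beside a s b → 1 + δ ≤ length s
          long-of (near-b _ _ _ l) = l
          long-of (near-a _ _ _ l) = l

          -- The second clump forces 1 + δ vertices into one arc, beside δ in the other and the two
          -- ends: 2δ + 3 in all.
          no-two : c ≤ 2 * δ + 2 → ∀ {a s b t} → Arcs L a s b t → a ∈ N → b ∈ N → ⊥
          no-two c≤ {a} {s} {b} {t} X a∈ b∈ with beside-one X a∈ b∈
          ... | inj₁ B = (1≰0 (lin (c ∷ δ ∷ []) (s ∷ t ∷ []) (a ∷ b ∷ []) ((at 0 ≼ (2 ⊗ (at 1) ⊕ κ 2)) ∷ (lng ((• 0 · (# 0 · (• 1 · # 1)))) ≋ at 0) ∷ ((κ 1 ⊕ at 1) ≼ lng (# 0)) ∷ (at 1 ≼ lng (# 1)) ∷ []) (κ 1) (κ 0) 0 ((1 , 0) ∷ (1 , 0) ∷ (1 , 0) ∷ (1 , 0) ∷ []) (c≤ , len X , long-of B , δ≤arc (arcs-swap X) T b∈ a∈ , tt)))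
          ... | inj₂ B = (1≰0 (lin (c ∷ δ ∷ []) (s ∷ t ∷ []) (a ∷ b ∷ []) ((at 0 ≼ (2 ⊗ (at 1) ⊕ κ 2)) ∷ (lng ((• 0 · (# 0 · (• 1 · # 1)))) ≋ at 0) ∷ ((κ 1 ⊕ at 1) ≼ lng (# 1)) ∷ (at 1 ≼ lng (# 0)) ∷ []) (κ 1) (κ 0) 0 ((1 , 0) ∷ (1 , 0) ∷ (1 , 0) ∷ (1 , 0) ∷ []) (c≤ , len X , long-of B , δ≤arc X T a∈ b∈ , tt)))

        module _ {L P P′ P″ N N′ N″ : List V} (T : Two L P N) (T′ : Two L P′ N′) (T″ : Two L P″ N″)
                 (disj : ∀ {v} → v ∈ P → v ∉ P′) (disj′ : ∀ {v} → v ∈ P → v ∉ P″) (disj″ : ∀ {v} → v ∈ P′ → v ∉ P″) where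

          private
            -- Around the cycle come `a`, `x`, `y`, `b`, so the pairs `x`, `b` and `y`, `a`
            -- alternate.
            no-mixed : ∀ {Q Q′ M M′ a s b t x r y r′} → (U : Two L Q M) (U′ : Two L Q′ M′) → (∀ {v} → v ∈ Q → v ∉ Q′) → Arcs L a s b t →
                       s ≡ x ∷ r → x ∈ M → b ∈ M → s ≡ r′ ++ y ∷ [] → y ∈ M′ → a ∈ M′ → 2 ≤ length s → ⊥
            no-mixed {t = t} {r′ = []} U U′ dj X refl xM bM refl yM aM (s≤s ())
            no-mixed {a = a} {t = t} {r′ = w ∷ r′} U U′ dj X refl xM bM eq yM aM _ with ∷-injective eq
            ... | refl , refl = no-crossing U U′ dj (arcs-splitˢ [] X) xM bM (∈-++⁺ʳ r′ (here refl)) (∈-++⁺ʳ t (here refl)) yM aM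

            both : ∀ {a s b t} → Arcs L a s b t → Beside T T′ disj a s b → Beside T T″ disj′ a s b → ⊥
            both {s = s} X (near-b refl x∈ b∈ _) (near-b refl x∈″ b∈″ _) =
              same-ends T′ T″ disj″ (arcs-splitˢ [] X) x∈ b∈ x∈″ b∈″
            both X (near-a {r = r} refl x∈ a∈ _) (near-a {r = r″} eq x∈″ a∈″ _) with ∷ʳ-injective r r″ eq
            ... | refl , refl = same-ends T′ T″ disj″ (arcs-splitᵖ r X) a∈ x∈ a∈″ x∈″
            both X (near-b eq x∈ b∈ l) (near-a eq′ y∈ a∈ _) = no-mixed T′ T″ disj″ X eq x∈ b∈ eq′ y∈ a∈ (≤-trans two l)
              where two = (lin (δ ∷ []) (P ∷ []) ([]) (((lng (# 0) ⊕ κ 1) ≋ at 0) ∷ []) (κ 2) ((κ 1 ⊕ at 0)) 0 ((1 , 0) ∷ []) (P-size T , tt))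
            both X (near-a eq′ y∈ a∈ l) (near-b eq x∈ b∈ _) = no-mixed T″ T′ (λ p q → disj″ q p) X eq x∈ b∈ eq′ y∈ a∈ (≤-trans two l)
              where two = (lin (δ ∷ []) (P ∷ []) ([]) (((lng (# 0) ⊕ κ 1) ≋ at 0) ∷ []) (κ 2) ((κ 1 ⊕ at 0)) 0 ((1 , 0) ∷ []) (P-size T , tt))

          -- Only one arc can hold 1 + δ vertices, so both further clumps lie beside the same arc.
          -- At the same end they share their neighbours, at different ends they cross.
          no-three : ∀ {a s b t} → Arcs L a s b t → a ∈ N → b ∈ N → ⊥
          no-three {a} {s} {b} {t} X a∈ b∈ with beside-one T T′ disj X a∈ b∈ | beside-one T T″ disj′ X a∈ b∈
          ... | inj₁ B | inj₂ B″ = (1≰0 (lin (c ∷ δ ∷ []) (s ∷ t ∷ []) (a ∷ b ∷ []) ((at 0 ≼ (2 ⊗ (at 1) ⊕ κ 3)) ∷ (lng ((• 0 · (# 0 · (• 1 · # 1)))) ≋ at 0) ∷ ((κ 1 ⊕ at 1) ≼ lng (# 0)) ∷ ((κ 1 ⊕ at 1) ≼ lng (# 1)) ∷ []) (κ 1) (κ 0) 0 ((1 , 0) ∷ (1 , 0) ∷ (1 , 0) ∷ (1 , 0) ∷ []) (small , len X , long-of T T′ disj B , long-of T T″ disj′ B″ , tt)))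
          ... | inj₂ B | inj₁ B″ = (1≰0 (lin (c ∷ δ ∷ []) (s ∷ t ∷ []) (a ∷ b ∷ []) ((at 0 ≼ (2 ⊗ (at 1) ⊕ κ 3)) ∷ (lng ((• 0 · (# 0 · (• 1 · # 1)))) ≋ at 0) ∷ ((κ 1 ⊕ at 1) ≼ lng (# 1)) ∷ ((κ 1 ⊕ at 1) ≼ lng (# 0)) ∷ []) (κ 1) (κ 0) 0 ((1 , 0) ∷ (1 , 0) ∷ (1 , 0) ∷ (1 , 0) ∷ []) (small , len X , long-of T T′ disj B , long-of T T″ disj′ B″ , tt)))
          ... | inj₁ B | inj₁ B″ = both X B B″
          ... | inj₂ B | inj₂ B″ = both (arcs-swap X) B B″

      module _ {L : List V} (cycL : Cyc L) (max : Max (length L)) (small : length L ≤ 2 * δ + 3) where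

        open Exchange max
        open Bounds max
        open Chords max small

        -- Clumps with one vertex

        module Ones {x : V} {N : List V} (Cx : Clump L (x ∷ []) N) (δ≥3 : 3 ≤ δ) where

          R : List Seg → Set
          R = Rep L N

          x∉L : x ∉ L
          x∉L = C.offP Cx (here refl)

          x-nbr : ∀ {v} → E x v → v ∈ N
          x-nbr e with C.closed Cx (here refl) e
          ... | inj₁ (here refl) = ⊥-elim (E-irrefl e)
          ... | inj₂ p = p

          x-join : ∀ {v} → v ∈ N → E x v
          x-join = C.join Cx (here refl)

          |N| : length N ≡ δ
          |N| = suc-injective (C.count Cx)

          segs : ∀ {Z} → R Z → length Z ≡ δ
          segs {Z} r = trans (sym (length-map proj₁ Z)) (trans (≤-antisym
            (length-⊆ (heads-nodup Z (nodupᶻ r)) (λ p → All.lookup (headsM r) p))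
            (length-⊆ (C.ndN Cx) (λ p → M⊆heads r (C.N⊆L Cx p) p))) |N|)

          -- The excess over the minimal length 1. Since |L| is 2δ plus the total excess, that total
          -- is at most 3.
          exc : List Seg → ℕ
          exc []            = 0
          exc ((ξ , s) ∷ Z) = (length s ∸ 1) + exc Z

          exc-++ : ∀ X Y → exc (X ++ Y) ≡ exc X + exc Y
          exc-++ []            Y = refl
          exc-++ ((ξ , s) ∷ X) Y = trans (cong (length s ∸ 1 +_) (exc-++ X Y)) (sym (+-assoc (length s ∸ 1) _ _))

          seg≥1 : ∀ {ξ s Y} → R ((ξ , s) ∷ Y) → 1 ≤ length s
          seg≥1 {s = s} r = gap S tail≥1 [ x ] (E-sym (x-join (Single.ξ∈ S))) (x-join (Single.α∈ S))
                          (NoDup-single x) (λ { (here refl) p → x∉L (to r p) })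
            where
            S = single-seg r
            tail≥1 = s≤s⁻¹ (≤-trans (≤-trans (s≤s (s≤s z≤n)) δ≥3) (≤-reflexive (sym (segs r))))

          flatten-exc : ∀ X Y → R (X ++ Y) → length (flatten Y) ≡ 2 * length Y + exc Y
          flatten-exc X []            r = refl
          flatten-exc X ((ξ , s) ∷ Y) r =
            (≤-antisym (lin (length Y ∷ exc Y ∷ (length s ∸ 1) ∷ []) (flatten Y ∷ s ∷ []) (ξ ∷ []) ((lng (# 0) ≋ (2 ⊗ (at 0) ⊕ at 1)) ∷ ((at 2 ⊕ κ 1) ≋ lng (# 1)) ∷ []) (lng ((• 0 · (# 1 · # 0)))) ((2 ⊗ ((κ 1 ⊕ at 0)) ⊕ (at 2 ⊕ at 1))) 0 ((1 , 0) ∷ (0 , 1) ∷ []) (flatten-exc (X ++ (ξ , s) ∷ []) Y (subst R (sym (++-assoc X _ Y)) r) , m∸n+n≡m (seg≥1 (rep-rotate X r)) , tt)) (lin (length Y ∷ exc Y ∷ (length s ∸ 1) ∷ []) (flatten Y ∷ s ∷ []) (ξ ∷ []) ((lng (# 0) ≋ (2 ⊗ (at 0) ⊕ at 1)) ∷ ((at 2 ⊕ κ 1) ≋ lng (# 1)) ∷ []) ((2 ⊗ ((κ 1 ⊕ at 0)) ⊕ (at 2 ⊕ at 1))) (lng ((• 0 · (# 1 · # 0)))) 0 ((0 , 1) ∷ (1 , 0) ∷ []) (flatten-exc (X ++ (ξ , s) ∷ []) Y (subst R (sym (++-assoc X _ Y)) r) , m∸n+n≡m (seg≥1 (rep-rotate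 X r)) , tt)))

          exc≤3 : ∀ {Z} → R Z → exc Z ≤ 3
          exc≤3 {Z} r = (lin (length Z ∷ exc Z ∷ δ ∷ []) (flatten Z ∷ L ∷ []) ([]) ((lng (# 0) ≋ (2 ⊗ (at 0) ⊕ at 1)) ∷ (at 0 ≋ at 2) ∷ (lng (# 0) ≋ lng (# 1)) ∷ (lng (# 1) ≼ (2 ⊗ (at 2) ⊕ κ 3)) ∷ []) (at 1) (κ 3) 0 ((0 , 1) ∷ (0 , 2) ∷ (1 , 0) ∷ (1 , 0) ∷ []) (flatten-exc [] Z r , segs r , size r , small , tt))

          -- Two segments are counted with their full lengths, hence 5 = 3 + 2. Most impossible
          -- configurations below are discarded by this bound alone.
          pair-budget : ∀ {ξ s Y ξ′ s′ W} → R ((ξ , s) ∷ Y ++ (ξ′ , s′) ∷ W) → length s + exc Y + length s′ + exc W ≤ 5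
          pair-budget {ξ} {s} {Y} {ξ′} {s′} {W} r =
            (lin ((length s ∸ 1) ∷ exc (Y ++ (ξ′ , s′) ∷ W) ∷ exc Y ∷ (length s′ ∸ 1) ∷ exc W ∷ []) (s ∷ s′ ∷ []) ([]) (((at 0 ⊕ at 1) ≼ κ 3) ∷ (at 1 ≋ (at 2 ⊕ (at 3 ⊕ at 4))) ∷ ((at 0 ⊕ κ 1) ≋ lng (# 0)) ∷ ((at 3 ⊕ κ 1) ≋ lng (# 1)) ∷ []) ((((lng (# 0) ⊕ at 2) ⊕ lng (# 1)) ⊕ at 4)) (κ 5) 0 ((1 , 0) ∷ (0 , 1) ∷ (0 , 1) ∷ (0 , 1) ∷ []) (exc≤3 r , exc-++ Y ((ξ′ , s′) ∷ W) , m∸n+n≡m (seg≥1 r) , m∸n+n≡m (seg≥1 (rep-rotate ((ξ , s) ∷ Y) r)) , tt))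

          seg∉N : ∀ X {ξ s Y v} → R (X ++ (ξ , s) ∷ Y) → v ∈ s → v ∉ N
          seg∉N X r v∈ = All.lookup (All.head (++⁻ʳ X (offM r))) v∈

          pair-off : ∀ {ξ s Y ξ′ s′ W v} → R ((ξ , s) ∷ Y ++ (ξ′ , s′) ∷ W) → v ∉ L → v ∉ ξ ∷ s ++ flatten Y ++ ξ′ ∷ s′ ++ flatten W
          pair-off {ξ} {s} {Y} {ξ′} {s′} {W} r v∉ v∈ = v∉ (to r (∈-resp (sym (flatten-pair ξ s Y ξ′ s′ W)) v∈))

          module _ {ξ o₁ y r₁ Y ξ′ o₂ z r₂ W} (r : R ((ξ , o₁ ++ y ∷ r₁) ∷ Y ++ (ξ′ , o₂ ++ z ∷ r₂) ∷ W))
                   {ls : List V} (l : Lk y ls z) (nd : NoDup ls) (off : ∀ {v} → v ∈ ls → v ∉ L) where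

            private
              module P = Pair (pair r)

              x∉ls : ∀ ls → Lk y ls z → (∀ {v} → v ∈ ls → v ∉ L) → x ∉ ls
              x∉ls (w ∷ ls) l off x∈ with lk-inner l
              ... | _ , e , p , _ with C-stays Cx (con-sym (path-con∈ p off x∈)) (here refl)
              ...   | here refl = seg∉N [] r (∈-++⁺ʳ o₁ (here refl)) (x-nbr (E-sym e))

              nd₁ : NoDup ((x ∷ []) ++ ls)
              nd₁ = NoDup-∷ (x∉ls ls l off) nd

              off₁ : ∀ {v} → v ∈ x ∷ ls → v ∉ ξ ∷ (o₁ ++ y ∷ r₁) ++ flatten Y ++ ξ′ ∷ (o₂ ++ z ∷ r₂) ++ flatten W
              off₁ (here refl) = pair-off r x∉L
              off₁ (there p)   = pair-off r (off p)

            link-before : 1 + length ls ≤ length o₁ + length o₂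
            link-before = (lin ([]) (ls ∷ o₁ ∷ o₂ ∷ []) ([]) (((κ 1 ⊕ lng (rev (# 0))) ≼ (lng (# 1) ⊕ lng (# 2))) ∷ []) ((κ 1 ⊕ lng (# 0))) ((lng (# 1) ⊕ lng (# 2))) 0 ((1 , 0) ∷ []) (reroute₁ (pair r) [ x ] (E-sym (x-join P.ξ′∈)) (x-join P.ξ∈) (lk-reverse ls l)
                ((nodup⊆ (ls ∷ []) (x ∷ []) (((• 0 · ε) · rev (# 0))) (((• 0 · ε) · # 0)) (nd₁)))
                (λ { (here refl) → off₁ (here refl) ; (there p) → off₁ (there (reverse⁻ p)) }) , tt))

            link-after : 1 + length ls ≤ length r₁ + length r₂
            link-after = reroute₂ (pair r) [ x ] (E-sym (x-join P.α∈)) (x-join P.β∈) l nd₁ off₁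

            -- A link with an inner vertex needs two vertices before and two behind `y` and `z`, six
            -- in both segments together.
            link-edge : ls ≡ []
            link-edge = empty ls link-before link-after
              where
              empty : ∀ ls → 1 + length ls ≤ length o₁ + length o₂ → 1 + length ls ≤ length r₁ + length r₂ → ls ≡ []
              empty []       b a = refl
              empty (l ∷ ls) b a =
                (1≰0 (lin (exc Y ∷ exc W ∷ []) (ls ∷ o₁ ∷ o₂ ∷ r₁ ∷ r₂ ∷ []) (y ∷ z ∷ []) (((κ 1 ⊕ (κ 1 ⊕ lng (# 0))) ≼ (lng (# 1) ⊕ lng (# 2))) ∷ ((κ 1 ⊕ (κ 1 ⊕ lng (# 0))) ≼ (lng (# 3) ⊕ lng (# 4))) ∷ ((((lng ((# 1 · (• 0 · # 3))) ⊕ at 0) ⊕ lng ((# 2 · (• 1 · # 4)))) ⊕ at 1) ≼ κ 5) ∷ []) (κ 1) (κ 0) 0 ((1 , 0) ∷ (1 , 0) ∷ (1 , 0) ∷ []) (b , a , pair-budget r , tt)))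

          edge-before : ∀ {ξ o₁ y r₁ Y ξ′ o₂ z r₂ W} → R ((ξ , o₁ ++ y ∷ r₁) ∷ Y ++ (ξ′ , o₂ ++ z ∷ r₂) ∷ W) → E y z →
                        1 ≤ length o₁ + length o₂
          edge-before r e = link-before r {ls = []} e NoDup-[] λ ()

          edge-after : ∀ {ξ o₁ y r₁ Y ξ′ o₂ z r₂ W} → R ((ξ , o₁ ++ y ∷ r₁) ∷ Y ++ (ξ′ , o₂ ++ z ∷ r₂) ∷ W) → E y z →
                       1 ≤ length r₁ + length r₂
          edge-after r e = link-after r {ls = []} e NoDup-[] λ ()

          -- These are the representations to be refuted. If instead all segments have length 2, the
          -- excess is δ, and so δ = 3.
          Odd : List Seg → Set
          Odd Z = Any (λ σ → length (proj₂ σ) ≢ 2) Z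

          odd-rotate : ∀ X {Y} → Odd (X ++ Y) → Odd (Y ++ X)
          odd-rotate X {Y} o = [ any-++ʳ Y , any-++ˡ ]′ (any-++⁻ X o)

          -- In the reversed order a stretch belongs to the cutting vertex that used to follow it.
          -- The chain records this vertex, so the recursion runs over the chain.
          rc : ∀ {a Y b} → Chain a Y b → List Seg
          rc []                     = []
          rc (_∷_ {s = s} {ζ} l ch) = rc ch ++ (ζ , reverse s) ∷ []

          rc-chain : ∀ {a Y b} (ch : Chain a Y b) → Chain b (rc ch) a
          rc-chain []               = []
          rc-chain (_∷_ {s = s} l ch) = chain-++⁺ (rc-chain ch) (lk-reverse s l ∷ [])

          rc-++ : ∀ {a X m Y b} (c₁ : Chain a X m) (c₂ : Chain m Y b) → rc (chain-++⁺ c₁ c₂) ≡ rc c₂ ++ rc c₁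
          rc-++ []       c₂ = sym (++-identityʳ (rc c₂))
          rc-++ (l ∷ c₁) c₂ = trans (cong (_++ _) (rc-++ c₁ c₂)) (++-assoc (rc c₂) _ _)

          rc-cnt : ∀ {a Y b} (ch : Chain a Y b) v → cnt v (flatten (rc ch)) + single v a ≡ cnt v (flatten Y) + single v b
          rc-cnt []                             v = refl
          rc-cnt (_∷_ {ξ} {s} {ζ} {Y} {η} l ch) v =
            (≤-antisym (lin {A = ⊤} (cnt v (flatten (rc ch ++ (ζ , reverse s) ∷ [])) ∷ cnt v (flatten (rc ch) ++ ζ ∷ reverse s ++ []) ∷ cnt v (flatten (rc ch)) ∷ single v ζ ∷ cnt v (reverse s ++ []) ∷ cnt v (reverse s) ∷ cnt v s ∷ cnt v (s ++ flatten Y) ∷ cnt v (flatten Y) ∷ single v η ∷ single v ξ ∷ []) ([]) ([]) ((at 0 ≋ at 1) ∷ (at 1 ≋ (at 2 ⊕ (at 3 ⊕ at 4))) ∷ (at 4 ≋ at 5) ∷ (at 5 ≋ at 6) ∷ (at 7 ≋ (at 6 ⊕ at 8)) ∷ ((at 2 ⊕ at 3) ≋ (at 8 ⊕ at 9)) ∷ []) ((at 0 ⊕ at 10)) (((at 10 ⊕ at 7) ⊕ at 9)) 0 ((1 , 0) ∷ (1 , 0) ∷ (1 , 0) ∷ (1 , 0) ∷ (0 , 1) ∷ (1 , 0) ∷ []) (cong (cnt v) (flatten-++ (rc ch) _) , cnt-++ v (flatten (rc ch)) _ , cong (cnt v) (++-identityʳ (reverse s)) , cnt-reverse v s , cnt-++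 v s (flatten Y) , rc-cnt ch v , tt)) (lin {A = ⊤} (cnt v (flatten (rc ch ++ (ζ , reverse s) ∷ [])) ∷ cnt v (flatten (rc ch) ++ ζ ∷ reverse s ++ []) ∷ cnt v (flatten (rc ch)) ∷ single v ζ ∷ cnt v (reverse s ++ []) ∷ cnt v (reverse s) ∷ cnt v s ∷ cnt v (s ++ flatten Y) ∷ cnt v (flatten Y) ∷ single v η ∷ single v ξ ∷ []) ([]) ([]) ((at 0 ≋ at 1) ∷ (at 1 ≋ (at 2 ⊕ (at 3 ⊕ at 4))) ∷ (at 4 ≋ at 5) ∷ (at 5 ≋ at 6) ∷ (at 7 ≋ (at 6 ⊕ at 8)) ∷ ((at 2 ⊕ at 3) ≋ (at 8 ⊕ at 9)) ∷ []) (((at 10 ⊕ at 7) ⊕ at 9)) ((at 0 ⊕ at 10)) 0 ((0 , 1) ∷ (0 , 1) ∷ (0 , 1) ∷ (0 , 1) ∷ (1 , 0) ∷ (0 , 1) ∷ []) (cong (cnt v) (flatten-++ (rc ch) _) , cnt-++ v (flatten (rc ch)) _ , cong (cnt v) (++-identityʳ (reverse s)) , cnt-reverse v s , cnt-++ v s (flatten Y) , rc-cnt ch v , tt)))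

          rc-size : ∀ {a Y b} (ch : Chain a Y b) → length (flatten (rc ch)) ≡ length (flatten Y)
          rc-size []                         = refl
          rc-size (_∷_ {ξ} {s} {ζ} {Y} l ch) =
            (≤-antisym (lin (length (flatten (rc ch ++ (ζ , reverse s) ∷ [])) ∷ []) (flatten (rc ch) ∷ s ∷ flatten Y ∷ []) (ζ ∷ ξ ∷ []) ((at 0 ≋ lng ((# 0 · (• 0 · (rev (# 1) · ε))))) ∷ (lng (# 0) ≋ lng (# 2)) ∷ []) (at 0) (lng ((• 1 · (# 1 · # 2)))) 0 ((1 , 0) ∷ (1 , 0) ∷ []) (cong length (flatten-++ (rc ch) _) , rc-size ch , tt)) (lin (length (flatten (rc ch ++ (ζ , reverse s) ∷ [])) ∷ []) (flatten (rc ch) ∷ s ∷ flatten Y ∷ []) (ζ ∷ ξ ∷ []) ((at 0 ≋ lng ((# 0 · (• 0 · (rev (# 1) · ε))))) ∷ (lng (# 0) ≋ lng (# 2)) ∷ []) (lng ((• 1 · (# 1 · # 2)))) (at 0) 0 ((0 , 1) ∷ (0 , 1) ∷ []) (cong length (flatten-++ (rc ch) _) , rc-size ch , tt)))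

          rc-heads : ∀ {M : List V} {a Y b} (ch : Chain a Y b) → All (_∈ M) (heads Y ++ b ∷ []) → All (_∈ M) (heads (rc ch))
          rc-heads []                   h       = []
          rc-heads {M} (_∷_ {s = s} {ζ} l ch) (_ ∷ h) =
            subst (All (_∈ M)) (sym (map-++ proj₁ (rc ch) _)) (++⁺ (rc-heads ch h) (All.lookup h (chain-start∈ ch) ∷ []))

          rc-off : ∀ {M : List V} {a Y b} (ch : Chain a Y b) → All (λ σ → All (_∉ M) (proj₂ σ)) Y → All (λ σ → All (_∉ M) (proj₂ σ)) (rc ch)
          rc-off []       h       = []
          rc-off (l ∷ ch) (o ∷ h) = ++⁺ (rc-off ch h) (All.tabulate (λ p → All.lookup o (reverse⁻ p)) ∷ [])

          rc-odd : ∀ {a Y b} (ch : Chain a Y b) → Odd Y → Odd (rc ch)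
          rc-odd (_∷_ {s = s} l ch) (here p)  = any-++ʳ (rc ch) (here λ eq → p (trans (sym (length-reverse s)) eq))
          rc-odd (l ∷ ch)           (there o) = any-++ˡ (rc-odd ch o)

          rep-reverse : ∀ {a Z} (ch : Chain a Z a) → R Z → R (rc ch)
          rep-reverse {a} {Z} ch r = record
            { chain = rc-chain ch ; nodupᶻ = nodup (λ v → ≤-trans (≤-reflexive (eq v)) (once (nodupᶻ r) v))
            ; size = trans (rc-size ch) (size r)
            ; to = λ {v} p → to r (cnt⇒∈ _ (≤-trans (∈⇒cnt p) (≤-reflexive (eq v))))
            ; from = λ {v} p → cnt⇒∈ _ (≤-trans (∈⇒cnt (from r p)) (≤-reflexive (sym (eq v))))
            ; headsM = rc-heads ch (++⁺ (headsM r) (a∈ ch ∷ []))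
            ; offM = rc-off ch (offM r) }
            where
            eq : ∀ v → cnt v (flatten (rc ch)) ≡ cnt v (flatten Z)
            eq v = +-cancelʳ-≡ (single v a) _ _ (rc-cnt ch v)
            a∈ : Chain a Z a → a ∈ N
            a∈ (l ∷ ch) = All.head (headsM r)
            a∈ [] = ⊥-elim (<⇒≱ {0} {3} (s≤s z≤n) (≤-trans δ≥3 (≤-reflexive (sym (segs r)))))

          -- Mirror symmetry: the two stretches are reversed, their heads become `α` and `β`, and
          -- `Y` and `W` change places.
          pair-reverse : ∀ {ξ s Y ξ′ s′ W} → R ((ξ , s) ∷ Y ++ (ξ′ , s′) ∷ W) → Odd ((ξ , s) ∷ Y ++ (ξ′ , s′) ∷ W) →
                         (∀ {α W′ β Y′} → R ((α , reverse s) ∷ W′ ++ (β , reverse s′) ∷ Y′) →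
                                          Odd ((α , reverse s) ∷ W′ ++ (β , reverse s′) ∷ Y′) → ⊥) → ⊥
          pair-reverse {ξ} {s} {Y} {ξ′} {s′} {W} r o k = k {α} {rc chW} {β} {rc chY}
            (subst R (++-assoc ((α , reverse s) ∷ rc chW) _ _) (rep-rotate (rc chY) (rep-rotate′ (subst R eq (rep-reverse ch r)))))
            (subst Odd (++-assoc ((α , reverse s) ∷ rc chW) _ _) (odd-rotate (rc chY) (odd-rotate′ (subst Odd eq (rc-odd ch o)))))
            where
            open Pair (pair r)
            ch : Chain ξ ((ξ , s) ∷ Y ++ (ξ′ , s′) ∷ W) ξ
            ch = lk ∷ chain-++⁺ chY (lk′ ∷ chW)
            Z′ = rc chW ++ (β , reverse s′) ∷ rc chY ++ (α , reverse s) ∷ []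
            eq : rc ch ≡ Z′
            eq = trans (cong (_++ (α , reverse s) ∷ []) (rc-++ chY (lk′ ∷ chW)))
                       (trans (++-assoc (rc chW ++ _) (rc chY) _) (++-assoc (rc chW) _ _))
            rep-rotate′ : R Z′ → R (rc chY ++ (α , reverse s) ∷ rc chW ++ (β , reverse s′) ∷ [])
            rep-rotate′ q = subst R (++-assoc (rc chY) _ _)
              (rep-rotate (rc chW ++ (β , reverse s′) ∷ []) (subst R (sym (++-assoc (rc chW) _ _)) q))
            odd-rotate′ : Odd Z′ → Odd (rc chY ++ (α , reverse s) ∷ rc chW ++ (β , reverse s′) ∷ [])
            odd-rotate′ q = subst Odd (++-assoc (rc chY) _ _)
              (odd-rotate (rc chW ++ (β , reverse s′) ∷ []) (subst Odd (sym (++-assoc (rc chW) _ _)) q))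

          -- An edge from the first vertex y of a segment to the second vertex z of another one frees the first
          -- vertex v of the latter: rerouting through y z and x gives a longest cycle L″ without v.
          module Tight {ξ y r Y ξ′ v z r′ W} (ρ : R ((ξ , y ∷ r) ∷ Y ++ (ξ′ , v ∷ z ∷ r′) ∷ W)) (e : E y z) where

            module P = Pair (pair ρ)
            open P using (α; β) public

            A B L″ everything : List V
            A = y ∷ r ++ arc Y ξ′
            B = z ∷ r′ ++ arc W ξ
            L″ = A ++ x ∷ reverse B
            everything = ξ ∷ (y ∷ r) ++ flatten Y ++ ξ′ ∷ (v ∷ z ∷ r′) ++ flatten W

            in-all : ∀ {w} → w ∈ L → w ∈ everything
            in-all w∈ = ∈-resp (flatten-pair ξ (y ∷ r) Y ξ′ (v ∷ z ∷ r′) W) (from ρ w∈)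

            all-in : ∀ {w} → w ∈ everything → w ∈ L
            all-in w∈ = to ρ (∈-resp (sym (flatten-pair ξ (y ∷ r) Y ξ′ (v ∷ z ∷ r′) W)) w∈)

            path-A : Path y A ξ′
            path-A = lk-path (proj₂ P.lk) P.arcY

            path-B : Path z B ξ
            path-B = lk-path (proj₂ (proj₂ P.lk′)) P.arcW

            ξ-y : E ξ y
            ξ-y = proj₁ P.lk

            ξ′-v : E ξ′ v
            ξ′-v = proj₁ P.lk′

            v-z : E v z
            v-z = proj₁ (proj₂ P.lk′)

            x-N : ∀ {w} → w ∈ N → E w x
            x-N w∈ = E-sym (x-join w∈)

            nd-x : NoDup (x ∷ ξ ∷ (y ∷ r) ++ flatten Y ++ ξ′ ∷ (v ∷ z ∷ r′) ++ flatten W)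
            nd-x = NoDup-∷ (λ p → x∉L (all-in p)) P.nd

            path-L″ : Path y L″ z
            path-L″ = path-A ⟨ x-N P.ξ′∈ ⟩ ([ x ] ⟨ x-join P.ξ∈ ⟩ path-reverse path-B)

            nd-L″ : NoDup L″
            nd-L″ = (nodup⊆ (r ∷ flatten Y ∷ r′ ∷ flatten W ∷ []) (x ∷ ξ ∷ y ∷ ξ′ ∷ v ∷ z ∷ []) (((• 2 · (# 0 · (# 1 · (• 3 · ε)))) · (• 0 · rev ((• 5 · (# 2 · (# 3 · (• 1 · ε)))))))) ((• 0 · (• 1 · ((• 2 · # 0) · (# 1 · (• 3 · ((• 4 · (• 5 · # 2)) · # 3))))))) (nd-x))

            len-L″ : length L″ ≡ length L
            len-L″ = (≤-antisym (lin ([]) (r ∷ flatten Y ∷ r′ ∷ flatten W ∷ L ∷ []) (ξ ∷ y ∷ ξ′ ∷ v ∷ z ∷ x ∷ []) ((lng ((• 0 · ((• 1 · # 0) · (# 1 · (• 2 · ((• 3 · (• 4 · # 2)) · # 3)))))) ≋ lng (# 4)) ∷ []) (lng (((• 1 · (# 0 · (# 1 · (• 2 · ε)))) · (• 5 · rev ((• 4 · (# 2 · (# 3 · (• 0 · ε))))))))) (lng (# 4)) 0 ((1 , 0) ∷ []) (P.len , tt)) (lin ([]) (r ∷ flatten Y ∷ r′ ∷ flatten W ∷ L ∷ []) (ξ ∷ y ∷ ξ′ ∷ v ∷ z ∷ x ∷ []) ((lng ((• 0 · ((• 1 · # 0) · (# 1 · (• 2 · ((• 3 · (• 4 · # 2))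 · # 3)))))) ≋ lng (# 4)) ∷ []) (lng (# 4)) (lng (((• 1 · (# 0 · (# 1 · (• 2 · ε)))) · (• 5 · rev ((• 4 · (# 2 · (# 3 · (• 0 · ε))))))))) 0 ((0 , 1) ∷ []) (P.len , tt)))

            cyc-L″ : Cyc L″
            cyc-L″ = cyc nd-L″ (≤-trans (longᶜ cycL) (≤-reflexive (sym len-L″))) path-L″ (E-sym e)

            v∈L : v ∈ L
            v∈L = all-in ((∈⊆ (r ∷ flatten Y ∷ r′ ∷ flatten W ∷ []) (v ∷ ξ ∷ y ∷ ξ′ ∷ z ∷ []) ((• 0 · ε)) ((• 1 · ((• 2 · # 0) · (# 1 · (• 3 · ((• 0 · (• 4 · # 2)) · # 3)))))) (here refl)))

            v∉L″ : v ∉ L″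
            v∉L″ p = NoDup-disjoint {v ∷ []} {L″}
              ((nodup⊆ (r ∷ flatten Y ∷ r′ ∷ flatten W ∷ []) (x ∷ ξ ∷ y ∷ ξ′ ∷ v ∷ z ∷ []) (((• 4 · ε) · ((• 2 · (# 0 · (# 1 · (• 3 · ε)))) · (• 0 · rev ((• 5 · (# 2 · (# 3 · (• 1 · ε))))))))) ((• 0 · (• 1 · ((• 2 · # 0) · (# 1 · (• 3 · ((• 4 · (• 5 · # 2)) · # 3))))))) (nd-x)))
              (here refl) p

            rest : ∀ {w} → w ∈ L → w ≢ v → w ∈ L″
            rest {w} w∈ w≢v with (∈⊆ (r ∷ flatten Y ∷ r′ ∷ flatten W ∷ []) (ξ ∷ y ∷ ξ′ ∷ v ∷ z ∷ x ∷ []) ((• 0 · ((• 1 · # 0) · (# 1 · (• 2 · ((• 3 · (• 4 · # 2)) · # 3)))))) ((• 3 · ((• 1 · (# 0 · (# 1 · (• 2 · ε)))) · (• 5 · rev ((• 4 · (# 2 · (# 3 · (• 0 · ε))))))))) (in-all w∈))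
            ... | here eq = contradiction eq w≢v
            ... | there p = p

            L″-in : ∀ {w} → w ∈ L″ → w ≡ x ⊎ w ∈ L
            L″-in p with (∈⊆ (r ∷ flatten Y ∷ r′ ∷ flatten W ∷ []) (y ∷ ξ′ ∷ x ∷ z ∷ ξ ∷ v ∷ []) (((• 0 · (# 0 · (# 1 · (• 1 · ε)))) · (• 2 · rev ((• 3 · (# 2 · (# 3 · (• 4 · ε)))))))) ((• 2 · (• 4 · ((• 0 · # 0) · (# 1 · (• 1 · ((• 5 · (• 3 · # 2)) · # 3))))))) (p))
            ... | here eq = inj₁ eq
            ... | there q = inj₂ (all-in q)

            free : ¬ ¬ (∃[ N* ] Clump L″ (v ∷ []) N*)
            free = lone cycL refl cyc-L″ len-L″ v∉L″ rest (end∈ path-L″) v-z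
              (path-B ⟨ ξ-y ⟩ (path-A ⟨ ξ′-v ⟩ [ v ]))
              ((nodup⊆ (r ∷ flatten Y ∷ r′ ∷ flatten W ∷ []) (x ∷ ξ ∷ y ∷ ξ′ ∷ v ∷ z ∷ []) (((• 5 · (# 2 · (# 3 · (• 1 · ε)))) · ((• 2 · (# 0 · (# 1 · (• 3 · ε)))) · (• 4 · ε)))) ((• 0 · (• 1 · ((• 2 · # 0) · (# 1 · (• 3 · ((• 4 · (• 5 · # 2)) · # 3))))))) (nd-x)))
              (λ p → all-in ((∈⊆ (r′ ∷ flatten W ∷ r ∷ flatten Y ∷ []) (z ∷ ξ ∷ y ∷ ξ′ ∷ v ∷ []) (((• 0 · (# 0 · (# 1 · (• 1 · ε)))) · ((• 2 · (# 2 · (# 3 · (• 3 · ε)))) · (• 4 · ε)))) ((• 1 · ((• 2 · # 2) · (# 3 · (• 3 · ((• 4 · (• 0 · # 0)) · # 1)))))) (p))))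
              ((≤-antisym (lin ([]) (r ∷ flatten Y ∷ r′ ∷ flatten W ∷ L ∷ []) (ξ ∷ y ∷ ξ′ ∷ v ∷ z ∷ []) ((lng ((• 0 · ((• 1 · # 0) · (# 1 · (• 2 · ((• 3 · (• 4 · # 2)) · # 3)))))) ≋ lng (# 4)) ∷ []) (lng (((• 4 · (# 2 · (# 3 · (• 0 · ε)))) · ((• 1 · (# 0 · (# 1 · (• 2 · ε)))) · (• 3 · ε))))) (lng (# 4)) 0 ((1 , 0) ∷ []) (P.len , tt)) (lin ([]) (r ∷ flatten Y ∷ r′ ∷ flatten W ∷ L ∷ []) (ξ ∷ y ∷ ξ′ ∷ v ∷ z ∷ []) ((lng ((• 0 · ((• 1 · # 0) · (# 1 · (• 2 · ((• 3 · (• 4 · # 2)) · # 3)))))) ≋ lng (# 4)) ∷ []) (lng (# 4)) (lng (((• 4 · (# 2 · (# 3 · (• 0 · ε)))) · ((• 1 · (# 0 · (# 1 · (• 2 · ε)))) · (• 3 · ε))))) 0 ((0 , 1) ∷ []) (P.len , tt))))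

            module Free {N* : List V} (C* : Clump L″ (v ∷ []) N*) where

              |N*| : length N* ≡ δ
              |N*| = suc-injective (C.count C*)

              N*-E : ∀ {w} → w ∈ N* → E v w
              N*-E = C.join C* (here refl)

              E-N* : ∀ {w} → E v w → w ∈ N*
              E-N* e with C.closed C* (here refl) e
              ... | inj₁ (here refl) = ⊥-elim (E-irrefl e)
              ... | inj₂ p = p

              nbr-in-L : ∀ {w} → E v w → w ∈ L
              nbr-in-L ew with L″-in (C.N⊆L C* (E-N* ew))
              ... | inj₂ p = p
              ... | inj₁ refl = ⊥-elim (seg∉N ((ξ , y ∷ r) ∷ Y) ρ (here refl) (x-nbr (E-sym ew)))

              -- No two consecutive vertices of L″ are both adjacent to v.
              consec : ∀ {u D w} → Path u D w → NoDup D → (∀ {t} → t ∈ D → t ∈ L″) → length D ≡ length L → u ≢ w →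
                       E v u → E v w → ⊥
              consec {D = D} p nd sub len u≢w eu ew =
                (1≰0 (lin ([]) (D ∷ L ∷ []) ([]) (((lng (# 0) ⊕ κ 1) ≼ lng (# 1)) ∷ (lng (# 0) ≋ lng (# 1)) ∷ []) (κ 1) (κ 0) 0 ((1 , 0) ∷ (0 , 1) ∷ []) (far C* p nd sub u≢w (E-N* eu) (E-N* ew) , len , tt)))

              v≁y : ¬ E v y
              v≁y ey = consec path-L″ nd-L″ (λ p → p) len-L″ (E⇒≢ e) ey v-z

              -- The vertex after `z` on `L` is still next to `z` on `L″`, and `v` is adjacent to
              -- `z`.
              v≁z⁺ : ∀ {z⁺ D} → r′ ++ arc W ξ ≡ D → Path z⁺ D ξ → ¬ E v z⁺
              v≁z⁺ {D = D} refl p ez = consec {D = z ∷ (y ∷ r ++ arc Y ξ′) ++ x ∷ reverse (r′ ++ arc W ξ)}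
                (E-sym e ∷ (path-A ⟨ x-N P.ξ′∈ ⟩ ([ x ] ⟨ x-join P.ξ∈ ⟩ path-reverse p)))
                ((nodup⊆ (r ∷ flatten Y ∷ r′ ∷ flatten W ∷ []) (x ∷ ξ ∷ y ∷ ξ′ ∷ v ∷ z ∷ []) ((• 5 · ((• 2 · (# 0 · (# 1 · (• 3 · ε)))) · (• 0 · rev ((# 2 · (# 3 · (• 1 · ε)))))))) ((• 0 · (• 1 · ((• 2 · # 0) · (# 1 · (• 3 · ((• 4 · (• 5 · # 2)) · # 3))))))) (nd-x)))
                (λ q → (∈⊆ (r ∷ flatten Y ∷ r′ ∷ flatten W ∷ []) (z ∷ y ∷ ξ′ ∷ x ∷ ξ ∷ []) ((• 0 · ((• 1 · (# 0 · (# 1 · (• 2 · ε)))) · (• 3 · rev ((# 2 · (# 3 · (• 4 · ε)))))))) (((• 1 · (# 0 · (# 1 · (• 2 · ε)))) · (• 3 · rev ((• 0 · (# 2 · (# 3 · (• 4 · ε)))))))) (q)))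
                ((≤-antisym (lin ([]) (r ∷ flatten Y ∷ r′ ∷ flatten W ∷ L ∷ []) (ξ ∷ y ∷ ξ′ ∷ v ∷ z ∷ x ∷ []) ((lng ((• 0 · ((• 1 · # 0) · (# 1 · (• 2 · ((• 3 · (• 4 · # 2)) · # 3)))))) ≋ lng (# 4)) ∷ []) (lng ((• 4 · ((• 1 · (# 0 · (# 1 · (• 2 · ε)))) · (• 5 · rev ((# 2 · (# 3 · (• 0 · ε))))))))) (lng (# 4)) 0 ((1 , 0) ∷ []) (P.len , tt)) (lin ([]) (r ∷ flatten Y ∷ r′ ∷ flatten W ∷ L ∷ []) (ξ ∷ y ∷ ξ′ ∷ v ∷ z ∷ x ∷ []) ((lng ((• 0 · ((• 1 · # 0) · (# 1 · (• 2 · ((• 3 · (• 4 · # 2)) · # 3)))))) ≋ lng (# 4)) ∷ []) (lng (# 4)) (lng ((• 4 · ((• 1 · (# 0 · (# 1 · (• 2 · ε)))) · (• 5 · rev ((# 2 · (# 3 · (• 0 · ε))))))))) 0 ((0 , 1) ∷ []) (P.len , tt))))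
                (λ { refl → NoDup-disjoint {z ∷ []} {r′ ++ arc W ξ} ((nodup⊆ (r ∷ flatten Y ∷ r′ ∷ flatten W ∷ []) (x ∷ ξ ∷ y ∷ ξ′ ∷ v ∷ z ∷ []) (((• 5 · ε) · (# 2 · (# 3 · (• 1 · ε))))) ((• 0 · (• 1 · ((• 2 · # 0) · (# 1 · (• 3 · ((• 4 · (• 5 · # 2)) · # 3))))))) (nd-x))) (here refl) (start∈ p) })
                v-z ez

            data Spot (w : V) : Set where
              at-N : w ∈ N → Spot w
              at-s : w ∈ y ∷ r → Spot w
              at-s′ : w ∈ v ∷ z ∷ r′ → Spot w
              at-Y : ∀ {X η t X′} → Y ≡ X ++ (η , t) ∷ X′ → w ∈ t → Spot w
              at-W : ∀ {X η t X′} → W ≡ X ++ (η , t) ∷ X′ → w ∈ t → Spot w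

            headsY : ∀ {w} → w ∈ heads Y → w ∈ N
            headsY p = All.lookup (headsM ρ) (there (∈-resp (sym (map-++ proj₁ Y _)) (∈-++⁺ˡ p)))

            headsW : ∀ {w} → w ∈ heads W → w ∈ N
            headsW p = All.lookup (headsM ρ) (there (∈-resp (sym (map-++ proj₁ Y _)) (∈-++⁺ʳ (heads Y) (there p))))

            spot : ∀ {w} → w ∈ L → Spot w
            spot {w} w∈ with in-all w∈
            ... | here refl = at-N P.ξ∈
            ... | there p with ∈-++⁻ (y ∷ r) p
            ...   | inj₁ q = at-s q
            ...   | inj₂ q with ∈-++⁻ (flatten Y) q
            ...     | inj₂ (here refl) = at-N P.ξ′∈
            ...     | inj₁ q′ with w ∈? heads Y
            ...       | yes h = at-N (headsY h)
            ...       | no ¬h with locate Y q′ ¬h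
            ...         | _ , _ , _ , _ , eq , w∈t = at-Y eq w∈t
            spot {w} w∈ | there p | inj₂ q | inj₂ (there q′) with ∈-++⁻ (v ∷ z ∷ r′) q′
            ... | inj₁ h = at-s′ h
            ... | inj₂ h with w ∈? heads W
            ...   | yes h′ = at-N (headsW h′)
            ...   | no ¬h′ with locate W h ¬h′
            ...     | _ , _ , _ , _ , eq , w∈t = at-W eq w∈t

            -- The representation starting at the segment of v, a segment of W or Y coming next.
            ρ-W : ∀ {X η t X′} → W ≡ X ++ (η , t) ∷ X′ →
                  R ((ξ′ , v ∷ z ∷ r′) ∷ X ++ (η , t) ∷ X′ ++ (ξ , y ∷ r) ∷ Y)
            ρ-W {X} {η} {t} {X′} refl = subst (λ Z → R ((ξ′ , v ∷ z ∷ r′) ∷ Z)) (++-assoc X ((η , t) ∷ X′) ((ξ , y ∷ r) ∷ Y)) (rep-rotate ((ξ , y ∷ r) ∷ Y) ρ)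

            ρ-Y : ∀ {X η t X′} → Y ≡ X ++ (η , t) ∷ X′ →
                  R ((ξ′ , v ∷ z ∷ r′) ∷ (W ++ (ξ , y ∷ r) ∷ X) ++ (η , t) ∷ X′)
            ρ-Y {X} {η} {t} {X′} refl = subst (λ Z → R ((ξ′ , v ∷ z ∷ r′) ∷ Z)) (sym (++-assoc W ((ξ , y ∷ r) ∷ X) ((η , t) ∷ X′))) (rep-rotate ((ξ , y ∷ r) ∷ Y) ρ)

            -- The budget of 5 after paying for `y`, `v` and `z`.
            budget : length r + exc Y + length r′ + exc W ≤ 2
            budget = (lin (exc Y ∷ exc W ∷ []) (r ∷ r′ ∷ []) (y ∷ v ∷ z ∷ []) (((((lng ((• 0 · # 0)) ⊕ at 0) ⊕ lng ((• 1 · (• 2 · # 1)))) ⊕ at 1) ≼ κ 5) ∷ []) ((((lng (# 0) ⊕ at 0) ⊕ lng (# 1)) ⊕ at 1)) (κ 2) 0 ((1 , 0) ∷ []) (pair-budget ρ , tt))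

            r+r′≥1 : 1 ≤ length r + length r′
            r+r′≥1 = edge-after {o₁ = []} {o₂ = v ∷ []} ρ e

            exc-at : ∀ X {η t X′} → exc (X ++ (η , t) ∷ X′) ≡ exc X + ((length t ∸ 1) + exc X′)
            exc-at X {η} {t} {X′} = exc-++ X ((η , t) ∷ X′)

            -- A further segment adjacent to v is [p , w] with w the neighbour.
            third : ∀ {X η t X′ w} → R ((ξ′ , v ∷ z ∷ r′) ∷ X ++ (η , t) ∷ X′) → length t ≤ 2 → w ∈ t → E v w →
                    ∃[ p ] (t ≡ p ∷ w ∷ [])
            third {t = t} q t≤2 w∈ ew with ∈-∃++ w∈
            ... | [] , _ , refl with edge-before {o₁ = []} {o₂ = []} q ew
            ...   | ()
            third q t≤2 w∈ ew | p ∷ [] , [] , refl = p , refl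
            third q (s≤s (s≤s ())) w∈ ew | p ∷ [] , _ ∷ _ , refl
            third q (s≤s (s≤s ())) w∈ ew | p ∷ p′ ∷ [] , _ , refl
            third q (s≤s (s≤s ())) w∈ ew | p ∷ p′ ∷ _ ∷ _ , _ , refl

          too-long : ∀ {a D b} → Path a D b → E b a → NoDup D → length L < length D → ⊥
          too-long p e nd l = <⇒≱ l (max (cyc nd (≤-trans (longᶜ cycL) (<⇒≤ l)) p e))

          -- A segment with a single vertex u can be exchanged with x, so that u is a clump as well.
          module Trivial {η u X} (r : R ((η , u ∷ []) ∷ X)) where

            open Single (single-seg r)

            private
              path-X : Path α (arc X η) η
              path-X = arc-path chY

              nd-x : NoDup (x ∷ η ∷ u ∷ flatten X)
              nd-x = NoDup-∷ (λ p → x∉L (to r p)) nd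

            trivial-nbrs : ¬ ¬ (∃[ Nᵤ ] (NoDup Nᵤ × length Nᵤ ≡ δ × (∀ {w} → w ∈ Nᵤ → E u w × w ∈ L)))
            trivial-nbrs k = lone cycL refl cyc′ len′ u∉ rest (start∈ path′) (proj₂ lk)
              (path-X ⟨ proj₁ lk ⟩ [ u ])
              ((nodup⊆ (flatten X ∷ []) (η ∷ u ∷ []) (((# 0 · (• 0 · ε)) · (• 1 · ε))) ((• 0 · (• 1 · # 0))) (nd)))
              (λ p → to r ((∈⊆ (flatten X ∷ []) (η ∷ u ∷ []) (((# 0 · (• 0 · ε)) · (• 1 · ε))) ((• 0 · (• 1 · # 0))) (p))))
              ((≤-antisym (lin ([]) (flatten X ∷ L ∷ []) (η ∷ u ∷ []) ((lng ((• 0 · (• 1 · # 0))) ≋ lng (# 1)) ∷ []) (lng (((# 0 · (• 0 · ε)) · (• 1 · ε)))) (lng (# 1)) 0 ((1 , 0) ∷ []) (len , tt)) (lin ([]) (flatten X ∷ L ∷ []) (η ∷ u ∷ []) ((lng ((• 0 · (• 1 · # 0))) ≋ lng (# 1)) ∷ []) (lng (# 1)) (lng (((# 0 · (• 0 · ε)) · (• 1 · ε)))) 0 ((0 , 1) ∷ []) (len , tt))))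
              λ { (N* , C*) → k (N* , C.ndN C* , suc-injective (C.count C*) , λ w∈ → C.join C* (here refl) w∈ , in-L (C.join C* (here refl) w∈) (C.N⊆L C* w∈)) }
              where
              path′ : Path α (arc X η ++ x ∷ []) x
              path′ = path-X ⟨ E-sym (x-join ξ∈) ⟩ [ x ]
              len′ : length (arc X η ++ x ∷ []) ≡ length L
              len′ = (≤-antisym (lin ([]) (flatten X ∷ L ∷ []) (η ∷ u ∷ x ∷ []) ((lng ((• 0 · (• 1 · # 0))) ≋ lng (# 1)) ∷ []) (lng (((# 0 · (• 0 · ε)) · (• 2 · ε)))) (lng (# 1)) 0 ((1 , 0) ∷ []) (len , tt)) (lin ([]) (flatten X ∷ L ∷ []) (η ∷ u ∷ x ∷ []) ((lng ((• 0 · (• 1 · # 0))) ≋ lng (# 1)) ∷ []) (lng (# 1)) (lng (((# 0 · (• 0 · ε)) · (• 2 · ε)))) 0 ((0 , 1) ∷ []) (len , tt)))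
              cyc′ : Cyc (arc X η ++ x ∷ [])
              cyc′ = cyc ((nodup⊆ (flatten X ∷ []) (x ∷ η ∷ u ∷ []) (((# 0 · (• 1 · ε)) · (• 0 · ε))) ((• 0 · (• 1 · (• 2 · # 0)))) (nd-x))) (≤-trans (longᶜ cycL) (≤-reflexive (sym len′)))
                         path′ (x-join α∈)
              u∉ : u ∉ arc X η ++ x ∷ []
              u∉ p = NoDup-head ((nodup⊆ (flatten X ∷ []) (x ∷ η ∷ u ∷ []) ((• 2 · ((# 0 · (• 1 · ε)) · (• 0 · ε)))) ((• 0 · (• 1 · (• 2 · # 0)))) (nd-x))) p
              rest : ∀ {w} → w ∈ L → w ≢ u → w ∈ arc X η ++ x ∷ []
              rest w∈ w≢u with (∈⊆ (flatten X ∷ []) (x ∷ η ∷ u ∷ []) ((• 0 · (• 1 · (• 2 · # 0)))) ((• 2 · ((# 0 · (• 1 · ε)) · (• 0 · ε)))) (there (from r w∈)))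
              ... | here eq = contradiction eq w≢u
              ... | there p = p
              in-L : ∀ {w} → E u w → w ∈ arc X η ++ x ∷ [] → w ∈ L
              in-L e p with ∈-++⁻ (arc X η) p
              ... | inj₁ q = to r ((∈⊆ (flatten X ∷ []) (η ∷ u ∷ []) ((# 0 · (• 0 · ε))) ((• 0 · (• 1 · # 0))) (q)))
              ... | inj₂ (here refl) = ⊥-elim (seg∉N [] r (here refl) (x-nbr (E-sym e)))

            -- A neighbour of u on L outside N is interior to a segment of length at least 3.
            trivial-spot : ∀ {w} → E u w → w ∈ L → w ∉ N →
                           ∃[ X₁ ] ∃[ ξ ] ∃[ o ] ∃[ b ] ∃[ X₂ ] (X ≡ X₁ ++ (ξ , o ++ w ∷ b) ∷ X₂ × 1 ≤ length o × 1 ≤ length b)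
            trivial-spot {w} e w∈ w∉N with from r w∈
            ... | here refl = contradiction ξ∈ w∉N
            ... | there (here refl) = ⊥-elim (E-irrefl e)
            ... | there (there p) with locate X p (λ h → w∉N (All.lookup (headsM r) (there h)))
            ...   | X₁ , ξ , s , X₂ , refl , w∈s with ∈-∃++ w∈s
            ...     | o , b , refl = X₁ , ξ , o , b , X₂ , refl , edge-before {o₁ = []} {r₁ = []} r e , edge-after {o₁ = []} {r₁ = []} r e

          -- The edge joins the first vertex of a segment to the last vertex of a segment of two.
          -- Each `kill` lemma assumes one more edge and exhibits a cycle through `x` and all of
          -- `L`.
          module Beta {ξ y r Y ξ′ v z W} (ρ : R ((ξ , y ∷ r) ∷ Y ++ (ξ′ , v ∷ z ∷ []) ∷ W)) (e : E y z) where

            open Tight ρ e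

            private
              s-end : ∃[ t ] (E ξ y × Path y (y ∷ r) t × E t α)
              s-end = lk-inner P.lk

              t : V
              t = proj₁ s-end

              path-s : Path y (y ∷ r) t
              path-s = proj₁ (proj₂ (proj₂ s-end))

              t-α : E t α
              t-α = proj₂ (proj₂ (proj₂ s-end))

              z-β : E z β
              z-β = proj₂ (proj₂ P.lk′)

            kill-I : ¬ E v ξ
            kill-I v-ξ = too-long
              (path-reverse path-s ⟨ e ⟩ (E-sym v-z ∷ ([ v ] ⟨ v-ξ ⟩ (path-reverse P.arcW ⟨ x-N P.β∈ ⟩ ([ x ] ⟨ x-join P.ξ′∈ ⟩ path-reverse P.arcY)))))
              (E-sym t-α)
              ((nodup⊆ (r ∷ flatten Y ∷ flatten W ∷ []) (x ∷ ξ ∷ y ∷ ξ′ ∷ v ∷ z ∷ []) ((rev ((• 2 · # 0)) · (• 5 · (• 4 · (rev ((# 2 · (• 1 · ε))) · (• 0 · rev ((# 1 · (• 3 · ε))))))))) ((• 0 · (• 1 · ((• 2 · # 0) · (# 1 · (• 3 · ((• 4 · (• 5 · ε)) · # 2))))))) (nd-x)))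
              ((lin ([]) (r ∷ flatten Y ∷ flatten W ∷ L ∷ []) (ξ ∷ y ∷ ξ′ ∷ v ∷ z ∷ x ∷ []) ((lng ((• 0 · ((• 1 · # 0) · (# 1 · (• 2 · ((• 3 · (• 4 · ε)) · # 2)))))) ≋ lng (# 3)) ∷ []) ((κ 1 ⊕ lng (# 3))) (lng ((rev ((• 1 · # 0)) · (• 4 · (• 3 · (rev ((# 2 · (• 0 · ε))) · (• 5 · rev ((# 1 · (• 2 · ε)))))))))) 0 ((0 , 1) ∷ []) (P.len , tt)))

            kill-last : ∀ {t′} → Path y (y ∷ r) t′ → ¬ E v t′
            kill-last p v-t = too-long
              (P.arcY ⟨ ξ′-v ⟩ ([ v ] ⟨ v-t ⟩ (path-reverse p ⟨ e ⟩ (z-β ∷ (P.arcW ⟨ x-N P.ξ∈ ⟩ [ x ])))))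
              (x-join P.α∈)
              ((nodup⊆ (r ∷ flatten Y ∷ flatten W ∷ []) (x ∷ ξ ∷ y ∷ ξ′ ∷ v ∷ z ∷ []) (((# 1 · (• 3 · ε)) · (• 4 · (rev ((• 2 · # 0)) · (• 5 · ((# 2 · (• 1 · ε)) · (• 0 · ε))))))) ((• 0 · (• 1 · ((• 2 · # 0) · (# 1 · (• 3 · ((• 4 · (• 5 · ε)) · # 2))))))) (nd-x)))
              ((lin ([]) (r ∷ flatten Y ∷ flatten W ∷ L ∷ []) (ξ ∷ y ∷ ξ′ ∷ v ∷ z ∷ x ∷ []) ((lng ((• 0 · ((• 1 · # 0) · (# 1 · (• 2 · ((• 3 · (• 4 · ε)) · # 2)))))) ≋ lng (# 3)) ∷ []) ((κ 1 ⊕ lng (# 3))) (lng (((# 1 · (• 2 · ε)) · (• 3 · (rev ((• 1 · # 0)) · (• 4 · ((# 2 · (• 0 · ε)) · (• 5 · ε)))))))) 0 ((0 , 1) ∷ []) (P.len , tt)))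

            kill-second : ∀ {m r₂} → r ≡ m ∷ r₂ → ¬ E v m
            kill-second {m} {r₂} refl v-m = too-long
              (P.arcW ⟨ ξ-y ⟩ ([ y ] ⟨ e ⟩ (E-sym v-z ∷ ([ v ] ⟨ v-m ⟩ (lk-path (proj₂ (proj₂ P.lk)) P.arcY ⟨ x-N P.ξ′∈ ⟩ [ x ])))))
              (x-join P.β∈)
              ((nodup⊆ (r₂ ∷ flatten Y ∷ flatten W ∷ []) (x ∷ ξ ∷ y ∷ m ∷ ξ′ ∷ v ∷ z ∷ []) (((# 2 · (• 1 · ε)) · (• 2 · (• 6 · (• 5 · ((• 3 · (# 0 · (# 1 · (• 4 · ε)))) · (• 0 · ε))))))) ((• 0 · (• 1 · ((• 2 · (• 3 · # 0)) · (# 1 · (• 4 · ((• 5 · (• 6 · ε)) · # 2))))))) (nd-x)))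
              ((lin ([]) (r₂ ∷ flatten Y ∷ flatten W ∷ L ∷ []) (ξ ∷ y ∷ m ∷ ξ′ ∷ v ∷ z ∷ x ∷ []) ((lng ((• 0 · ((• 1 · (• 2 · # 0)) · (# 1 · (• 3 · ((• 4 · (• 5 · ε)) · # 2)))))) ≋ lng (# 3)) ∷ []) ((κ 1 ⊕ lng (# 3))) (lng (((# 2 · (• 0 · ε)) · (• 1 · (• 5 · (• 4 · ((• 2 · (# 0 · (# 1 · (• 3 · ε)))) · (• 6 · ε)))))))) 0 ((0 , 1) ∷ []) (P.len , tt)))

            r≥1 : 1 ≤ length r
            r≥1 = (lin ([]) (r ∷ []) ([]) ((κ 1 ≼ (lng (# 0) ⊕ κ 0)) ∷ []) (κ 1) (lng (# 0)) 0 ((1 , 0) ∷ []) (r+r′≥1 , tt))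

            r≤2 : length r ≤ 2
            r≤2 = (lin (exc Y ∷ exc W ∷ []) (r ∷ []) ([]) (((((lng (# 0) ⊕ at 0) ⊕ κ 0) ⊕ at 1) ≼ κ 2) ∷ []) (lng (# 0)) (κ 2) 0 ((1 , 0) ∷ []) (budget , tt))

            v≁r : ∀ {w} → w ∈ r → ¬ E v w
            v≁r = go r refl r≤2
              where
              go : ∀ r′ → r ≡ r′ → length r′ ≤ 2 → ∀ {w} → w ∈ r′ → ¬ E v w
              go (m ∷ r₂) refl _ (here refl) = kill-second refl
              go (m ∷ w ∷ []) refl _ (there (here refl)) = kill-last (path-with path-s)
                where
                path-with : ∀ {t′} → Path y (y ∷ m ∷ w ∷ []) t′ → Path y (y ∷ m ∷ w ∷ []) w
                path-with (a ∷ (b ∷ [ _ ])) = a ∷ (b ∷ [ _ ])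
              go (m ∷ w ∷ _ ∷ _) refl (s≤s (s≤s ())) _

            -- A segment of Y or W holding a further neighbour of v.
            further-W : ∀ {X η t X′ w} → W ≡ X ++ (η , t) ∷ X′ → w ∈ t → E v w → ∃[ p ] (t ≡ p ∷ w ∷ [])
            further-W {X} {η} {t} {X′} eq w∈ ew = third (ρ-W eq)
              ((lin (exc X ∷ exc (X′ ++ (ξ , y ∷ r) ∷ Y) ∷ exc X′ ∷ exc Y ∷ []) (t ∷ r ∷ []) ([]) (((((κ 2 ⊕ at 0) ⊕ lng (# 0)) ⊕ at 1) ≼ κ 5) ∷ (at 1 ≋ (at 2 ⊕ (lng (# 1) ⊕ at 3))) ∷ (κ 1 ≼ lng (# 1)) ∷ []) (lng (# 0)) (κ 2) 0 ((1 , 0) ∷ (0 , 1) ∷ (1 , 0) ∷ []) (pair-budget (ρ-W eq) , exc-at X′ , r≥1 , tt))) w∈ ew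

            further-Y : ∀ {X η t X′ w} → Y ≡ X ++ (η , t) ∷ X′ → w ∈ t → E v w → ∃[ p ] (t ≡ p ∷ w ∷ [])
            further-Y {X} {η} {t} {X′} eq w∈ ew = third (ρ-Y eq)
              ((lin (exc (W ++ (ξ , y ∷ r) ∷ X) ∷ exc X′ ∷ exc W ∷ exc X ∷ []) (t ∷ r ∷ []) ([]) (((((κ 2 ⊕ at 0) ⊕ lng (# 0)) ⊕ at 1) ≼ κ 5) ∷ (at 0 ≋ (at 2 ⊕ (lng (# 1) ⊕ at 3))) ∷ (κ 1 ≼ lng (# 1)) ∷ []) (lng (# 0)) (κ 2) 0 ((1 , 0) ∷ (0 , 1) ∷ (1 , 0) ∷ []) (pair-budget (ρ-Y eq) , exc-at W , r≥1 , tt))) w∈ ew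

            -- The trivial segment at η inside Y, and the chains of Y before and after it.
            record Around (Y₁ : List Seg) (η u : V) (Y₂ : List Seg) : Set where
              field
                {η⁺} : V
                before : Chain α Y₁ η
                η-u    : E η u
                u-η⁺   : E u η⁺
                after  : Chain η⁺ Y₂ ξ′
                η∈     : η ∈ N

            module _ {Y₁ η u Y₂} (eqY : Y ≡ Y₁ ++ (η , u ∷ []) ∷ Y₂) where

              flatY : flatten Y ≡ flatten Y₁ ++ η ∷ u ∷ flatten Y₂
              flatY = trans (cong flatten eqY) (flatten-++ Y₁ _)

              nd-u : NoDup (x ∷ ξ ∷ (y ∷ r) ++ (flatten Y₁ ++ η ∷ u ∷ flatten Y₂) ++ ξ′ ∷ (v ∷ z ∷ []) ++ flatten W)
              nd-u = subst (λ l → NoDup (x ∷ ξ ∷ (y ∷ r) ++ l ++ ξ′ ∷ (v ∷ z ∷ []) ++ flatten W)) flatY nd-x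

              len-u : length (ξ ∷ (y ∷ r) ++ (flatten Y₁ ++ η ∷ u ∷ flatten Y₂) ++ ξ′ ∷ (v ∷ z ∷ []) ++ flatten W) ≡ length L
              len-u = trans (cong (λ l → length (ξ ∷ (y ∷ r) ++ l ++ ξ′ ∷ (v ∷ z ∷ []) ++ flatten W)) (sym flatY)) P.len

              around : Around Y₁ η u Y₂
              around with chain-++⁻ Y₁ (subst (λ Z → Chain α Z ξ′) eqY P.chY)
              ... | _ , c₁ , (a , b) ∷ c₂ = record { before = c₁ ; η-u = a ; u-η⁺ = b ; after = c₂
                ; η∈ = headsY (∈-resp (sym (trans (cong heads eqY) (map-++ proj₁ Y₁ _))) (∈-++⁺ʳ (heads Y₁) (here refl))) }

              -- With `W` empty, the edge from `u` to `ξ` lets a cycle pick up `x` between `ξ` and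
              -- `η` while still visiting all of `L`.
              kill-II : length (flatten W) ≡ 0 → ¬ E u ξ
              kill-II W₀ u-ξ = too-long
                (path-reverse path-s ⟨ e ⟩ (E-sym v-z ∷ ([ v ] ⟨ E-sym ξ′-v ⟩ (path-reverse (arc-path after) ⟨ E-sym u-η⁺ ⟩
                  (u-ξ ∷ (x-N P.ξ∈ ∷ ([ x ] ⟨ x-join η∈ ⟩ path-reverse (arc-path before))))))))
                (E-sym t-α)
                ((nodup⊆ (r ∷ flatten Y₁ ∷ flatten Y₂ ∷ flatten W ∷ []) (x ∷ ξ ∷ y ∷ η ∷ u ∷ ξ′ ∷ v ∷ z ∷ []) ((rev ((• 2 · # 0)) · (• 7 · (• 6 · (rev ((# 2 · (• 5 · ε))) · (• 4 · (• 1 · (• 0 · rev ((# 1 · (• 3 · ε))))))))))) ((• 0 · (• 1 · ((• 2 · # 0) · ((# 1 · (• 3 · (• 4 · # 2))) · (• 5 · ((• 6 · (• 7 · ε)) · # 3))))))) (nd-u)))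
                ((lin ([]) (flatten W ∷ r ∷ flatten Y₁ ∷ flatten Y₂ ∷ L ∷ []) (ξ ∷ y ∷ η ∷ u ∷ ξ′ ∷ v ∷ z ∷ x ∷ []) ((lng (# 0) ≋ κ 0) ∷ (lng ((• 0 · ((• 1 · # 1) · ((# 2 · (• 2 · (• 3 · # 3))) · (• 4 · ((• 5 · (• 6 · ε)) · # 0)))))) ≋ lng (# 4)) ∷ []) ((κ 1 ⊕ lng (# 4))) (lng ((rev ((• 1 · # 1)) · (• 6 · (• 5 · (rev ((# 3 · (• 4 · ε))) · (• 3 · (• 0 · (• 7 · rev ((# 2 · (• 2 · ε)))))))))))) 0 ((1 , 0) ∷ (0 , 1) ∷ []) (W₀ , len-u , tt)))
                where open Around around

            -- If ξ directly precedes y and follows z, a trivial segment in Y finishes the argument: its vertex is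
            -- adjacent to ξ, or to the middle of y q w, and then y is freed with z and ξ consecutive.
            trivial-⊥ : W ≡ [] → ∀ {Y₁ η u Y₂} → Y ≡ Y₁ ++ (η , u ∷ []) ∷ Y₂ → ⊥
            trivial-⊥ refl {Y₁} {η} {u} {Y₂} refl = trivial-nbrs λ { (Nᵤ , ndᵤ , lenᵤ , nbr) → search Nᵤ ndᵤ lenᵤ nbr }
              where
              X = Y₂ ++ (ξ′ , v ∷ z ∷ []) ∷ (ξ , y ∷ r) ∷ Y₁
              ρᵤ : R ((η , u ∷ []) ∷ X)
              ρᵤ = subst (λ Z → R ((η , u ∷ []) ∷ Z)) (++-assoc Y₂ _ _)
                     (rep-rotate ((ξ , y ∷ r) ∷ Y₁) (subst R (cong ((ξ , y ∷ r) ∷_) (++-assoc Y₁ _ _)) ρ))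
              open Trivial ρᵤ
              open Around (around {Y₁} {η} {u} {Y₂} refl)
              big : ∀ {o b : List V} {q} → 1 ≤ length o → 1 ≤ length b → 2 ≤ length (o ++ q ∷ b) ∸ 1
              big {o} {b} {q} o≥1 b≥1 = ∸-monoˡ-≤ {3} 1 ((lin ([]) (o ∷ b ∷ []) (q ∷ []) ((κ 1 ≼ lng (# 0)) ∷ (κ 1 ≼ lng (# 1)) ∷ []) (κ 3) (lng ((# 0 · (• 0 · # 1)))) 0 ((1 , 0) ∷ (1 , 0) ∷ []) (o≥1 , b≥1 , tt)))
              exc-Y : exc Y₁ + exc Y₂ ≤ 1
              exc-Y = (lin (exc (Y₁ ++ (η , u ∷ []) ∷ Y₂) ∷ exc Y₁ ∷ exc Y₂ ∷ []) (r ∷ []) ([]) (((((lng (# 0) ⊕ at 0) ⊕ κ 0) ⊕ κ 0) ≼ κ 2) ∷ (κ 1 ≼ lng (# 0)) ∷ (at 0 ≋ (at 1 ⊕ at 2)) ∷ []) ((at 1 ⊕ at 2)) (κ 1) 0 ((1 , 0) ∷ (1 , 0) ∷ (0 , 1) ∷ []) (budget , r≥1 , exc-at Y₁ , tt))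
              -- A neighbour of `u` outside `N` is interior to its segment, whose excess is then at
              -- least 2. The excess left for `Y` is at most 1, and the segment of `v` and `z` is
              -- too short, so only `y ∷ r` remains.
              middle : ∀ {q} → E u q → q ∈ L → q ∉ N → ∃[ w ] (r ≡ q ∷ w ∷ [])
              middle {q} u-q q∈ q∉ with trivial-spot u-q q∈ q∉
              ... | X₁ , θ , o , b , X₂ , eq , o≥1 , b≥1 with split-cases X₁ Y₂ (sym eq)
              ...   | inj₁ (D , refl) = (1≰0 (lin {A = ⊤} (exc Y₁ ∷ exc (X₁ ++ (θ , o ++ q ∷ b) ∷ D) ∷ (length (o ++ q ∷ b) ∸ 1) ∷ exc X₁ ∷ exc D ∷ []) ([]) ([]) (((at 0 ⊕ at 1) ≼ κ 1) ∷ (κ 2 ≼ at 2) ∷ (at 1 ≋ (at 3 ⊕ (at 2 ⊕ at 4))) ∷ []) (κ 1) (κ 0) 0 ((1 , 0) ∷ (1 , 0) ∷ (0 , 1) ∷ []) (exc-Y , big {o} {b} {q} o≥1 b≥1 , exc-at X₁ , tt)))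
              ...   | inj₂ (inj₁ (_ , eqs , _)) with big {o} {b} {q} o≥1 b≥1 | cong (λ σ → length (proj₂ σ) ∸ 1) eqs
              ...     | l | eq′ = ⊥-elim (<⇒≱ {1} ≤-refl (≤-trans l (≤-reflexive eq′)))
              middle {q} u-q q∈ q∉ | X₁ , θ , o , b , X₂ , eq , o≥1 , b≥1 | inj₂ (inj₂ (d ∷ D , refl , eq₂)) with ∷-injective eq₂
              ... | _ , refl = (1≰0 (lin {A = ⊤} (exc (D ++ (θ , o ++ q ∷ b) ∷ X₂) ∷ exc Y₂ ∷ (length (o ++ q ∷ b) ∸ 1) ∷ exc D ∷ exc X₂ ∷ []) ([]) ([]) (((at 0 ⊕ at 1) ≼ κ 1) ∷ (κ 2 ≼ at 2) ∷ (at 0 ≋ (at 3 ⊕ (at 2 ⊕ at 4))) ∷ []) (κ 1) (κ 0) 0 ((1 , 0) ∷ (1 , 0) ∷ (0 , 1) ∷ []) (exc-Y , big {o} {b} {q} o≥1 b≥1 , exc-at D , tt)))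
              middle {q} u-q q∈ q∉ | X₁ , θ , o , b , X₂ , eq , o≥1 , b≥1 | inj₂ (inj₂ ([] , refl , eq₂)) =
                middle-of-three o b r≤2 o≥1 b≥1 (cong proj₂ (proj₁ (∷-injective eq₂)))
              freed : ∀ {q w} → r ≡ q ∷ w ∷ [] → E u q → ⊥
              freed {q} {w} refl u-q = T₂.free λ { (N* , C*) → T₂.Free.consec C*
                  (E-sym (x-join P.ξ∈) ∷ (x-join η∈ ∷ (path-reverse T₂.path-B ⟨ E-sym u-q ⟩ (u-η⁺ ∷ (arc-path after ⟨ ξ′-v ⟩ (v-z ∷ [ z ]))))))
                  ((nodup⊆ (flatten Y₁ ∷ flatten Y₂ ∷ []) (x ∷ ξ ∷ y ∷ q ∷ w ∷ η ∷ u ∷ ξ′ ∷ v ∷ z ∷ []) ((• 1 · (• 0 · (rev ((• 3 · (• 4 · (# 0 · (• 5 · ε))))) · (• 6 · ((# 1 · (• 7 · ε)) · (• 8 · (• 9 · ε)))))))) ((• 0 · (• 1 · ((• 2 · (• 3 · (• 4 · ε))) · ((# 0 · (• 5 · (• 6 · # 1))) · (• 7 · ((• 8 · (• 9 · ε)) · ε))))))) (ndᵤ)))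
                  (λ p → ∈-resp (sym eqL) ((∈⊆ (flatten Y₁ ∷ flatten Y₂ ∷ []) (ξ ∷ x ∷ q ∷ w ∷ η ∷ u ∷ ξ′ ∷ v ∷ z ∷ []) ((• 0 · (• 1 · (rev ((• 2 · (• 3 · (# 0 · (• 4 · ε))))) · (• 5 · ((# 1 · (• 6 · ε)) · (• 7 · (• 8 · ε)))))))) (((• 5 · ((# 1 · (• 6 · (• 7 · (• 8 · ε)))) · (• 0 · ε))) · (• 1 · rev ((• 2 · (• 3 · (# 0 · (• 4 · ε)))))))) (p))))
                  ((≤-antisym (lin ([]) (flatten Y₁ ∷ flatten Y₂ ∷ L ∷ []) (ξ ∷ y ∷ q ∷ w ∷ η ∷ u ∷ ξ′ ∷ v ∷ z ∷ x ∷ []) ((lng ((• 0 · ((• 1 · (• 2 · (• 3 · ε))) · ((# 0 · (• 4 · (• 5 · # 1))) · (• 6 · ((• 7 · (• 8 · ε)) · ε)))))) ≋ lng (# 2)) ∷ []) (lng ((• 0 · (• 9 · (rev ((• 2 · (• 3 · (# 0 · (• 4 · ε))))) · (• 5 · ((# 1 · (• 6 · ε)) · (• 7 · (• 8 · ε))))))))) (lng (# 2)) 0 ((1 , 0) ∷ []) (lenᵤ , tt)) (lin ([]) (flatten Y₁ ∷ flatten Y₂ ∷ L ∷ []) (ξ ∷ y ∷ q ∷ w ∷ η ∷ u ∷ ξ′ ∷ v ∷ z ∷ x ∷ []) ((lng ((• 0 · ((• 1 · (• 2 · (• 3 · ε))) · ((# 0 · (• 4 · (• 5 · # 1))) ·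 (• 6 · ((• 7 · (• 8 · ε)) · ε)))))) ≋ lng (# 2)) ∷ []) (lng (# 2)) (lng ((• 0 · (• 9 · (rev ((• 2 · (• 3 · (# 0 · (• 4 · ε))))) · (• 5 · ((# 1 · (• 6 · ε)) · (• 7 · (• 8 · ε))))))))) 0 ((0 , 1) ∷ []) (lenᵤ , tt))))
                  (λ { refl → NoDup-disjoint {ξ ∷ []} {z ∷ []} ((nodup⊆ (flatten Y₁ ∷ flatten Y₂ ∷ []) (x ∷ ξ ∷ y ∷ q ∷ w ∷ η ∷ u ∷ ξ′ ∷ v ∷ z ∷ []) ((• 1 · (• 9 · ε))) ((• 0 · (• 1 · ((• 2 · (• 3 · (• 4 · ε))) · ((# 0 · (• 5 · (• 6 · # 1))) · (• 7 · ((• 8 · (• 9 · ε)) · ε))))))) (ndᵤ))) (here refl) (here refl) })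
                  (E-sym ξ-y) e }
                where
                ρ₂ : R ((η , u ∷ []) ∷ (Y₂ ++ (ξ′ , v ∷ z ∷ []) ∷ []) ++ (ξ , y ∷ q ∷ w ∷ []) ∷ Y₁)
                ρ₂ = subst (λ Z → R ((η , u ∷ []) ∷ Z)) (sym (++-assoc Y₂ _ _)) ρᵤ
                module T₂ = Tight ρ₂ u-q
                eqL : T₂.L″ ≡ (u ∷ ((flatten Y₂ ++ ξ′ ∷ v ∷ z ∷ []) ++ ξ ∷ [])) ++ x ∷ reverse (q ∷ w ∷ (flatten Y₁ ++ η ∷ []))
                eqL = cong (λ l → (u ∷ (l ++ ξ ∷ [])) ++ x ∷ reverse (q ∷ w ∷ (flatten Y₁ ++ η ∷ []))) (flatten-++ Y₂ _)
                ndᵤ = nd-u {Y₁} {η} {u} {Y₂} refl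
                lenᵤ = len-u {Y₁} {η} {u} {Y₂} refl
              search : ∀ Nᵤ → NoDup Nᵤ → length Nᵤ ≡ δ → (∀ {w} → w ∈ Nᵤ → E u w × w ∈ L) → ⊥
              search Nᵤ ndᵤ lenᵤ nbr with E? u ξ
              ... | yes u-ξ = kill-II {Y₁} {η} {u} {Y₂} refl refl u-ξ
              ... | no ¬u-ξ with any? (λ w → ¬? (w ∈? N)) Nᵤ
              ...   | yes p = outside (find p)
                where
                outside : ∃[ q ] (q ∈ Nᵤ × q ∉ N) → ⊥
                outside (q , q∈ , q∉) = freed (proj₂ (middle (proj₁ (nbr q∈)) (proj₂ (nbr q∈)) q∉)) (proj₁ (nbr q∈))
              -- Otherwise the δ neighbours of `u` would all lie among the δ - 1 vertices of `N`
              -- other than `ξ`.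
              ...   | no ¬p = (1≰0 (lin (δ ∷ []) (Nᵤ ∷ N ∷ []) (ξ ∷ []) ((lng ((• 0 · # 0)) ≼ lng (# 1)) ∷ (lng (# 0) ≋ at 0) ∷ (lng (# 1) ≋ at 0) ∷ []) (κ 1) (κ 0) 0 ((1 , 0) ∷ (0 , 1) ∷ (1 , 0) ∷ []) (length-⊆ {ξ ∷ Nᵤ} {N} (NoDup-∷ (λ p → ¬u-ξ (proj₁ (nbr p))) ndᵤ)
                                      (λ { (here refl) → P.ξ∈ ; (there p) → within p }) , lenᵤ , |N| , tt)))
                where
                within : ∀ {w} → w ∈ Nᵤ → w ∈ N
                within {w} w∈ with w ∈? N
                ... | yes h = h
                ... | no ¬h = ⊥-elim (¬p (lose w∈ ¬h))

            all-big : ∀ X Y′ U → R (X ++ Y′ ++ U) → All (λ σ → length (proj₂ σ) ≢ 1) Y′ → length Y′ ≤ exc Y′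
            all-big X []            U q []      = z≤n
            all-big X ((η , t) ∷ Y′) U q (h ∷ hs) =
              +-mono-≤ (big t (seg≥1 (rep-rotate X q)) h) (all-big (X ++ (η , t) ∷ []) Y′ U (subst R (sym (++-assoc X _ _)) q) hs)
              where
              big : ∀ (t : List V) → 1 ≤ length t → length t ≢ 1 → 1 ≤ length t ∸ 1
              big (_ ∷ [])    _ h = contradiction refl h
              big (_ ∷ _ ∷ _) _ h = s≤s z≤n

            -- If `Y` has no segment of one vertex, its excess is at least its length and at most 1.
            -- With δ ≥ 3 there are then exactly three segments, and the budget makes each of them
            -- have two vertices.
            empty-W : Odd ((ξ , y ∷ r) ∷ Y ++ (ξ′ , v ∷ z ∷ []) ∷ W) → W ≡ [] → ⊥
            empty-W odd refl with any? (λ σ → length (proj₂ σ) ≟ 1) Y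
            ... | yes p = single-at (first (λ σ → length (proj₂ σ) ≟ 1) p)
              where
              single-at : ∃[ as ] ∃[ σ ] ∃[ bs ] (Y ≡ as ++ σ ∷ bs × All _ as × length (proj₂ σ) ≡ 1) → ⊥
              single-at (as , (η , u ∷ []) , bs , eq , _ , _) = trivial-⊥ refl eq
            ... | no ¬p = small-case Y refl (all-big ((ξ , y ∷ r) ∷ []) Y _ ρ (¬Any⇒All¬ Y ¬p)) r refl
              where
              small-case : ∀ Y′ → Y ≡ Y′ → length Y′ ≤ exc Y′ → ∀ r′ → r ≡ r′ → ⊥
              small-case [] refl _ _ _ = (1≰0 (lin {A = ⊤} (δ ∷ []) ([]) ([]) ((κ 2 ≋ at 0) ∷ (κ 3 ≼ at 0) ∷ []) (κ 1) (κ 0) 0 ((0 , 1) ∷ (1 , 0) ∷ []) (segs ρ , δ≥3 , tt)))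
              small-case (_ ∷ _ ∷ Y′) refl l _ refl =
                (1≰0 (lin (length Y′ ∷ exc Y ∷ []) (r ∷ []) ([]) (((κ 2 ⊕ at 0) ≼ at 1) ∷ ((((lng (# 0) ⊕ at 1) ⊕ κ 0) ⊕ κ 0) ≼ κ 2) ∷ (κ 1 ≼ lng (# 0)) ∷ []) (κ 1) (κ 0) 0 ((1 , 0) ∷ (1 , 0) ∷ (1 , 0) ∷ []) (l , budget , r≥1 , tt)))
              small-case ((η , t) ∷ []) refl l [] refl = (1≰0 (lin {A = ⊤} ([]) ([]) ([]) ((κ 1 ≼ κ 0) ∷ []) (κ 1) (κ 0) 0 ((1 , 0) ∷ []) (r≥1 , tt)))
              small-case ((η , t) ∷ []) refl l (_ ∷ _ ∷ r′) refl = (1≰0 (lin (exc Y ∷ []) (r′ ∷ []) ([]) ((((((κ 2 ⊕ lng (# 0)) ⊕ at 0) ⊕ κ 0) ⊕ κ 0) ≼ κ 2) ∷ (κ 1 ≼ at 0) ∷ []) (κ 1) (κ 0) 0 ((1 , 0) ∷ (1 , 0) ∷ []) (budget , l , tt)))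
              small-case ((η , []) ∷ []) refl () (_ ∷ []) refl
              small-case ((η , _ ∷ []) ∷ []) refl () (_ ∷ []) refl
              small-case ((η , _ ∷ _ ∷ []) ∷ []) refl l (_ ∷ []) refl = not-odd refl refl refl odd
              small-case ((η , _ ∷ _ ∷ _ ∷ t) ∷ []) refl l (_ ∷ []) refl =
                (1≰0 (lin ([]) (t ∷ []) ([]) (((((κ 1 ⊕ ((κ 2 ⊕ lng (# 0)) ⊕ κ 0)) ⊕ κ 0) ⊕ κ 0) ≼ κ 2) ∷ []) (κ 1) (κ 0) 0 ((1 , 0) ∷ []) (budget , tt)))

            -- An excess of 1 is used up by a single segment of two vertices.
            one-at : ∀ {Y′ X η p w X′ X₂ η₂ p₂ w₂ X₂′} → exc Y′ ≤ 1 → Y′ ≡ X ++ (η , p ∷ w ∷ []) ∷ X′ →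
                     Y′ ≡ X₂ ++ (η₂ , p₂ ∷ w₂ ∷ []) ∷ X₂′ → w ≡ w₂
            one-at {X = X} {η} {p} {w} {X′} {X₂} {η₂} {p₂} {w₂} {X₂′} l refl eq with split-cases X X₂ eq
            ... | inj₂ (inj₁ (refl , refl , refl)) = refl
            ... | inj₁ (D , refl) =
              (1≰0 (lin {A = ⊤} (exc (X ++ (η , p ∷ w ∷ []) ∷ X′) ∷ exc ((X ++ (η , p ∷ w ∷ []) ∷ D) ++ (η₂ , p₂ ∷ w₂ ∷ []) ∷ X₂′) ∷ exc (X ++ (η , p ∷ w ∷ []) ∷ D) ∷ exc X₂′ ∷ exc X ∷ exc D ∷ []) ([]) ([]) ((at 0 ≼ κ 1) ∷ (at 0 ≋ at 1) ∷ (at 1 ≋ (at 2 ⊕ (κ 1 ⊕ at 3))) ∷ (at 2 ≋ (at 4 ⊕ (κ 1 ⊕ at 5))) ∷ []) (κ 1) (κ 0) 0 ((1 , 0) ∷ (0 , 1) ∷ (0 , 1) ∷ (0 , 1) ∷ []) (l , cong exc eq , exc-at (X ++ (η , p ∷ w ∷ []) ∷ D) , exc-at X , tt)))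
            ... | inj₂ (inj₂ (D , refl , refl)) =
              (1≰0 (lin {A = ⊤} (exc ((X₂ ++ (η₂ , p₂ ∷ w₂ ∷ []) ∷ D) ++ (η , p ∷ w ∷ []) ∷ X′) ∷ exc (X₂ ++ (η₂ , p₂ ∷ w₂ ∷ []) ∷ D) ∷ exc X′ ∷ exc X₂ ∷ exc D ∷ []) ([]) ([]) ((at 0 ≼ κ 1) ∷ (at 0 ≋ (at 1 ⊕ (κ 1 ⊕ at 2))) ∷ (at 1 ≋ (at 3 ⊕ (κ 1 ⊕ at 4))) ∷ []) (κ 1) (κ 0) 0 ((1 , 0) ∷ (0 , 1) ∷ (0 , 1) ∷ []) (l , exc-at (X₂ ++ (η₂ , p₂ ∷ w₂ ∷ []) ∷ D) , exc-at X₂ , tt)))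

            module Further (odd : Odd ((ξ , y ∷ r) ∷ Y ++ (ξ′ , v ∷ z ∷ []) ∷ W))
                           (k : ∀ {W₁ η p w} → W ≡ W₁ ++ (η , p ∷ w ∷ []) ∷ [] → E v w → ⊥) (W≥1 : 1 ≤ length W) where

              β≢ξ : β ≢ ξ
              β≢ξ = chain-start≢ {s = []} W≥1
                      ((nodup⊆ (r ∷ flatten Y ∷ flatten W ∷ []) (ξ ∷ y ∷ ξ′ ∷ v ∷ z ∷ []) ((• 0 · # 2)) ((• 0 · ((• 1 · # 0) · (# 1 · (• 2 · ((• 3 · (• 4 · ε)) · # 2)))))) (P.nd))) P.chW

              -- Of the δ neighbours of `v` none is `ξ` or `β`, so besides `z` at least one, `w`,
              -- lies outside `N`. The budget makes `w` unique, and therefore `v` cannot miss a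
              -- third vertex of `N`.
              hunt : ∀ {N*} → Clump L″ (v ∷ []) N* → ⊥
              hunt {N*} C* with any? (λ w → ¬? (w ∈? z ∷ N)) N*
              ... | no ¬p = (1≰0 (lin (δ ∷ []) (N* ∷ N ∷ []) (ξ ∷ β ∷ z ∷ []) ((lng ((• 0 · (• 1 · # 0))) ≼ lng ((• 2 · # 1))) ∷ (lng (# 0) ≋ at 0) ∷ (lng (# 1) ≋ at 0) ∷ []) (κ 1) (κ 0) 0 ((1 , 0) ∷ (0 , 1) ∷ (1 , 0) ∷ []) (length-⊆ {ξ ∷ β ∷ N*} {z ∷ N}
                                    (NoDup-∷ (λ { (here eq) → β≢ξ (sym eq) ; (there p) → kill-I (N*-E p) })
                                      (NoDup-∷ (λ p → v≁z⁺ refl P.arcW (N*-E p)) (C.ndN C*)))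
                                    (λ { (here refl) → there P.ξ∈ ; (there (here refl)) → there P.β∈ ; (there (there p)) → within p }) , |N*| , |N| , tt)))
                where
                open Free C*
                within : ∀ {w} → w ∈ N* → w ∈ z ∷ N
                within {w} w∈ with w ∈? z ∷ N
                ... | yes h = h
                ... | no ¬h = ⊥-elim (¬p (lose w∈ ¬h))
              ... | yes p = located (find p)
                where
                open Free C*
                data Third (w : V) : Set where
                  inY : ∀ {X η p X′} → Y ≡ X ++ (η , p ∷ w ∷ []) ∷ X′ → Third w
                  inW : ∀ {X η p X′} → W ≡ X ++ (η , p ∷ w ∷ []) ∷ X′ → Third w
                where-is : ∀ {w} → w ∈ N* → w ∉ z ∷ N → Third w
                where-is {w} w∈ w∉ = go (spot (nbr-in-L v-w))
                  where
                  v-w = N*-E w∈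
                  in-Y : ∀ {X η t X′} → Y ≡ X ++ (η , t) ∷ X′ → ∃[ p ] (t ≡ p ∷ w ∷ []) → Third w
                  in-Y eq (p , refl) = inY eq
                  in-W : ∀ {X η t X′} → W ≡ X ++ (η , t) ∷ X′ → ∃[ p ] (t ≡ p ∷ w ∷ []) → Third w
                  in-W eq (p , refl) = inW eq
                  go : Spot w → Third w
                  go (at-N h) = contradiction (there h) w∉
                  go (at-s (here refl)) = ⊥-elim (v≁y v-w)
                  go (at-s (there h)) = ⊥-elim (v≁r h v-w)
                  go (at-s′ (here refl)) = ⊥-elim (E-irrefl v-w)
                  go (at-s′ (there (here refl))) = contradiction (here refl) w∉
                  go (at-Y eq h) = in-Y eq (further-Y eq h v-w)
                  go (at-W eq h) = in-W eq (further-W eq h v-w)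
                excs : exc Y + exc W ≤ 1
                excs = (lin (exc Y ∷ exc W ∷ []) (r ∷ []) ([]) (((((lng (# 0) ⊕ at 0) ⊕ κ 0) ⊕ at 1) ≼ κ 2) ∷ (κ 1 ≼ lng (# 0)) ∷ []) ((at 0 ⊕ at 1)) (κ 1) 0 ((1 , 0) ∷ (1 , 0) ∷ []) (budget , r≥1 , tt))
                both : ∀ {X η p w X′ X₂ η₂ p₂ w₂ X₂′} {A : Set} → Y ≡ X ++ (η , p ∷ w ∷ []) ∷ X′ → W ≡ X₂ ++ (η₂ , p₂ ∷ w₂ ∷ []) ∷ X₂′ → A
                both {X} {X′ = X′} {X₂} {X₂′ = X₂′} e₁ e₂ =
                  (1≰0 (lin {A = ⊤} (exc Y ∷ exc W ∷ exc X ∷ exc X′ ∷ exc X₂ ∷ exc X₂′ ∷ []) ([]) ([]) (((at 0 ⊕ at 1) ≼ κ 1) ∷ (at 0 ≋ (at 2 ⊕ (κ 1 ⊕ at 3))) ∷ (at 1 ≋ (at 4 ⊕ (κ 1 ⊕ at 5))) ∷ []) (κ 1) (κ 0) 0 ((1 , 0) ∷ (0 , 1) ∷ (0 , 1) ∷ []) (excs , trans (cong exc e₁) (exc-at X) , trans (cong exc e₂) (exc-at X₂) , tt)))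
                same : ∀ {w w′} → Third w → Third w′ → w ≡ w′
                same (inY e₁) (inY e₂) = one-at (≤-trans (m≤m+n _ _) excs) e₁ e₂
                same (inW e₁) (inW e₂) = one-at (≤-trans (m≤n+m _ (exc Y)) excs) e₁ e₂
                same (inY e₁) (inW e₂) = both e₁ e₂
                same (inW e₂) (inY e₁) = both e₁ e₂
                located : ∃[ w ] (w ∈ N* × w ∉ z ∷ N) → ⊥
                located (w , w∈ , w∉) = conclude th
                  where
                  th = where-is w∈ w∉
                  within : ∀ {u} → u ∈ N* → u ∈ z ∷ w ∷ N
                  within {u} u∈ with u ∈? z ∷ N
                  ... | yes (here eq) = here eq
                  ... | yes (there h) = there (there h)
                  ... | no ¬h = there (here (sym (same th (where-is u∈ ¬h))))
                  missed : ∀ {η⁺} → η⁺ ∈ N → η⁺ ≢ ξ → η⁺ ≢ β → ¬ E v η⁺ → ⊥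
                  missed {η⁺} η⁺∈ ≢ξ ≢β ¬e = (1≰0 (lin (δ ∷ []) (N* ∷ N ∷ []) (η⁺ ∷ ξ ∷ β ∷ z ∷ w ∷ []) ((lng ((• 0 · (• 1 · (• 2 · # 0)))) ≼ lng ((• 3 · (• 4 · # 1)))) ∷ (lng (# 0) ≋ at 0) ∷ (lng (# 1) ≋ at 0) ∷ []) (κ 1) (κ 0) 0 ((1 , 0) ∷ (0 , 1) ∷ (1 , 0) ∷ []) (length-⊆ {η⁺ ∷ ξ ∷ β ∷ N*} {z ∷ w ∷ N}
                      (NoDup-∷ (λ { (here eq) → ≢ξ eq ; (there (here eq)) → ≢β eq ; (there (there p)) → ¬e (N*-E p) })
                        (NoDup-∷ (λ { (here eq) → β≢ξ (sym eq) ; (there p) → kill-I (N*-E p) })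
                          (NoDup-∷ (λ p → v≁z⁺ refl P.arcW (N*-E p)) (C.ndN C*))))
                      (λ { (here refl) → there (there η⁺∈) ; (there (here refl)) → there (there P.ξ∈) ; (there (there (here refl))) → there (there P.β∈)
                         ; (there (there (there p))) → within p }) , |N*| , |N| , tt)))
                  conclude : Third w → ⊥
                  conclude (inY {X} {η} {p} {X′} eq) with chain-++⁻ X (subst (λ Z → Chain α Z ξ′) eq P.chY)
                  ... | _ , c₁ , _∷_ {ζ = η⁺} (η-p , p-w , w-η⁺) c₂ = missed η⁺∈ (λ { refl → off-W (∈-++⁺ʳ (flatten W) (here refl)) }) (λ { refl → off-W (start∈ P.arcW) })
                    -- This path goes once around `L″`, from `η⁺` to the vertex `w` next to it.
                    (λ ev → consec
                      (arc-path c₂ ⟨ x-N P.ξ′∈ ⟩ ([ x ] ⟨ x-join P.ξ∈ ⟩ (path-reverse path-B ⟨ E-sym e ⟩ (lk-path (proj₂ P.lk) (arc-path c₁) ⟨ η-p ⟩ (p-w ∷ [ w ])))))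
                      ((nodup⊆ (r ∷ flatten X ∷ flatten X′ ∷ flatten W ∷ []) (x ∷ ξ ∷ y ∷ η ∷ p ∷ w ∷ ξ′ ∷ v ∷ z ∷ []) (((# 2 · (• 6 · ε)) · (• 0 · (rev ((• 8 · (# 3 · (• 1 · ε)))) · ((• 2 · (# 0 · (# 1 · (• 3 · ε)))) · (• 4 · (• 5 · ε))))))) ((• 0 · (• 1 · ((• 2 · # 0) · ((# 1 · (• 3 · (• 4 · (• 5 · # 2)))) · (• 6 · ((• 7 · (• 8 · ε)) · # 3))))))) (nd′)))
                      (λ q → ∈-resp (cong (λ l → (y ∷ r ++ (l ++ ξ′ ∷ [])) ++ x ∷ reverse (z ∷ (flatten W ++ ξ ∷ []))) (sym fl))
                        ((∈⊆ (flatten X′ ∷ flatten W ∷ r ∷ flatten X ∷ []) (ξ′ ∷ x ∷ z ∷ ξ ∷ y ∷ η ∷ p ∷ w ∷ []) (((# 0 · (• 0 · ε)) · (• 1 · (rev ((• 2 · (# 1 · (• 3 · ε)))) · ((• 4 · (# 2 · (# 3 · (• 5 · ε)))) · (• 6 · (• 7 · ε))))))) (((• 4 · (# 2 · ((# 3 · (• 5 · (• 6 · (• 7 · # 0)))) · (• 0 · ε)))) · (• 1 · rev ((• 2 · (# 1 · (• 3 · ε))))))) (q))))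
                      ((≤-antisym (lin ([]) (flatten Y ∷ flatten X ∷ flatten X′ ∷ r ∷ flatten W ∷ L ∷ []) (η ∷ p ∷ w ∷ ξ ∷ y ∷ ξ′ ∷ v ∷ z ∷ x ∷ []) ((lng (# 0) ≋ lng ((# 1 · (• 0 · (• 1 · (• 2 · # 2)))))) ∷ (lng ((• 3 · ((• 4 · # 3) · (# 0 · (• 5 · ((• 6 · (• 7 · ε)) · # 4)))))) ≋ lng (# 5)) ∷ []) (lng (((# 2 · (• 5 · ε)) · (• 8 · (rev ((• 7 · (# 4 · (• 3 · ε)))) · ((• 4 · (# 3 · (# 1 · (• 0 · ε)))) · (• 1 · (• 2 · ε)))))))) (lng (# 5)) 0 ((0 , 1) ∷ (1 , 0) ∷ []) (cong length fl , P.len , tt)) (lin ([]) (flatten Y ∷ flatten X ∷ flatten X′ ∷ r ∷ flatten W ∷ L ∷ []) (η ∷ p ∷ w ∷ ξ ∷ y ∷ ξ′ ∷ v ∷ z ∷ x ∷ []) ((lng (# 0) ≋ lng ((# 1 · (• 0 · (• 1 · (• 2 · # 2)))))) ∷ (lng ((• 3 · ((• 4 · # 3) · (# 0 · (• 5 · ((• 6 · (• 7 · ε)) · # 4)))))) ≋ lng (# 5)) ∷ []) (lng (# 5)) (lng (((# 2 · (• 5 · ε)) · (• 8 · (rev ((• 7 · (# 4 · (• 3 · ε)))) · ((• 4 · (# 3 · (# 1 · (• 0 · ε)))) · (• 1 · (• 2 · ε)))))))) 0 ((1 , 0) ∷ (0 , 1) ∷ []) (cong length fl , P.len , tt))))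
                      (λ { refl → w∉ (there η⁺∈) }) ev (N*-E w∈))
                    where
                    fl : flatten Y ≡ flatten X ++ η ∷ p ∷ w ∷ flatten X′
                    fl = trans (cong flatten eq) (flatten-++ X _)
                    nd′ = subst (λ l → NoDup (x ∷ ξ ∷ (y ∷ r) ++ l ++ ξ′ ∷ (v ∷ z ∷ []) ++ flatten W)) fl nd-x
                    off-W : η⁺ ∉ flatten W ++ ξ ∷ []
                    off-W q = NoDup-disjoint {flatten X′ ++ ξ′ ∷ []} {flatten W ++ ξ ∷ []}
                      ((nodup⊆ (r ∷ flatten X ∷ flatten X′ ∷ flatten W ∷ []) (x ∷ ξ ∷ y ∷ η ∷ p ∷ w ∷ ξ′ ∷ v ∷ z ∷ []) (((# 2 · (• 6 · ε)) · (# 3 · (• 1 · ε)))) ((• 0 · (• 1 · ((• 2 · # 0) · ((# 1 · (• 3 · (• 4 · (• 5 · # 2)))) · (• 6 · ((• 7 · (• 8 · ε)) · # 3))))))) (nd′))) (start∈ (arc-path c₂)) q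
                    η⁺∈ : η⁺ ∈ N
                    η⁺∈ with ∈-++⁻ (heads X′) (chain-start∈ c₂)
                    ... | inj₂ (here refl) = P.ξ′∈
                    ... | inj₁ q = headsY (∈-resp (sym (trans (cong heads eq) (map-++ proj₁ X _))) (∈-++⁺ʳ (heads X) (there q)))
                  conclude (inW {X} {η} {p} {[]} eq) = k eq (N*-E w∈)
                  conclude (inW {X} {η} {p} {τ ∷ X′} eq) with chain-++⁻ X (subst (λ Z → Chain β Z ξ) eq P.chW)
                  ... | _ , c₁ , _∷_ {ζ = η⁺} (η-p , p-w , w-η⁺) c₂ = missed η⁺∈ (λ { refl → NoDup-disjoint {ξ ∷ []} {flatten (τ ∷ X′)} ((nodup⊆ (r ∷ flatten Y ∷ flatten X ∷ flatten (τ ∷ X′) ∷ []) (x ∷ ξ ∷ y ∷ ξ′ ∷ v ∷ z ∷ η ∷ p ∷ w ∷ []) ((• 1 · # 3)) ((• 0 · (• 1 · ((• 2 · # 0) · (# 1 · (• 3 · ((• 4 · (• 5 · ε)) · (# 2 · (• 6 · (• 7 · (• 8 · # 3))))))))))) (nd′))) (here refl) η⁺∈X′ })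
                      (λ { refl → NoDup-disjoint {flatten X ++ η ∷ []} {flatten (τ ∷ X′)} ((nodup⊆ (r ∷ flatten Y ∷ flatten X ∷ flatten (τ ∷ X′) ∷ []) (x ∷ ξ ∷ y ∷ ξ′ ∷ v ∷ z ∷ η ∷ p ∷ w ∷ []) (((# 2 · (• 6 · ε)) · # 3)) ((• 0 · (• 1 · ((• 2 · # 0) · (# 1 · (• 3 · ((• 4 · (• 5 · ε)) · (# 2 · (• 6 · (• 7 · (• 8 · # 3))))))))))) (nd′))) (start∈ (arc-path c₁)) η⁺∈X′ })
                    (λ ev → consec
                      (E-sym p-w ∷ (E-sym η-p ∷ (path-reverse (arc-path c₁) ⟨ E-sym z-β ⟩ (E-sym e ∷ (path-A ⟨ x-N P.ξ′∈ ⟩ ([ x ] ⟨ x-join P.ξ∈ ⟩ path-reverse (arc-path c₂)))))))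
                      ((nodup⊆ (r ∷ flatten Y ∷ flatten X ∷ flatten (τ ∷ X′) ∷ []) (x ∷ ξ ∷ y ∷ ξ′ ∷ v ∷ z ∷ η ∷ p ∷ w ∷ []) ((• 8 · (• 7 · (rev ((# 2 · (• 6 · ε))) · (• 5 · ((• 2 · (# 0 · (# 1 · (• 3 · ε)))) · (• 0 · rev ((# 3 · (• 1 · ε)))))))))) ((• 0 · (• 1 · ((• 2 · # 0) · (# 1 · (• 3 · ((• 4 · (• 5 · ε)) · (# 2 · (• 6 · (• 7 · (• 8 · # 3))))))))))) (nd′)))
                      (λ q → ∈-resp (cong (λ l → (y ∷ r ++ (flatten Y ++ ξ′ ∷ [])) ++ x ∷ reverse (z ∷ (l ++ ξ ∷ []))) (sym fl))
                        ((∈⊆ (flatten X ∷ r ∷ flatten Y ∷ flatten (τ ∷ X′) ∷ []) (w ∷ p ∷ η ∷ z ∷ y ∷ ξ′ ∷ x ∷ ξ ∷ []) ((• 0 · (• 1 · (rev ((# 0 · (• 2 · ε))) · (• 3 · ((• 4 · (# 1 · (# 2 · (• 5 · ε)))) · (• 6 · rev ((# 3 · (• 7 · ε)))))))))) (((• 4 · (# 1 · (# 2 · (• 5 · ε)))) · (• 6 · rev ((• 3 · ((# 0 · (• 2 · (• 1 · (• 0 · # 3)))) · (• 7 · ε))))))) (q))))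
                      ((≤-antisym (lin ([]) (flatten W ∷ flatten X ∷ flatten (τ ∷ X′) ∷ r ∷ flatten Y ∷ L ∷ []) (η ∷ p ∷ w ∷ ξ ∷ y ∷ ξ′ ∷ v ∷ z ∷ x ∷ []) ((lng (# 0) ≋ lng ((# 1 · (• 0 · (• 1 · (• 2 · # 2)))))) ∷ (lng ((• 3 · ((• 4 · # 3) · (# 4 · (• 5 · ((• 6 · (• 7 · ε)) · # 0)))))) ≋ lng (# 5)) ∷ []) (lng ((• 2 · (• 1 · (rev ((# 1 · (• 0 · ε))) · (• 7 · ((• 4 · (# 3 · (# 4 · (• 5 · ε)))) · (• 8 · rev ((# 2 · (• 3 · ε))))))))))) (lng (# 5)) 0 ((0 , 1) ∷ (1 , 0) ∷ []) (cong length fl , P.len , tt)) (lin ([]) (flatten W ∷ flatten X ∷ flatten (τ ∷ X′) ∷ r ∷ flatten Y ∷ L ∷ []) (η ∷ p ∷ w ∷ ξ ∷ y ∷ ξ′ ∷ v ∷ z ∷ x ∷ []) ((lng (# 0) ≋ lng ((# 1 · (• 0 · (• 1 · (• 2 · # 2)))))) ∷ (lng ((• 3 · ((• 4 · # 3) · (# 4 · (• 5 · ((• 6 · (• 7 · ε)) · # 0)))))) ≋ lng (# 5)) ∷ []) (lng (# 5)) (lng ((• 2 · (• 1 · (rev ((# 1 · (• 0 · ε))) · (• 7 · ((• 4 · (# 3 · (# 4 · (• 5 · ε)))) · (• 8 · rev ((# 2 · (• 3 · ε))))))))))) 0 ((1 , 0) ∷ (0 , 1) ∷ []) (cong length fl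 , P.len , tt))))
                      (λ { refl → w∉ (there η⁺∈) }) (N*-E w∈) ev)
                    where
                    fl : flatten W ≡ flatten X ++ η ∷ p ∷ w ∷ flatten (τ ∷ X′)
                    fl = trans (cong flatten eq) (flatten-++ X _)
                    nd′ = subst (λ l → NoDup (x ∷ ξ ∷ (y ∷ r) ++ flatten Y ++ ξ′ ∷ (v ∷ z ∷ []) ++ l)) fl nd-x
                    start-head : ∀ {a Z b} → Chain a (τ ∷ Z) b → a ∈ heads (τ ∷ Z)
                    start-head (l ∷ c) = here refl
                    η⁺∈X′ : η⁺ ∈ flatten (τ ∷ X′)
                    η⁺∈X′ = heads⊆flatten (τ ∷ X′) (start-head c₂)
                    η⁺∈ : η⁺ ∈ N
                    η⁺∈ = headsW (∈-resp (sym (trans (cong heads eq) (map-++ proj₁ X _))) (∈-++⁺ʳ (heads X) (there (start-head c₂))))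

            -- v misses ξ and the vertex after z, so a further neighbour is needed; it ends a segment [p , w], and
            -- the vertex after w is missed as well, so it must be ξ.
            advance : Odd ((ξ , y ∷ r) ∷ Y ++ (ξ′ , v ∷ z ∷ []) ∷ W) →
                   (∀ {W₁ η p w} → W ≡ W₁ ++ (η , p ∷ w ∷ []) ∷ [] → E v w → ⊥) → ⊥
            advance odd k = go W refl
              where
              go : ∀ W′ → W ≡ W′ → ⊥
              go []       eq = empty-W odd eq
              go (σ ∷ W′) eqW = free λ { (N* , C*) → Further.hunt odd k (subst (λ Z → 1 ≤ length Z) (sym eqW) (s≤s z≤n)) C* }

          -- Three rounds of Beta.advance go once around the cycle, which then has just three segments, all of length 2.
          β-dead : ∀ {ξ y r Y ξ′ v z W} → R ((ξ , y ∷ r) ∷ Y ++ (ξ′ , v ∷ z ∷ []) ∷ W) →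
                   Odd ((ξ , y ∷ r) ∷ Y ++ (ξ′ , v ∷ z ∷ []) ∷ W) → ¬ E y z
          β-dead {ξ} {y} {r} {Y} {ξ′} {v} {z} {W} ρ odd e = Beta.advance ρ e odd round₂
            where
            round₂ : ∀ {W₁ η p w} → W ≡ W₁ ++ (η , p ∷ w ∷ []) ∷ [] → E v w → ⊥
            round₂ {W₁} {η} {p} {w} refl v-w = Beta.advance ρ₂ v-w odd₂ round₃
              where
              ρ₂ : R ((ξ′ , v ∷ z ∷ []) ∷ W₁ ++ (η , p ∷ w ∷ []) ∷ (ξ , y ∷ r) ∷ Y)
              ρ₂ = Tight.ρ-W ρ e {W₁} {η} {p ∷ w ∷ []} {[]} refl
              odd₂ : Odd ((ξ′ , v ∷ z ∷ []) ∷ W₁ ++ (η , p ∷ w ∷ []) ∷ (ξ , y ∷ r) ∷ Y)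
              odd₂ = subst (λ Z → Odd ((ξ′ , v ∷ z ∷ []) ∷ Z)) (++-assoc W₁ _ _) (odd-rotate ((ξ , y ∷ r) ∷ Y) odd)
              -- The budget of 2 is spent on `r` and on the segment of `p` and `w`, so all segments
              -- in `Y` and `W₁` have one vertex.
              excs : exc Y + exc W₁ ≤ 0
              excs = (lin (exc Y ∷ exc (W₁ ++ (η , p ∷ w ∷ []) ∷ []) ∷ exc W₁ ∷ []) (r ∷ []) ([]) (((((lng (# 0) ⊕ at 0) ⊕ κ 0) ⊕ at 1) ≼ κ 2) ∷ (κ 1 ≼ lng (# 0)) ∷ (at 1 ≋ (at 2 ⊕ κ 1)) ∷ []) ((at 0 ⊕ at 2)) (κ 0) 0 ((1 , 0) ∷ (1 , 0) ∷ (0 , 1) ∷ []) (Tight.budget ρ e , Beta.r≥1 ρ e , exc-++ W₁ ((η , p ∷ w ∷ []) ∷ []) , tt))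
              round₃ : ∀ {W₂ θ p′ w′} → (ξ , y ∷ r) ∷ Y ≡ W₂ ++ (θ , p′ ∷ w′ ∷ []) ∷ [] → E p w′ → ⊥
              round₃ {[]} {θ} {p′} {w′} refl p-w = Beta.advance {Y = []} ρ₃ p-w odd₃ last-round
                where
                ρ₃ : R ((η , p ∷ w ∷ []) ∷ (ξ , y ∷ w′ ∷ []) ∷ (ξ′ , v ∷ z ∷ []) ∷ W₁)
                ρ₃ = rep-rotate ((ξ′ , v ∷ z ∷ []) ∷ W₁) ρ₂
                odd₃ : Odd ((η , p ∷ w ∷ []) ∷ (ξ , y ∷ w′ ∷ []) ∷ (ξ′ , v ∷ z ∷ []) ∷ W₁)
                odd₃ = odd-rotate ((ξ′ , v ∷ z ∷ []) ∷ W₁) odd₂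
                last-round : ∀ {W₃ θ′ p″ w″} → (ξ′ , v ∷ z ∷ []) ∷ W₁ ≡ W₃ ++ (θ′ , p″ ∷ w″ ∷ []) ∷ [] → E y w″ → ⊥
                last-round {[]} refl _ = not-odd refl refl refl odd₃
                last-round {_ ∷ W₃} {θ′} {p″} {w″} refl _ =
                  (1≰0 (lin {A = ⊤} (exc (W₃ ++ (θ′ , p″ ∷ w″ ∷ []) ∷ []) ∷ exc W₃ ∷ []) ([]) ([]) (((κ 0 ⊕ at 0) ≼ κ 0) ∷ (at 0 ≋ (at 1 ⊕ κ 1)) ∷ []) (κ 1) (κ 0) 0 ((1 , 0) ∷ (0 , 1) ∷ []) (excs , exc-++ W₃ ((θ′ , p″ ∷ w″ ∷ []) ∷ []) , tt)))
              round₃ {_ ∷ W₂} {θ} {p′} {w′} refl _ =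
                (1≰0 (lin {A = ⊤} (exc (W₂ ++ (θ , p′ ∷ w′ ∷ []) ∷ []) ∷ exc W₁ ∷ exc W₂ ∷ []) ([]) ([]) (((at 0 ⊕ at 1) ≼ κ 0) ∷ (at 0 ≋ (at 2 ⊕ κ 1)) ∷ []) (κ 1) (κ 0) 0 ((1 , 0) ∷ (0 , 1) ∷ []) (excs , exc-++ W₂ ((θ , p′ ∷ w′ ∷ []) ∷ []) , tt)))

          swap-rep : ∀ {σ} Y {τ W} → R (σ ∷ Y ++ τ ∷ W) → R (τ ∷ W ++ σ ∷ Y)
          swap-rep {σ} Y r = rep-rotate (σ ∷ Y) r

          swap-odd : ∀ {σ} Y {τ W} → Odd (σ ∷ Y ++ τ ∷ W) → Odd (τ ∷ W ++ σ ∷ Y)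
          swap-odd {σ} Y o = odd-rotate (σ ∷ Y) o

          -- Edges between different segments

          Interior : List V → List V → Set
          Interior o b = 1 ≤ length o × 1 ≤ length b

          private
            -- For an edge from a first to a last vertex the budget leaves a segment of two vertices
            -- on one side. That is the situation of `β-dead`, directly or after reversal.
            half : ∀ {ξ y r₁ Y ξ′ o₂ z W} → R ((ξ , y ∷ r₁) ∷ Y ++ (ξ′ , o₂ ++ z ∷ []) ∷ W) →
                   Odd ((ξ , y ∷ r₁) ∷ Y ++ (ξ′ , o₂ ++ z ∷ []) ∷ W) → ¬ E y z
            half {ξ} {y} {r₁} {Y} {ξ′} {o₂} {z} {W} q o e = cases o₂ refl r₁ refl
              where
              before = edge-before {o₁ = []} {o₂ = o₂} q e
              after = edge-after {o₁ = []} {o₂ = o₂} {r₂ = []} q e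
              cases : ∀ o′ → o₂ ≡ o′ → ∀ r′ → r₁ ≡ r′ → ⊥
              cases [] refl _ _ = (1≰0 (lin {A = ⊤} ([]) ([]) ([]) ((κ 1 ≼ κ 0) ∷ []) (κ 1) (κ 0) 0 ((1 , 0) ∷ []) (before , tt)))
              cases (v ∷ []) refl _ _ = β-dead q o e
              cases (v ∷ v′ ∷ []) refl [] refl = (1≰0 (lin {A = ⊤} ([]) ([]) ([]) ((κ 1 ≼ (κ 0 ⊕ κ 0)) ∷ []) (κ 1) (κ 0) 0 ((1 , 0) ∷ []) (after , tt)))
              cases (v ∷ v′ ∷ []) refl (t ∷ []) refl = pair-reverse q o λ {_} {W′} q′ o′ → β-dead (swap-rep W′ q′) (swap-odd W′ o′) (E-sym e)
              cases (v ∷ v′ ∷ []) refl (t ∷ t′ ∷ r) refl = (1≰0 (lin (exc Y ∷ exc W ∷ []) (r ∷ []) (y ∷ t ∷ t′ ∷ []) (((((lng ((• 0 · (• 1 · (• 2 · # 0)))) ⊕ at 0) ⊕ κ 3) ⊕ at 1) ≼ κ 5) ∷ []) (κ 1) (κ 0) 0 ((1 , 0) ∷ []) (pair-budget q , tt)))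
              cases (v ∷ v′ ∷ v″ ∷ o₃) refl r′ refl =
                (1≰0 (lin (exc Y ∷ exc W ∷ []) (r₁ ∷ o₃ ∷ []) (y ∷ v ∷ v′ ∷ v″ ∷ z ∷ []) (((((lng ((• 0 · # 0)) ⊕ at 0) ⊕ lng ((• 1 · (• 2 · (• 3 · (# 1 · (• 4 · ε))))))) ⊕ at 1) ≼ κ 5) ∷ (κ 1 ≼ (lng (# 0) ⊕ κ 0)) ∷ []) (κ 1) (κ 0) 0 ((1 , 0) ∷ (1 , 0) ∷ []) (pair-budget q , after , tt)))

          -- If neither end is interior, then both are first, both are last, or one is first and the
          -- other last. These are excluded by `edge-before`, `edge-after` and `half`.
          edge-interior : ∀ {ξ o₁ y r₁ Y ξ′ o₂ z r₂ W} → R ((ξ , o₁ ++ y ∷ r₁) ∷ Y ++ (ξ′ , o₂ ++ z ∷ r₂) ∷ W) →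
                          Odd ((ξ , o₁ ++ y ∷ r₁) ∷ Y ++ (ξ′ , o₂ ++ z ∷ r₂) ∷ W) → E y z → Interior o₁ r₁ ⊎ Interior o₂ r₂
          edge-interior {o₁ = []} {o₂ = []} q o e = 1≰0 (edge-before {o₁ = []} {o₂ = []} q e)
          edge-interior {o₁ = []} {o₂ = o₂@(_ ∷ _)} {r₂ = []} q o e = ⊥-elim (half {o₂ = o₂} q o e)
          edge-interior {o₁ = []} {o₂ = _ ∷ _} {r₂ = _ ∷ _} q o e = inj₂ (s≤s z≤n , s≤s z≤n)
          edge-interior {o₁ = _ ∷ _} {r₁ = _ ∷ _} q o e = inj₁ (s≤s z≤n , s≤s z≤n)
          edge-interior {o₁ = o₁@(_ ∷ _)} {r₁ = []} {Y} {o₂ = []} q o e = ⊥-elim (half {o₂ = o₁} (swap-rep Y q) (swap-odd Y o) (E-sym e))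
          edge-interior {o₁ = _ ∷ _} {r₁ = []} {o₂ = _ ∷ _} {r₂ = _ ∷ _} q o e = inj₂ (s≤s z≤n , s≤s z≤n)
          edge-interior {o₁ = o₁@(_ ∷ _)} {y} {r₁ = []} {o₂ = o₂@(_ ∷ _)} {z} {r₂ = []} q o e =
            1≰0 (edge-after {o₁ = o₁} {r₁ = []} {o₂ = o₂} {r₂ = []} q e)

          -- The count for the separator N ∪ {m}, where v m s″ is the long segment.
          module Alpha {ξ′ v m s″ T} (q : R ((ξ′ , v ∷ m ∷ s″) ∷ T)) (odd : Odd ((ξ′ , v ∷ m ∷ s″) ∷ T)) (s″≥1 : 1 ≤ length s″)
                       (v-closed : ∀ {w} → E v w → w ∈ N ⊎ w ≡ m)
                       (s″-closed : ∀ {X η t X′ p u} → T ≡ X ++ (η , t) ∷ X′ → p ∈ t → u ∈ s″ → ¬ E p u) where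

            private
              S : List V
              S = m ∷ N
              σ : Seg
              σ = ξ′ , v ∷ m ∷ s″

            module Sep = Separation L N S there
            open Sep using (NoLink; apart)

            private
              -- A link is an edge by `link-edge`. Between two segments of `T` it requires four
              -- vertices there, which together with the excess 2 of `σ` breaks the budget of 5; at
              -- `σ` the hypotheses on `v` and `s″` exclude it.
              nolink : ∀ {T₁ η t T₂} → T ≡ T₁ ++ (η , t) ∷ T₂ → NoLink t (T₂ ++ σ ∷ T₁)
              nolink {T₁} {η} {t} {T₂} eqT {X} {ξ″} {s} {X′} {y} {z} eq y∈ z∈ y∉ z∉ l nd off with ∈-∃++ y∈ | ∈-∃++ z∈
              ... | o₁ , r₁ , refl | o₂ , r₂ , refl = by-edge (link-edge ρ l nd off)
                where
                ρ : R ((η , o₁ ++ y ∷ r₁) ∷ X ++ (ξ″ , o₂ ++ z ∷ r₂) ∷ X′)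
                ρ = subst (λ Z → R ((η , o₁ ++ y ∷ r₁) ∷ Z)) eq (rep-rotate (σ ∷ T₁) (subst (λ Z → R (σ ∷ Z)) eqT q))
                long : ∀ {Z} → E y z → exc Z ≥ 2 → exc Z ≤ exc X + exc X′ → ⊥
                long {Z} e l₂ l₁ = (1≰0 (lin (exc X ∷ exc X′ ∷ exc Z ∷ []) (o₁ ∷ r₁ ∷ o₂ ∷ r₂ ∷ []) (y ∷ z ∷ []) (((((lng ((# 0 · (• 0 · # 1))) ⊕ at 0) ⊕ lng ((# 2 · (• 1 · # 3)))) ⊕ at 1) ≼ κ 5) ∷ (κ 1 ≼ (lng (# 0) ⊕ lng (# 2))) ∷ (κ 1 ≼ (lng (# 1) ⊕ lng (# 3))) ∷ (κ 2 ≼ at 2) ∷ (at 2 ≼ (at 0 ⊕ at 1)) ∷ []) (κ 1) (κ 0) 0 ((1 , 0) ∷ (1 , 0) ∷ (1 , 0) ∷ (1 , 0) ∷ (1 , 0) ∷ []) (pair-budget ρ , edge-before {o₁ = o₁} {o₂ = o₂} ρ e , edge-after {o₁ = o₁} {o₂ = o₂} ρ e , l₂ , l₁ , tt)))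
                exc-σ : ∀ A B → 2 ≤ exc (A ++ σ ∷ B)
                exc-σ A B = (lin (exc (A ++ σ ∷ B) ∷ exc A ∷ exc B ∷ []) (s″ ∷ []) ([]) ((at 0 ≋ (at 1 ⊕ ((κ 1 ⊕ lng (# 0)) ⊕ at 2))) ∷ (κ 1 ≼ lng (# 0)) ∷ []) (κ 2) (at 0) 0 ((0 , 1) ∷ (1 , 0) ∷ []) (exc-++ A (σ ∷ B) , s″≥1 , tt))
                by-edge : _ ≡ [] → ⊥
                by-edge refl with split-cases X T₂ (sym eq)
                ... | inj₁ (D , eq₂) = long {X′} l (subst (λ Z → 2 ≤ exc Z) (sym X′≡) (exc-σ D T₁)) (m≤n+m _ (exc X))
                  where
                  X′≡ : X′ ≡ D ++ σ ∷ T₁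
                  X′≡ = ∷-injectiveʳ (++-cancelˡ X _ _ (trans (sym eq) (trans (cong (_++ σ ∷ T₁) eq₂) (++-assoc X _ _))))
                ... | inj₂ (inj₂ (D , refl , _)) = long {T₂ ++ σ ∷ D} l (exc-σ T₂ D) (m≤m+n _ _)
                ... | inj₂ (inj₁ (_ , eqσ , _)) = at-σ (∈-resp (cong proj₂ eqσ) (∈-++⁺ʳ o₂ (here refl)))
                  where
                  at-σ : z ∈ v ∷ m ∷ s″ → ⊥
                  at-σ (here refl) with v-closed (E-sym l)
                  ... | inj₁ h = y∉ (there h)
                  ... | inj₂ h = y∉ (here h)
                  at-σ (there (here refl)) = z∉ (here refl)
                  at-σ (there (there h)) = s″-closed eqT y∈ h l

              in-L : ∀ {w} → w ∈ flatten (σ ∷ T) → w ∈ L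
              in-L = to q

            contradictory : ⊥
            contradictory = go s″ refl s″≥1
              where
              go : ∀ s‴ → s″ ≡ s‴ → 1 ≤ length s‴ → ⊥
              go (w ∷ s‴) eq-s″ _ = <⇒≱ (≤-reflexive count) (separated S reps two outside pairs)
                where
                w∈s″ : w ∈ s″
                w∈s″ = subst (w ∈_) (sym eq-s″) (here refl)
                v∈ : v ∈ L
                v∈ = in-L (there (here refl))
                w∈ : w ∈ L
                w∈ = in-L (there (there (there (∈-++⁺ˡ w∈s″))))
                -- Deleting `m` splits its segment, which thus yields two representatives and pays
                -- for the additional vertex of the separator.
                xs = v ∷ w ∷ x ∷ []
                reps = firsts T ++ xs
                nonempties : ∀ X Y → R (X ++ Y) → All (λ τ → 1 ≤ length (proj₂ τ)) Y
                nonempties X []      r = []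
                nonempties X (τ ∷ Y) r = seg≥1 (rep-rotate X r) ∷ nonempties (X ++ τ ∷ []) Y (subst R (sym (++-assoc X _ Y)) r)
                count : 1 + length S ≡ length reps
                count = (≤-antisym (lin (δ ∷ length T ∷ []) (N ∷ firsts T ∷ []) (m ∷ v ∷ w ∷ x ∷ []) ((lng (# 0) ≋ at 0) ∷ ((κ 1 ⊕ at 1) ≋ at 0) ∷ (lng (# 1) ≋ at 1) ∷ []) ((κ 1 ⊕ lng ((• 0 · # 0)))) (lng ((# 1 · (• 1 · (• 2 · (• 3 · ε)))))) 0 ((1 , 0) ∷ (0 , 1) ∷ (0 , 1) ∷ []) (|N| , segs q , firsts-length T (nonempties (σ ∷ []) T q) , tt)) (lin (δ ∷ length T ∷ []) (N ∷ firsts T ∷ []) (m ∷ v ∷ w ∷ x ∷ []) ((lng (# 0) ≋ at 0) ∷ ((κ 1 ⊕ at 1) ≋ at 0) ∷ (lng (# 1) ≋ at 1) ∷ []) (lng ((# 1 · (• 1 · (• 2 · (• 3 · ε)))))) ((κ 1 ⊕ lng ((• 0 · # 0)))) 0 ((0 , 1) ∷ (1 , 0) ∷ (1 , 0) ∷ []) (|N| , segs q , firsts-length T (nonempties (σ ∷ []) T q) , tt)))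
                two : 2 ≤ length reps
                two = (lin ([]) (firsts T ∷ []) (v ∷ w ∷ x ∷ []) ([]) (κ 2) (lng ((# 0 · (• 0 · (• 1 · (• 2 · ε)))))) 0 ([]) (tt))
                nd : NoDup (ξ′ ∷ (v ∷ m ∷ s″) ++ flatten T)
                nd = nodupᶻ q
                m∉ : m ∉ s″ ++ flatten T
                m∉ p = NoDup-disjoint {m ∷ []} {s″ ++ flatten T} ((nodup⊆ (s″ ∷ flatten T ∷ []) (ξ′ ∷ v ∷ m ∷ []) (((• 2 · ε) · (# 0 · # 1))) ((• 0 · ((• 1 · (• 2 · # 0)) · # 1))) (nd))) (here refl) p
                v∉ : v ∉ m ∷ s″ ++ flatten T
                v∉ p = NoDup-disjoint {v ∷ []} {m ∷ s″ ++ flatten T} ((nodup⊆ (s″ ∷ flatten T ∷ []) (ξ′ ∷ v ∷ m ∷ []) (((• 1 · ε) · (• 2 · (# 0 · # 1)))) ((• 0 · ((• 1 · (• 2 · # 0)) · # 1))) (nd))) (here refl) p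
                σ∉N : ∀ {u} → u ∈ v ∷ m ∷ s″ → u ∉ N
                σ∉N u∈ = seg∉N [] q u∈
                outside : All (_∉ S) reps
                outside = ++⁺ (All.tabulate λ p → λ { (here refl) → m∉ (∈-++⁺ʳ s″ (firsts⊆ T p)) ; (there h) → firsts∉ (σ ∷ T) q (there p) h })
                              ((λ { (here refl) → v∉ (here refl) ; (there h) → σ∉N (here refl) h })
                               ∷ (λ { (here refl) → m∉ (∈-++⁺ˡ w∈s″) ; (there h) → σ∉N (there (there w∈s″)) h })
                               ∷ (λ { (here refl) → x∉L (in-L (there (there (here refl)))) ; (there h) → x∉L (C.N⊆L Cx h) }) ∷ [])
                x-closed : ∀ {z u} → z ∈ x ∷ [] → E z u → u ∈ x ∷ [] ⊎ u ∈ S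
                x-closed (here refl) e = inj₂ (there (x-nbr e))
                v-block : ∀ {z u} → z ∈ v ∷ [] → E z u → u ∈ v ∷ [] ⊎ u ∈ S
                v-block (here refl) e = inj₂ ([ there , here ]′ (v-closed e))
                from-x : ∀ {u} → u ∈ L → ¬ Con (_∉ S) u x
                from-x u∈ con = closed-apart x-closed (here refl) (λ { (here refl) → x∉L u∈ }) (con-sym con)
                seg-apart : ∀ T₁ {η u t T₂ u′} → T ≡ T₁ ++ (η , u ∷ t) ∷ T₂ → u′ ∈ firsts T₂ ⊎ u′ ∈ xs → ¬ Con (_∉ S) u u′
                seg-apart T₁ {η} {u} {t} {T₂} {u′} eq u′∈ = split u′∈
                  where
                  ρ : R ((η , u ∷ t) ∷ T₂ ++ σ ∷ T₁)
                  ρ = rep-rotate (σ ∷ T₁) (subst (λ Z → R (σ ∷ Z)) eq q)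
                  to-rest : u′ ∈ flatten T₂ ++ flatten (σ ∷ T₁) → ¬ Con (_∉ S) u u′
                  to-rest p = apart (nolink eq) ρ (here refl) (to ρ (there (∈-++⁺ʳ (u ∷ t) p′)))
                                (λ h → NoDup-disjoint {u ∷ t} (NoDup-tail (nodupᶻ ρ)) h p′)
                    where p′ = ∈-resp (sym (flatten-++ T₂ (σ ∷ T₁))) p
                  split : u′ ∈ firsts T₂ ⊎ u′ ∈ xs → ¬ Con (_∉ S) u u′
                  split (inj₁ h) = to-rest (∈-++⁺ˡ (firsts⊆ T₂ h))
                  split (inj₂ (here refl)) = to-rest (∈-++⁺ʳ (flatten T₂) (there (here refl)))
                  split (inj₂ (there (here refl))) = to-rest (∈-++⁺ʳ (flatten T₂) (there (there (there (∈-++⁺ˡ w∈s″)))))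
                  split (inj₂ (there (there (here refl)))) = from-x (to ρ (there (here refl)))
                pairs : AllPairs (λ u u′ → ¬ Con (_∉ S) u u′) reps
                pairs = firsts-pairs (λ u u′ → ¬ Con (_∉ S) u u′) xs T seg-apart
                  ((closed-apart v-block (here refl) (λ { (here refl) → v∉ (there (∈-++⁺ˡ w∈s″)) })
                    ∷ from-x v∈ ∷ []) ∷ (from-x w∈ ∷ []) ∷ [] ∷ [])

          module KillTight {ξ y r Y ξ′ v m s″ W} (ρ : R ((ξ , y ∷ r) ∷ Y ++ (ξ′ , v ∷ m ∷ s″) ∷ W))
                           (odd : Odd ((ξ , y ∷ r) ∷ Y ++ (ξ′ , v ∷ m ∷ s″) ∷ W)) (e : E y m) (s″≥1 : 1 ≤ length s″) where

            open Tight ρ e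

            private
              T : List Seg
              T = W ++ (ξ , y ∷ r) ∷ Y

              σ : Seg
              σ = ξ′ , v ∷ m ∷ s″

              q : R (σ ∷ T)
              q = rep-rotate ((ξ , y ∷ r) ∷ Y) ρ

              odd-q : Odd (σ ∷ T)
              odd-q = odd-rotate ((ξ , y ∷ r) ∷ Y) odd

            at-T : ∀ {X η t X′} → T ≡ X ++ (η , t) ∷ X′ → R ((η , t) ∷ X′ ++ σ ∷ X)
            at-T {X} eq = rep-rotate (σ ∷ X) (subst (λ Z → R (σ ∷ Z)) eq q)

            -- Some end of the edge is interior to its segment. Were it `p`, there would be three
            -- vertices in its segment and three in that of `v`.
            T-edge : ∀ {X η t X′ p u} o₂ {r₂} → T ≡ X ++ (η , t) ∷ X′ → p ∈ t → v ∷ m ∷ s″ ≡ o₂ ++ u ∷ r₂ → E p u → Interior o₂ r₂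
            T-edge {X} {η} {t} {X′} {p} {u} o₂ {r₂} eq p∈ eqσ e′ with ∈-∃++ p∈
            ... | o , b , refl with edge-interior {o₁ = o} {o₂ = o₂} ρ′ odd′ e′
              where
              ρ′ : R ((η , o ++ p ∷ b) ∷ X′ ++ (ξ′ , o₂ ++ u ∷ r₂) ∷ X)
              ρ′ = subst (λ l → R ((η , o ++ p ∷ b) ∷ X′ ++ (ξ′ , l) ∷ X)) eqσ (at-T eq)
              odd′ : Odd ((η , o ++ p ∷ b) ∷ X′ ++ (ξ′ , o₂ ++ u ∷ r₂) ∷ X)
              odd′ = subst (λ l → Odd ((η , o ++ p ∷ b) ∷ X′ ++ (ξ′ , l) ∷ X)) eqσ (odd-rotate (σ ∷ X) (subst (λ Z → Odd (σ ∷ Z)) eq odd-q))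
            ...   | inj₂ h = h
            ...   | inj₁ (h₁ , h₂) = (1≰0 (lin (exc X′ ∷ exc X ∷ []) (o ∷ b ∷ s″ ∷ []) (p ∷ v ∷ m ∷ []) (((((lng ((# 0 · (• 0 · # 1))) ⊕ at 0) ⊕ lng ((• 1 · (• 2 · # 2)))) ⊕ at 1) ≼ κ 5) ∷ (κ 1 ≼ lng (# 0)) ∷ (κ 1 ≼ lng (# 1)) ∷ (κ 1 ≼ lng (# 2)) ∷ []) (κ 1) (κ 0) 0 ((1 , 0) ∷ (1 , 0) ∷ (1 , 0) ∷ (1 , 0) ∷ []) (pair-budget (at-T eq) , h₁ , h₂ , s″≥1 , tt)))

            v-nbr : ∀ {N*} → Clump L″ (v ∷ []) N* → ∀ {w} → E v w → w ∉ s″ → w ∈ N ⊎ w ≡ m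
            v-nbr C* {w} ew w∉ with from q (Free.nbr-in-L C* ew)
            ... | here refl = inj₁ (All.head (headsM q))
            ... | there (here refl) = ⊥-elim (E-irrefl ew)
            ... | there (there (here refl)) = inj₂ refl
            ... | there (there (there p)) with ∈-++⁻ s″ p
            ...   | inj₁ h = contradiction h w∉
            ...   | inj₂ h with w ∈? heads T
            ...     | yes h′ = inj₁ (All.lookup (headsM q) (there h′))
            ...     | no ¬h′ with locate T h ¬h′
            ...       | X , η , t , X′ , eq , w∈t = 1≰0 (proj₁ (T-edge {X} [] eq w∈t refl (E-sym ew)))

          -- By `v≁z⁺` the ends `v` and `w` are not adjacent, and other segments can reach this one
          -- only in its interior vertex `m`. So `Alpha` applies.
          three : ∀ {ξ y r Y ξ′ v m w W} → R ((ξ , y ∷ r) ∷ Y ++ (ξ′ , v ∷ m ∷ w ∷ []) ∷ W) →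
                  Odd ((ξ , y ∷ r) ∷ Y ++ (ξ′ , v ∷ m ∷ w ∷ []) ∷ W) → ¬ E y m
          three {ξ} {y} {r} {Y} {ξ′} {v} {m} {w} {W} ρ odd e = T.free λ { (N* , C*) →
              Alpha.contradictory (rep-rotate ((ξ , y ∷ r) ∷ Y) ρ) (odd-rotate ((ξ , y ∷ r) ∷ Y) odd) (s≤s z≤n)
                (λ ev → v-nbr C* ev (λ { (here refl) → T.Free.v≁z⁺ C* refl (proj₂ (proj₂ (proj₂ T.P.lk′)) ∷ T.P.arcW) ev }))
                (λ { {X} eq p∈ (here refl) ew → 1≰0 (proj₂ (T-edge {X} (v ∷ m ∷ []) eq p∈ refl ew)) }) }
            where
            module T = Tight ρ e
            open KillTight ρ odd e (s≤s z≤n)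

          -- A segment of four vertices takes the whole excess of 3, so all other segments are
          -- single vertices. Each forbidden edge at `m′`, and the edge from `v` to `w`, would give
          -- a cycle through `x` and all of `L`, after which `Alpha` applies.
          module Four {ξ u Y ξ′ v m m′ w W} (ρ : R ((ξ , u ∷ []) ∷ Y ++ (ξ′ , v ∷ m ∷ m′ ∷ w ∷ []) ∷ W))
                      (odd : Odd ((ξ , u ∷ []) ∷ Y ++ (ξ′ , v ∷ m ∷ m′ ∷ w ∷ []) ∷ W)) (e : E u m) where

            open Tight ρ e
            open KillTight ρ odd e (s≤s z≤n)

            private
              m-m′ : E m m′
              m-m′ = proj₁ (proj₂ (proj₂ P.lk′))
              m′-w : E m′ w
              m′-w = proj₁ (proj₂ (proj₂ (proj₂ P.lk′)))
              w-β : E w β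
              w-β = proj₂ (proj₂ (proj₂ (proj₂ P.lk′)))
              u-α : E u α
              u-α = proj₂ P.lk

            kill-vw : ¬ E v w
            kill-vw v-w = too-long
              (e ∷ (m-m′ ∷ (m′-w ∷ (E-sym v-w ∷ ([ v ] ⟨ E-sym ξ′-v ⟩ (path-reverse P.arcY ⟨ x-N P.α∈ ⟩ (x-join P.β∈ ∷ P.arcW)))))))
              ξ-y
              ((nodup⊆ (flatten Y ∷ flatten W ∷ []) (x ∷ ξ ∷ u ∷ ξ′ ∷ v ∷ m ∷ m′ ∷ w ∷ []) ((• 2 · (• 5 · (• 6 · (• 7 · (• 4 · (rev ((# 0 · (• 3 · ε))) · (• 0 · (# 1 · (• 1 · ε)))))))))) ((• 0 · (• 1 · ((• 2 · ε) · (# 0 · (• 3 · ((• 4 · (• 5 · (• 6 · (• 7 · ε)))) · # 1))))))) (nd-x)))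
              ((lin ([]) (flatten Y ∷ flatten W ∷ L ∷ []) (ξ ∷ u ∷ ξ′ ∷ v ∷ m ∷ m′ ∷ w ∷ x ∷ []) ((lng ((• 0 · ((• 1 · ε) · (# 0 · (• 2 · ((• 3 · (• 4 · (• 5 · (• 6 · ε)))) · # 1)))))) ≋ lng (# 2)) ∷ []) ((κ 1 ⊕ lng (# 2))) (lng ((• 1 · (• 4 · (• 5 · (• 6 · (• 3 · (rev ((# 0 · (• 2 · ε))) · (• 7 · (# 1 · (• 0 · ε))))))))))) 0 ((0 , 1) ∷ []) (P.len , tt)))

            kill-same : ¬ E u m′
            kill-same u-m′ = too-long
              (v-z ∷ (E-sym e ∷ (u-m′ ∷ (m′-w ∷ (w-β ∷ (P.arcW ⟨ x-N P.ξ∈ ⟩ (x-join P.α∈ ∷ P.arcY)))))))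
              ξ′-v
              ((nodup⊆ (flatten Y ∷ flatten W ∷ []) (x ∷ ξ ∷ u ∷ ξ′ ∷ v ∷ m ∷ m′ ∷ w ∷ []) ((• 4 · (• 5 · (• 2 · (• 6 · (• 7 · ((# 1 · (• 1 · ε)) · (• 0 · (# 0 · (• 3 · ε)))))))))) ((• 0 · (• 1 · ((• 2 · ε) · (# 0 · (• 3 · ((• 4 · (• 5 · (• 6 · (• 7 · ε)))) · # 1))))))) (nd-x)))
              ((lin ([]) (flatten Y ∷ flatten W ∷ L ∷ []) (ξ ∷ u ∷ ξ′ ∷ v ∷ m ∷ m′ ∷ w ∷ x ∷ []) ((lng ((• 0 · ((• 1 · ε) · (# 0 · (• 2 · ((• 3 · (• 4 · (• 5 · (• 6 · ε)))) · # 1)))))) ≋ lng (# 2)) ∷ []) ((κ 1 ⊕ lng (# 2))) (lng ((• 3 · (• 4 · (• 1 · (• 5 · (• 6 · ((# 1 · (• 0 · ε)) · (• 7 · (# 0 · (• 2 · ε))))))))))) 0 ((0 , 1) ∷ []) (P.len , tt)))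

            kill-Y : ∀ {Y₁ η u′ Y₂} → Y ≡ Y₁ ++ (η , u′ ∷ []) ∷ Y₂ → ¬ E u′ m′
            kill-Y {Y₁} {η} {u′} {Y₂} eq e′ with chain-++⁻ Y₁ (subst (λ Z → Chain α Z ξ′) eq P.chY)
            ... | _ , c₁ , _∷_ {ζ = η⁺} (η-u′ , u′-η⁺) c₂ = too-long
              ((u-α ∷ arc-path c₁) ⟨ η-u′ ⟩ (e′ ∷ (m′-w ∷ (w-β ∷ (P.arcW ⟨ x-N P.ξ∈ ⟩ (x-join η⁺∈ ∷ (arc-path c₂ ⟨ ξ′-v ⟩ (v-z ∷ [ m ]))))))))
              (E-sym e)
              ((nodup⊆ (flatten Y₁ ∷ flatten Y₂ ∷ flatten W ∷ []) (x ∷ ξ ∷ u ∷ η ∷ u′ ∷ ξ′ ∷ v ∷ m ∷ m′ ∷ w ∷ []) (((• 2 · (# 0 · (• 3 · ε))) · (• 4 · (• 8 · (• 9 · ((# 2 · (• 1 · ε)) · (• 0 · ((# 1 · (• 5 · ε)) · (• 6 · (• 7 · ε)))))))))) ((• 0 · (• 1 · ((• 2 · ε) · ((# 0 · (• 3 · (• 4 · # 1))) · (• 5 · ((• 6 · (• 7 · (• 8 · (• 9 · ε)))) · # 2))))))) (nd′)))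
              ((lin ([]) (flatten Y ∷ flatten Y₁ ∷ flatten Y₂ ∷ flatten W ∷ L ∷ []) (η ∷ u′ ∷ ξ ∷ u ∷ ξ′ ∷ v ∷ m ∷ m′ ∷ w ∷ x ∷ []) ((lng (# 0) ≋ lng ((# 1 · (• 0 · (• 1 · # 2))))) ∷ (lng ((• 2 · ((• 3 · ε) · (# 0 · (• 4 · ((• 5 · (• 6 · (• 7 · (• 8 · ε)))) · # 3)))))) ≋ lng (# 4)) ∷ []) ((κ 1 ⊕ lng (# 4))) (lng (((• 3 · (# 1 · (• 0 · ε))) · (• 1 · (• 7 · (• 8 · ((# 3 · (• 2 · ε)) · (• 9 · ((# 2 · (• 4 · ε)) · (• 5 · (• 6 · ε))))))))))) 0 ((1 , 0) ∷ (0 , 1) ∷ []) (cong length fl , P.len , tt)))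
              where
              fl : flatten Y ≡ flatten Y₁ ++ η ∷ u′ ∷ flatten Y₂
              fl = trans (cong flatten eq) (flatten-++ Y₁ _)
              nd′ = subst (λ l → NoDup (x ∷ ξ ∷ (u ∷ []) ++ l ++ ξ′ ∷ (v ∷ m ∷ m′ ∷ w ∷ []) ++ flatten W)) fl nd-x
              η⁺∈ : η⁺ ∈ N
              η⁺∈ with ∈-++⁻ (heads Y₂) (chain-start∈ c₂)
              ... | inj₂ (here refl) = P.ξ′∈
              ... | inj₁ h = headsY (∈-resp (sym (trans (cong heads eq) (map-++ proj₁ Y₁ _))) (∈-++⁺ʳ (heads Y₁) (there h)))

            kill-W : ∀ {W₁ η u′ W₂} → W ≡ W₁ ++ (η , u′ ∷ []) ∷ W₂ → ¬ E u′ m′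
            kill-W {W₁} {η} {u′} {W₂} eq e′ with chain-++⁻ W₁ (subst (λ Z → Chain β Z ξ) eq P.chW)
            ... | _ , c₁ , _∷_ {ζ = η⁺} (η-u′ , u′-η⁺) c₂ = too-long
              (u′-η⁺ ∷ (arc-path c₂ ⟨ ξ-y ⟩ (e ∷ (E-sym v-z ∷ (E-sym ξ′-v ∷′ (path-reverse P.arcY ⟨ x-N P.α∈ ⟩
                (x-join η∈ ∷ (path-reverse (arc-path c₁) ⟨ E-sym w-β ⟩ (E-sym m′-w ∷ [ m′ ])))))))))
              (E-sym e′)
              ((nodup⊆ (flatten Y ∷ flatten W₁ ∷ flatten W₂ ∷ []) (x ∷ ξ ∷ u ∷ ξ′ ∷ v ∷ m ∷ m′ ∷ w ∷ η ∷ u′ ∷ []) ((• 9 · ((# 2 · (• 1 · ε)) · (• 2 · (• 5 · (• 4 · (rev ((# 0 · (• 3 · ε))) · (• 0 · (rev ((# 1 · (• 8 · ε))) · (• 7 · (• 6 · ε))))))))))) ((• 0 · (• 1 · ((• 2 · ε) · (# 0 · (• 3 · ((• 4 · (• 5 · (• 6 · (• 7 · ε)))) · (# 1 · (• 8 · (• 9 · # 2)))))))))) (nd′)))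
              ((lin ([]) (flatten W ∷ flatten W₁ ∷ flatten W₂ ∷ flatten Y ∷ L ∷ []) (η ∷ u′ ∷ ξ ∷ u ∷ ξ′ ∷ v ∷ m ∷ m′ ∷ w ∷ x ∷ []) ((lng (# 0) ≋ lng ((# 1 · (• 0 · (• 1 · # 2))))) ∷ (lng ((• 2 · ((• 3 · ε) · (# 3 · (• 4 · ((• 5 · (• 6 · (• 7 · (• 8 · ε)))) · # 0)))))) ≋ lng (# 4)) ∷ []) ((κ 1 ⊕ lng (# 4))) (lng ((• 1 · ((# 2 · (• 2 · ε)) · (• 3 · (• 6 · (• 5 · (rev ((# 3 · (• 4 · ε))) · (• 9 · (rev ((# 1 · (• 0 · ε))) · (• 8 · (• 7 · ε)))))))))))) 0 ((1 , 0) ∷ (0 , 1) ∷ []) (cong length fl , P.len , tt)))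
              where
              _∷′_ : ∀ {a b l c} → E a b → Path b l c → Path a (a ∷ l) c
              _∷′_ = _∷_
              fl : flatten W ≡ flatten W₁ ++ η ∷ u′ ∷ flatten W₂
              fl = trans (cong flatten eq) (flatten-++ W₁ _)
              nd′ = subst (λ l → NoDup (x ∷ ξ ∷ (u ∷ []) ++ flatten Y ++ ξ′ ∷ (v ∷ m ∷ m′ ∷ w ∷ []) ++ l)) fl nd-x
              η∈ : η ∈ N
              η∈ = headsW (∈-resp (sym (trans (cong heads eq) (map-++ proj₁ W₁ _))) (∈-++⁺ʳ (heads W₁) (here refl)))

            four-⊥ : ⊥
            four-⊥ = free λ { (N* , C*) →
              Alpha.contradictory (rep-rotate ((ξ , u ∷ []) ∷ Y) ρ) (odd-rotate ((ξ , u ∷ []) ∷ Y) odd) (s≤s z≤n)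
                (λ ev → v-nbr C* ev λ { (here refl) → Free.v≁z⁺ C* refl (m′-w ∷ (w-β ∷ P.arcW)) ev ; (there (here refl)) → kill-vw ev })
                (λ { {X} eq p∈ (here refl) e′ → to-m′ X eq p∈ e′
                   ; {X} eq p∈ (there (here refl)) e′ → 1≰0 (proj₂ (T-edge {X} (v ∷ m ∷ m′ ∷ []) eq p∈ refl e′)) }) }
              where
              to-m′ : ∀ X {η t X′ p} → W ++ (ξ , u ∷ []) ∷ Y ≡ X ++ (η , t) ∷ X′ → p ∈ t → ¬ E p m′
              to-m′ X {η} {t} {X′} {p} eq p∈ e′ = one t refl p∈ (split-cases X W (sym eq))
                where
                short : length t ≤ 1
                short = (lin (exc X′ ∷ exc X ∷ []) (t ∷ []) ([]) (((((lng (# 0) ⊕ at 0) ⊕ κ 4) ⊕ at 1) ≼ κ 5) ∷ []) (lng (# 0)) (κ 1) 0 ((1 , 0) ∷ []) (pair-budget (at-T {X} eq) , tt))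
                one : ∀ t′ → t ≡ t′ → p ∈ t′ →
                      (∃[ D ] (W ≡ X ++ (η , t) ∷ D)) ⊎ (X ≡ W × (η , t) ≡ (ξ , u ∷ []) × X′ ≡ Y) ⊎ (∃[ D ] (X ≡ W ++ (ξ , u ∷ []) ∷ D × Y ≡ D ++ (η , t) ∷ X′)) → ⊥
                one (_ ∷ []) refl (here refl) (inj₁ (D , eqW)) = kill-W {X} eqW e′
                one (_ ∷ []) refl (here refl) (inj₂ (inj₁ (_ , refl , _))) = kill-same e′
                one (_ ∷ []) refl (here refl) (inj₂ (inj₂ (D , _ , eqY))) = kill-Y {D} eqY e′
                one (_ ∷ _ ∷ t′) refl _ _ = <⇒≱ (s≤s (s≤s z≤n)) short

          -- Five or more vertices in the second segment, or four beside two in the first, exceed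
          -- the budget; `three` and `Four` are what is left.
          tight-⊥ : ∀ {ξ y r Y ξ′ v m s″ W} → R ((ξ , y ∷ r) ∷ Y ++ (ξ′ , v ∷ m ∷ s″) ∷ W) →
                    Odd ((ξ , y ∷ r) ∷ Y ++ (ξ′ , v ∷ m ∷ s″) ∷ W) → 1 ≤ length s″ → ¬ E y m
          tight-⊥ {s″ = w ∷ []} ρ odd _ e = three ρ odd e
          tight-⊥ {r = []} {s″ = m′ ∷ w ∷ []} ρ odd _ e = Four.four-⊥ ρ odd e
          tight-⊥ {y = y} {r = t ∷ r} {Y} {v = v} {m} {s″ = m′ ∷ w ∷ []} {W} ρ odd _ e =
            (1≰0 (lin (exc Y ∷ exc W ∷ []) (r ∷ []) (y ∷ t ∷ v ∷ m ∷ m′ ∷ w ∷ []) (((((lng ((• 0 · (• 1 · # 0))) ⊕ at 0) ⊕ lng ((• 2 · (• 3 · (• 4 · (• 5 · ε)))))) ⊕ at 1) ≼ κ 5) ∷ []) (κ 1) (κ 0) 0 ((1 , 0) ∷ []) (pair-budget ρ , tt)))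
          tight-⊥ {y = y} {r} {Y} {v = v} {m} {s″ = a ∷ b ∷ d ∷ s} {W} ρ odd _ e =
            (1≰0 (lin (exc Y ∷ exc W ∷ []) (r ∷ s ∷ []) (y ∷ v ∷ m ∷ a ∷ b ∷ d ∷ []) (((((lng ((• 0 · # 0)) ⊕ at 0) ⊕ lng ((• 1 · (• 2 · (• 3 · (• 4 · (• 5 · # 1))))))) ⊕ at 1) ≼ κ 5) ∷ []) (κ 1) (κ 0) 0 ((1 , 0) ∷ []) (pair-budget ρ , tt)))

          -- The budget leaves two configurations, mirror images of each other: `y` is the first of
          -- its segment and `z` the second, or `y` is the last and `z` the last but one.
          interior-⊥ : ∀ {ξ y Y ξ′ z W} o₁ r₁ o₂ r₂ → R ((ξ , o₁ ++ y ∷ r₁) ∷ Y ++ (ξ′ , o₂ ++ z ∷ r₂) ∷ W) →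
                       Odd ((ξ , o₁ ++ y ∷ r₁) ∷ Y ++ (ξ′ , o₂ ++ z ∷ r₂) ∷ W) → Interior o₂ r₂ → ¬ E y z
          interior-⊥ [] r₁ (v ∷ []) r₂ ρ odd (_ , h) e = tight-⊥ ρ odd h e
          interior-⊥ {y = y} {z = z} o₁ [] o₂ (w ∷ []) ρ odd (h , _) e = pair-reverse ρ odd λ {α} {W′} {β} {Y′} ρ′ odd′ →
            tight-⊥ (subst R (eq α W′ β Y′) ρ′) (subst Odd (eq α W′ β Y′) odd′) (≤-trans h (≤-reflexive (sym (length-reverse o₂)))) e
            where
            eq : ∀ α W′ β Y′ → (α , reverse (o₁ ++ y ∷ [])) ∷ W′ ++ (β , reverse (o₂ ++ z ∷ w ∷ [])) ∷ Y′ ≡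
                 (α , y ∷ reverse o₁) ∷ W′ ++ (β , w ∷ z ∷ reverse o₂) ∷ Y′
            eq α W′ β Y′ = cong₂ (λ a b → (α , a) ∷ W′ ++ (β , b) ∷ Y′) (reverse-++ o₁ (y ∷ [])) (reverse-++ o₂ (z ∷ w ∷ []))
          interior-⊥ {y = y} {Y} {z = z} {W} o₁ r₁ (v ∷ v′ ∷ o₂) (w ∷ w′ ∷ r₂) ρ odd _ e =
            (1≰0 (lin (exc Y ∷ exc W ∷ []) (o₁ ∷ r₁ ∷ o₂ ∷ r₂ ∷ []) (y ∷ v ∷ v′ ∷ z ∷ w ∷ w′ ∷ []) (((((lng ((# 0 · (• 0 · # 1))) ⊕ at 0) ⊕ lng ((• 1 · (• 2 · (# 2 · (• 3 · (• 4 · (• 5 · # 3)))))))) ⊕ at 1) ≼ κ 5) ∷ []) (κ 1) (κ 0) 0 ((1 , 0) ∷ []) (pair-budget ρ , tt)))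
          interior-⊥ {y = y} {Y} {z = z} {W} o₁ (t ∷ r₁) (v ∷ v′ ∷ o₂) r₂ ρ odd (_ , h) e =
            (1≰0 (lin (exc Y ∷ exc W ∷ []) (o₁ ∷ r₁ ∷ o₂ ∷ r₂ ∷ []) (y ∷ t ∷ v ∷ v′ ∷ z ∷ []) (((((lng ((# 0 · (• 0 · (• 1 · # 1)))) ⊕ at 0) ⊕ lng ((• 2 · (• 3 · (# 2 · (• 4 · # 3)))))) ⊕ at 1) ≼ κ 5) ∷ (κ 1 ≼ lng (# 3)) ∷ []) (κ 1) (κ 0) 0 ((1 , 0) ∷ (1 , 0) ∷ []) (pair-budget ρ , h , tt)))
          interior-⊥ {y = y} {Y} {z = z} {W} (t ∷ o₁) r₁ (v ∷ o₂) (w ∷ w′ ∷ r₂) ρ odd _ e =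
            (1≰0 (lin (exc Y ∷ exc W ∷ []) (o₁ ∷ r₁ ∷ o₂ ∷ r₂ ∷ []) (t ∷ y ∷ v ∷ z ∷ w ∷ w′ ∷ []) (((((lng (((• 0 · # 0) · (• 1 · # 1))) ⊕ at 0) ⊕ lng (((• 2 · # 2) · (• 3 · (• 4 · (• 5 · # 3)))))) ⊕ at 1) ≼ κ 5) ∷ []) (κ 1) (κ 0) 0 ((1 , 0) ∷ []) (pair-budget ρ , tt)))
          interior-⊥ {y = y} {Y} {z = z} {W} (t ∷ o₁) (t′ ∷ r₁) (v ∷ o₂) (w ∷ []) ρ odd _ e =
            (1≰0 (lin (exc Y ∷ exc W ∷ []) (o₁ ∷ r₁ ∷ o₂ ∷ []) (t ∷ y ∷ t′ ∷ v ∷ z ∷ w ∷ []) (((((lng (((• 0 · # 0) · (• 1 · (• 2 · # 1)))) ⊕ at 0) ⊕ lng (((• 3 · # 2) · (• 4 · (• 5 · ε))))) ⊕ at 1) ≼ κ 5) ∷ []) (κ 1) (κ 0) 0 ((1 , 0) ∷ []) (pair-budget ρ , tt)))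
          interior-⊥ _ _ [] _ _ _ (() , _)
          interior-⊥ _ _ _ [] _ _ (_ , ())

          no-cross-edge : ∀ {ξ s Y ξ′ s′ W y z} → R ((ξ , s) ∷ Y ++ (ξ′ , s′) ∷ W) → Odd ((ξ , s) ∷ Y ++ (ξ′ , s′) ∷ W) →
                          y ∈ s → z ∈ s′ → ¬ E y z
          no-cross-edge {Y = Y} ρ odd y∈ z∈ e with ∈-∃++ y∈ | ∈-∃++ z∈
          ... | o₁ , r₁ , refl | o₂ , r₂ , refl with edge-interior {o₁ = o₁} {o₂ = o₂} ρ odd e
          ...   | inj₂ h = interior-⊥ o₁ r₁ o₂ r₂ ρ odd h e
          ...   | inj₁ h = interior-⊥ o₂ r₂ o₁ r₁ (swap-rep Y ρ) (swap-odd Y odd) h (E-sym e)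

          -- Without edges between segments G ∖ N has δ + 1 components.
          odd-⊥ : ∀ {Z} → R Z → Odd Z → ⊥
          odd-⊥ {Z} r odd = <⇒≱ (≤-reflexive count) (separated N reps two outside pairs)
            where
            reps = firsts Z ++ x ∷ []
            nonempties : ∀ X Y → R (X ++ Y) → All (λ τ → 1 ≤ length (proj₂ τ)) Y
            nonempties X []      r = []
            nonempties X (τ ∷ Y) r = seg≥1 (rep-rotate X r) ∷ nonempties (X ++ τ ∷ []) Y (subst R (sym (++-assoc X _ Y)) r)
            count : 1 + length N ≡ length reps
            count = (≤-antisym (lin (δ ∷ length Z ∷ []) (N ∷ firsts Z ∷ []) (x ∷ []) ((lng (# 0) ≋ at 0) ∷ (at 1 ≋ at 0) ∷ (lng (# 1) ≋ at 1) ∷ []) ((κ 1 ⊕ lng (# 0))) (lng ((# 1 · (• 0 · ε)))) 0 ((1 , 0) ∷ (0 , 1) ∷ (0 , 1) ∷ []) (|N| , segs r , firsts-length Z (nonempties [] Z r) , tt)) (lin (δ ∷ length Z ∷ []) (N ∷ firsts Z ∷ []) (x ∷ []) ((lng (# 0) ≋ at 0) ∷ (at 1 ≋ at 0) ∷ (lng (# 1) ≋ at 1) ∷ []) (lng ((# 1 · (• 0 · ε)))) ((κ 1 ⊕ lng (# 0))) 0 ((0 , 1) ∷ (1 , 0) ∷ (1 , 0) ∷ []) (|N| , segs r , firsts-length Z (nonempties [] Z r) , tt)))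
            two : 2 ≤ length reps
            two = (lin (δ ∷ []) (N ∷ firsts Z ∷ []) (x ∷ []) (((κ 1 ⊕ lng (# 0)) ≋ lng ((# 1 · (• 0 · ε)))) ∷ (lng (# 0) ≋ at 0) ∷ (κ 3 ≼ at 0) ∷ []) (κ 2) (lng ((# 1 · (• 0 · ε)))) 0 ((1 , 0) ∷ (0 , 1) ∷ (1 , 0) ∷ []) (count , |N| , δ≥3 , tt))
            outside : All (_∉ N) reps
            outside = ++⁺ (All.tabulate (firsts∉ Z r)) ((λ h → x∉L (C.N⊆L Cx h)) ∷ [])
            open Separation L N N (λ h → h)
            from-x : ∀ {u} → u ∈ L → ¬ Con (_∉ N) u x
            from-x u∈ con = closed-apart {S = N} {B = x ∷ []} (λ { (here refl) e → inj₂ (x-nbr e) }) (here refl) (λ { (here refl) → x∉L u∈ }) (con-sym con)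
            seg-apart : ∀ Z₁ {η u t Z₂ u′} → Z ≡ Z₁ ++ (η , u ∷ t) ∷ Z₂ → u′ ∈ firsts Z₂ ⊎ u′ ∈ x ∷ [] → ¬ Con (_∉ N) u u′
            seg-apart Z₁ {η} {u} {t} {Z₂} refl = λ { (inj₂ (here refl)) → from-x (to ρ (there (here refl))) ; (inj₁ h) → in-rest h }
              where
              ρ : R ((η , u ∷ t) ∷ Z₂ ++ Z₁)
              ρ = rep-rotate Z₁ r
              nolink : NoLink (u ∷ t) (Z₂ ++ Z₁)
              nolink {X} {ξ′} {s′} {X′} eq y∈ z∈ _ _ l nd off with ∈-∃++ y∈ | ∈-∃++ z∈
              ... | o₁ , r₁ , eq₁ | o₂ , r₂ , refl = by-edge (link-edge {o₁ = o₁} {o₂ = o₂} (subst (λ s → R ((η , s) ∷ X ++ (ξ′ , o₂ ++ _ ∷ r₂) ∷ X′)) eq₁ ρ′) l nd off)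
                where
                ρ′ : R ((η , u ∷ t) ∷ X ++ (ξ′ , o₂ ++ _ ∷ r₂) ∷ X′)
                ρ′ = subst (λ Y → R ((η , u ∷ t) ∷ Y)) eq ρ
                by-edge : _ ≡ [] → ⊥
                by-edge refl = no-cross-edge ρ′ (subst (λ Y → Odd ((η , u ∷ t) ∷ Y)) eq (odd-rotate Z₁ odd)) y∈ z∈ l
              in-rest : ∀ {u′} → u′ ∈ firsts Z₂ → ¬ Con (_∉ N) u u′
              in-rest h = apart nolink ρ (here refl) (to ρ (there (∈-++⁺ʳ (u ∷ t) p)))
                            (λ h′ → NoDup-disjoint {u ∷ t} (NoDup-tail (nodupᶻ ρ)) h′ p)
                where p = ∈-resp (sym (flatten-++ Z₂ Z₁)) (∈-++⁺ˡ (firsts⊆ Z₂ h))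
            pairs : AllPairs (λ u u′ → ¬ Con (_∉ N) u u′) reps
            pairs = firsts-pairs (λ u u′ → ¬ Con (_∉ N) u u′) (x ∷ []) Z seg-apart ([] ∷ [])

          all-two : ∀ {Z} → R Z → All (λ σ → length (proj₂ σ) ≡ 2) Z
          all-two r = All.tabulate λ {σ} σ∈ → decidable-stable (length (proj₂ σ) ≟ 2) λ ne → odd-⊥ r (lose σ∈ ne)

          exc-two : ∀ {Z} → All (λ σ → length (proj₂ σ) ≡ 2) Z → exc Z ≡ length Z
          exc-two []       = refl
          exc-two (h ∷ hs) = cong₂ _+_ (cong (_∸ 1) h) (exc-two hs)

          δ≡3 : ∀ {Z} → R Z → δ ≡ 3
          δ≡3 {Z} r = (≤-antisym (lin {A = ⊤} (δ ∷ length Z ∷ exc Z ∷ []) ([]) ([]) ((κ 3 ≼ at 0) ∷ (at 1 ≋ at 0) ∷ (at 2 ≋ at 1) ∷ (at 2 ≼ κ 3) ∷ []) (at 0) (κ 3) 0 ((0 , 0) ∷ (0 , 1) ∷ (0 , 1) ∷ (1 , 0) ∷ []) (δ≥3 , segs r , exc-two (all-two r) , exc≤3 r , tt)) (lin {A = ⊤} (δ ∷ length Z ∷ exc Z ∷ []) ([]) ([]) ((κ 3 ≼ at 0) ∷ (at 1 ≋ at 0) ∷ (at 2 ≋ at 1) ∷ (at 2 ≼ κ 3) ∷ []) (κ 3) (at 0) 0 ((1 , 0) ∷ (0 , 0) ∷ (0 , 0) ∷ (0 , 0) ∷ []) (δ≥3 , segs r , exc-two (all-two r) , exc≤3 r ,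 tt)))

        -- Clumps with two vertices and three neighbours

        -- The cycle without reference to a cutting set, so that it can be rotated, reversed, and
        -- cut again at the neighbours of another clump.
        record Ring (v : V) (vs : List V) : Set where
          constructor ring
          field
            lkʳ   : Lk v vs v
            ndʳ   : NoDup (v ∷ vs)
            lenʳ  : length (v ∷ vs) ≡ length L
            toʳ   : ∀ {w} → w ∈ v ∷ vs → w ∈ L
            fromʳ : ∀ {w} → w ∈ L → w ∈ v ∷ vs

        open Ring public

        chain-lk : ∀ {a s ζ Y b} → Lk a s ζ → Chain ζ Y b → Lk a (s ++ flatten Y) b
        chain-lk {a} {s} {ζ} l [] = subst (λ xs → Lk a xs ζ) (sym (++-identityʳ s)) l
        chain-lk {s = s} l (l′ ∷ ch) = lk-++ s l (chain-lk l′ ch)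

        rep-ring : ∀ {M ξ s Y} → Rep L M ((ξ , s) ∷ Y) → Ring ξ (s ++ flatten Y)
        rep-ring r@(rep (l ∷ ch) nd sz to from _ _) = ring (chain-lk l ch) nd sz to from

        ring-rotate : ∀ {v w vs} → Ring v (w ∷ vs) → Ring w (vs ++ v ∷ [])
        ring-rotate {v} {w} {vs} (ring (e , l) nd sz to from) = ring (lk-++ vs l e)
          ((nodup⊆ (vs ∷ []) (v ∷ w ∷ []) ((• 1 · (# 0 · (• 0 · ε)))) ((• 0 · (• 1 · # 0))) (nd))) ((≤-antisym (lin ([]) (vs ∷ L ∷ []) (v ∷ w ∷ []) ((lng ((• 0 · (• 1 · # 0))) ≋ lng (# 1)) ∷ []) (lng ((• 1 · (# 0 · (• 0 · ε))))) (lng (# 1)) 0 ((1 , 0) ∷ []) (sz , tt)) (lin ([]) (vs ∷ L ∷ []) (v ∷ w ∷ []) ((lng ((• 0 · (• 1 · # 0))) ≋ lng (# 1)) ∷ []) (lng (# 1)) (lng ((• 1 · (# 0 · (• 0 · ε))))) 0 ((0 , 1) ∷ []) (sz , tt))))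
          (λ p → to ((∈⊆ (vs ∷ []) (w ∷ v ∷ []) ((• 0 · (# 0 · (• 1 · ε)))) ((• 1 · (• 0 · # 0))) (p)))) (λ p → (∈⊆ (vs ∷ []) (v ∷ w ∷ []) ((• 0 · (• 1 · # 0))) ((• 1 · (# 0 · (• 0 · ε)))) (from p)))

        ring-reverse : ∀ {v vs} → Ring v vs → Ring v (reverse vs)
        ring-reverse {v} {vs} (ring l nd sz to from) = ring (lk-reverse vs l)
          ((nodup⊆ (vs ∷ []) (v ∷ []) ((• 0 · rev (# 0))) ((• 0 · # 0)) (nd))) ((≤-antisym (lin ([]) (vs ∷ L ∷ []) (v ∷ []) ((lng ((• 0 · # 0)) ≋ lng (# 1)) ∷ []) (lng ((• 0 · rev (# 0)))) (lng (# 1)) 0 ((1 , 0) ∷ []) (sz , tt)) (lin ([]) (vs ∷ L ∷ []) (v ∷ []) ((lng ((• 0 · # 0)) ≋ lng (# 1)) ∷ []) (lng (# 1)) (lng ((• 0 · rev (# 0)))) 0 ((0 , 1) ∷ []) (sz , tt))))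
          (λ p → to ((∈⊆ (vs ∷ []) (v ∷ []) ((• 0 · rev (# 0))) ((• 0 · # 0)) (p)))) (λ p → (∈⊆ (vs ∷ []) (v ∷ []) ((• 0 · # 0)) ((• 0 · rev (# 0))) (from p)))

        ring-arcs : ∀ {v} s {b t} → Ring v (s ++ b ∷ t) → Arcs L v s b t
        ring-arcs s (ring l nd sz to from) = record
          { lk₁ = proj₁ (lk-split s l) ; lk₂ = proj₂ (lk-split s l) ; nd = nd ; len = sz ; toL = to ; fromL = from }

        ring-rep : ∀ {N a s b t d u} → Ring a (s ++ b ∷ t ++ d ∷ u) → a ∈ N → b ∈ N → d ∈ N → length N ≡ 3 → NoDup N →
                   Rep L N ((a , s) ∷ (b , t) ∷ (d , u) ∷ [])
        ring-rep {N} {a} {s} {b} {t} {d} {u} (ring l nd sz to from) a∈ b∈ d∈ |N| ndN with lk-split s l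
        ... | l₁ , l′ with lk-split t l′
        ...   | l₂ , l₃ = rep (l₁ ∷ (l₂ ∷ (l₃ ∷ [])))
          (subst NoDup eq nd) (trans (cong length (sym eq)) sz) (λ p → to (∈-resp (sym eq) p)) (λ p → ∈-resp eq (from p))
          (a∈ ∷ b∈ ∷ d∈ ∷ [])
          (off (λ p → (∈⊆ (s ∷ t ∷ u ∷ []) ([]) (# 0) ((# 0 · (# 1 · # 2))) (p))) ∷ off (λ p → (∈⊆ (t ∷ s ∷ u ∷ []) ([]) (# 0) ((# 1 · (# 0 · # 2))) (p))) ∷ off (λ p → (∈⊆ (u ∷ s ∷ t ∷ []) ([]) (# 0) ((# 1 · (# 2 · # 0))) (p))) ∷ [])
          where
          eq : a ∷ s ++ b ∷ t ++ d ∷ u ≡ a ∷ s ++ b ∷ t ++ d ∷ u ++ []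
          eq = cong (λ z → a ∷ s ++ b ∷ t ++ d ∷ z) (sym (++-identityʳ u))
          three : ∀ {v} → v ∈ N → v ∈ a ∷ b ∷ d ∷ []
          three = ⊆-reverse {a ∷ b ∷ d ∷ []} ((nodup⊆ (s ∷ t ∷ u ∷ []) (a ∷ b ∷ d ∷ []) ((• 0 · (• 1 · (• 2 · ε)))) ((• 0 · (# 0 · (• 1 · (# 1 · (• 2 · # 2)))))) (nd)))
                    (λ { (here refl) → a∈ ; (there (here refl)) → b∈ ; (there (there (here refl))) → d∈ }) (≤-reflexive |N|)
          off : ∀ {w} → (∀ {v} → v ∈ w → v ∈ s ++ t ++ u) → All (_∉ N) w
          off sub = All.tabulate λ p q → NoDup-disjoint {s ++ t ++ u} {a ∷ b ∷ d ∷ []}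
            ((nodup⊆ (s ∷ t ∷ u ∷ []) (a ∷ b ∷ d ∷ []) (((# 0 · (# 1 · # 2)) · (• 0 · (• 1 · (• 2 · ε))))) ((• 0 · (# 0 · (• 1 · (# 1 · (• 2 · # 2)))))) (nd))) (sub p) (three q)

        rep-length : ∀ {P N Z} → Clump L P N → Rep L N Z → length Z ≡ length N
        rep-length {Z = Z} C r = trans (sym (length-map proj₁ Z)) (≤-antisym
          (length-⊆ (heads-nodup Z (nodupᶻ r)) (λ p → All.lookup (headsM r) p))
          (length-⊆ (C.ndN C) (λ p → M⊆heads r (C.N⊆L C p) p)))

        cut-three : ∀ {P N} → Clump L P N → length N ≡ 3 → ∃[ a ] ∃[ s ] ∃[ b ] ∃[ t ] ∃[ d ] ∃[ u ] Rep L N ((a , s) ∷ (b , t) ∷ (d , u) ∷ [])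
        cut-three {N = m ∷ N} C eq = shape (represent cycL (C.N⊆L C (here refl)) (here refl))
          where
          shape′ : ∀ {s} Z → Rep L (m ∷ N) ((m , s) ∷ Z) → length ((m , s) ∷ Z) ≡ 3 →
                   ∃[ a ] ∃[ s ] ∃[ b ] ∃[ t ] ∃[ d ] ∃[ u ] Rep L (m ∷ N) ((a , s) ∷ (b , t) ∷ (d , u) ∷ [])
          shape′ (_ ∷ _ ∷ []) r refl = _ , _ , _ , _ , _ , _ , r
          shape : ∃[ s ] ∃[ Z ] Rep L (m ∷ N) ((m , s) ∷ Z) →
                  ∃[ a ] ∃[ s ] ∃[ b ] ∃[ t ] ∃[ d ] ∃[ u ] Rep L (m ∷ N) ((a , s) ∷ (b , t) ∷ (d , u) ∷ [])
          shape (_ , Z , r) = shape′ Z r (trans (rep-length C r) eq)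

        module _ {P N : List V} (C : Clump L P N) where

          private
            P∉ : ∀ {ξ s Y ξ′ s′ W v} → Rep L N ((ξ , s) ∷ Y ++ (ξ′ , s′) ∷ W) → v ∉ L → v ∉ ξ ∷ s ++ flatten Y ++ ξ′ ∷ s′ ++ flatten W
            P∉ {ξ} {s} {Y} {ξ′} {s′} {W} r h p = h (to r (∈-resp (sym (flatten-pair ξ s Y ξ′ s′ W)) p))

          clump-before : ∀ {ξ y r₁ Y ξ′ z r₂ W ls} o₁ o₂ → Rep L N ((ξ , o₁ ++ y ∷ r₁) ∷ Y ++ (ξ′ , o₂ ++ z ∷ r₂) ∷ W) → Lk y ls z →
                         NoDup (P ++ ls) → (∀ {v} → v ∈ ls → v ∉ L) → length P + length ls ≤ length o₁ + length o₂
          clump-before {ls = ls} o₁ o₂ r l nd off =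
            (lin ([]) (P ∷ ls ∷ o₁ ∷ o₂ ∷ []) ([]) (((lng (# 0) ⊕ lng (rev (# 1))) ≼ (lng (# 2) ⊕ lng (# 3))) ∷ []) ((lng (# 0) ⊕ lng (# 1))) ((lng (# 2) ⊕ lng (# 3))) 0 ((1 , 0) ∷ []) (reroute₁ (pair r) (C.path C) (E-sym (C.join C (start∈ (C.path C)) P.ξ′∈)) (C.join C (end∈ (C.path C)) P.ξ∈) (lk-reverse ls l)
                 ((nodup⊆ (P ∷ ls ∷ []) ([]) ((# 0 · rev (# 1))) ((# 0 · # 1)) (nd)))
                 (λ p → P∉ r ([ C.offP C , (λ q → off (reverse⁻ q)) ]′ (∈-++⁻ P p))) , tt))
            where module P = Pair (pair r)

          clump-after : ∀ {ξ y r₁ Y ξ′ z r₂ W ls} o₁ o₂ → Rep L N ((ξ , o₁ ++ y ∷ r₁) ∷ Y ++ (ξ′ , o₂ ++ z ∷ r₂) ∷ W) → Lk y ls z →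
                        NoDup (P ++ ls) → (∀ {v} → v ∈ ls → v ∉ L) → length P + length ls ≤ length r₁ + length r₂
          clump-after {ls = ls} o₁ o₂ r l nd off =
            reroute₂ (pair r) (C.path C) (E-sym (C.join C (start∈ (C.path C)) P.α∈)) (C.join C (end∈ (C.path C)) P.β∈) l nd
              (λ p → P∉ r ([ C.offP C , off ]′ (∈-++⁻ P p)))
            where module P = Pair (pair r)

          -- In both reroutings `P` is the path outside the cycle and `P′` the link; the final 2
          -- counts `y` and `z`.
          link-bound : ∀ {ξ s Y ξ′ s′ W y z P′ N′} → Rep L N ((ξ , s) ∷ Y ++ (ξ′ , s′) ∷ W) → Clump L P′ N′ → (∀ {v} → v ∈ P → v ∉ P′) →
                       y ∈ s → z ∈ s′ → y ∈ N′ → z ∈ N′ → 2 * (length P + length P′) + 2 ≤ length s + length s′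
          link-bound {y = y} {z} {P′} r C′ disj y∈ z∈ yN zN with ∈-∃++ y∈ | ∈-∃++ z∈
          ... | o₁ , r₁ , refl | o₂ , r₂ , refl =
            (lin ([]) (P ∷ P′ ∷ o₁ ∷ o₂ ∷ r₁ ∷ r₂ ∷ []) (y ∷ z ∷ []) (((lng (# 0) ⊕ lng (# 1)) ≼ (lng (# 2) ⊕ lng (# 3))) ∷ ((lng (# 0) ⊕ lng (# 1)) ≼ (lng (# 4) ⊕ lng (# 5))) ∷ []) ((2 ⊗ ((lng (# 0) ⊕ lng (# 1))) ⊕ κ 2)) ((lng ((# 2 · (• 0 · # 4))) ⊕ lng ((# 3 · (• 1 · # 5))))) 0 ((1 , 0) ∷ (1 , 0) ∷ []) (clump-before o₁ o₂ r (C-lk C′ yN zN) nd (C.offP C′) , clump-after o₁ o₂ r (C-lk C′ yN zN) nd (C.offP C′) , tt))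
            where nd = NoDup-++ (C.ndP C) (C.ndP C′) disj

        module Threes {P N : List V} (C : Clump L P N) (|P| : length P ≡ 2) (|N| : length N ≡ 3) where

          δ≡4 : δ ≡ 4
          δ≡4 = (≤-antisym (lin (δ ∷ []) (P ∷ N ∷ []) ([]) (((lng (# 0) ⊕ lng (# 1)) ≋ (κ 1 ⊕ at 0)) ∷ (lng (# 0) ≋ κ 2) ∷ (lng (# 1) ≋ κ 3) ∷ []) (at 0) (κ 4) 0 ((0 , 1) ∷ (1 , 0) ∷ (1 , 0) ∷ []) (C.count C , |P| , |N| , tt)) (lin (δ ∷ []) (P ∷ N ∷ []) ([]) (((lng (# 0) ⊕ lng (# 1)) ≋ (κ 1 ⊕ at 0)) ∷ (lng (# 0) ≋ κ 2) ∷ (lng (# 1) ≋ κ 3) ∷ []) (κ 4) (at 0) 0 ((1 , 0) ∷ (0 , 1) ∷ (0 , 1) ∷ []) (C.count C , |P| , |N| , tt)))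

          -- `slack` gives 3 · 3 + 2 from below, `small` gives 2 · 4 + 3 from above.
          L≡11 : length L ≡ 11
          L≡11 = ≤-antisym ((lin (δ ∷ []) (L ∷ []) ([]) ((lng (# 0) ≼ (2 ⊗ (at 0) ⊕ κ 3)) ∷ (at 0 ≋ κ 4) ∷ []) (lng (# 0)) (κ 11) 0 ((1 , 0) ∷ (2 , 0) ∷ []) (small , δ≡4 , tt)))
                   (subst₂ (λ s q → s * (1 + q) + 2 ≤ length L) |N| |P| (C.slack C))

          -- Exchanging a segment of two vertices with P shows that its only outside neighbours are those of P.
          pair-closed : ∀ {ξ u u′ α s β t} → Rep L N ((ξ , u ∷ u′ ∷ []) ∷ (α , s) ∷ (β , t) ∷ []) → 2 ≤ length s → 2 ≤ length t →
                        ¬ ¬ (∀ {z v} → z ∈ u ∷ u′ ∷ [] → E z v → v ∈ u ∷ u′ ∷ [] ⊎ v ∈ N)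
          pair-closed {ξ} {u} {u′} {α} {s} {β} {t} r s≥2 t≥2 k =
            exchange-clump X C (All.head (headsM r)) (All.head (All.tail (headsM r))) (sym |P|)
              λ { (P* , N* , C* , s⊆ , ξ∈* , α∈* , cy , len′) → k (closed C* s⊆ ξ∈* α∈*) }
            where
            rest = s ++ β ∷ t ++ []
            X : Arcs L ξ (u ∷ u′ ∷ []) α rest
            X = ring-arcs (u ∷ u′ ∷ []) (rep-ring r)
            module X = Arcs X
            r-swap : Rep L N ((ξ , u ∷ u′ ∷ []) ∷ ((α , s) ∷ []) ++ (β , t) ∷ [])
            r-swap = r
            len-st : length s + length t ≡ 6
            len-st = (≤-antisym (lin ([]) (s ∷ t ∷ L ∷ []) (ξ ∷ u ∷ u′ ∷ α ∷ β ∷ []) ((lng ((• 0 · ((• 1 · (• 2 · ε)) · (• 3 · (# 0 · (• 4 · (# 1 · ε))))))) ≋ lng (# 2)) ∷ (lng (# 2) ≋ κ 11) ∷ []) ((lng (# 0) ⊕ lng (# 1))) (κ 6) 0 ((1 , 0) ∷ (1 , 0) ∷ []) (X.len , L≡11 , tt)) (lin ([]) (s ∷ t ∷ L ∷ []) (ξ ∷ u ∷ u′ ∷ α ∷ β ∷ []) ((lng ((• 0 · ((• 1 · (• 2 · ε)) · (• 3 · (# 0 · (• 4 · (# 1 · ε))))))) ≋ lng (# 2)) ∷ (lng (# 2) ≋ κ 11) ∷ []) (κ 6) ((lng (# 0) ⊕ lng (# 1))) 0 ((0 , 1) ∷ (0 , 1) ∷ []) (X.len , L≡11 , tt)))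
            -- The edge from `u` needs two vertices before `v`, the edge from `u′` two behind it,
            -- which makes five in `s′`.
            no-edge : ∀ {ξ′ s′ Y W v} → Rep L N ((ξ , u ∷ u′ ∷ []) ∷ Y ++ (ξ′ , s′) ∷ W) → length s′ ≤ 4 → v ∈ s′ → E u v → E u′ v → ⊥
            no-edge {v = v} r′ l v∈ e e′ with ∈-∃++ v∈
            ... | o , b , refl =
              (1≰0 (lin ([]) (o ∷ b ∷ P ∷ []) (v ∷ []) ((lng ((# 0 · (• 0 · # 1))) ≼ κ 4) ∷ (lng (# 2) ≋ κ 2) ∷ ((lng (# 2) ⊕ κ 0) ≼ (κ 0 ⊕ lng (# 0))) ∷ ((lng (# 2) ⊕ κ 0) ≼ (κ 0 ⊕ lng (# 1))) ∷ []) (κ 1) (κ 0) 0 ((1 , 0) ∷ (0 , 2) ∷ (1 , 0) ∷ (1 , 0) ∷ []) (l , |P| , clump-before C {ls = []} [] o r′ e nd₀ (λ ()) , clump-after C {ls = []} (u ∷ []) o r′ e′ nd₀ (λ ()) , tt)))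
              where
              nd₀ : NoDup (P ++ [])
              nd₀ = (nodup⊆ (P ∷ []) ([]) ((# 0 · ε)) (# 0) (C.ndP C))
            closed : ∀ {P* N*} → Clump (P ++ α ∷ rest ++ ξ ∷ []) P* N* → (∀ {v} → v ∈ u ∷ u′ ∷ [] → v ∈ P*) → ξ ∈ N* → α ∈ N* →
                     ∀ {z v} → z ∈ u ∷ u′ ∷ [] → E z v → v ∈ u ∷ u′ ∷ [] ⊎ v ∈ N
            closed {P*} {N*} C* s⊆ ξ∈* α∈* z∈ e with C.closed C* (s⊆ z∈) e
            ... | inj₁ h = inj₁ (⊆-reverse ((nodup⊆ (s ∷ t ∷ []) (ξ ∷ u ∷ u′ ∷ α ∷ β ∷ []) ((• 1 · (• 2 · ε))) ((• 0 · ((• 1 · (• 2 · ε)) · (• 3 · (# 0 · (• 4 · (# 1 · ε))))))) (X.nd))) s⊆ P*≤2 h)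
              where
              P*≤2 : length P* ≤ 2
              P*≤2 = (lin ([]) (s ∷ t ∷ L ∷ P* ∷ []) (ξ ∷ u ∷ u′ ∷ α ∷ β ∷ []) ((lng ((• 0 · ((• 1 · (• 2 · ε)) · (• 3 · (# 0 · (• 4 · (# 1 · ε))))))) ≋ lng (# 2)) ∷ ((lng ((• 3 · ((# 0 · (• 4 · (# 1 · ε))) · (• 0 · ε)))) ⊕ lng (# 3)) ≼ lng (# 2)) ∷ []) (lng (# 3)) (κ 2) 0 ((0 , 1) ∷ (1 , 0) ∷ []) (X.len , far C* (path-bta X) ((nodup⊆ (s ∷ t ∷ []) (ξ ∷ u ∷ u′ ∷ α ∷ β ∷ []) ((• 3 · ((# 0 · (• 4 · (# 1 · ε))) · (• 0 · ε)))) ((• 0 · ((• 1 · (• 2 · ε)) · (• 3 · (# 0 · (• 4 · (# 1 · ε))))))) (X.nd)))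
                         (∈-++⁺ʳ P) (λ eq → arcs-≢ X (sym eq)) α∈* ξ∈* , tt))
            ... | inj₂ h = inj₂ (in-N (C.N⊆L C* h) (C.join C* (s⊆ (here refl)) h) (C.join C* (s⊆ (there (here refl))) h))
              where
              in-N : ∀ {v} → v ∈ P ++ α ∷ rest ++ ξ ∷ [] → E u v → E u′ v → v ∈ N
              in-N {v} v∈ eu eu′ with ∈-++⁻ P v∈
              ... | inj₁ p = ⊥-elim ([ (λ q → C.offP C q (X.toL (there (here refl)))) , (λ q → All.lookup (All.head (offM r)) (here refl) q) ]′
                                       (C.closed C p (E-sym eu)))
              ... | inj₂ (here refl) = All.head (All.tail (headsM r))
              ... | inj₂ (there p) with ∈-++⁻ rest p
              ...   | inj₂ (here refl) = All.head (headsM r)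
              ...   | inj₁ q with ∈-++⁻ s q
              ...     | inj₁ v∈s = ⊥-elim (no-edge {Y = []} r ((lin ([]) (s ∷ t ∷ []) ([]) (((lng (# 0) ⊕ lng (# 1)) ≋ κ 6) ∷ (κ 2 ≼ lng (# 1)) ∷ []) (lng (# 0)) (κ 4) 0 ((1 , 0) ∷ (1 , 0) ∷ []) (len-st , t≥2 , tt))) v∈s eu eu′)
              ...     | inj₂ (here refl) = All.head (All.tail (All.tail (headsM r)))
              ...     | inj₂ (there q′) with ∈-++⁻ t q′
              ...       | inj₁ v∈t = ⊥-elim (no-edge {Y = (α , s) ∷ []} r-swap ((lin ([]) (s ∷ t ∷ []) ([]) (((lng (# 0) ⊕ lng (# 1)) ≋ κ 6) ∷ (κ 2 ≼ lng (# 0)) ∷ []) (lng (# 1)) (κ 4) 0 ((1 , 0) ∷ (1 , 0) ∷ []) (len-st , s≥2 , tt))) v∈t eu eu′)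

          seg≥2 : ∀ {ξ s τ Y} → Rep L N ((ξ , s) ∷ τ ∷ Y) → 2 ≤ length s
          seg≥2 {s = s} r = ≤-trans (≤-reflexive (sym |P|)) (gap S (s≤s z≤n) (C.path C) (E-sym (C.join C (start∈ (C.path C)) (Single.ξ∈ S)))
            (C.join C (end∈ (C.path C)) (Single.α∈ S)) (C.ndP C) (λ p q → C.offP C p (to r q)))
            where S = single-seg r

          P-block : ∀ {S} → (∀ {v} → v ∈ N → v ∈ S) → ∀ {z v} → z ∈ P → E z v → v ∈ P ⊎ v ∈ S
          P-block sub z∈ e = [ inj₁ , (λ q → inj₂ (sub q)) ]′ (C.closed C z∈ e)

          -- Two segments of two vertices would be separate components of G ∖ N, besides P and the rest.
          two-pairs : ∀ {a u u′ b w w′ d s} → Rep L N ((a , u ∷ u′ ∷ []) ∷ (b , w ∷ w′ ∷ []) ∷ (d , s) ∷ []) → ⊥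
          two-pairs {a} {u} {u′} {b} {w} {w′} {d} {[]} r with seg≥2 (rep-rotate ((a , u ∷ u′ ∷ []) ∷ (b , w ∷ w′ ∷ []) ∷ []) r)
          ... | ()
          two-pairs {a} {u} {u′} {b} {w} {w′} {d} {v ∷ s} r =
            pair-closed r (s≤s (s≤s z≤n)) s≥2 λ U → pair-closed (rep-rotate ((a , u ∷ u′ ∷ []) ∷ []) r) s≥2 (s≤s (s≤s z≤n)) λ W′ →
            <⇒≱ {3} {4} ≤-refl (≤-trans (separated N (C.p C ∷ u ∷ w ∷ v ∷ []) (s≤s (s≤s z≤n))
              ((λ h → C.offP C p∈ (C.N⊆L C h)) ∷ All.lookup (All.head (offM r)) (here refl) ∷ All.lookup (All.head (All.tail (offM r))) (here refl)
               ∷ All.lookup (All.head (All.tail (All.tail (offM r)))) (here refl) ∷ [])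
              ((apart-P (there (here refl)) ∷ apart-P (there (there (there (there (here refl))))) ∷ apart-P v∈ ∷ [])
               ∷ (closed-apart U (here refl) (off-u (there (here refl))) ∷ closed-apart U (here refl) (off-u (there (there (there (there (here refl)))))) ∷ [])
               ∷ (closed-apart W′ (here refl) off-w ∷ []) ∷ [] ∷ []))
              (≤-reflexive |N|))
            where
            s≥2 = seg≥2 (rep-rotate ((a , u ∷ u′ ∷ []) ∷ (b , w ∷ w′ ∷ []) ∷ []) r)
            p∈ = start∈ (C.path C)
            v∈ : v ∈ flatten ((a , u ∷ u′ ∷ []) ∷ (b , w ∷ w′ ∷ []) ∷ (d , v ∷ s) ∷ [])
            v∈ = there (there (there (there (there (there (there (here refl)))))))
            apart-P : ∀ {z} → z ∈ flatten ((a , u ∷ u′ ∷ []) ∷ (b , w ∷ w′ ∷ []) ∷ (d , v ∷ s) ∷ []) → ¬ Con (_∉ N) (C.p C) z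
            apart-P z∈ = closed-apart (P-block (λ h → h)) p∈ (λ h → C.offP C h (to r z∈))
            off-u : ∀ {z} → z ∈ b ∷ w ∷ w′ ∷ d ∷ v ∷ [] → z ∉ u ∷ u′ ∷ []
            off-u z∈ h = NoDup-disjoint {u ∷ u′ ∷ []} {b ∷ w ∷ w′ ∷ d ∷ v ∷ []} ((nodup⊆ (s ∷ []) (a ∷ u ∷ u′ ∷ b ∷ w ∷ w′ ∷ d ∷ v ∷ []) (((• 1 · (• 2 · ε)) · (• 3 · (• 4 · (• 5 · (• 6 · (• 7 · ε))))))) ((• 0 · (• 1 · (• 2 · (• 3 · (• 4 · (• 5 · (• 6 · (• 7 · (# 0 · ε)))))))))) (nodupᶻ r))) h z∈
            off-w : v ∉ w ∷ w′ ∷ []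
            off-w h = NoDup-disjoint {w ∷ w′ ∷ []} {v ∷ []} ((nodup⊆ (s ∷ []) (a ∷ u ∷ u′ ∷ b ∷ w ∷ w′ ∷ d ∷ v ∷ []) (((• 4 · (• 5 · ε)) · (• 7 · ε))) ((• 0 · (• 1 · (• 2 · (• 3 · (• 4 · (• 5 · (• 6 · (• 7 · (# 0 · ε)))))))))) (nodupᶻ r))) h (here refl)

        module TwoThrees {P N P′ N′ : List V} (C : Clump L P N) (|P| : length P ≡ 2) (|N| : length N ≡ 3)
                         (C′ : Clump L P′ N′) (|P′| : length P′ ≡ 2) (|N′| : length N′ ≡ 3) (disj : ∀ {v} → v ∈ P → v ∉ P′) where

          private
            module T = Threes C |P| |N|
            module T′ = Threes C′ |P′| |N′|

          spaced : ∀ {v z} o {w} → Ring v (o ++ z ∷ w) → v ∈ N′ → z ∈ N′ → 2 ≤ length o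
          spaced o ρ v∈ z∈ = ≤-trans (≤-reflexive (sym |P′|)) (arcs-gap (ring-arcs o ρ) C′ v∈ z∈)

          all-of : ∀ {x y z} → (∀ {v} → v ∈ N′ → v ∈ x ∷ y ∷ z ∷ []) → ∀ {v} → v ∈ x ∷ y ∷ z ∷ [] → v ∈ N′
          all-of sub = ⊆-reverse (C.ndN C′) sub (≤-reflexive (sym |N′|))

          module _ {d u₁ u₂ a s₁ s₂ s₃ b t₁ t₂ t₃ : V}
                   (r : Rep L N ((d , u₁ ∷ u₂ ∷ []) ∷ (a , s₁ ∷ s₂ ∷ s₃ ∷ []) ∷ (b , t₁ ∷ t₂ ∷ t₃ ∷ []) ∷ []))
                   (U : ∀ {z v} → z ∈ u₁ ∷ u₂ ∷ [] → E z v → v ∈ u₁ ∷ u₂ ∷ [] ⊎ v ∈ N) where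

            private
              p = C.p C
              p′ = C.p C′
              p∈ = start∈ (C.path C)
              p′∈ = start∈ (C.path C′)

              ρ : Ring d (u₁ ∷ u₂ ∷ a ∷ s₁ ∷ s₂ ∷ s₃ ∷ b ∷ t₁ ∷ t₂ ∷ t₃ ∷ [])
              ρ = rep-ring r

              ρa : Ring a (s₁ ∷ s₂ ∷ s₃ ∷ b ∷ t₁ ∷ t₂ ∷ t₃ ∷ d ∷ u₁ ∷ u₂ ∷ [])
              ρa = ring-rotate (ring-rotate (ring-rotate ρ))

              ρ₁ : Ring s₁ (s₂ ∷ s₃ ∷ b ∷ t₁ ∷ t₂ ∷ t₃ ∷ d ∷ u₁ ∷ u₂ ∷ a ∷ [])
              ρ₁ = ring-rotate ρa

              ρ₂ : Ring s₂ (s₃ ∷ b ∷ t₁ ∷ t₂ ∷ t₃ ∷ d ∷ u₁ ∷ u₂ ∷ a ∷ s₁ ∷ [])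
              ρ₂ = ring-rotate ρ₁

              ρ₃ : Ring s₃ (b ∷ t₁ ∷ t₂ ∷ t₃ ∷ d ∷ u₁ ∷ u₂ ∷ a ∷ s₁ ∷ s₂ ∷ [])
              ρ₃ = ring-rotate ρ₂

              N⇒ : ∀ {v} → v ∈ N → v ∈ d ∷ a ∷ b ∷ []
              N⇒ h = M⊆heads r (C.N⊆L C h) h

              u∉ : ∀ {v} → v ∈ u₁ ∷ u₂ ∷ [] → v ∉ N′
              u∉ v∈ h with U v∈ (E-sym (C.join C′ p′∈ h))
              ... | inj₁ q = C.offP C′ p′∈ (to r (there ((∈⊆ ([]) (u₁ ∷ u₂ ∷ a ∷ s₁ ∷ s₂ ∷ s₃ ∷ b ∷ t₁ ∷ t₂ ∷ t₃ ∷ []) ((• 0 · (• 1 · ε))) ((• 0 · (• 1 · (• 2 · (• 3 · (• 4 · (• 5 · (• 6 · (• 7 · (• 8 · (• 9 · ε))))))))))) (q)))))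
              ... | inj₂ q = C.offP C′ p′∈ (C.N⊆L C q)

              -- Neighbours of `P′` in both segments would require ten vertices there by
              -- `link-bound`, and there are six.
              t∉ : ∀ {v y} → y ∈ s₁ ∷ s₂ ∷ s₃ ∷ [] → y ∈ N′ → v ∈ t₁ ∷ t₂ ∷ t₃ ∷ [] → v ∉ N′
              t∉ y∈ yN v∈ vN = (1≰0 (lin ([]) (P ∷ P′ ∷ []) ([]) ((lng (# 0) ≋ κ 2) ∷ (lng (# 1) ≋ κ 2) ∷ ((2 ⊗ ((lng (# 0) ⊕ lng (# 1))) ⊕ κ 2) ≼ κ 6) ∷ []) (κ 1) (κ 0) 0 ((0 , 2) ∷ (0 , 2) ∷ (1 , 0) ∷ []) (|P| , |P′| , link-bound C {Y = []} (rep-rotate ((d , u₁ ∷ u₂ ∷ []) ∷ []) r) C′ disj y∈ v∈ yN vN , tt)))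

              two≰ : ∀ {k} → k ≡ 1 ⊎ k ≡ 0 → ¬ 2 ≤ k
              two≰ (inj₁ refl) (s≤s ())
              two≰ (inj₂ refl) ()

              P′-block : ∀ {S} → (∀ {v} → v ∈ N′ → v ∈ S) → ∀ {z v} → z ∈ P′ → E z v → v ∈ P′ ⊎ v ∈ S
              P′-block sub z∈ e = [ inj₁ , (λ q → inj₂ (sub q)) ]′ (C.closed C′ z∈ e)

              U-block : ∀ {S} → (∀ {v} → v ∈ N → v ∈ S) → ∀ {z v} → z ∈ u₁ ∷ u₂ ∷ [] → E z v → v ∈ u₁ ∷ u₂ ∷ [] ⊎ v ∈ S
              U-block sub z∈ e = [ inj₁ , (λ q → inj₂ (sub q)) ]′ (U z∈ e)

            -- Otherwise G ∖ N has the components P, P′, {u₁, u₂} and a fourth one.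
            inside-N : ¬ (∀ {v} → v ∈ N′ → v ∈ N)
            inside-N sub = <⇒≱ {3} {4} ≤-refl (≤-trans (separated N (p ∷ p′ ∷ u₁ ∷ s₁ ∷ []) (s≤s (s≤s z≤n))
                ((λ h → C.offP C p∈ (C.N⊆L C h)) ∷ (λ h → C.offP C′ p′∈ (C.N⊆L C h))
                 ∷ All.lookup (All.head (offM r)) (here refl) ∷ All.lookup (All.head (All.tail (offM r))) (here refl) ∷ [])
                ((closed-apart (T.P-block (λ h → h)) p∈ (λ h → disj h p′∈) ∷ closed-apart (T.P-block (λ h → h)) p∈ (λ h → C.offP C h u∈L)
                  ∷ closed-apart (T.P-block (λ h → h)) p∈ (λ h → C.offP C h s∈L) ∷ [])
                 ∷ (closed-apart (P′-block sub) p′∈ (λ h → C.offP C′ h u∈L) ∷ closed-apart (P′-block sub) p′∈ (λ h → C.offP C′ h s∈L) ∷ [])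
                 ∷ (closed-apart (U-block (λ h → h)) (here refl) s∉u ∷ []) ∷ [] ∷ []))
                (≤-reflexive |N|))
              where
              u∈L : u₁ ∈ L
              u∈L = to r (there (here refl))
              s∈L : s₁ ∈ L
              s∈L = toʳ ρ₁ (here refl)
              s∉u : s₁ ∉ u₁ ∷ u₂ ∷ []
              s∉u = NoDup-head ((nodup⊆ ([]) (s₁ ∷ s₂ ∷ s₃ ∷ b ∷ t₁ ∷ t₂ ∷ t₃ ∷ d ∷ u₁ ∷ u₂ ∷ a ∷ []) ((• 0 · (• 8 · (• 9 · ε)))) ((• 0 · (• 1 · (• 2 · (• 3 · (• 4 · (• 5 · (• 6 · (• 7 · (• 8 · (• 9 · (• 10 · ε)))))))))))) (ndʳ ρ₁)))

            -- Here G ∖ {a, b, d, s₁} has the components P, P′, {u₁, u₂}, {s₂, s₃} and a fifth one.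
            first-in : (∀ {v} → v ∈ N′ → v ∈ s₁ ∷ b ∷ d ∷ []) → ⊥
            first-in sub = T′.pair-closed r′ (s≤s (s≤s z≤n)) (s≤s (s≤s z≤n)) λ S₂₃ →
              let S = d ∷ a ∷ b ∷ s₁ ∷ []
                  S-block : ∀ {z v} → z ∈ s₂ ∷ s₃ ∷ [] → E z v → v ∈ s₂ ∷ s₃ ∷ [] ⊎ v ∈ S
                  S-block = λ z∈ e → [ inj₁ , (λ q → inj₂ (N′⇒ q)) ]′ (S₂₃ z∈ e)
              in <⇒≱ {4} {5} ≤-refl (separated S (p ∷ p′ ∷ u₁ ∷ s₂ ∷ t₁ ∷ []) (s≤s (s≤s z≤n))
                ((λ h → C.offP C p∈ (S⊆L h)) ∷ (λ h → C.offP C′ p′∈ (S⊆L h)) ∷ apartˢ (here refl) ∷ apartˢ (there (there (here refl)))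
                 ∷ apartˢ (there (there (there (there (here refl))))) ∷ [])
                ((closed-apart (T.P-block N⇒S) p∈ (λ h → disj h p′∈) ∷ closed-apart (T.P-block N⇒S) p∈ (λ h → C.offP C h u∈L)
                  ∷ closed-apart (T.P-block N⇒S) p∈ (λ h → C.offP C h s∈L) ∷ closed-apart (T.P-block N⇒S) p∈ (λ h → C.offP C h t∈L) ∷ [])
                 ∷ (closed-apart (P′-block N′⇒) p′∈ (λ h → C.offP C′ h u∈L) ∷ closed-apart (P′-block N′⇒) p′∈ (λ h → C.offP C′ h s∈L)
                    ∷ closed-apart (P′-block N′⇒) p′∈ (λ h → C.offP C′ h t∈L) ∷ [])
                 ∷ (closed-apart (U-block N⇒S) (here refl) s∉u ∷ closed-apart (U-block N⇒S) (here refl) t∉u ∷ [])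
                 ∷ (closed-apart S-block (here refl) t∉s ∷ []) ∷ [] ∷ []))
              where
              r′ : Rep L N′ ((s₁ , s₂ ∷ s₃ ∷ []) ∷ (b , t₁ ∷ t₂ ∷ t₃ ∷ []) ∷ (d , u₁ ∷ u₂ ∷ a ∷ []) ∷ [])
              r′ = ring-rep {s = s₂ ∷ s₃ ∷ []} {t = t₁ ∷ t₂ ∷ t₃ ∷ []} ρ₁ (all-of sub (here refl)) (all-of sub (there (here refl)))
                     (all-of sub (there (there (here refl)))) |N′| (C.ndN C′)
              N⇒S : ∀ {v} → v ∈ N → v ∈ d ∷ a ∷ b ∷ s₁ ∷ []
              N⇒S h = ∈-++⁺ˡ (N⇒ h)
              N′⇒ : ∀ {v} → v ∈ N′ → v ∈ d ∷ a ∷ b ∷ s₁ ∷ []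
              N′⇒ h = (∈⊆ ([]) (s₁ ∷ b ∷ d ∷ a ∷ []) ((• 0 · (• 1 · (• 2 · ε)))) ((• 2 · (• 3 · (• 1 · (• 0 · ε))))) (sub h))
              S⊆L : ∀ {v} → v ∈ d ∷ a ∷ b ∷ s₁ ∷ [] → v ∈ L
              S⊆L h = toʳ ρ ((∈⊆ ([]) (d ∷ a ∷ b ∷ s₁ ∷ u₁ ∷ u₂ ∷ s₂ ∷ s₃ ∷ t₁ ∷ t₂ ∷ t₃ ∷ []) ((• 0 · (• 1 · (• 2 · (• 3 · ε))))) ((• 0 · (• 4 · (• 5 · (• 1 · (• 3 · (• 6 · (• 7 · (• 2 · (• 8 · (• 9 · (• 10 · ε)))))))))))) (h)))
              u∈L : u₁ ∈ L
              u∈L = to r (there (here refl))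
              s∈L : s₂ ∈ L
              s∈L = toʳ ρ₂ (here refl)
              t∈L : t₁ ∈ L
              t∈L = toʳ ρ₃ (there (there (here refl)))
              s∉u : s₂ ∉ u₁ ∷ u₂ ∷ []
              s∉u = NoDup-head ((nodup⊆ ([]) (s₁ ∷ s₂ ∷ s₃ ∷ b ∷ t₁ ∷ t₂ ∷ t₃ ∷ d ∷ u₁ ∷ u₂ ∷ a ∷ []) ((• 1 · (• 8 · (• 9 · ε)))) ((• 0 · (• 1 · (• 2 · (• 3 · (• 4 · (• 5 · (• 6 · (• 7 · (• 8 · (• 9 · (• 10 · ε)))))))))))) (ndʳ ρ₁)))
              t∉u : t₁ ∉ u₁ ∷ u₂ ∷ []
              t∉u = NoDup-head ((nodup⊆ ([]) (s₁ ∷ s₂ ∷ s₃ ∷ b ∷ t₁ ∷ t₂ ∷ t₃ ∷ d ∷ u₁ ∷ u₂ ∷ a ∷ []) ((• 4 · (• 8 · (• 9 · ε)))) ((• 0 · (• 1 · (• 2 · (• 3 · (• 4 · (• 5 · (• 6 · (• 7 · (• 8 · (• 9 · (• 10 · ε)))))))))))) (ndʳ ρ₁)))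
              t∉s : t₁ ∉ s₂ ∷ s₃ ∷ []
              t∉s = NoDup-head ((nodup⊆ ([]) (s₁ ∷ s₂ ∷ s₃ ∷ b ∷ t₁ ∷ t₂ ∷ t₃ ∷ d ∷ u₁ ∷ u₂ ∷ a ∷ []) ((• 4 · (• 1 · (• 2 · ε)))) ((• 0 · (• 1 · (• 2 · (• 3 · (• 4 · (• 5 · (• 6 · (• 7 · (• 8 · (• 9 · (• 10 · ε)))))))))))) (ndʳ ρ₁)))
              apartˢ : ∀ {v} → v ∈ u₁ ∷ u₂ ∷ s₂ ∷ s₃ ∷ t₁ ∷ [] → v ∉ d ∷ a ∷ b ∷ s₁ ∷ []
              apartˢ h q = NoDup-disjoint {d ∷ a ∷ b ∷ s₁ ∷ []} {u₁ ∷ u₂ ∷ s₂ ∷ s₃ ∷ t₁ ∷ []}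
                ((nodup⊆ ([]) (s₁ ∷ s₂ ∷ s₃ ∷ b ∷ t₁ ∷ t₂ ∷ t₃ ∷ d ∷ u₁ ∷ u₂ ∷ a ∷ []) (((• 7 · (• 10 · (• 3 · (• 0 · ε)))) · (• 8 · (• 9 · (• 1 · (• 2 · (• 4 · ε))))))) ((• 0 · (• 1 · (• 2 · (• 3 · (• 4 · (• 5 · (• 6 · (• 7 · (• 8 · (• 9 · (• 10 · ε)))))))))))) (ndʳ ρ₁))) q h

            -- Cut at `N′`, the cycle has two segments of two vertices, which `two-pairs` forbids
            -- for the second clump.
            last-in : (∀ {v} → v ∈ N′ → v ∈ a ∷ s₃ ∷ d ∷ []) → ⊥
            last-in sub = T′.two-pairs (rep-rotate ((a , s₁ ∷ s₂ ∷ []) ∷ (s₃ , b ∷ t₁ ∷ t₂ ∷ t₃ ∷ []) ∷ []) r′)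
              where
              r′ : Rep L N′ ((a , s₁ ∷ s₂ ∷ []) ∷ (s₃ , b ∷ t₁ ∷ t₂ ∷ t₃ ∷ []) ∷ (d , u₁ ∷ u₂ ∷ []) ∷ [])
              r′ = ring-rep {s = s₁ ∷ s₂ ∷ []} {t = b ∷ t₁ ∷ t₂ ∷ t₃ ∷ []} ρa (all-of sub (here refl)) (all-of sub (there (here refl)))
                     (all-of sub (there (there (here refl)))) |N′| (C.ndN C′)

            data Spot (v : V) : Set where
              at-d : v ≡ d → Spot v
              in-u : v ∈ u₁ ∷ u₂ ∷ [] → Spot v
              at-a : v ≡ a → Spot v
              in-s : v ∈ s₁ ∷ s₂ ∷ s₃ ∷ [] → Spot v
              at-b : v ≡ b → Spot v
              in-t : v ∈ t₁ ∷ t₂ ∷ t₃ ∷ [] → Spot v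

            spot : ∀ {v} → v ∈ N′ → Spot v
            spot h with place (u₁ ∷ u₂ ∷ []) (from r (C.N⊆L C′ h))
            ... | at-a eq = at-d eq
            ... | in-s q  = in-u q
            ... | at-b eq = at-a eq
            ... | in-t q with ∈-++⁻ (s₁ ∷ s₂ ∷ s₃ ∷ []) q
            ...   | inj₁ q′ = in-s q′
            ...   | inj₂ (here eq) = at-b eq
            ...   | inj₂ (there q′) = in-t q′

            -- Members of `N′` are separated by at least two vertices, and the other two stretches
            -- are closed to them. A member in `s` thus leaves only three possibilities, according
            -- to its position: those of `first-in` and `last-in`, or a set of at most two.
            s-free : ∀ {y} → y ∈ s₁ ∷ s₂ ∷ s₃ ∷ [] → y ∉ N′
            s-free (here refl) yN = first-in λ h → go h (spot h)
              where
              go : ∀ {v} → v ∈ N′ → Spot v → v ∈ s₁ ∷ b ∷ d ∷ []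
              go h (at-d refl) = there (there (here refl))
              go h (in-u q) = ⊥-elim (u∉ q h)
              go h (at-a refl) = ⊥-elim (two≰ (inj₂ refl) (spaced [] ρa h yN))
              go h (in-s (here refl)) = here refl
              go h (in-s (there (here refl))) = ⊥-elim (two≰ (inj₂ refl) (spaced [] ρ₁ yN h))
              go h (in-s (there (there (here refl)))) = ⊥-elim (two≰ (inj₁ refl) (spaced (s₂ ∷ []) ρ₁ yN h))
              go h (at-b refl) = there (here refl)
              go h (in-t q) = ⊥-elim (t∉ (here refl) yN q h)
            s-free (there (here refl)) yN = <⇒≱ {2} {3} ≤-refl
              (≤-trans (≤-reflexive (sym |N′|)) (length-⊆ {ys = s₂ ∷ d ∷ []} (C.ndN C′) (λ h → go h (spot h))))
              where
              go : ∀ {v} → v ∈ N′ → Spot v → v ∈ s₂ ∷ d ∷ []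
              go h (at-d refl) = there (here refl)
              go h (in-u q) = ⊥-elim (u∉ q h)
              go h (at-a refl) = ⊥-elim (two≰ (inj₁ refl) (spaced (s₁ ∷ []) ρa h yN))
              go h (in-s (here refl)) = ⊥-elim (two≰ (inj₂ refl) (spaced [] ρ₁ h yN))
              go h (in-s (there (here refl))) = here refl
              go h (in-s (there (there (here refl)))) = ⊥-elim (two≰ (inj₂ refl) (spaced [] ρ₂ yN h))
              go h (at-b refl) = ⊥-elim (two≰ (inj₁ refl) (spaced (s₃ ∷ []) ρ₂ yN h))
              go h (in-t q) = ⊥-elim (t∉ (there (here refl)) yN q h)
            s-free (there (there (here refl))) yN = last-in λ h → go h (spot h)
              where
              go : ∀ {v} → v ∈ N′ → Spot v → v ∈ a ∷ s₃ ∷ d ∷ []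
              go h (at-d refl) = there (there (here refl))
              go h (in-u q) = ⊥-elim (u∉ q h)
              go h (at-a refl) = here refl
              go h (in-s (here refl)) = ⊥-elim (two≰ (inj₁ refl) (spaced (s₂ ∷ []) ρ₁ h yN))
              go h (in-s (there (here refl))) = ⊥-elim (two≰ (inj₂ refl) (spaced [] ρ₂ h yN))
              go h (in-s (there (there (here refl)))) = there (here refl)
              go h (at-b refl) = ⊥-elim (two≰ (inj₂ refl) (spaced [] ρ₃ yN h))
              go h (in-t q) = ⊥-elim (t∉ (there (there (here refl))) yN q h)

          three-three-two : ∀ {d u₁ u₂ a s₁ s₂ s₃ b t₁ t₂ t₃} →
            Rep L N ((d , u₁ ∷ u₂ ∷ []) ∷ (a , s₁ ∷ s₂ ∷ s₃ ∷ []) ∷ (b , t₁ ∷ t₂ ∷ t₃ ∷ []) ∷ []) → ⊥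
          three-three-two {d} {u₁} {u₂} {a} {s₁} {s₂} {s₃} {b} {t₁} {t₂} {t₃} r =
            T.pair-closed r (s≤s (s≤s z≤n)) (s≤s (s≤s z≤n)) λ U → T.pair-closed r̄ (s≤s (s≤s z≤n)) (s≤s (s≤s z≤n)) λ Ū →
            inside-N r U λ h → in-N U (λ z∈ e → Ū z∈ e) h (spot r U h)
            where
            -- In the mirror image the other segment of three vertices takes the place treated by
            -- `s-free`.
            r̄ : Rep L N ((a , u₂ ∷ u₁ ∷ []) ∷ (d , t₃ ∷ t₂ ∷ t₁ ∷ []) ∷ (b , s₃ ∷ s₂ ∷ s₁ ∷ []) ∷ [])
            r̄ = rep-rotate ((d , t₃ ∷ t₂ ∷ t₁ ∷ []) ∷ (b , s₃ ∷ s₂ ∷ s₁ ∷ []) ∷ [])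
              (ring-rep {s = t₃ ∷ t₂ ∷ t₁ ∷ []} {t = s₃ ∷ s₂ ∷ s₁ ∷ []} (ring-reverse (rep-ring r))
                (All.head (headsM r)) (All.head (All.tail (All.tail (headsM r)))) (All.head (All.tail (headsM r))) |N| (C.ndN C))
            Exchangeable : V → V → Set
            Exchangeable u u′ = ∀ {z v} → z ∈ u ∷ u′ ∷ [] → E z v → v ∈ u ∷ u′ ∷ [] ⊎ v ∈ N
            in-N : (U : Exchangeable u₁ u₂) → Exchangeable u₂ u₁ → ∀ {v} → v ∈ N′ → Spot r U v → v ∈ N
            in-N U Ū h (at-d refl) = All.head (headsM r)
            in-N U Ū h (in-u q) = ⊥-elim ([ (λ z → C.offP C′ (start∈ (C.path C′)) (to r (there (∈-++⁺ˡ z)))) ,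
                                            (λ z → C.offP C′ (start∈ (C.path C′)) (C.N⊆L C z)) ]′ (U q (E-sym (C.join C′ (start∈ (C.path C′)) h))))
            in-N U Ū h (at-a refl) = All.head (All.tail (headsM r))
            in-N U Ū h (in-s q) = ⊥-elim (s-free r U q h)
            in-N U Ū h (at-b refl) = All.head (All.tail (All.tail (headsM r)))
            in-N U Ū h (in-t q) = ⊥-elim (s-free r̄ Ū ((∈⊆ ([]) (t₁ ∷ t₂ ∷ t₃ ∷ []) ((• 0 · (• 1 · (• 2 · ε)))) ((• 2 · (• 1 · (• 0 · ε)))) (q))) h)

          private
            -- The segments hold 11 - 3 = 8 vertices, at least two each. With two in the first, the
            -- others have 2 and 4 or 3 and 3.
            led′ : ∀ {d u₁ u₂ a s b t} → Rep L N ((d , u₁ ∷ u₂ ∷ []) ∷ (a , s) ∷ (b , t) ∷ []) → 2 ≤ length s → 2 ≤ length t → ⊥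
            led′ {s = []} r () _
            led′ {s = _ ∷ []} r (s≤s ()) _
            led′ {s = _ ∷ _ ∷ _} {t = []} r _ ()
            led′ {s = _ ∷ _ ∷ _} {t = _ ∷ []} r _ (s≤s ())
            led′ {s = _ ∷ _ ∷ []} {t = _ ∷ _ ∷ _} r _ _ = T.two-pairs r
            led′ {s = _ ∷ _ ∷ _ ∷ _} {t = _ ∷ _ ∷ []} r _ _ = T.two-pairs (rep-rotate (_ ∷ _ ∷ []) r)
            led′ {s = _ ∷ _ ∷ _ ∷ []} {t = _ ∷ _ ∷ _ ∷ []} r _ _ = three-three-two r
            led′ {d} {u₁} {u₂} {a} {s₁ ∷ s₂ ∷ s₃ ∷ s} {b} {t₁ ∷ t₂ ∷ t₃ ∷ t₄ ∷ t} r _ _ =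
              (1≰0 (lin ([]) (s ∷ t ∷ []) (d ∷ u₁ ∷ u₂ ∷ a ∷ s₁ ∷ s₂ ∷ s₃ ∷ b ∷ t₁ ∷ t₂ ∷ t₃ ∷ t₄ ∷ []) ((lng ((• 0 · ((• 1 · (• 2 · ε)) · (• 3 · ((• 4 · (• 5 · (• 6 · # 0))) · (• 7 · ((• 8 · (• 9 · (• 10 · (• 11 · # 1)))) · ε))))))) ≋ κ 11) ∷ []) (κ 1) (κ 0) 0 ((1 , 0) ∷ []) (trans (size r) T.L≡11 , tt)))
            led′ {d} {u₁} {u₂} {a} {s₁ ∷ s₂ ∷ s₃ ∷ s₄ ∷ s} {b} {t₁ ∷ t₂ ∷ t₃ ∷ []} r _ _ =
              (1≰0 (lin ([]) (s ∷ []) (d ∷ u₁ ∷ u₂ ∷ a ∷ s₁ ∷ s₂ ∷ s₃ ∷ s₄ ∷ b ∷ t₁ ∷ t₂ ∷ t₃ ∷ []) ((lng ((• 0 · ((• 1 · (• 2 · ε)) · (• 3 · ((• 4 · (• 5 · (• 6 · (• 7 · # 0)))) · (• 8 · ((• 9 · (• 10 · (• 11 · ε))) · ε))))))) ≋ κ 11) ∷ []) (κ 1) (κ 0) 0 ((1 , 0) ∷ []) (trans (size r) T.L≡11 , tt)))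

          led : ∀ {d u a s b t} → Rep L N ((d , u) ∷ (a , s) ∷ (b , t) ∷ []) → length u ≡ 2 → ⊥
          led {u = _ ∷ _ ∷ []} r refl = led′ r (T.seg≥2 (rep-rotate (_ ∷ []) r)) (T.seg≥2 (rep-rotate (_ ∷ _ ∷ []) r))

          -- Three segments of at least three vertices would make a cycle of at least 12, so some
          -- segment has two.
          contradictory : ⊥
          contradictory with cut-three C |N|
          ... | a , s , b , t , d , u , r with length s ≟ 2 | length t ≟ 2 | length u ≟ 2
          ...   | yes h | _ | _ = led r h
          ...   | _ | yes h | _ = led (rep-rotate ((a , s) ∷ []) r) h
          ...   | _ | _ | yes h = led (rep-rotate ((a , s) ∷ (b , t) ∷ []) r) h
          ...   | no h | no h′ | no h″ =
            (1≰0 (lin ([]) (s ∷ t ∷ u ∷ L ∷ []) (a ∷ b ∷ d ∷ []) ((lng ((• 0 · (# 0 · (• 1 · (# 1 · (• 2 · (# 2 · ε))))))) ≋ lng (# 3)) ∷ (lng (# 3) ≋ κ 11) ∷ (κ 3 ≼ lng (# 0)) ∷ (κ 3 ≼ lng (# 1)) ∷ (κ 3 ≼ lng (# 2)) ∷ []) (κ 1) (κ 0) 0 ((1 , 0) ∷ (1 , 0) ∷ (1 , 0) ∷ (1 , 0) ∷ (1 , 0) ∷ []) (size r , T.L≡11 , ≤∧≢⇒< (T.seg≥2 r) (λ e → h (sym e)) , ≤∧≢⇒< (T.seg≥2 (rep-rotate ((a , s) ∷ []) r)) (λ e → h′ (sym e)) , ≤∧≢⇒< (T.seg≥2 (rep-rotate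 ((a , s) ∷ (b , t) ∷ []) r)) (λ e → h″ (sym e)) , tt)))

        -- Further clumps beside a clump with one vertex

        module OnesRest {x : V} {N : List V} (Cx : Clump L (x ∷ []) N) (δ≥3 : 3 ≤ δ) where

          private
            x∉L : x ∉ L
            x∉L = Ones.x∉L Cx δ≥3

            |N| : length N ≡ δ
            |N| = Ones.|N| Cx δ≥3

            all-two : ∀ {Z} → Rep L N Z → All (λ σ → length (proj₂ σ) ≡ 2) Z
            all-two = Ones.all-two Cx δ≥3

          Six : (a s₁ s₂ b t₁ t₂ d u₁ u₂ : V) → Set
          Six a s₁ s₂ b t₁ t₂ d u₁ u₂ = Rep L N ((a , s₁ ∷ s₂ ∷ []) ∷ (b , t₁ ∷ t₂ ∷ []) ∷ (d , u₁ ∷ u₂ ∷ []) ∷ [])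

          δ≡three : δ ≡ 3
          δ≡three with represent cycL (C.N⊆L Cx h) h
            where h = proj₂ (head-of {N} (≤-trans (s≤s z≤n) (C.N≥2 Cx)))
          ... | _ , _ , r = Ones.δ≡3 Cx δ≥3 r

          |N|≡3 : length N ≡ 3
          |N|≡3 = trans |N| δ≡three

          -- In continuation form: a with-abstraction over the existential would normalise its proof.
          six : ∀ {A : Set} → (∀ {a s₁ s₂ b t₁ t₂ d u₁ u₂} → Six a s₁ s₂ b t₁ t₂ d u₁ u₂ → A) → A
          six {A} k = shape (cut-three Cx |N|≡3)
            where
            shape′ : ∀ {a s b t d u} → All (λ σ → length (proj₂ σ) ≡ 2) ((a , s) ∷ (b , t) ∷ (d , u) ∷ []) →
                     Rep L N ((a , s) ∷ (b , t) ∷ (d , u) ∷ []) →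
                     A
            shape′ {a} {s₁ ∷ s₂ ∷ []} {b} {t₁ ∷ t₂ ∷ []} {d} {u₁ ∷ u₂ ∷ []} _ r = k r
            shape′ {s = []} (() ∷ _) r
            shape′ {s = _ ∷ []} (() ∷ _) r
            shape′ {s = _ ∷ _ ∷ _ ∷ _} (() ∷ _) r
            shape′ {s = _ ∷ _ ∷ []} {t = []} (_ ∷ () ∷ _) r
            shape′ {s = _ ∷ _ ∷ []} {t = _ ∷ []} (_ ∷ () ∷ _) r
            shape′ {s = _ ∷ _ ∷ []} {t = _ ∷ _ ∷ _ ∷ _} (_ ∷ () ∷ _) r
            shape′ {s = _ ∷ _ ∷ []} {t = _ ∷ _ ∷ []} {u = []} (_ ∷ _ ∷ () ∷ _) r
            shape′ {s = _ ∷ _ ∷ []} {t = _ ∷ _ ∷ []} {u = _ ∷ []} (_ ∷ _ ∷ () ∷ _) r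
            shape′ {s = _ ∷ _ ∷ []} {t = _ ∷ _ ∷ []} {u = _ ∷ _ ∷ _ ∷ _} (_ ∷ _ ∷ () ∷ _) r
            shape : ∃[ a ] ∃[ s ] ∃[ b ] ∃[ t ] ∃[ d ] ∃[ u ] Rep L N ((a , s) ∷ (b , t) ∷ (d , u) ∷ []) →
                    A
            shape (_ , _ , _ , _ , _ , _ , r) = shape′ (all-two r) r

          L≡9 : length L ≡ 9
          L≡9 = six λ r → sym (size r)

          module _ {P′ N′} (C′ : Clump L P′ N′) (disj : x ∉ P′) where

            private
              disj′ : ∀ {v} → v ∈ x ∷ [] → v ∉ P′
              disj′ (here refl) = disj

              P≥1 : 1 ≤ length P′
              P≥1 = C-nonempty C′

            -- Gaps and links confine `N′` to `s₁`, `b`, `d`. If `P′` is one vertex, all three occur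
            -- and cut off the segment of `s₂` alone, against `all-two`. If `P′` is larger, the gap
            -- from `s₁` to `b` is too small for it, and with `d` instead a cycle of at least ten
            -- vertices passes through `x` and `P′`.
            first-off : ∀ {a s₁ s₂ b t₁ t₂ d u₁ u₂} → Six a s₁ s₂ b t₁ t₂ d u₁ u₂ → s₁ ∉ N′
            first-off {a} {s₁} {s₂} {b} {t₁} {t₂} {d} {u₁} {u₂} r sN = by-size P′ N′ C′ refl refl
              where
              ρ : Ring a (s₁ ∷ s₂ ∷ b ∷ t₁ ∷ t₂ ∷ d ∷ u₁ ∷ u₂ ∷ [])
              ρ = rep-ring r
              ρ₁ : Ring s₁ (s₂ ∷ b ∷ t₁ ∷ t₂ ∷ d ∷ u₁ ∷ u₂ ∷ a ∷ [])
              ρ₁ = ring-rotate ρ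
              spaced : ∀ {v z} o {w} → Ring v (o ++ z ∷ w) → v ∈ N′ → z ∈ N′ → length P′ ≤ length o
              spaced o ρ′ v∈ z∈ = arcs-gap (ring-arcs o ρ′) C′ v∈ z∈
              linked : ∀ {ξ Y W ξ′ z w w′} → Rep L N ((ξ , s₁ ∷ s₂ ∷ []) ∷ Y ++ (ξ′ , w ∷ w′ ∷ []) ∷ W) → z ∈ w ∷ w′ ∷ [] → z ∉ N′
              linked r′ z∈ zN = (1≰0 (lin ([]) (P′ ∷ []) ([]) ((κ 1 ≼ lng (# 0)) ∷ ((2 ⊗ ((κ 1 ⊕ lng (# 0))) ⊕ κ 2) ≼ κ 4) ∷ []) (κ 1) (κ 0) 0 ((2 , 0) ∷ (1 , 0) ∷ []) (P≥1 , link-bound Cx r′ C′ disj′ (here refl) z∈ sN zN , tt)))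
              only : ∀ {v} → v ∈ N′ → v ∈ s₁ ∷ b ∷ d ∷ []
              only h with place (s₁ ∷ s₂ ∷ []) (from r (C.N⊆L C′ h))
              ... | at-a refl = ⊥-elim (<⇒≱ P≥1 (spaced [] ρ h sN))
              ... | in-s (here refl) = here refl
              ... | in-s (there (here refl)) = ⊥-elim (<⇒≱ P≥1 (spaced [] ρ₁ sN h))
              ... | at-b refl = there (here refl)
              ... | in-t (here refl) = ⊥-elim (linked {Y = []} r (here refl) h)
              ... | in-t (there (here refl)) = ⊥-elim (linked {Y = []} r (there (here refl)) h)
              ... | in-t (there (there (here refl))) = there (there (here refl))
              ... | in-t (there (there (there (here refl)))) = ⊥-elim (linked {Y = (b , t₁ ∷ t₂ ∷ []) ∷ []} r (here refl) h)
              ... | in-t (there (there (there (there (here refl))))) = ⊥-elim (linked {Y = (b , t₁ ∷ t₂ ∷ []) ∷ []} r (there (here refl)) h)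
              by-size : ∀ Q M → Clump L Q M → Q ≡ P′ → M ≡ N′ → ⊥
              by-size (p ∷ []) M D refl refl = not-two (Ones.all-two D δ≥3 r′)
                where
                |M| : length M ≡ 3
                |M| = (≤-antisym (lin (δ ∷ []) (M ∷ []) ([]) (((κ 1 ⊕ lng (# 0)) ≋ (κ 1 ⊕ at 0)) ∷ (at 0 ≋ κ 3) ∷ []) (lng (# 0)) (κ 3) 0 ((1 , 0) ∷ (1 , 0) ∷ []) (C.count D , δ≡three , tt)) (lin (δ ∷ []) (M ∷ []) ([]) (((κ 1 ⊕ lng (# 0)) ≋ (κ 1 ⊕ at 0)) ∷ (at 0 ≋ κ 3) ∷ []) (κ 3) (lng (# 0)) 0 ((0 , 1) ∷ (0 , 1) ∷ []) (C.count D , δ≡three , tt)))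
                all-of : ∀ {v} → v ∈ s₁ ∷ b ∷ d ∷ [] → v ∈ M
                all-of = ⊆-reverse (C.ndN D) only (≤-reflexive (sym |M|))
                r′ : Rep L M ((s₁ , s₂ ∷ []) ∷ (b , t₁ ∷ t₂ ∷ []) ∷ (d , u₁ ∷ u₂ ∷ a ∷ []) ∷ [])
                r′ = ring-rep {s = s₂ ∷ []} {t = t₁ ∷ t₂ ∷ []} ρ₁ (all-of (here refl)) (all-of (there (here refl))) (all-of (there (there (here refl)))) |M| (C.ndN D)
                not-two : ∀ {Z} → All (λ σ → length (proj₂ σ) ≡ 2) ((s₁ , s₂ ∷ []) ∷ Z) → ⊥
                not-two (() ∷ _)
              by-size (p ∷ q ∷ Q) M D refl refl = other (another-member (C.N≥2 D) (C.ndN D) sN)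
                where
                other : ∃[ f ] (f ∈ M × f ≢ s₁) → ⊥
                other (f , fN , f≢) with only fN
                ... | here refl = f≢ refl
                ... | there (here refl) = <⇒≱ {1} (s≤s (s≤s z≤n)) (spaced (s₂ ∷ []) ρ₁ sN fN)
                ... | there (there (here refl)) = (1≰0 (lin ([]) (L ∷ Q ∷ []) (p ∷ q ∷ []) ((lng (# 0) ≋ κ 9) ∷ ((((κ 3 ⊕ κ 1) ⊕ κ 4) ⊕ lng ((• 0 · (• 1 · # 1)))) ≼ lng (# 0)) ∷ []) (κ 1) (κ 0) 0 ((1 , 0) ∷ (1 , 0) ∷ []) (L≡9 , crossLk (lk-path (proj₁ (lk-split (s₂ ∷ []) (lkʳ ρ₁))) [ b ]) (lk-path l-da [ a ]) [ x ]
                    (E-sym (C.join Cx (here refl) (All.head (All.tail (headsM r))))) (C.join Cx (here refl) (All.head (headsM r)))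
                    (C-lk D fN sN)
                    ((nodup⊆ (Q ∷ []) (a ∷ s₁ ∷ s₂ ∷ b ∷ t₁ ∷ t₂ ∷ d ∷ u₁ ∷ u₂ ∷ x ∷ p ∷ q ∷ []) (((• 1 · (• 2 · (• 3 · ε))) · ((• 9 · ε) · ((• 6 · (• 7 · (• 8 · (• 0 · ε)))) · (• 10 · (• 11 · # 0)))))) (((• 0 · (• 1 · (• 2 · (• 3 · (• 4 · (• 5 · (• 6 · (• 7 · (• 8 · ε))))))))) · (• 9 · (• 10 · (• 11 · # 0))))) (ndAll))) , tt)))
                  where
                  l-da : Lk d (u₁ ∷ u₂ ∷ []) a
                  l-da = proj₂ (lk-split (t₁ ∷ t₂ ∷ []) (proj₂ (lk-split (s₁ ∷ s₂ ∷ []) (lkʳ ρ))))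
                  ndAll : NoDup ((a ∷ s₁ ∷ s₂ ∷ b ∷ t₁ ∷ t₂ ∷ d ∷ u₁ ∷ u₂ ∷ []) ++ x ∷ p ∷ q ∷ Q)
                  ndAll = NoDup-++ (ndʳ ρ) (NoDup-∷ disj (C.ndP D))
                            λ { h (here refl) → x∉L (toʳ ρ h) ; h (there h′) → C.offP D h′ (toʳ ρ h) }
              by-size [] M D refl refl = <⇒≱ P≥1 z≤n

            seg-off : ∀ {a s₁ s₂ b t₁ t₂ d u₁ u₂ v} → Six a s₁ s₂ b t₁ t₂ d u₁ u₂ → v ∈ s₁ ∷ s₂ ∷ [] → v ∉ N′
            seg-off r (here refl) = first-off r
            seg-off {a} {s₁} {s₂} {b} {t₁} {t₂} {d} {u₁} {u₂} r (there (here refl)) = first-off r̄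
              where
              r̄ : Six b s₂ s₁ a u₂ u₁ d t₂ t₁
              r̄ = rep-rotate ((a , u₂ ∷ u₁ ∷ []) ∷ (d , t₂ ∷ t₁ ∷ []) ∷ [])
                (ring-rep {s = u₂ ∷ u₁ ∷ []} {t = t₂ ∷ t₁ ∷ []} (ring-reverse (rep-ring r))
                  (All.head (headsM r)) (All.head (All.tail (All.tail (headsM r)))) (All.head (All.tail (headsM r))) |N|≡3 (C.ndN Cx))

            same-nbrs : ∀ {v} → v ∈ N′ → v ∈ N
            same-nbrs h = six λ r → at-place h r (place _ (from r (C.N⊆L C′ h)))
              where
              at-place : ∀ {a s₁ s₂ b t₁ t₂ d u₁ u₂ v} → v ∈ N′ → Six a s₁ s₂ b t₁ t₂ d u₁ u₂ →
                         Place a (s₁ ∷ s₂ ∷ []) b (t₁ ∷ t₂ ∷ d ∷ u₁ ∷ u₂ ∷ []) v → v ∈ N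
              at-place h r (at-a refl) = All.head (headsM r)
              at-place h r (in-s q) = ⊥-elim (seg-off r q h)
              at-place h r (at-b refl) = All.head (All.tail (headsM r))
              at-place {t₁ = t₁} {t₂} h r (in-t q) with ∈-++⁻ (t₁ ∷ t₂ ∷ []) q
              ... | inj₁ q′ = ⊥-elim (seg-off (rep-rotate (_ ∷ []) r) q′ h)
              ... | inj₂ (here refl) = All.head (All.tail (All.tail (headsM r)))
              ... | inj₂ (there q′) = ⊥-elim (seg-off (rep-rotate (_ ∷ _ ∷ []) r) q′ h)

            -- With |N′| ≥ 3 this follows from |P′| + |N′| = 4. With |N′| = 2 both neighbours lie in
            -- `N`, two vertices apart along one arc, whereas `δ≤arc` requires three.
            lone-clump : length P′ ≡ 1
            lone-clump with length N′ ≟ 2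
            ... | no h = (≤-antisym (lin (δ ∷ []) (P′ ∷ N′ ∷ []) ([]) ((κ 1 ≼ lng (# 0)) ∷ ((lng (# 0) ⊕ lng (# 1)) ≋ (κ 1 ⊕ at 0)) ∷ (at 0 ≋ κ 3) ∷ (κ 3 ≼ lng (# 1)) ∷ []) (lng (# 0)) (κ 1) 0 ((0 , 0) ∷ (1 , 0) ∷ (1 , 0) ∷ (1 , 0) ∷ []) (P≥1 , C.count C′ , δ≡three , ≤∧≢⇒< (C.N≥2 C′) (λ e → h (sym e)) , tt)) (lin (δ ∷ []) (P′ ∷ N′ ∷ []) ([]) ((κ 1 ≼ lng (# 0)) ∷ ((lng (# 0) ⊕ lng (# 1)) ≋ (κ 1 ⊕ at 0)) ∷ (at 0 ≋ κ 3) ∷ (κ 3 ≼ lng (# 1)) ∷ []) (κ 1) (lng (# 0)) 0 ((1 , 0) ∷ (0 , 0) ∷ (0 , 0) ∷ (0 , 0) ∷ []) (P≥1 , C.count C′ , δ≡three , ≤∧≢⇒< (C.N≥2 C′) (λ e → h (sym e)) , tt)))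
            ... | yes |N′| with two-members N′ |N′| (C.ndN C′)
            ...   | f , g , fN , gN , f≢g =
              six λ r → ⊥-elim (by-place r (M⊆heads r (C.N⊆L C′ fN) (same-nbrs fN)) (M⊆heads r (C.N⊆L C′ gN) (same-nbrs gN)))
              where
              module _ {a s₁ s₂ b t₁ t₂ d u₁ u₂} (r : Six a s₁ s₂ b t₁ t₂ d u₁ u₂) where
                ρ : Ring a (s₁ ∷ s₂ ∷ b ∷ t₁ ∷ t₂ ∷ d ∷ u₁ ∷ u₂ ∷ [])
                ρ = rep-ring r
                short : ∀ {v w y y′ t} → Arcs L v (y ∷ y′ ∷ []) w t → v ∈ N′ → w ∈ N′ → ⊥
                short X v∈ w∈ = <⇒≱ δ≥3 (δ≤arc X (C′ , |N′|) v∈ w∈)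
                ab : a ∈ N′ → b ∈ N′ → ⊥
                ab = short (ring-arcs (s₁ ∷ s₂ ∷ []) ρ)
                bd : b ∈ N′ → d ∈ N′ → ⊥
                bd = short (ring-arcs (t₁ ∷ t₂ ∷ []) (ring-rotate (ring-rotate (ring-rotate ρ))))
                da : d ∈ N′ → a ∈ N′ → ⊥
                da = short (ring-arcs (u₁ ∷ u₂ ∷ []) (ring-rotate (ring-rotate (ring-rotate (ring-rotate (ring-rotate (ring-rotate ρ)))))))
                by-place : f ∈ a ∷ b ∷ d ∷ [] → g ∈ a ∷ b ∷ d ∷ [] → ⊥
                by-place f∈ g∈ = pairs-of-three {R = λ v w → v ∈ N′ → w ∈ N′ → ⊥} (λ h v∈ w∈ → h w∈ v∈) ab bd da f∈ g∈ f≢g fN gN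

          -- The clumps then have the same neighbours, and deleting these leaves a fourth component.
          no-three-ones : ∀ {P′ P″ N′ N″} → Clump L P′ N′ → Clump L P″ N″ → x ∉ P′ → x ∉ P″ → (∀ {v} → v ∈ P′ → v ∉ P″) → ⊥
          no-three-ones {P′} {P″} {N′} {N″} C′ C″ d′ d″ dd = six λ {a} {s₁} r →
            let s∈L : s₁ ∈ L
                s∈L = to r (there (here refl))
            in
            <⇒≱ {3} {4} ≤-refl (≤-trans (separated N (x ∷ p′ ∷ p″ ∷ s₁ ∷ []) (s≤s (s≤s z≤n))
              ((λ h → x∉L (C.N⊆L Cx h)) ∷ (λ h → C.offP C′ p′∈ (C.N⊆L Cx h)) ∷ (λ h → C.offP C″ p″∈ (C.N⊆L Cx h))
               ∷ All.lookup (All.head (offM r)) (here refl) ∷ [])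
              ((closed-apart (block Cx (λ h → h)) (here refl) (λ { (here refl) → d′ p′∈ })
                ∷ closed-apart (block Cx (λ h → h)) (here refl) (λ { (here refl) → d″ p″∈ })
                ∷ closed-apart (block Cx (λ h → h)) (here refl) (λ { (here refl) → x∉L s∈L }) ∷ [])
               ∷ (closed-apart (block C′ (same-nbrs C′ d′)) p′∈ (λ h → dd h p″∈) ∷ closed-apart (block C′ (same-nbrs C′ d′)) p′∈ (λ h → C.offP C′ h s∈L) ∷ [])
               ∷ (closed-apart (block C″ (same-nbrs C″ d″)) p″∈ (λ h → C.offP C″ h s∈L) ∷ []) ∷ [] ∷ []))
              (≤-reflexive |N|≡3))
            where
            p′ = C.p C′
            p″ = C.p C″
            p′∈ = start∈ (C.path C′)
            p″∈ = start∈ (C.path C″)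
            block : ∀ {Q M} → Clump L Q M → (∀ {v} → v ∈ M → v ∈ N) → ∀ {z v} → z ∈ Q → E z v → v ∈ Q ⊎ v ∈ N
            block D sub z∈ e = [ inj₁ , (λ q → inj₂ (sub q)) ]′ (C.closed D z∈ e)

        -- Counting the clumps

        Disjoint : List V → List V → Set
        Disjoint P Q = ∀ {v} → v ∈ P → v ∉ Q

        IsClump : List V → Set
        IsClump P = ∃[ N ] Clump L P N

        -- Clumps are collected vertex by vertex; the set `X` of vertices handled so far is a
        -- parameter to make this an induction.
        record Packing (ps : List (List V)) (X : V → Set) : Set where
          constructor packing
          field
            clumps   : All IsClump ps
            disjoint : AllPairs Disjoint ps
            covers   : ∀ {v} → X v → v ∉ L → Any (v ∈_) ps

        open Packing

        -- A vertex common to `P` and some `Q` is adjacent or equal to `v`, since `P` is a clique;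
        -- as `Q` is closed outside `L`, it would contain `v`.
        add : ∀ {ps P N v} → Clump L P N → v ∈ P → All IsClump ps → ¬ Any (v ∈_) ps → All (Disjoint P) ps
        add {P = P} {v = v} C v∈ cl v∉ = All.tabulate λ {Q} Q∈ {w} w∈P w∈Q → v∉ (lose Q∈ (reach (proj₂ (All.lookup cl Q∈)) w∈P w∈Q (w ≟ᶠ v)))
          where
          reach : ∀ {w Q M} → Clump L Q M → w ∈ P → w ∈ Q → Dec (w ≡ v) → v ∈ Q
          reach D w∈P w∈Q (yes refl) = w∈Q
          reach D w∈P w∈Q (no ne) = [ (λ q → q) , (λ q → ⊥-elim (C.offP C v∈ (C.N⊆L D q))) ]′
            (C.closed D w∈Q (C.clique C w∈P v∈ (λ eq → ne (sym eq))))

        pack : ∀ vs → ¬ ¬ (∃[ ps ] Packing ps (_∈ vs))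
        pack [] k = k ([] , packing [] [] λ ())
        pack (v ∷ vs) k = pack vs λ { (ps , A) → step′ ps A (v ∈? L) (any? (v ∈?_) ps) }
          where
          step′ : ∀ ps → Packing ps (_∈ vs) → Dec (v ∈ L) → Dec (Any (v ∈_) ps) → ⊥
          step′ ps A (yes v∈) _ = k (ps , packing (clumps A) (disjoint A) λ { (here refl) h → contradiction v∈ h ; (there p) h → covers A p h })
          step′ ps A (no v∉) (yes p) = k (ps , packing (clumps A) (disjoint A) λ { (here refl) h → p ; (there p) h → covers A p h })
          step′ ps A (no v∉) (no h) = classified cycL refl v∉ λ { (P , N , C , v∈) →
            k (P ∷ ps , packing ((N , C) ∷ clumps A) (add C v∈ (clumps A) h ∷ disjoint A)
              λ { (here refl) _ → here v∈ ; (there p) q → there (covers A p q) }) }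

        Full : List (List V) → Set
        Full ps = Packing ps (λ _ → ⊤)

        front : ∀ {ps P} → P ∈ ps → Full ps → ∃[ qs ] Full (P ∷ qs)
        front {P = P} P∈ (packing cl dj cv) with ∈-∃++ P∈
        ... | xs , ys , refl = xs ++ ys , packing (All-resp-↭ (shift P xs ys) cl) (to-front xs dj) λ x h → Any-resp-↭ (shift P xs ys) (cv x h)
          where
          to-front : ∀ xs {ys} → AllPairs Disjoint (xs ++ P ∷ ys) → AllPairs Disjoint (P ∷ xs ++ ys)
          to-front [] d = d
          to-front (Q ∷ xs) {ys} (h ∷ d) with All-resp-↭ (shift P xs ys) h | to-front xs d
          ... | hP ∷ h′ | d₁ ∷ d₂ = ((λ p q → hP q p) ∷ d₁) ∷ (h′ ∷ d₂)

        order : ∀ {ps} → Full ps → n ≡ length L + length (concat ps)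
        order {ps} (packing cl dj cv) = trans (≤-antisym
          (≤-trans (≤-reflexive (sym (length-tabulate (λ v → v)))) (length-⊆ {allFin n} {L ++ concat ps} nd-all (λ {v} _ → every v)))
          (≤-trans (length-⊆ {L ++ concat ps} {allFin n} nd (λ {v} _ → ∈-allFin v)) (≤-reflexive (length-tabulate (λ v → v)))))
          (length-++ L)
          where
          nd-all : NoDup (allFin n)
          nd-all = tabulate-nodup (λ v → v) (λ e → e)
          every : ∀ v → v ∈ L ++ concat ps
          every v with v ∈? L
          ... | yes p = ∈-++⁺ˡ p
          ... | no ¬p = ∈-++⁺ʳ L (∈-concat⁺ (cv tt ¬p))
          nd-concat : ∀ {ps} → All IsClump ps → AllPairs Disjoint ps → NoDup (concat ps)
          nd-concat [] [] = NoDup-[]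
          nd-concat ((N , C) ∷ cl) (d ∷ dj) = NoDup-++ (C.ndP C) (nd-concat cl dj)
            λ p q → let Q , q∈ , Q∈ = ∈-concat⁻′ _ q in All.lookup d Q∈ p q∈
          off : ∀ {ps v} → All IsClump ps → v ∈ concat ps → v ∉ L
          off cl q h = let Q , q∈ , Q∈ = ∈-concat⁻′ _ q in C.offP (proj₂ (All.lookup cl Q∈)) q∈ h
          nd : NoDup (L ++ concat ps)
          nd = NoDup-++ (nodupᶜ cycL) (nd-concat cl dj) (λ p q → off cl q p)

        IsTwo IsOne IsThree : List V → Set
        IsTwo P   = ∃[ N ] Two L P N
        IsOne P   = ∃[ N ] (Clump L P N × length P ≡ 1 × 3 ≤ δ)
        IsThree P = ∃[ N ] (Clump L P N × length P ≡ 2 × length N ≡ 3)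

        kind : ∀ {P} → IsClump P → IsTwo P ⊎ IsOne P ⊎ IsThree P
        kind (N , C) with small-cases (C-nonempty C) (C.N≥2 C) (C.count C) (C.slack C) small
        ... | inj₁ h = inj₁ (N , C , h)
        ... | inj₂ (inj₁ (h , h′)) = inj₂ (inj₁ (N , C , h , h′))
        ... | inj₂ (inj₂ (h , h′)) = inj₂ (inj₂ (N , C , h , h′))

        Goal : Set
        Goal = n ≡ length L ⊎ bound n δ ≤ length L

        ends : ∀ {P N} → Two L P N → ∃[ a ] ∃[ b ] ∃[ s ] ∃[ t ] (Arcs L a s b t × a ∈ N × b ∈ N)
        ends {N = N} (C , h) with two-members N h (C.ndN C)
        ... | a , b , a∈ , b∈ , a≢b with arcs-of cycL refl (C.N⊆L C a∈) (C.N⊆L C b∈) a≢b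
        ...   | s , t , X = a , b , s , t , X , a∈ , b∈

        2δ+2≤c : ∀ {P N} → Two L P N → 2 * δ + 2 ≤ length L
        2δ+2≤c {P} T@(C , h) = (lin (δ ∷ []) (P ∷ L ∷ []) ([]) (((2 ⊗ ((κ 1 ⊕ lng (# 0))) ⊕ κ 2) ≼ lng (# 1)) ∷ ((lng (# 0) ⊕ κ 1) ≋ at 0) ∷ []) ((2 ⊗ (at 0) ⊕ κ 2)) (lng (# 1)) 0 ((1 , 0) ∷ (0 , 2) ∷ []) (subst (λ s → s * (1 + length P) + 2 ≤ length L) h (C.slack C) , P-size T , tt))

        -- Each clump adds δ - 1 to c. One clump gives n = 3δ + 1 for c = 2δ + 2 and n = 3δ + 2 for
        -- c = 2δ + 3; two clumps occur only for c = 2δ + 3 and give n = 4δ + 1. In each case the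
        -- residue of n lowers the bound to at most c.
        two-only : ∀ {ps} → Full ps → All IsTwo ps → Goal
        two-only {[]} A [] = inj₁ (trans (order A) (+-identityʳ _))
        two-only {P ∷ []} A ((N , T) ∷ []) with length L ≤? 2 * δ + 2
        ... | yes c≤ = inj₂ (≤-trans (≤-reflexive (bound≡2δ+2 n δ (trans (cong (_% 3) n≡) ([m+kn]%n≡m%n 1 δ 3)))) (2δ+2≤c T))
          where
          n≡ : n ≡ 1 + δ * 3
          n≡ = trans ((≤-antisym (lin (n ∷ δ ∷ []) (L ∷ P ∷ []) ([]) ((at 0 ≋ (lng (# 0) ⊕ lng ((# 1 · ε)))) ∷ ((lng (# 1) ⊕ κ 1) ≋ at 1) ∷ (lng (# 0) ≼ (2 ⊗ (at 1) ⊕ κ 2)) ∷ ((2 ⊗ (at 1) ⊕ κ 2) ≼ lng (# 0)) ∷ []) (at 0) ((κ 1 ⊕ 3 ⊗ (at 1))) 0 ((1 , 0) ∷ (1 , 0) ∷ (1 , 0) ∷ (0 , 0) ∷ []) (order A , P-size T , c≤ , 2δ+2≤c T , tt)) (lin (n ∷ δ ∷ []) (L ∷ P ∷ []) ([]) ((at 0 ≋ (lng (# 0) ⊕ lng ((# 1 · ε)))) ∷ ((lng (# 1) ⊕ κ 1) ≋ at 1) ∷ (lng (# 0) ≼ (2 ⊗ (at 1) ⊕ κ 2)) ∷ ((2 ⊗ (at 1) ⊕ κ 2) ≼ lng (# 0)) ∷ []) ((κ 1 ⊕ 3 ⊗ (at 1))) (at 0) 0 ((0 , 1) ∷ (0 ,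 1) ∷ (0 , 0) ∷ (1 , 0) ∷ []) (order A , P-size T , c≤ , 2δ+2≤c T , tt))))
                     (cong suc (*-comm 3 δ))
        ... | no c≰ = inj₂ (≤-trans (≤-reflexive (bound≡2δ+3 n δ (trans (cong (_% 3) n≡) ([m+kn]%n≡m%n 2 δ 3)))) c≥)
          where
          c≥ : 2 * δ + 3 ≤ length L
          c≥ = (lin (δ ∷ []) (L ∷ []) ([]) (((κ 1 ⊕ (2 ⊗ (at 0) ⊕ κ 2)) ≼ lng (# 0)) ∷ []) ((2 ⊗ (at 0) ⊕ κ 3)) (lng (# 0)) 0 ((1 , 0) ∷ []) (≰⇒> c≰ , tt))
          n≡ : n ≡ 2 + δ * 3
          n≡ = trans ((≤-antisym (lin (n ∷ δ ∷ []) (L ∷ P ∷ []) ([]) ((at 0 ≋ (lng (# 0) ⊕ lng ((# 1 · ε)))) ∷ ((lng (# 1) ⊕ κ 1) ≋ at 1) ∷ (lng (# 0) ≼ (2 ⊗ (at 1) ⊕ κ 3)) ∷ ((2 ⊗ (at 1) ⊕ κ 3) ≼ lng (# 0)) ∷ []) (at 0) ((κ 2 ⊕ 3 ⊗ (at 1))) 0 ((1 , 0) ∷ (1 , 0) ∷ (1 , 0) ∷ (0 , 0) ∷ []) (order A , P-size T , small , c≥ , tt)) (lin (n ∷ δ ∷ []) (L ∷ P ∷ []) ([]) ((at 0 ≋ (lng (# 0) ⊕ lng ((# 1 · ε)))) ∷ ((lng (# 1) ⊕ κ 1) ≋ at 1) ∷ (lng (# 0) ≼ (2 ⊗ (at 1)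 ⊕ κ 3)) ∷ ((2 ⊗ (at 1) ⊕ κ 3) ≼ lng (# 0)) ∷ []) ((κ 2 ⊕ 3 ⊗ (at 1))) (at 0) 0 ((0 , 1) ∷ (0 , 1) ∷ (0 , 0) ∷ (1 , 0) ∷ []) (order A , P-size T , small , c≥ , tt))))
                     (cong (2 +_) (*-comm 3 δ))
        two-only {P ∷ Q ∷ []} A ((N , T) ∷ (M , U) ∷ []) with length L ≤? 2 * δ + 2 | ends T | disjoint A
        ... | yes c≤ | a , b , s , t , X , a∈ , b∈ | (d ∷ []) ∷ _ = ⊥-elim (no-two T U d c≤ X a∈ b∈)
        ... | no c≰ | _ | _ = inj₂ (≤-trans (bound≤2δ+3 n δ (trans (cong (_% 4) n≡) ([m+kn]%n≡m%n 1 δ 4))) c≥)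
          where
          c≥ : 2 * δ + 3 ≤ length L
          c≥ = (lin (δ ∷ []) (L ∷ []) ([]) (((κ 1 ⊕ (2 ⊗ (at 0) ⊕ κ 2)) ≼ lng (# 0)) ∷ []) ((2 ⊗ (at 0) ⊕ κ 3)) (lng (# 0)) 0 ((1 , 0) ∷ []) (≰⇒> c≰ , tt))
          n≡ : n ≡ 1 + δ * 4
          n≡ = trans ((≤-antisym (lin (n ∷ δ ∷ []) (L ∷ P ∷ Q ∷ []) ([]) ((at 0 ≋ (lng (# 0) ⊕ lng ((# 1 · (# 2 · ε))))) ∷ ((lng (# 1) ⊕ κ 1) ≋ at 1) ∷ ((lng (# 2) ⊕ κ 1) ≋ at 1) ∷ (lng (# 0) ≼ (2 ⊗ (at 1) ⊕ κ 3)) ∷ ((2 ⊗ (at 1) ⊕ κ 3) ≼ lng (# 0)) ∷ []) (at 0) ((κ 1 ⊕ 4 ⊗ (at 1))) 0 ((1 , 0) ∷ (1 , 0) ∷ (1 , 0) ∷ (1 , 0) ∷ (0 , 0) ∷ []) (order A , P-size T , P-size U , small , c≥ , tt)) (lin (n ∷ δ ∷ []) (L ∷ P ∷ Q ∷ []) ([]) ((at 0 ≋ (lng (# 0) ⊕ lng ((# 1 · (# 2 · ε))))) ∷ ((lng (# 1) ⊕ κ 1) ≋ at 1) ∷ ((lng (# 2) ⊕ κ 1) ≋ at 1) ∷ (lng (# 0) ≼ (2 ⊗ (at 1) ⊕ κ 3)) ∷ ((2 ⊗ (at 1) ⊕ κ 3) ≼ lng (# 0)) ∷ []) ((κ 1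 ⊕ 4 ⊗ (at 1))) (at 0) 0 ((0 , 1) ∷ (0 , 1) ∷ (0 , 1) ∷ (0 , 0) ∷ (1 , 0) ∷ []) (order A , P-size T , P-size U , small , c≥ , tt))))
                     (cong suc (*-comm 4 δ))
        two-only {P ∷ Q ∷ O ∷ ps} A ((N , T) ∷ (M , U) ∷ (K , V′) ∷ _) with ends T | disjoint A
        ... | a , b , s , t , X , a∈ , b∈ | (d ∷ d′ ∷ _) ∷ (d″ ∷ _) ∷ _ = ⊥-elim (no-three T U V′ d d′ d″ X a∈ b∈)

        -- Here δ = 3 and c = 9, and n is 10 or 11, for which the bound is 8 or 9.
        some-one : ∀ {P qs} → IsOne P → Full (P ∷ qs) → Goal
        some-one {x ∷ []} {qs} (N , Cx , refl , δ≥3) A = inj₂ (go qs A)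
          where
          module O = OnesRest Cx δ≥3
          go : ∀ qs → Full ((x ∷ []) ∷ qs) → bound n δ ≤ length L
          go [] A = ≤-trans (≤-reflexive (bound≡2δ+2 n δ (cong (_% 3) n≡))) ((lin (δ ∷ []) (L ∷ []) ([]) ((lng (# 0) ≋ κ 9) ∷ (at 0 ≋ κ 3) ∷ []) ((2 ⊗ (at 0) ⊕ κ 2)) (lng (# 0)) 0 ((0 , 1) ∷ (2 , 0) ∷ []) (O.L≡9 , O.δ≡three , tt)))
            where
            n≡ : n ≡ 10
            n≡ = (≤-antisym (lin (n ∷ []) (L ∷ []) ([]) ((at 0 ≋ (lng (# 0) ⊕ κ 1)) ∷ (lng (# 0) ≋ κ 9) ∷ []) (at 0) (κ 10) 0 ((1 , 0) ∷ (1 , 0) ∷ []) (order A , O.L≡9 , tt)) (lin (n ∷ []) (L ∷ []) ([]) ((at 0 ≋ (lng (# 0) ⊕ κ 1)) ∷ (lng (# 0) ≋ κ 9) ∷ []) (κ 10) (at 0) 0 ((0 , 1) ∷ (0 , 1) ∷ []) (order A , O.L≡9 , tt)))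
          go (Q ∷ []) A with clumps A | disjoint A
          ... | _ ∷ (M , D) ∷ [] | (d ∷ []) ∷ _ =
            ≤-trans (≤-reflexive (bound≡2δ+3 n δ (cong (_% 3) n≡))) ((lin (δ ∷ []) (L ∷ []) ([]) ((lng (# 0) ≋ κ 9) ∷ (at 0 ≋ κ 3) ∷ []) ((2 ⊗ (at 0) ⊕ κ 3)) (lng (# 0)) 0 ((0 , 1) ∷ (2 , 0) ∷ []) (O.L≡9 , O.δ≡three , tt)))
            where
            n≡ : n ≡ 11
            n≡ = (≤-antisym (lin (n ∷ []) (L ∷ Q ∷ []) (x ∷ []) ((at 0 ≋ (lng (# 0) ⊕ lng ((• 0 · (# 1 · ε))))) ∷ (lng (# 0) ≋ κ 9) ∷ (lng (# 1) ≋ κ 1) ∷ []) (at 0) (κ 11) 0 ((1 , 0) ∷ (1 , 0) ∷ (1 , 0) ∷ []) (order A , O.L≡9 , O.lone-clump D (d (here refl)) , tt)) (lin (n ∷ []) (L ∷ Q ∷ []) (x ∷ []) ((at 0 ≋ (lng (# 0) ⊕ lng ((• 0 · (# 1 · ε))))) ∷ (lng (# 0) ≋ κ 9) ∷ (lng (# 1) ≋ κ 1) ∷ []) (κ 11) (at 0) 0 ((0 , 1) ∷ (0 , 1) ∷ (0 , 1) ∷ []) (order A , O.L≡9 , O.lone-clump D (d (here refl)) , tt)))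
          go (Q ∷ Q′ ∷ qs) A with clumps A | disjoint A
          ... | _ ∷ (M , D) ∷ (M′ , D′) ∷ _ | (d ∷ d′ ∷ _) ∷ (d″ ∷ _) ∷ _ = ⊥-elim (O.no-three-ones D D′ (d (here refl)) (d′ (here refl)) d″)
        some-one {[]} (N , Cx , () , δ≥3) A
        some-one {_ ∷ _ ∷ _} (N , Cx , () , δ≥3) A

        -- The cycle and `P` have 11 + 2 vertices and every other clump has three, so n ≡ 1 (mod 3)
        -- and the bound is 10.
        some-three : ∀ {P qs} → IsThree P → Full (P ∷ qs) → Goal
        some-three {P} {qs} (N , C , |P| , |N|) A with clumps A | disjoint A
        ... | _ ∷ cl | d ∷ _ = inj₂ (≤-trans (≤-reflexive (bound≡2δ+2 n δ (trans (cong (_% 3) n≡) ([m+kn]%n≡m%n 1 (4 + length qs) 3))))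
                ((lin (δ ∷ []) (L ∷ []) ([]) ((at 0 ≋ κ 4) ∷ (lng (# 0) ≋ κ 11) ∷ []) ((2 ⊗ (at 0) ⊕ κ 2)) (lng (# 0)) 0 ((2 , 0) ∷ (0 , 1) ∷ []) (T.δ≡4 , T.L≡11 , tt))))
          where
          module T = Threes C |P| |N|
          no-one : ∀ {Q M} → Clump L Q M → length Q ≡ 1 → 3 ≤ δ → ⊥
          no-one {x ∷ []} D′ refl δ≥3 = (1≰0 (lin {A = ⊤} (δ ∷ []) ([]) ([]) ((at 0 ≋ κ 3) ∷ (at 0 ≋ κ 4) ∷ []) (κ 1) (κ 0) 0 ((1 , 0) ∷ (0 , 1) ∷ []) (OnesRest.δ≡three D′ δ≥3 , T.δ≡4 , tt)))
          size-three : ∀ {Q} → IsClump Q → Disjoint P Q → length Q ≡ 3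
          size-three {Q} D d with kind D
          ... | inj₁ (M , U) = (≤-antisym (lin (δ ∷ []) (Q ∷ []) ([]) (((lng (# 0) ⊕ κ 1) ≋ at 0) ∷ (at 0 ≋ κ 4) ∷ []) (lng (# 0)) (κ 3) 0 ((1 , 0) ∷ (1 , 0) ∷ []) (P-size U , T.δ≡4 , tt)) (lin (δ ∷ []) (Q ∷ []) ([]) (((lng (# 0) ⊕ κ 1) ≋ at 0) ∷ (at 0 ≋ κ 4) ∷ []) (κ 3) (lng (# 0)) 0 ((0 , 1) ∷ (0 , 1) ∷ []) (P-size U , T.δ≡4 , tt)))
          ... | inj₂ (inj₂ (M , D′ , |Q| , |M|)) = ⊥-elim (TwoThrees.contradictory C |P| |N| D′ |Q| |M| d)
          ... | inj₂ (inj₁ (M , D′ , |Q| , δ≥3)) = ⊥-elim (no-one D′ |Q| δ≥3)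
          total : ∀ {qs} → All IsClump qs → All (Disjoint P) qs → length (concat qs) ≡ length qs * 3
          total [] [] = refl
          total {Q ∷ qs} (D ∷ cl) (d ∷ ds) = trans (length-++ Q) (cong₂ _+_ (size-three D d) (total cl ds))
          n≡ : n ≡ 1 + (4 + length qs) * 3
          n≡ = (≤-antisym (lin (n ∷ (length qs * 3) ∷ []) (L ∷ P ∷ concat qs ∷ []) ([]) ((at 0 ≋ (lng (# 0) ⊕ lng ((# 1 · # 2)))) ∷ (lng (# 1) ≋ κ 2) ∷ (lng (# 0) ≋ κ 11) ∷ (lng (# 2) ≋ at 1) ∷ []) (at 0) ((κ 13 ⊕ at 1)) 0 ((1 , 0) ∷ (1 , 0) ∷ (1 , 0) ∷ (1 , 0) ∷ []) (order A , |P| , T.L≡11 , total cl d , tt)) (lin (n ∷ (length qs * 3) ∷ []) (L ∷ P ∷ concat qs ∷ []) ([]) ((at 0 ≋ (lng (# 0) ⊕ lng ((# 1 · # 2)))) ∷ (lng (# 1) ≋ κ 2) ∷ (lng (# 0) ≋ κ 11) ∷ (lng (# 2) ≋ at 1) ∷ []) ((κ 13 ⊕ at 1)) (at 0) 0 ((0 , 1) ∷ (0 , 1) ∷ (0 , 1) ∷ (0 , 1) ∷ []) (order A , |P| , T.L≡11 , total cl d , tt)))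

        data Kinds (ps : List (List V)) : Set where
          all-twos  : All IsTwo ps → Kinds ps
          has-one   : ∀ {P} → P ∈ ps → IsOne P → Kinds ps
          has-three : ∀ {P} → P ∈ ps → IsThree P → Kinds ps

        kinds : ∀ {ps} → All IsClump ps → Kinds ps
        kinds [] = all-twos []
        kinds (D ∷ cl) with kind D | kinds cl
        ... | inj₂ (inj₁ h) | _ = has-one (here refl) h
        ... | inj₂ (inj₂ h) | _ = has-three (here refl) h
        ... | inj₁ _ | has-one p h = has-one (there p) h
        ... | inj₁ _ | has-three p h = has-three (there p) h
        ... | inj₁ h | all-twos hs = all-twos (h ∷ hs)

        conclusion : ¬ ¬ Goal
        conclusion k = pack (allFin n) λ { (ps , packing cl dj cv) → k (by-kinds (packing cl dj λ {v} _ → cv (∈-allFin v)) (kinds cl)) }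
          where
          by-kinds : ∀ {ps} → Full ps → Kinds ps → Goal
          by-kinds A (all-twos h) = two-only A h
          by-kinds A (has-one p h) = some-one h (proj₂ (front p A))
          by-kinds A (has-three p h) = some-three h (proj₂ (front p A))

theorem1 : ∀ (n : ℕ) (G : Graph n) (δ c : ℕ) → 3 ≤ n → OneTough G → IsMinDegree G δ →
  IsCircumference G c → Hamiltonian G ⊎ bound n δ ≤ c
theorem1 n G δ c _ tough (_ , mindeg) (C , longest) with c ≟ n | bound n δ ≤? c
... | yes refl | _ = inj₁ C
... | _ | yes h = inj₂ h
... | no c≢n | no h with fromCycle G C
-- Both alternatives have been decided and refuted, so the doubly negated `conclusion` suffices.
-- From c < `bound n δ` ≤ 2δ + 4 comes the hypothesis c ≤ 2δ + 3.
...   | L , cycL , refl = ⊥-elim (conclusion G tough δ mindeg cycL (λ D → longest _ (toCycle G D))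
          (s≤s⁻¹ (≤-trans (≰⇒> h) (≤-trans (bound≤2δ+4 n δ) (≤-reflexive (+-suc (2 * δ) 3)))))
          [ (λ eq → c≢n (sym eq)) , h ]′)
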